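{- There exists a function $c(h,g)$ with the following property. For every graph $H$ with $h$ vertices, every surface $\Sigma$ of Euler genus $g$ in which $H$ embeds, and every positive integer $n$, \[ C(H,\Sigma,n)\le c(h,g)\,n^{f(H)}. \]
   Context: All graphs are finite, simple and non-empty. Surfaces are compact 2-manifolds without boundary (Euler genus $2h$ for the sphere with $h$ handles, $c$ for the sphere with $c$ cross-caps). A copy of $H$ in $G$ is a subgraph of $G$ isomorphic to $H$; $C(H,\Sigma,n)$ is the maximum number of copies of $H$ in an $n$-vertex graph that embeds in $\Sigma$. A $k$-separation of $H$ is a pair $(H_1,H_2)$ of edge-disjoint subgraphs with $H_1\cup H_2=H$, $V(H_1)\setminus V(H_2)\ne\emptyset$, $V(H_2)\setminus V(H_1)\ne\emptyset$, $|V(H_1)\cap V(H_2)|=k$; a $(\le k)$-separation is a $k'$-separation for some $k'\le k$. For a separation $(H_1,H_2)$ with $X=V(H_1)\cap V(H_2)$, $H_i^-$, $H_i^+$ are the simple graphs obtained from $H_i$ by removing, respectively adding, all edges between vertices of $X$. A flap in $H$ is a $(\le2)$-separation $(A,B)$ with $A^+$ planar. Separations $(A,B)$, $(C,D)$ are independent if $E(A^-)\cap E(C^-)=\emptyset$ and $(V(A)\setminus V(B))\cap(V(C)\setminus V(D))=\emptyset$. The flap-number $f(H)$ is $1$ if $H$ is planar with no $(\le2)$-separation, and otherwise the maximum number of pairwise independent flaps in $H$. -}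

module Defs where

open import Data.Nat using (ℕ; zero; suc; _+_; _≤_; NonZero)
open import Data.Fin using (Fin; zero; suc; _≟_)
open import Data.Bool using (Bool; true; false; _∧_; _∨_; not; if_then_else_)
open import Data.Product using (Σ; Σ-syntax; ∃; ∃-syntax; _×_; _,_)
open import Data.Sum using (_⊎_)
open import Data.Empty using (⊥)
open import Relation.Nullary using (¬_)
open import Relation.Nullary.Decidable using (⌊_⌋)
open import Relation.Binary.PropositionalEquality using (_≡_; _≢_)

record Graph (n : ℕ) : Set where
  field
    adj    : Fin n → Fin n → Bool
    sym    : ∀ u v → adj u v ≡ adj v u
    irrefl : ∀ v → adj v v ≡ false
open Graph public

card : {n : ℕ} → (Fin n → Bool) → ℕ
card {zero}  f = 0
card {suc n} f = (if f zero then 1 else 0) + card (λ i → f (suc i))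

_==_ : {n : ℕ} → Fin n → Fin n → Bool
u == v = ⌊ u ≟ v ⌋

data Surface : Set where
  handles   : (h : ℕ) → Surface
  crosscaps : (c : ℕ) → .{{NonZero c}} → Surface

eulerGenus : Surface → ℕ
eulerGenus (handles h)   = h + h
eulerGenus (crosscaps c) = c

sphere : Surface
sphere = handles 0

data Reach₂ {m : ℕ} (a b : Fin m → Fin m) (x : Fin m) : Fin m → Set where
  here : Reach₂ a b x x
  stepa : ∀ {y} → Reach₂ a b x y → Reach₂ a b x (a y)
  stepb : ∀ {y} → Reach₂ a b x y → Reach₂ a b x (b y)

data Reach₃ {m : ℕ} (a b c : Fin m → Fin m) (x : Fin m) : Fin m → Set where
  here : Reach₃ a b c x x
  stepa : ∀ {y} → Reach₃ a b c x y → Reach₃ a b c x (a y)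
  stepb : ∀ {y} → Reach₃ a b c x y → Reach₃ a b c x (b y)
  stepc : ∀ {y} → Reach₃ a b c x y → Reach₃ a b c x (c y)

-- A (connected, closed) combinatorial map given by its flags and the three
-- fixed-point-free involutions τ₀ τ₁ τ₂ (τ₀τ₂ = τ₂τ₀ fixed-point-free).
-- Vertices / edges / faces are the orbits of ⟨τ₁,τ₂⟩ / ⟨τ₀,τ₂⟩ / ⟨τ₀,τ₁⟩,
-- enumerated by the surjections vtx / edg / fac onto Fin nV / Fin nE / Fin nF.
-- Such maps are exactly the cellular embeddings of connected graphs
-- (multigraphs allowed) in surfaces.
record Map : Set where
  field
    m     : ℕ
    flag₀ : Fin m
    τ₀ τ₁ τ₂ : Fin m → Fin m
    inv₀ : ∀ x → τ₀ (τ₀ x) ≡ x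
    inv₁ : ∀ x → τ₁ (τ₁ x) ≡ x
    inv₂ : ∀ x → τ₂ (τ₂ x) ≡ x
    fpf₀ : ∀ x → τ₀ x ≢ x
    fpf₁ : ∀ x → τ₁ x ≢ x
    fpf₂ : ∀ x → τ₂ x ≢ x
    comm₀₂ : ∀ x → τ₀ (τ₂ x) ≡ τ₂ (τ₀ x)
    fpf₀₂  : ∀ x → τ₀ (τ₂ x) ≢ x
    connected : ∀ x y → Reach₃ τ₀ τ₁ τ₂ x y
    nV nE nF : ℕ
    vtx : Fin m → Fin nV
    edg : Fin m → Fin nE
    fac : Fin m → Fin nF
    vtx-surj : ∀ v → ∃[ x ] vtx x ≡ v
    edg-surj : ∀ e → ∃[ x ] edg x ≡ e
    fac-surj : ∀ f → ∃[ x ] fac x ≡ f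
    vtx-orb₁ : ∀ x y → vtx x ≡ vtx y → Reach₂ τ₁ τ₂ x y
    vtx-orb₂ : ∀ x y → Reach₂ τ₁ τ₂ x y → vtx x ≡ vtx y
    edg-orb₁ : ∀ x y → edg x ≡ edg y → Reach₂ τ₀ τ₂ x y
    edg-orb₂ : ∀ x y → Reach₂ τ₀ τ₂ x y → edg x ≡ edg y
    fac-orb₁ : ∀ x y → fac x ≡ fac y → Reach₂ τ₀ τ₁ x y
    fac-orb₂ : ∀ x y → Reach₂ τ₀ τ₁ x y → fac x ≡ fac y
open Map public

Orientable : Map → Set
Orientable M = Σ[ col ∈ (Fin (m M) → Bool) ]
  ((∀ x → col (τ₀ M x) ≡ not (col x)) ×
   (∀ x → col (τ₁ M x) ≡ not (col x)) ×
   (∀ x → col (τ₂ M x) ≡ not (col x)))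

-- the map M is a cellular embedding in the surface S
-- (Euler's formula V - E + F = 2 - eulerGenus, written in ℕ, plus orientability type)
CellularIn : Map → Surface → Set
CellularIn M (handles h) =
  Orientable M × (nV M + nF M + (h + h) ≡ nE M + 2)
CellularIn M (crosscaps c) =
  ¬ Orientable M × (nV M + nF M + c ≡ nE M + 2)

MapAdj : (M : Map) → Fin (nV M) → Fin (nV M) → Set
MapAdj M u v = ∃[ x ] (vtx M x ≡ u × vtx M (τ₀ M x) ≡ v)

-- The graph with vertex set {v | V v} and edge relation E (vertices in Fin n)
-- embeds in S: it is a subgraph of (the underlying graph of) a cellularly
-- embedded connected graph in S.
EmbedsSub : (n : ℕ) → (Fin n → Bool) → (Fin n → Fin n → Bool) → Surface → Set
EmbedsSub n V E S = Σ[ M ∈ Map ] (CellularIn M S ×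
  (Σ[ f ∈ (Fin n → Fin (nV M)) ]
    ((∀ u v → V u ≡ true → V v ≡ true → f u ≡ f v → u ≡ v) ×
     (∀ u v → V u ≡ true → V v ≡ true → E u v ≡ true → MapAdj M (f u) (f v)))))

EmbedsIn : {n : ℕ} → Graph n → Surface → Set
EmbedsIn {n} G S = EmbedsSub n (λ _ → true) (adj G) S

Sub : ℕ → Set
Sub n = (Fin n → Bool) × (Fin n → Fin n → Bool)

IsSubgraph : {n : ℕ} → Graph n → Sub n → Set
IsSubgraph G (V , E) =
  (∀ u v → E u v ≡ E v u) ×
  (∀ u v → E u v ≡ true → (adj G u v ≡ true × V u ≡ true × V v ≡ true))

IsCopy : {h n : ℕ} → Graph h → Graph n → Sub n → Set
IsCopy {h} {n} H G (V , E) =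
  IsSubgraph G (V , E) ×
  Σ[ φ ∈ (Fin h → Fin n) ]
    ((∀ i j → φ i ≡ φ j → i ≡ j) ×
     (∀ v → V v ≡ true → ∃[ i ] φ i ≡ v) ×
     (∀ i → V (φ i) ≡ true) ×
     (∀ i j → adj H i j ≡ E (φ i) (φ j)))

SubDiffer : {n : ℕ} → Sub n → Sub n → Set
SubDiffer (V , E) (V' , E') = (∃[ v ] V v ≢ V' v) ⊎ (∃[ u ] ∃[ v ] E u v ≢ E' u v)

CopiesAtMost : {h n : ℕ} → Graph h → Graph n → ℕ → Set
CopiesAtMost {h} {n} H G N =
  ∀ (k : ℕ) (cs : Fin k → Sub n) →
  (∀ i → IsCopy H G (cs i)) →
  (∀ i j → i ≢ j → SubDiffer (cs i) (cs j)) →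
  k ≤ N

module _ {h : ℕ} (H : Graph h) where

  IsSeparation : ℕ → Sub h → Sub h → Set
  IsSeparation k (VA , EA) (VB , EB) =
    IsSubgraph H (VA , EA) × IsSubgraph H (VB , EB) ×
    (∀ u v → EA u v ≡ true → EB u v ≡ false) ×
    (∀ v → VA v ∨ VB v ≡ true) ×
    (∀ u v → adj H u v ≡ true → EA u v ∨ EB u v ≡ true) ×
    (∃[ v ] (VA v ≡ true × VB v ≡ false)) ×
    (∃[ v ] (VB v ≡ true × VA v ≡ false)) ×
    (card (λ v → VA v ∧ VB v) ≡ k)

  IsSmallSeparation : Sub h → Sub h → Set
  IsSmallSeparation A B = Σ[ k ∈ ℕ ] (k ≤ 2 × IsSeparation k A B)

  Planar : Set
  Planar = EmbedsIn H sphere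

  NoSmallSeparation : Set
  NoSmallSeparation = ∀ A B → ¬ IsSmallSeparation A B

Sep : ℕ → Set
Sep h = Sub h × Sub h

sepX : {h : ℕ} → Sep h → Fin h → Bool
sepX ((VA , _) , (VB , _)) v = VA v ∧ VB v

plusE : {h : ℕ} → Sep h → Fin h → Fin h → Bool
plusE s@((_ , EA) , _) u v = EA u v ∨ (sepX s u ∧ sepX s v ∧ not (u == v))

minusE : {h : ℕ} → Sep h → Fin h → Fin h → Bool
minusE s@((_ , EA) , _) u v = EA u v ∧ not (sepX s u ∧ sepX s v)

IsFlap : {h : ℕ} → Graph h → Sep h → Set
IsFlap {h} H s@((VA , EA) , B) =
  IsSmallSeparation H (VA , EA) B × EmbedsSub h VA (plusE s) sphere

Independent : {h : ℕ} → Sep h → Sep h → Set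
Independent s@((VA , _) , (VB , _)) t@((VC , _) , (VD , _)) =
  (∀ u v → minusE s u v ≡ true → minusE t u v ≡ false) ×
  (∀ v → VA v ≡ true → VB v ≡ false → VC v ≡ true → VD v ≡ false → ⊥)

IndepFlapFamily : {h : ℕ} → Graph h → (k : ℕ) → (Fin k → Sep h) → Set
IndepFlapFamily H k fs =
  (∀ i → IsFlap H (fs i)) × (∀ i j → i ≢ j → Independent (fs i) (fs j))

MaxIndepFlaps : {h : ℕ} → Graph h → ℕ → Set
MaxIndepFlaps {h} H k =
  (Σ[ fs ∈ (Fin k → Sep h) ] IndepFlapFamily H k fs) ×
  (∀ k' (fs : Fin k' → Sep h) → IndepFlapFamily H k' fs → k' ≤ k)

FlapNumber : {h : ℕ} → Graph h → ℕ → Set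
FlapNumber H k =
  (Planar H × NoSmallSeparation H × k ≡ 1) ⊎
  (¬ (Planar H × NoSmallSeparation H) × MaxIndepFlaps H k)

-- Rank the vertices of G by a degeneracy order, in which each vertex has a
-- bounded number of later neighbours, and keep only the copies of H that induce
-- one fixed order on V(H).  Call a vertex of H a source if it precedes all its
-- neighbours.  Let T be a set of at most f = f(H) vertices of H.  If there were
-- too many copies, then many would agree on T, hence many would form a sunflower
-- with a kernel K containing T.  Let C be a component of H - K.  Copies of C are
-- glued many times along the common image of N(C), and in a surface of bounded
-- genus this forces |N(C)| ≤ 2 and forces C, with an edge joining its
-- neighbours, to be planar: C is a flap.  Bounded later degree moreover puts the
-- petals before the kernel, so C contains a source and N(C) contains none.
-- Hence no f vertices meet all such flaps, and a minimal set of sources that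
-- meets them has at least f + 1 members, each with a private flap.  Uncrossing by
-- posimodularity of |N(·)| makes these flaps independent, a contradiction.
--
-- The topological input is a count of Euler characteristics.  A graph in a
-- surface is a set of flags on which only the rotation varies, by switching two
-- of its pairs; one switch changes the numbers of vertices and faces by at most
-- one.  Detaching edges one by one shows that the Euler genus never grows.
-- Cutting the graph apart along N(C) by switches yields maps of the parts whose
-- Euler characteristics nearly add up to the original one, so with enough parts
-- one of them must be a sphere met by N(C) in the required way.

module Submission where

open import Defs
import Data.Nat as ℕ
open import Data.Nat using (ℕ; zero; suc; _+_; _*_; _^_; _∸_; _≤_; _<_; z≤n; s≤s; _≤?_; _<?_)
import Data.Nat.Properties as ℕP
open import Data.Nat.Tactic.RingSolver using (solve-∀)
open import Data.Fin using (Fin; zero; suc; _≟_; toℕ; fromℕ<)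
import Data.Fin as F
import Data.Fin.Properties as FP
open import Data.Bool using (Bool; true; false; _∧_; _∨_; not; if_then_else_)
import Data.Bool as B
import Data.Bool.Properties as BP
open import Data.Product using (Σ-syntax; ∃-syntax; _×_; _,_; proj₁; proj₂)
open import Data.Sum using (_⊎_; inj₁; inj₂; [_,_]′)
open import Data.Empty using (⊥; ⊥-elim)
open import Data.Unit using (⊤; tt)
open import Data.List using (List; []; _∷_; allFin; cartesianProduct; length; lookup)
open import Data.List.Relation.Unary.All as All using (All; []; _∷_)
open import Data.List.Relation.Unary.AllPairs using (AllPairs; []; _∷_)
open import Data.List.Membership.Propositional using (_∈_)
import Data.List
import Data.List.Properties as LP
import Data.List.Membership.Propositional.Properties as LM
open import Data.List.Relation.Unary.Any using (here; there)
open import Relation.Nullary using (¬_; Dec; yes; no)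
open import Relation.Nullary.Decidable using (⌊_⌋; ¬?; decidable-stable)
open import Relation.Binary.PropositionalEquality using (_≡_; _≢_; refl; trans; cong; cong₂; subst; subst₂) renaming (sym to symm)
open import Relation.Binary.Definitions using (tri<; tri≈; tri>)
open import Function using (_∘_; id)

-- Two obstacles shape the development. Being a flap means having an embedding in the sphere, and
-- this is nowhere decided; so `Good` and `Free` sets cannot be searched for, and the minimal
-- hitting set of sources is found only under double negation, which suffices because the goal at
-- that point is absurd. Secondly, subtraction is avoided: for a fixed set of edges the Euler genus
-- is compared through 2K - V - F, where K counts components, and totals are multiplied by 4 because
-- an edge has four flags. As only flags are counted, a vertex without edges is invisible, and
-- isolated vertices are treated apart.
--
-- In the count for the cut graph every part has an excess of at least 0, and the total excess is
-- less than 8|X| + 4g. With more than 4h + 2g parts some part has excess at most 1, and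
-- divisibility by 4 turns this into exact planarity. Hence the summand 4h of `petals`; the rest, 6g
-- + 7, exceeds the number 6 + 6g of later neighbours of a vertex. The final constant has one factor
-- for the orders on V(H) and one for sunflowers.

absurd : {A : Set} {b : Bool} → b ≡ true → b ≡ false → A
absurd refl ()

bool-cases : (b : Bool) → b ≡ true ⊎ b ≡ false
bool-cases true  = inj₁ refl
bool-cases false = inj₂ refl

∧-elim : ∀ {a b} → a ∧ b ≡ true → a ≡ true × b ≡ true
∧-elim {true} p = refl , p

∧-intro : ∀ {a b} → a ≡ true → b ≡ true → a ∧ b ≡ true
∧-intro refl q = q

∨-elim : ∀ {a b} → a ∨ b ≡ true → a ≡ true ⊎ b ≡ true
∨-elim {true}  p = inj₁ refl
∨-elim {false} p = inj₂ p

∨-introˡ : ∀ {a b} → a ≡ true → a ∨ b ≡ true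
∨-introˡ refl = refl

∨-introʳ : ∀ {a b} → b ≡ true → a ∨ b ≡ true
∨-introʳ {true}  p = refl
∨-introʳ {false} p = p

not-elim : ∀ {a} → not a ≡ true → a ≡ false
not-elim {false} p = refl

not-intro : ∀ {a} → a ≡ false → not a ≡ true
not-intro refl = refl

≢true : ∀ {a} → ¬ a ≡ true → a ≡ false
≢true {true}  p = ⊥-elim (p refl)
≢true {false} p = refl

bool-iff : ∀ {a b} → (a ≡ true → b ≡ true) → (b ≡ true → a ≡ true) → a ≡ b
bool-iff {true}  {true}  f g = refl
bool-iff {true}  {false} f g = symm (f refl)
bool-iff {false} {true}  f g = g refl
bool-iff {false} {false} f g = refl

⌊⌋-sound : {P : Set} (d : Dec P) → ⌊ d ⌋ ≡ true → P
⌊⌋-sound (yes p) e = p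

⌊⌋-complete : {P : Set} (d : Dec P) → P → ⌊ d ⌋ ≡ true
⌊⌋-complete (yes p) q = refl
⌊⌋-complete (no ¬p) q = ⊥-elim (¬p q)

==-sound : ∀ {n} {u v : Fin n} → (u == v) ≡ true → u ≡ v
==-sound {u = u} {v} = ⌊⌋-sound (u ≟ v)

==-complete : ∀ {n} {u v : Fin n} → u ≡ v → (u == v) ≡ true
==-complete {u = u} {v} = ⌊⌋-complete (u ≟ v)

==-refl : ∀ {n} (u : Fin n) → (u == u) ≡ true
==-refl u = ==-complete refl

==-false : ∀ {n} {u v : Fin n} → u ≢ v → (u == v) ≡ false
==-false ne = ≢true (ne ∘ ==-sound)

==-refute : ∀ {n} {u v : Fin n} → (u == v) ≡ false → u ≢ v
==-refute e q = absurd (==-complete q) e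

==-suc : ∀ {n} (u v : Fin n) → (F.suc u == F.suc v) ≡ (u == v)
==-suc u v = bool-iff (λ e → ==-complete (FP.suc-injective (==-sound e))) (λ e → ==-complete (cong suc (==-sound e)))

-- Search, counting and sums over finite sets

abstract
  -- Sealed, so that terms that contain a search do not unfold to the decision procedure.
  ex : ∀ {n} → (Fin n → Bool) → Bool
  ex f = ⌊ FP.any? (λ x → f x B.≟ true) ⌋

  ex-elim : ∀ {n} {f : Fin n → Bool} → ex f ≡ true → ∃[ x ] f x ≡ true
  ex-elim {f = f} = ⌊⌋-sound (FP.any? (λ x → f x B.≟ true))

  ex-intro : ∀ {n} {f : Fin n → Bool} x → f x ≡ true → ex f ≡ true
  ex-intro {f = f} x p = ⌊⌋-complete (FP.any? (λ x → f x B.≟ true)) (x , p)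

ex-none : ∀ {n} {f : Fin n → Bool} → ex f ≡ false → ∀ x → f x ≡ false
ex-none e x = ≢true (λ p → absurd (ex-intro x p) e)

card-cong : ∀ {n} {f g : Fin n → Bool} → (∀ x → f x ≡ g x) → card f ≡ card g
card-cong {zero}  e = refl
card-cong {suc n} e rewrite e zero = cong (_ +_) (card-cong (e ∘ suc))

card-full : ∀ n → card {n} (λ _ → true) ≡ n
card-full zero    = refl
card-full (suc n) = cong suc (card-full n)

card-empty : ∀ {n} {f : Fin n → Bool} → (∀ x → f x ≡ false) → card f ≡ 0
card-empty {zero}  e = refl
card-empty {suc n} e rewrite e zero = card-empty (e ∘ suc)

suc≢zero : ∀ {n} {x : Fin n} → F.suc x ≢ zero
suc≢zero ()

card-remove : ∀ {n} (g : Fin n → Bool) y → g y ≡ true →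
  card g ≡ suc (card (λ z → g z ∧ not (z == y)))
card-remove g zero p rewrite p =
  cong suc (card-cong λ x → symm (trans (cong (λ b → g (suc x) ∧ not b) (==-false (suc≢zero {x = x}))) (BP.∧-identityʳ _)))
card-remove g (suc y) p with g zero
... | true  = cong suc (trans (card-remove (g ∘ suc) y p) (cong suc (card-cong λ x → cong (λ b → g (suc x) ∧ not b)
                (symm (==-suc x y)))))
... | false = trans (card-remove (g ∘ suc) y p) (cong suc (card-cong λ x → cong (λ b → g (suc x) ∧ not b)
                (symm (==-suc x y))))

-- Induction on the domain, removing the value at `zero` from g. The map may depend on the proof of
-- membership and is injective across all such proofs, so maps obtained by choosing witnesses
-- qualify.
card-inj : ∀ {m n} (f : Fin m → Bool) (g : Fin n → Bool) (ι : ∀ x → f x ≡ true → Fin n) →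
  (∀ x p → g (ι x p) ≡ true) → (∀ x y p q → ι x p ≡ ι y q → x ≡ y) → card f ≤ card g
card-inj {zero}  f g ι hit inj = z≤n
card-inj {suc m} f g ι hit inj = go (f zero) refl
  where
  rec : (g′ : Fin _ → Bool) → (∀ x p → g′ (ι (suc x) p) ≡ true) → card (f ∘ suc) ≤ card g′
  rec g′ h = card-inj (f ∘ suc) g′ (ι ∘ suc) h (λ x y p q e → FP.suc-injective (inj (suc x) (suc y) p q e))
  go : ∀ b → f zero ≡ b → card f ≤ card g
  go false e rewrite e = rec g (hit ∘ suc)
  go true  e = ℕP.≤-trans (ℕP.≤-reflexive (cong (λ b → (if b then 1 else 0) + card (f ∘ suc)) e))
    (ℕP.≤-trans (s≤s (rec (λ z → g z ∧ not (z == ι zero e))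
        λ x p → ∧-intro (hit (suc x) p) (not-intro (==-false λ q → suc≢zero (inj (suc x) zero p e q)))))
      (ℕP.≤-reflexive (symm (card-remove g (ι zero e) (hit zero e)))))

card-mono : ∀ {n} {f g : Fin n → Bool} → (∀ x → f x ≡ true → g x ≡ true) → card f ≤ card g
card-mono {f = f} {g} h = card-inj f g (λ x _ → x) h (λ x y _ _ e → e)

card-≥1 : ∀ {n} {f : Fin n → Bool} x → f x ≡ true → 1 ≤ card f
card-≥1 {f = f} x p = subst (1 ≤_) (symm (card-remove f x p)) (s≤s z≤n)

card-≥2 : ∀ {n} {f : Fin n → Bool} x y → x ≢ y → f x ≡ true → f y ≡ true → 2 ≤ card f
card-≥2 {f = f} x y ne p q =
  subst (2 ≤_) (symm (card-remove f x p)) (s≤s (card-≥1 y (∧-intro q (not-intro (==-false (ne ∘ symm))))))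

card-positive : ∀ {n} {f : Fin n → Bool} → 1 ≤ card f → ∃[ x ] f x ≡ true
card-positive {f = f} h with bool-cases (ex f)
... | inj₁ p = ex-elim p
... | inj₂ p with () ← subst (1 ≤_) (card-empty (ex-none p)) h

sumF : ∀ {n} → (Fin n → ℕ) → ℕ
sumF {zero}  a = 0
sumF {suc n} a = a zero + sumF (a ∘ suc)

sumF-cong : ∀ {n} {a b : Fin n → ℕ} → (∀ i → a i ≡ b i) → sumF a ≡ sumF b
sumF-cong {zero}  e = refl
sumF-cong {suc n} e = cong₂ _+_ (e zero) (sumF-cong (e ∘ suc))

sumF-mono : ∀ {n} {a b : Fin n → ℕ} → (∀ i → a i ≤ b i) → sumF a ≤ sumF b
sumF-mono {zero}  h = z≤n
sumF-mono {suc n} h = ℕP.+-mono-≤ (h zero) (sumF-mono (h ∘ suc))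

sumF-+ : ∀ {n} (a b : Fin n → ℕ) → sumF (λ i → a i + b i) ≡ sumF a + sumF b
sumF-+ {zero}  a b = refl
sumF-+ {suc n} a b = trans (cong (a zero + b zero +_) (sumF-+ (a ∘ suc) (b ∘ suc)))
  (interchange (a zero) (b zero) (sumF (a ∘ suc)) (sumF (b ∘ suc)))
  where
  interchange : ∀ w x y z → w + x + (y + z) ≡ w + y + (x + z)
  interchange = solve-∀

sumF-* : ∀ {n} c (a : Fin n → ℕ) → sumF (λ i → c * a i) ≡ c * sumF a
sumF-* {zero}  c a = symm (ℕP.*-zeroʳ c)
sumF-* {suc n} c a = trans (cong (c * a zero +_) (sumF-* c (a ∘ suc))) (symm (ℕP.*-distribˡ-+ c (a zero) _))

sumF-const : ∀ n c → sumF {n} (λ _ → c) ≡ n * c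
sumF-const zero    c = refl
sumF-const (suc n) c = cong (c +_) (sumF-const n c)

sumF-card : ∀ {n} (f : Fin n → Bool) c → sumF (λ i → if f i then c else 0) ≡ card f * c
sumF-card {zero}  f c = refl
sumF-card {suc n} f c with f zero
... | true  = cong (c +_) (sumF-card (f ∘ suc) c)
... | false = sumF-card (f ∘ suc) c

sumF-zero : ∀ {n} (a : Fin n → ℕ) → (∀ i → a i ≡ 0) → sumF a ≡ 0
sumF-zero {zero}  a e = refl
sumF-zero {suc n} a e = cong₂ _+_ (e zero) (sumF-zero (a ∘ suc) (e ∘ suc))

sumF-indicator : ∀ {n} (j : Fin n) → sumF (λ i → if j == i then 1 else 0) ≡ 1
sumF-indicator {suc n} zero =
  cong suc (sumF-zero {n} (λ i → if zero == suc i then 1 else 0) λ i → cong (λ b → if b then 1 else 0) (==-false {u = zero} {v = suc i} (λ ())))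
sumF-indicator {suc n} (suc j) =
  cong₂ _+_ (cong (λ b → if b then 1 else 0) (==-false {u = suc j} {v = zero} (λ ())))
    (trans (sumF-cong (λ i → cong (λ b → if b then 1 else 0) (==-suc j i))) (sumF-indicator j))

card-fibres : ∀ {n s} (f : Fin n → Bool) (lab : Fin n → Fin s) →
  card f ≡ sumF (λ i → card (λ x → f x ∧ (lab x == i)))
card-fibres {zero} {s} f lab = symm (sumF-zero {s} _ λ i → refl)
card-fibres {suc n} {s} f lab = trans (cong₂ _+_ (head (f zero)) (card-fibres (f ∘ suc) (lab ∘ suc)))
   (symm (sumF-+ (λ i → if f zero ∧ (lab zero == i) then 1 else 0) _))
  where
  head : ∀ b → (if b then 1 else 0) ≡ sumF (λ i → if b ∧ (lab zero == i) then 1 else 0)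
  head true  = symm (sumF-indicator (lab zero))
  head false = symm (sumF-zero {s} (λ _ → 0) λ i → refl)

card-split : ∀ {n} (f p : Fin n → Bool) →
  card f ≡ card (λ x → f x ∧ p x) + card (λ x → f x ∧ not (p x))
card-split {zero}  f p = refl
card-split {suc n} f p with f zero | p zero
... | true  | true  = cong suc (card-split (f ∘ suc) (p ∘ suc))
... | true  | false = trans (cong suc (card-split (f ∘ suc) (p ∘ suc))) (symm (ℕP.+-suc _ _))
... | false | _     = card-split (f ∘ suc) (p ∘ suc)

enum : ∀ {n} (f : Fin n → Bool) → Fin (card f) → Fin n
enum {suc n} f i with f zero
enum {suc n} f zero    | true  = zero
enum {suc n} f (suc i) | true  = suc (enum (f ∘ suc) i)
enum {suc n} f i       | false = suc (enum (f ∘ suc) i)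

enum-true : ∀ {n} (f : Fin n → Bool) i → f (enum f i) ≡ true
enum-true {suc n} f i with f zero in eq
enum-true {suc n} f zero    | true  = eq
enum-true {suc n} f (suc i) | true  = enum-true (f ∘ suc) i
enum-true {suc n} f i       | false = enum-true (f ∘ suc) i

enum-onto : ∀ {n} (f : Fin n → Bool) x → f x ≡ true → ∃[ i ] enum f i ≡ x
enum-onto {suc n} f zero p with f zero | p
... | true  | _  = zero , refl
... | false | ()
enum-onto {suc n} f (suc x) p with f zero
... | true  = let i , e = enum-onto (f ∘ suc) x p in suc i , cong suc e
... | false = let i , e = enum-onto (f ∘ suc) x p in i , cong suc e

index : ∀ {n} (f : Fin n → Bool) x → f x ≡ true → Fin (card f)
index f x p = proj₁ (enum-onto f x p)

enum-index : ∀ {n} (f : Fin n → Bool) x p → enum f (index f x p) ≡ x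
enum-index f x p = proj₂ (enum-onto f x p)

enum-injective : ∀ {n} (f : Fin n → Bool) i j → enum f i ≡ enum f j → i ≡ j
enum-injective {suc n} f i j e with f zero
enum-injective {suc n} f zero    zero    e | true  = refl
enum-injective {suc n} f (suc i) (suc j) e | true  = cong suc (enum-injective (f ∘ suc) i j (FP.suc-injective e))
enum-injective {suc n} f i       j       e | false = enum-injective (f ∘ suc) i j (FP.suc-injective e)

-- Equivalence closures and orbits of involutions

module _ {m : ℕ} (R : Fin m → Fin m → Bool) where

  data Star (x : Fin m) : Fin m → Set where
    ε   : Star x x
    _▻_ : ∀ {y z} → Star x y → R y z ≡ true → Star x z

  Star-trans : ∀ {x y z} → Star x y → Star y z → Star x z
  Star-trans p ε       = p
  Star-trans p (q ▻ r) = Star-trans p q ▻ r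

  Star-sym : (∀ x y → R x y ≡ true → R y x ≡ true) → ∀ {x y} → Star x y → Star y x
  Star-sym s ε       = ε
  Star-sym s (q ▻ r) = Star-trans (ε ▻ s _ _ r) (Star-sym s q)

Star-map : ∀ {m n} {R : Fin m → Fin m → Bool} {S : Fin n → Fin n → Bool} (f : Fin m → Fin n) →
  (∀ x y → R x y ≡ true → S (f x) (f y) ≡ true) → ∀ {x y} → Star R x y → Star S (f x) (f y)
Star-map f h ε       = ε
Star-map f h (p ▻ r) = Star-map f h p ▻ h _ _ r

-- Union-find: scanning all pairs and merging the classes of related ones
-- yields a class representative for the equivalence closure.
module _ {m : ℕ} (R : Fin m → Fin m → Bool) where

  private
    merge : (Fin m → Fin m) → Fin m → Fin m → Fin m → Fin m
    merge ρ x y z = if ρ z == ρ y then ρ x else ρ z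

    scan : List (Fin m × Fin m) → Fin m → Fin m
    scan []            = id
    scan ((x , y) ∷ l) = if R x y then merge (scan l) x y else scan l

    scan-sound : (∀ x y → R x y ≡ true → R y x ≡ true) → ∀ l z w → scan l z ≡ scan l w → Star R z w
    scan-sound s [] z w refl = ε
    scan-sound s ((x , y) ∷ l) z w e with R x y in r
    ... | false = scan-sound s l z w e
    ... | true with scan l z == scan l y in p | scan l w == scan l y in q
    ...   | true  | true  = scan-sound s l z w (trans (==-sound p) (symm (==-sound q)))
    ...   | true  | false = Star-trans R (scan-sound s l z y (==-sound p)) (Star-trans R (ε ▻ s _ _ r) (scan-sound s l x w e))
    ...   | false | true  = Star-trans R (scan-sound s l z x e) (Star-trans R (ε ▻ r) (scan-sound s l y w (symm (==-sound q))))
    ...   | false | false = scan-sound s l z w e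

    scan-idem : ∀ l z → scan l (scan l z) ≡ scan l z
    scan-idem [] z = refl
    scan-idem ((x , y) ∷ l) z with R x y
    ... | false = scan-idem l z
    ... | true with scan l z == scan l y in p
    ...   | true rewrite scan-idem l x with scan l x == scan l y
    ...     | true  = refl
    ...     | false = refl
    scan-idem ((x , y) ∷ l) z | true | false rewrite scan-idem l z | p = refl

    scan-keep : ∀ l p z w → scan l z ≡ scan l w → scan (p ∷ l) z ≡ scan (p ∷ l) w
    scan-keep l (x , y) z w e with R x y
    ... | false = e
    ... | true rewrite e = refl

    scan-join : ∀ l x y → (x , y) ∈ l → R x y ≡ true → scan l x ≡ scan l y
    scan-join ((x , y) ∷ l) x y (here refl) r rewrite r with scan l x == scan l y | ==-complete {u = scan l y} refl
    ... | true  | t rewrite t = refl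
    ... | false | t rewrite t = refl
    scan-join (p ∷ l) x y (there i) r = scan-keep l p x y (scan-join l x y i r)

    pairs : List (Fin m × Fin m)
    pairs = cartesianProduct (allFin m) (allFin m)

  abstract
    rep : Fin m → Fin m
    rep = scan pairs

    rep-sound : (∀ x y → R x y ≡ true → R y x ≡ true) → ∀ {z w} → rep z ≡ rep w → Star R z w
    rep-sound s = scan-sound s pairs _ _

    rep-idem : ∀ z → rep (rep z) ≡ rep z
    rep-idem = scan-idem pairs

    rep-step : ∀ {x y} → R x y ≡ true → rep x ≡ rep y
    rep-step {x} {y} = scan-join pairs x y (LM.∈-cartesianProduct⁺ (LM.∈-allFin x) (LM.∈-allFin y))

Involutive : ∀ {m} → (Fin m → Fin m) → Set
Involutive a = ∀ x → a (a x) ≡ x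

module _ {m : ℕ} (a b : Fin m → Fin m) where
  link₂ : Fin m → Fin m → Bool
  link₂ x y = (a x == y) ∨ (b x == y)

  cl₂ : Fin m → Fin m
  cl₂ = rep link₂

  cl₂-a : ∀ x → cl₂ (a x) ≡ cl₂ x
  cl₂-a x = symm (rep-step link₂ (∨-introˡ (==-refl (a x))))

  cl₂-b : ∀ x → cl₂ (b x) ≡ cl₂ x
  cl₂-b x = symm (rep-step link₂ (∨-introʳ {a x == b x} (==-refl (b x))))

  -- Orbit induction. Involutivity makes single steps symmetric, so closure of Q under a and b is
  -- enough, and later arguments never handle an explicit path.
  cl₂-elim : Involutive a → Involutive b → (Q : Fin m → Set) → (∀ z → Q z → Q (a z)) → (∀ z → Q z → Q (b z)) →
    ∀ {x y} → cl₂ x ≡ cl₂ y → Q x → Q y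
  cl₂-elim ia ib Q qa qb e q = go (rep-sound link₂ sy e)
    where
    sy : ∀ x y → link₂ x y ≡ true → link₂ y x ≡ true
    sy x y l with ∨-elim {a x == y} l
    ... | inj₁ p rewrite symm (==-sound p) = ∨-introˡ (==-complete (ia x))
    ... | inj₂ p rewrite symm (==-sound p) = ∨-introʳ {a (b x) == x} (==-complete (ib x))
    go : ∀ {y} → Star link₂ _ y → Q y
    go ε = q
    go (_▻_ {y} p r) with ∨-elim {a y == _} r
    ... | inj₁ s = subst Q (==-sound s) (qa y (go p))
    ... | inj₂ s = subst Q (==-sound s) (qb y (go p))

module _ {m : ℕ} (a b c : Fin m → Fin m) where
  link₃ : Fin m → Fin m → Bool
  link₃ x y = (a x == y) ∨ ((b x == y) ∨ (c x == y))

  cl₃ : Fin m → Fin m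
  cl₃ = rep link₃

  cl₃-a : ∀ x → cl₃ (a x) ≡ cl₃ x
  cl₃-a x = symm (rep-step link₃ (∨-introˡ (==-refl (a x))))

  cl₃-b : ∀ x → cl₃ (b x) ≡ cl₃ x
  cl₃-b x = symm (rep-step link₃ (∨-introʳ {a x == b x} (∨-introˡ (==-refl (b x)))))

  cl₃-c : ∀ x → cl₃ (c x) ≡ cl₃ x
  cl₃-c x = symm (rep-step link₃ (∨-introʳ {a x == c x} (∨-introʳ {b x == c x} (==-refl (c x)))))

  cl₃-elim : Involutive a → Involutive b → Involutive c → (Q : Fin m → Set) →
    (∀ z → Q z → Q (a z)) → (∀ z → Q z → Q (b z)) → (∀ z → Q z → Q (c z)) →
    ∀ {x y} → cl₃ x ≡ cl₃ y → Q x → Q y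
  cl₃-elim ia ib ic Q qa qb qc e q = go (rep-sound link₃ sy e)
    where
    sy : ∀ x y → link₃ x y ≡ true → link₃ y x ≡ true
    sy x y l with ∨-elim {a x == y} l
    ... | inj₁ p rewrite symm (==-sound p) = ∨-introˡ (==-complete (ia x))
    ... | inj₂ l′ with ∨-elim {b x == y} l′
    ...   | inj₁ p rewrite symm (==-sound p) = ∨-introʳ {a (b x) == x} (∨-introˡ (==-complete (ib x)))
    ...   | inj₂ p rewrite symm (==-sound p) = ∨-introʳ {a (c x) == x} (∨-introʳ {b (c x) == x} (==-complete (ic x)))
    go : ∀ {y} → Star link₃ _ y → Q y
    go ε = q
    go (_▻_ {y} p r) with ∨-elim {a y == _} r
    ... | inj₁ s = subst Q (==-sound s) (qa y (go p))
    ... | inj₂ r′ with ∨-elim {b y == _} r′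
    ...   | inj₁ s = subst Q (==-sound s) (qb y (go p))
    ...   | inj₂ s = subst Q (==-sound s) (qc y (go p))

all : ∀ {m} → Fin m → Bool
all _ = true

sumF-bound : ∀ {k} (f : Fin k → Bool) (c : ℕ) (a : Fin k → ℕ) → (∀ y → f y ≡ true → c ≤ a y) → card f * c ≤ sumF a
sumF-bound f c a h = ℕP.≤-trans (ℕP.≤-reflexive (symm (sumF-card f c))) (sumF-mono go)
  where
  go : ∀ i → (if f i then c else 0) ≤ a i
  go i with f i in e
  ... | true  = h i e
  ... | false = z≤n

sumF-bound′ : ∀ {k} (f : Fin k → Bool) (c : ℕ) (a : Fin k → ℕ) → (∀ y → f y ≡ true → a y ≤ c) →
  (∀ y → f y ≡ false → a y ≡ 0) → sumF a ≤ card f * c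
sumF-bound′ f c a h z = ℕP.≤-trans (sumF-mono go) (ℕP.≤-reflexive (sumF-card f c))
  where
  go : ∀ i → a i ≤ (if f i then c else 0)
  go i with f i in e
  ... | true  = h i e
  ... | false = ℕP.≤-reflexive (z i e)

-- Counting equivalence classes

module Images where
  abstract
    image : ∀ {m k} → (Fin m → Bool) → (Fin m → Fin k) → Fin k → Bool
    image P r y = ex (λ x → P x ∧ (r x == y))

    image-intro : ∀ {m k} {P : Fin m → Bool} {r : Fin m → Fin k} x → P x ≡ true → image P r (r x) ≡ true
    image-intro x p = ex-intro x (∧-intro p (==-complete refl))

    image-elim : ∀ {m k} {P : Fin m → Bool} {r : Fin m → Fin k} {y} → image P r y ≡ true → ∃[ x ] (P x ≡ true × r x ≡ y)
    image-elim p with ex-elim p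
    ... | x , q = x , proj₁ (∧-elim q) , ==-sound (proj₂ (∧-elim q))

open Images public

abstract
  -- The number of classes (fibres of r) that meet P.
  nc : ∀ {m k} → (Fin m → Bool) → (Fin m → Fin k) → ℕ
  nc P r = card (image P r)

  -- Choose one element in each class of r and apply f: since f reflects equivalence, distinct
  -- classes are sent to distinct classes. f itself may tear a class of r apart.
  nc-≤ : ∀ {m k m′ k′} {P : Fin m → Bool} {r : Fin m → Fin k} {Q : Fin m′ → Bool} {r′ : Fin m′ → Fin k′}
    (f : ∀ x → P x ≡ true → Fin m′) → (∀ x p → Q (f x p) ≡ true) →
    (∀ x y p q → r′ (f x p) ≡ r′ (f y q) → r x ≡ r y) → nc P r ≤ nc Q r′
  nc-≤ {P = P} {r} {Q} {r′} f hit refl-cl = card-inj (image P r) (image Q r′)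
    (λ y i → let x , p , _ = image-elim i in r′ (f x p))
    (λ y i → let x , p , _ = image-elim i in image-intro (f x p) (hit x p))
    (λ y z i j e → let x , p , xy = image-elim i ; w , q , wz = image-elim j in
      trans (symm xy) (trans (refl-cl x w p q e) wz))

  nc-≥1 : ∀ {m k} {P : Fin m → Bool} {r : Fin m → Fin k} x → P x ≡ true → 1 ≤ nc P r
  nc-≥1 {P = P} {r} x p = card-≥1 {f = image P r} (r x) (image-intro x p)

  nc-≥2 : ∀ {m k} {P : Fin m → Bool} {r : Fin m → Fin k} x y → P x ≡ true → P y ≡ true → r x ≢ r y → 2 ≤ nc P r
  nc-≥2 {P = P} {r} x y p q ne = card-≥2 {f = image P r} (r x) (r y) ne (image-intro x p) (image-intro y q)

  nc-bound : ∀ {m k} {P : Fin m → Bool} {r : Fin m → Fin k} → nc P r ≤ k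
  nc-bound {k = k} {P} {r} = subst (nc P r ≤_) (card-full k) (card-mono {f = image P r} {g = λ _ → true} λ _ _ → refl)

  class-of : ∀ {m k} (r : Fin m → Fin k) → Fin m → Fin (nc all r)
  class-of r x = index (image all r) (r x) (image-intro x refl)

  class-of-onto : ∀ {m k} (r : Fin m → Fin k) i → ∃[ x ] class-of r x ≡ i
  class-of-onto r i = let x , _ , e = image-elim (enum-true (image all r) i) in
    x , enum-injective (image all r) _ _ (trans (enum-index (image all r) (r x) _) e)

  class-of-≡ : ∀ {m k} (r : Fin m → Fin k) {x y} → r x ≡ r y → class-of r x ≡ class-of r y
  class-of-≡ r {x} {y} e = enum-injective (image all r) _ _
    (trans (enum-index (image all r) (r x) _) (trans e (symm (enum-index (image all r) (r y) _))))

  class-of-sound : ∀ {m k} (r : Fin m → Fin k) {x y} → class-of r x ≡ class-of r y → r x ≡ r y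
  class-of-sound r {x} {y} e = trans (symm (enum-index (image all r) (r x) _))
    (trans (cong (enum (image all r)) e) (enum-index (image all r) (r y) _))

  nc-id : ∀ n → nc {n} all (λ x → x) ≡ n
  nc-id n = trans (card-cong {n} {image all (λ x → x)} (λ x → image-intro {r = λ y → y} x refl)) (card-full n)

  nc-split : ∀ {m k} (P S : Fin m → Bool) (r : Fin m → Fin k) → (∀ x y → r x ≡ r y → S x ≡ S y) →
    nc P r ≡ nc (λ x → P x ∧ S x) r + nc (λ x → P x ∧ not (S x)) r
  nc-split P S r resp = trans (card-split (image P r) (image (λ x → P x ∧ S x) r)) (cong₂ _+_ (card-cong one) (card-cong two))
    where
    one : ∀ y → image P r y ∧ image (λ x → P x ∧ S x) r y ≡ image (λ x → P x ∧ S x) r y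
    one y = bool-iff (proj₂ ∘ ∧-elim) λ i → let x , p , e = image-elim i in
      ∧-intro (subst (λ z → image P r z ≡ true) e (image-intro x (proj₁ (∧-elim p)))) i
    two : ∀ y → image P r y ∧ not (image (λ x → P x ∧ S x) r y) ≡ image (λ x → P x ∧ not (S x)) r y
    two y = bool-iff
      (λ i → let a , b = ∧-elim i ; x , p , e = image-elim a in
        subst (λ z → image _ r z ≡ true) e (image-intro x (∧-intro p (not-intro (≢true λ s →
          absurd (subst (λ z → image _ r z ≡ true) e (image-intro {P = λ x → P x ∧ S x} x (∧-intro p s))) (not-elim b))))))
      (λ i → let x , p , e = image-elim i ; p₁ , p₂ = ∧-elim p in
        ∧-intro (subst (λ z → image P r z ≡ true) e (image-intro x p₁))
          (not-intro (≢true λ j → let x′ , p′ , e′ = image-elim j in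
            absurd (trans (resp x x′ (trans e (symm e′))) (proj₂ (∧-elim p′))) (not-elim p₂))))

  -- Idempotence makes the value `r x` a member of its own class, so the label of a class can be
  -- read off from its value.
  nc-fibres : ∀ {m s} (P : Fin m → Bool) (r : Fin m → Fin m) (lab : Fin m → Fin s) →
    (∀ x y → r x ≡ r y → lab x ≡ lab y) → (∀ x → r (r x) ≡ r x) →
    nc P r ≡ sumF (λ i → nc (λ x → P x ∧ (lab x == i)) r)
  nc-fibres P r lab resp idem = trans (card-fibres (image P r) lab) (sumF-cong λ i → card-cong λ y → bool-iff
    (λ h → let a , b = ∧-elim h ; x , p , e = image-elim a in
      subst (λ z → image _ r z ≡ true) e (image-intro x (∧-intro p (trans (cong (_== i)
        (resp x y (trans (symm (idem x)) (cong r e)))) b))))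
    (λ h → let x , p , e = image-elim h ; p₁ , p₂ = ∧-elim p in
      ∧-intro (subst (λ z → image P r z ≡ true) e (image-intro x p₁))
        (trans (cong (_== i) (resp y x (trans (cong r (symm e)) (idem x)))) p₂)))

  nc-large : ∀ {m k} (q : ℕ) (P : Fin m → Bool) (r : Fin m → Fin k) (e : Fin m → Fin q → Fin m) →
    (∀ x j → P x ≡ true → P (e x j) ≡ true × r (e x j) ≡ r x) →
    (∀ x i j → P x ≡ true → e x i ≡ e x j → i ≡ j) → nc P r * q ≤ card P
  nc-large q P r e inside inj = ℕP.≤-trans
    (sumF-bound (image P r) q (λ y → card (λ x → P x ∧ (r x == y))) big)
    (ℕP.≤-reflexive (symm (card-fibres P r)))
    where
    big : ∀ y → image P r y ≡ true → q ≤ card (λ x → P x ∧ (r x == y))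
    big y i = let x , p , rx = image-elim i in subst (_≤ _) (card-full q)
      (card-inj (λ _ → true) _ (λ j _ → e x j)
        (λ j _ → let p′ , r′ = inside x j p in ∧-intro p′ (==-complete (trans r′ rx)))
        (λ i j _ _ → inj x i j p))

  nc-small : ∀ {m k} (q : ℕ) (P : Fin m → Bool) (r : Fin m → Fin k) (e : Fin m → Fin q → Fin m) →
    (∀ x y → P x ≡ true → P y ≡ true → r y ≡ r x → ∃[ j ] e x j ≡ y) → card P ≤ nc P r * q
  nc-small q P r e cover = ℕP.≤-trans (ℕP.≤-reflexive (card-fibres P r))
    (sumF-bound′ (image P r) q (λ y → card (λ x → P x ∧ (r x == y))) small none)
    where
    small : ∀ y → image P r y ≡ true → card (λ x → P x ∧ (r x == y)) ≤ q
    small y i = let x , p , rx = image-elim i in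
      let pick : ∀ z → (P z ∧ (r z == y)) ≡ true → ∃[ j ] e x j ≡ z
          pick z h = cover x z p (proj₁ (∧-elim h)) (trans (==-sound (proj₂ (∧-elim h))) (symm rx))
      in subst (_ ≤_) (card-full q) (card-inj _ (λ _ → true) (λ z h → proj₁ (pick z h)) (λ _ _ → refl)
        (λ z w h h′ ee → trans (symm (proj₂ (pick z h))) (trans (cong (e x) ee) (proj₂ (pick w h′)))))
    none : ∀ y → image P r y ≡ false → card (λ x → P x ∧ (r x == y)) ≡ 0
    none y i = card-empty λ x → ≢true λ h → absurd
      (subst (λ z → image P r z ≡ true) (==-sound (proj₂ (∧-elim h))) (image-intro x (proj₁ (∧-elim h)))) i

nc-mono : ∀ {m k} {P Q : Fin m → Bool} {r : Fin m → Fin k} → (∀ x → P x ≡ true → Q x ≡ true) → nc P r ≤ nc Q r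
nc-mono h = nc-≤ (λ x _ → x) h (λ x y _ _ e → e)

nc-coarser : ∀ {m k k′} {P : Fin m → Bool} {r : Fin m → Fin k} {r′ : Fin m → Fin k′} →
  (∀ x y → P x ≡ true → P y ≡ true → r′ x ≡ r′ y → r x ≡ r y) → nc P r ≤ nc P r′
nc-coarser h = nc-≤ (λ x _ → x) (λ x p → p) (λ x y p q → h x y p q)

nc-one : ∀ {m k} {P : Fin m → Bool} {r : Fin m → Fin k} u → (∀ x → P x ≡ true → r x ≡ u) → nc P r ≤ 1
nc-one {m} {P = P} u h = ℕP.≤-trans
  (nc-≤ {Q = P} {r′ = λ _ → F.zero {0}} (λ x _ → x) (λ x p → p) (λ x y p q _ → trans (h x p) (symm (h y q))))
  nc-bound

nc-two : ∀ {m k} {P : Fin m → Bool} {r : Fin m → Fin k} u v → (∀ x → P x ≡ true → r x ≡ u ⊎ r x ≡ v) → nc P r ≤ 2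
nc-two {P = P} {r} u v h = ℕP.≤-trans
  (nc-≤ {Q = P} {r′ = λ x → side (r x == u)} (λ x _ → x) (λ x p → p) same) nc-bound
  where
  side : Bool → Fin 2
  side true  = zero
  side false = suc zero
  same : ∀ x y → P x ≡ true → P y ≡ true → side (r x == u) ≡ side (r y == u) → r x ≡ r y
  same x y p q e with r x == u in a | r y == u in b
  ... | true  | true  = trans (==-sound a) (symm (==-sound b))
  same x y p q () | true | false
  same x y p q () | false | true
  ... | false | false with h x p | h y q
  ...   | inj₁ c | _ = absurd (==-complete c) a
  ...   | _ | inj₁ d = absurd (==-complete d) b
  ...   | inj₂ c | inj₂ d = trans c (symm d)

-- Matchings, their alternating paths, and switches

FixFree : ∀ {m} → (Fin m → Fin m) → Set
FixFree a = ∀ x → a x ≢ x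

inv-injective : ∀ {m} (a : Fin m → Fin m) → Involutive a → ∀ {x y} → a x ≡ a y → x ≡ y
inv-injective a ia {x} {y} e = trans (symm (ia x)) (trans (cong a e) (ia y))

inv-flip : ∀ {m} (a : Fin m → Fin m) → Involutive a → ∀ {x y} → a x ≡ y → x ≡ a y
inv-flip a ia {x} e = trans (symm (ia x)) (cong a e)

search : (f : ℕ → Bool) (n : ℕ) →
  (∃[ k ] (f k ≡ true × (∀ j → j < k → f j ≡ false))) ⊎ (∀ j → j < n → f j ≡ false)
search f zero = inj₂ λ j ()
search f (suc n) with search f n
... | inj₁ r = inj₁ r
... | inj₂ h with bool-cases (f n)
...   | inj₁ t = inj₁ (n , t , h)
...   | inj₂ t = inj₂ λ j j<sn → [ h j , (λ { refl → t }) ]′ (ℕP.m≤n⇒m<n∨m≡n (ℕP.≤-pred j<sn))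

-- In the graph of the matching a and of the matching b restricted to the
-- complement of P, the elements of P are exactly the end points of paths, so a
-- component contains no element of P or precisely two, u and ret u.
module Pairing {m : ℕ} (a b : Fin m → Fin m) (P : Fin m → Bool)
  (ia : Involutive a) (ib : Involutive b) (fa : FixFree a) (fb : FixFree b) (Pb : ∀ x → P (b x) ≡ P x) where

  off : Fin m → Fin m
  off x = if P x then x else b x

  off-on : ∀ {x} → P x ≡ true → off x ≡ x
  off-on {x} p rewrite p = refl

  off-off : ∀ {x} → P x ≡ false → off x ≡ b x
  off-off {x} p rewrite p = refl

  off-inv : Involutive off
  off-inv x with P x in e
  ... | true  rewrite e = refl
  ... | false rewrite trans (Pb x) e = ib x

  walk : Fin m → ℕ → Fin m
  walk u zero    = a u
  walk u (suc k) = a (b (walk u k))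

  private
    -- Undoing common steps turns a repetition into u = b (walk u d), and P is invariant under b, so
    -- the walk met P earlier. With the pigeonhole principle this makes the walk reach P.
    collide : ∀ u i d → P u ≡ true → P (walk u d) ≡ false → walk u i ≢ walk u (i + suc d)
    collide u zero    d p q e = absurd p (trans (cong P (inv-injective a ia e)) (trans (Pb _) q))
    collide u (suc i) d p q e = collide u i d p q (inv-injective b ib (inv-injective a ia e))

    no-escape : ∀ u → P u ≡ true → ¬ (∀ j → j < suc m → P (walk u j) ≡ false)
    no-escape u p h with FP.pigeonhole (ℕP.n<1+n m) (λ j → walk u (toℕ j))
    ... | i , j , i<j , e = collide u (toℕ i) d p
        (h d (ℕP.≤-<-trans (ℕP.m∸n≤m (toℕ j) (suc (toℕ i))) (FP.toℕ<n j)))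
        (trans e (cong (walk u) (symm (trans (ℕP.+-suc (toℕ i) d) (ℕP.m+[n∸m]≡n i<j)))))
      where
      d = toℕ j ∸ suc (toℕ i)

    -- Move the two indices towards each other, one step at a time; they meet in a fixed point of a
    -- or of b. Thus a path does not return to its starting point.
    fold : ∀ u i j → j ≤ i → walk u i ≢ b (walk u j)
    fold u zero zero z≤n e = fb _ (symm e)
    fold u (suc i) j j≤ e with ℕP.m≤n⇒m<n∨m≡n j≤
    ... | inj₂ refl = fb _ (symm e)
    ... | inj₁ (s≤s j≤i) with ℕP.m≤n⇒m<n∨m≡n j≤i
    ...   | inj₂ refl = fa _ e
    ...   | inj₁ j<i  = fold u i (suc j) j<i (inv-flip b ib (inv-flip a ia e))

    hit : ∀ u → P u ≡ true → ∃[ k ] (P (walk u k) ≡ true × (∀ j → j < k → P (walk u j) ≡ false))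
    hit u p with search (P ∘ walk u) (suc m)
    ... | inj₁ r = r
    ... | inj₂ h = ⊥-elim (no-escape u p h)

    -- Off P there is no path to follow, and d is a dummy value.
    at : Fin m → (b : Bool) → ∀ u → P u ≡ b → Fin m
    at d true  u p = walk u (proj₁ (hit u p))
    at d false u p = d

  abstract
    ret : Fin m → Fin m
    ret u = at u (P u) u refl

    private
      ret-walk : ∀ u → P u ≡ true → ∃[ k ] (ret u ≡ walk u k × P (walk u k) ≡ true × (∀ j → j < k → P (walk u j) ≡ false))
      ret-walk u p = go (P u) refl p
        where
        go : ∀ b (e : P u ≡ b) → b ≡ true → ∃[ k ] (at u b u e ≡ walk u k × P (walk u k) ≡ true × (∀ j → j < k → P (walk u j) ≡ false))
        go true e _ = let k , h , l = hit u e in k , refl , h , l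

    ret-P : ∀ {u} → P u ≡ true → P (ret u) ≡ true
    ret-P {u} p = let k , e , h , l = ret-walk u p in trans (cong P e) h

    ret-≢ : ∀ {u} → P u ≡ true → ret u ≢ u
    ret-≢ {u} p q with ret-walk u p
    ... | zero  , e , h , l = fa u (trans (symm e) q)
    ... | suc k , e , h , l = fold u k 0 z≤n (inv-flip b ib (inv-flip a ia (trans (symm e) q)))

    private
      walk-cl : ∀ u K → (∀ j → j < K → P (walk u j) ≡ false) → cl₂ a off (walk u K) ≡ cl₂ a off u
      walk-cl u zero    l = cl₂-a a off u
      walk-cl u (suc K) l = trans (cl₂-a a off _) (trans (cong (cl₂ a off) (symm (off-off (l K ℕP.≤-refl))))
        (trans (cl₂-b a off _) (walk-cl u K λ j j< → l j (ℕP.m<n⇒m<1+n j<))))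

    ret-cl : ∀ {u} → P u ≡ true → cl₂ a off (ret u) ≡ cl₂ a off u
    ret-cl {u} p = let k , e , h , l = ret-walk u p in trans (cong (cl₂ a off) e) (walk-cl u k l)

    ret-unique : ∀ {u z} → P u ≡ true → P z ≡ true → cl₂ a off u ≡ cl₂ a off z → z ≡ u ⊎ z ≡ ret u
    ret-unique {u} {z} p pz e with ret-walk u p
    ... | K , re , h , l = finish (cl₂-elim a off ia off-inv Trace go-a go-off e (inj₁ refl))
      where
      -- The start, the walk and the b-partners of its inner points form a set closed under a and
      -- `off`; its only members in P are u and `ret u`.
      Trace : Fin m → Set
      Trace y = y ≡ u ⊎ (∃[ k ] (k ≤ K × y ≡ walk u k)) ⊎ (∃[ k ] (k < K × y ≡ b (walk u k)))
      go-a : ∀ y → Trace y → Trace (a y)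
      go-a y (inj₁ refl) = inj₂ (inj₁ (0 , z≤n , refl))
      go-a y (inj₂ (inj₁ (zero , k≤ , refl)))  = inj₁ (ia u)
      go-a y (inj₂ (inj₁ (suc k , k≤ , refl))) = inj₂ (inj₂ (k , k≤ , ia _))
      go-a y (inj₂ (inj₂ (k , k< , refl)))     = inj₂ (inj₁ (suc k , k< , refl))
      go-off : ∀ y → Trace y → Trace (off y)
      go-off y (inj₁ refl) = inj₁ (off-on p)
      go-off y (inj₂ (inj₁ (k , k≤ , refl))) with ℕP.m≤n⇒m<n∨m≡n k≤
      ... | inj₂ refl = inj₂ (inj₁ (k , k≤ , off-on h))
      ... | inj₁ k<   = inj₂ (inj₂ (k , k< , off-off (l k k<)))
      go-off y (inj₂ (inj₂ (k , k< , refl))) =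
        inj₂ (inj₁ (k , ℕP.<⇒≤ k< , trans (off-off (trans (Pb _) (l k k<))) (ib _)))
      finish : Trace z → z ≡ u ⊎ z ≡ ret u
      finish (inj₁ q) = inj₁ q
      finish (inj₂ (inj₁ (k , k≤ , refl))) with ℕP.m≤n⇒m<n∨m≡n k≤
      ... | inj₂ refl = inj₂ (symm re)
      ... | inj₁ k<   = absurd pz (l k k<)
      finish (inj₂ (inj₂ (k , k< , refl))) = absurd pz (trans (Pb _) (l k k<))

    -- The path alternates between a and b and both begins and ends with a, so its length is odd.
    ret-colour : (c : Fin m → Bool) → (∀ x → c (a x) ≡ not (c x)) → (∀ x → P x ≡ false → c (b x) ≡ not (c x)) →
      ∀ {u} → P u ≡ true → c (ret u) ≡ not (c u)
    ret-colour c ca cb {u} p with ret-walk u p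
    ... | K , e , _ , l = trans (cong c e) (go K l)
      where
      go : ∀ K → (∀ j → j < K → P (walk u j) ≡ false) → c (walk u K) ≡ not (c u)
      go zero    l = ca u
      go (suc K) l = trans (ca _) (trans (cong not (cb _ (l K ℕP.≤-refl)))
        (trans (BP.not-involutive _) (go K λ j j< → l j (ℕP.m<n⇒m<1+n j<))))

  ret-ret : ∀ {u} → P u ≡ true → ret (ret u) ≡ u
  ret-ret p with ret-unique (ret-P p) p (ret-cl p)
  ... | inj₁ e = ⊥-elim (ret-≢ p (symm e))
  ... | inj₂ e = symm e

  ret-inv : {A : Set} (c : Fin m → A) → (∀ x → c (a x) ≡ c x) → (∀ x → P x ≡ false → c (b x) ≡ c x) →
    ∀ {u} → P u ≡ true → c (ret u) ≡ c u
  ret-inv c ca cb {u} p = symm (cl₂-elim a off ia off-inv (λ z → c u ≡ c z) (λ z e → trans e (symm (ca z))) so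
    (symm (ret-cl p)) refl)
    where
    so : ∀ z → c u ≡ c z → c u ≡ c (off z)
    so z e with P z in q
    ... | true  = e
    ... | false = trans e (symm (cb z q))

  off⊆ : (b′ : Fin m → Fin m) → (∀ x → P x ≡ false → b′ x ≡ b x) → ∀ {x y} → cl₂ a off x ≡ cl₂ a off y → cl₂ a b′ x ≡ cl₂ a b′ y
  off⊆ b′ agree {x} e = cl₂-elim a off ia off-inv (λ z → cl₂ a b′ x ≡ cl₂ a b′ z) (λ z q → trans q (symm (cl₂-a a b′ z))) so e refl
    where
    so : ∀ z → cl₂ a b′ x ≡ cl₂ a b′ z → cl₂ a b′ x ≡ cl₂ a b′ (off z)
    so z e with P z in q
    ... | true  = e
    ... | false = trans e (trans (symm (cl₂-b a b′ z)) (cong (cl₂ a b′) (agree z q)))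

module _ {m : ℕ} (a : Fin m → Fin m) (P : Fin m → Bool) (ia : Involutive a) where

  private
    Meets : (Fin m → Fin m) → Fin m → Bool
    Meets b x = image P (cl₂ a b) (cl₂ a b x)

    avoid : ∀ b b′ → Involutive b′ → (∀ x → P x ≡ false → b x ≡ b′ x) →
      ∀ x y → Meets b x ≡ false → cl₂ a b′ x ≡ cl₂ a b′ y → cl₂ a b x ≡ cl₂ a b y
    avoid b b′ ib′ agree x y miss e = cl₂-elim a b′ ia ib′ (λ z → cl₂ a b x ≡ cl₂ a b z)
      (λ z q → trans q (symm (cl₂-a a b z))) sb e refl
      where
      sb : ∀ z → cl₂ a b x ≡ cl₂ a b z → cl₂ a b x ≡ cl₂ a b (b′ z)
      sb z q with P z in pz
      ... | true  = absurd (subst (λ w → image P (cl₂ a b) w ≡ true) (symm q) (image-intro z pz)) miss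
      ... | false = trans q (trans (symm (cl₂-b a b z)) (cong (cl₂ a b) (agree z pz)))

    meeting : ∀ b → nc (λ x → all x ∧ Meets b x) (cl₂ a b) ≡ nc P (cl₂ a b)
    meeting b = ℕP.≤-antisym
      (nc-≤ (λ x h → proj₁ (image-elim h)) (λ x h → proj₁ (proj₂ (image-elim h)))
        (λ x y h k e → trans (symm (proj₂ (proj₂ (image-elim h)))) (trans e (proj₂ (proj₂ (image-elim k))))))
      (nc-mono λ x p → image-intro x p)

    missing : ∀ b b′ → Involutive b′ → (∀ x → P x ≡ false → b x ≡ b′ x) →
      nc (λ x → all x ∧ not (Meets b x)) (cl₂ a b) ≤ nc (λ x → all x ∧ not (Meets b′ x)) (cl₂ a b′)
    missing b b′ ib′ agree = nc-≤ (λ x _ → x)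
      (λ x h → not-intro (≢true λ k → let w , pw , e = image-elim k in
        absurd (subst (λ v → image P (cl₂ a b) v ≡ true) (symm (avoid b b′ ib′ agree x w (not-elim h) (symm e))) (image-intro w pw))
          (not-elim h)))
      (λ x y h k e → avoid b b′ ib′ agree x y (not-elim h) e)

    decompose : ∀ b → nc all (cl₂ a b) ≡ nc P (cl₂ a b) + nc (λ x → all x ∧ not (Meets b x)) (cl₂ a b)
    decompose b = trans (nc-split all (Meets b) (cl₂ a b) (λ x y e → cong (image P (cl₂ a b)) e)) (cong (_+ nc (λ x → all x ∧ not (Meets b x)) (cl₂ a b)) (meeting b))

  -- A class that misses P is the same for b and for b′, so the two counts differ only by the
  -- classes that meet P.
  count-change : ∀ b b′ → Involutive b → Involutive b′ → (∀ x → P x ≡ false → b x ≡ b′ x) →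
    nc all (cl₂ a b) + nc P (cl₂ a b′) ≡ nc all (cl₂ a b′) + nc P (cl₂ a b)
  count-change b b′ ib ib′ agree rewrite decompose b | decompose b′
    | ℕP.≤-antisym (missing b b′ ib′ agree) (missing b′ b ib (λ x p → symm (agree x p))) =
      shuffle (nc P (cl₂ a b)) (nc P (cl₂ a b′)) _
    where
    shuffle : ∀ x y z → x + z + y ≡ y + z + x
    shuffle = solve-∀

module Switch {m : ℕ} (τ : Fin m → Fin m) (iτ : Involutive τ) (fτ : FixFree τ)
  (p q : Fin m) (p≢q : p ≢ q) (q≢τp : q ≢ τ p) where

  -- The matched pairs {p, τ p} and {q, τ q} are exchanged for {p, q} and {τ p, τ q}.
  sw : Fin m → Fin m
  sw x = if x == p then q else if x == q then p else if x == τ p then τ q else if x == τ q then τ p else τ x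

  P₄ : Fin m → Bool
  P₄ x = (x == p) ∨ ((x == q) ∨ ((x == τ p) ∨ (x == τ q)))

  p≢τq : p ≢ τ q
  p≢τq e = q≢τp (inv-flip τ iτ (symm e))

  τp≢τq : τ p ≢ τ q
  τp≢τq e = p≢q (inv-injective τ iτ e)

  sw-p : sw p ≡ q
  sw-p rewrite ==-refl p = refl

  sw-q : sw q ≡ p
  sw-q rewrite ==-false (p≢q ∘ symm) | ==-refl q = refl

  sw-τp : sw (τ p) ≡ τ q
  sw-τp rewrite ==-false (fτ p) | ==-false (q≢τp ∘ symm) | ==-refl (τ p) = refl

  sw-τq : sw (τ q) ≡ τ p
  sw-τq rewrite ==-false (p≢τq ∘ symm) | ==-false (fτ q) | ==-false (τp≢τq ∘ symm) | ==-refl (τ q) = refl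

  P₄-p : P₄ p ≡ true
  P₄-p = ∨-introˡ (==-refl p)

  P₄-q : P₄ q ≡ true
  P₄-q = ∨-introʳ {q == p} (∨-introˡ (==-refl q))

  P₄-τp : P₄ (τ p) ≡ true
  P₄-τp = ∨-introʳ {τ p == p} (∨-introʳ {τ p == q} (∨-introˡ (==-refl (τ p))))

  P₄-τq : P₄ (τ q) ≡ true
  P₄-τq = ∨-introʳ {τ q == p} (∨-introʳ {τ q == q} (∨-introʳ {τ q == τ p} (==-refl (τ q))))

  sw-off : ∀ {x} → P₄ x ≡ false → sw x ≡ τ x
  sw-off {x} h with x == p | x == q | x == τ p | x == τ q
  ... | false | false | false | false = refl

  data Spot (x : Fin m) : Set where
    is-p  : x ≡ p → Spot x
    is-q  : x ≡ q → Spot x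
    is-τp : x ≡ τ p → Spot x
    is-τq : x ≡ τ q → Spot x
    is-off : P₄ x ≡ false → Spot x

  spot : ∀ x → Spot x
  spot x with x ≟ p
  ... | yes e = is-p e
  ... | no n₁ with x ≟ q
  ...   | yes e = is-q e
  ...   | no n₂ with x ≟ τ p
  ...     | yes e = is-τp e
  ...     | no n₃ with x ≟ τ q
  ...       | yes e = is-τq e
  ...       | no n₄ = is-off (trans (cong₂ _∨_ (==-false n₁) (cong₂ _∨_ (==-false n₂) (cong₂ _∨_ (==-false n₃) (==-false n₄)))) refl)

  P₄-τ : ∀ x → P₄ (τ x) ≡ P₄ x
  P₄-τ x with spot x
  ... | is-p refl  = trans P₄-τp (symm P₄-p)
  ... | is-q refl  = trans P₄-τq (symm P₄-q)
  ... | is-τp refl = trans (trans (cong P₄ (iτ p)) P₄-p) (symm P₄-τp)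
  ... | is-τq refl = trans (trans (cong P₄ (iτ q)) P₄-q) (symm P₄-τq)
  ... | is-off h with spot (τ x)
  ...   | is-p e   = absurd (trans (cong P₄ (inv-flip τ iτ e)) P₄-τp) h
  ...   | is-q e   = absurd (trans (cong P₄ (inv-flip τ iτ e)) P₄-τq) h
  ...   | is-τp e  = absurd (trans (cong P₄ (inv-injective τ iτ e)) P₄-p) h
  ...   | is-τq e  = absurd (trans (cong P₄ (inv-injective τ iτ e)) P₄-q) h
  ...   | is-off k = trans k (symm h)

  sw-inv : Involutive sw
  sw-inv x with spot x
  ... | is-p refl  = trans (cong sw sw-p) sw-q
  ... | is-q refl  = trans (cong sw sw-q) sw-p
  ... | is-τp refl = trans (cong sw sw-τp) sw-τq
  ... | is-τq refl = trans (cong sw sw-τq) sw-τp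
  ... | is-off h   = trans (cong sw (sw-off h)) (trans (sw-off (trans (P₄-τ x) h)) (iτ x))

  sw-fpf : FixFree sw
  sw-fpf x e with spot x
  ... | is-p refl  = p≢q (trans (symm e) sw-p)
  ... | is-q refl  = p≢q (trans (symm sw-q) e)
  ... | is-τp refl = τp≢τq (trans (symm e) sw-τp)
  ... | is-τq refl = τp≢τq (trans (symm sw-τq) e)
  ... | is-off h   = fτ x (trans (symm (sw-off h)) e)

  sw-label : {A : Set} (c : Fin m → A) → (∀ x → c (τ x) ≡ c x) → c p ≡ c q → ∀ x → c (sw x) ≡ c x
  sw-label c cτ e x with spot x
  ... | is-p refl  = trans (cong c sw-p) (symm e)
  ... | is-q refl  = trans (cong c sw-q) e
  ... | is-τp refl = trans (cong c sw-τp) (trans (cτ q) (trans (symm e) (symm (cτ p))))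
  ... | is-τq refl = trans (cong c sw-τq) (trans (cτ p) (trans e (symm (cτ q))))
  ... | is-off h   = trans (cong c (sw-off h)) (cτ x)

  module Count (a : Fin m → Fin m) (ia : Involutive a) (fa : FixFree a) where
    open Pairing a τ P₄ ia iτ fa fτ P₄-τ
      using (off; off-inv; off-off; off-on; off⊆; ret; ret-P; ret-cl; ret-colour; ret-inv; ret-ret; ret-unique; ret-≢; walk) public

    old new : Fin m → Fin m
    old = cl₂ a τ
    new = cl₂ a sw

    off⊆old : ∀ {x y} → cl₂ a off x ≡ cl₂ a off y → old x ≡ old y
    off⊆old = off⊆ τ (λ _ _ → refl)

    off⊆new : ∀ {x y} → cl₂ a off x ≡ cl₂ a off y → new x ≡ new y
    off⊆new = off⊆ sw (λ _ h → sw-off h)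

    private
      balance : nc all old + nc P₄ new ≡ nc all new + nc P₄ old
      balance = count-change a P₄ ia τ sw iτ sw-inv (λ x h → symm (sw-off h))

      old-τp : old (τ p) ≡ old p
      old-τp = cl₂-b a τ p
      old-τq : old (τ q) ≡ old q
      old-τq = cl₂-b a τ q
      new-q : new q ≡ new p
      new-q = trans (cong new (symm sw-p)) (cl₂-b a sw p)
      new-τq : new (τ q) ≡ new (τ p)
      new-τq = trans (cong new (symm sw-τp)) (cl₂-b a sw (τ p))

      old-two : ∀ x → P₄ x ≡ true → old x ≡ old p ⊎ old x ≡ old q
      old-two x h with spot x
      ... | is-p refl  = inj₁ refl
      ... | is-q refl  = inj₂ refl
      ... | is-τp refl = inj₁ old-τp
      ... | is-τq refl = inj₂ old-τq
      ... | is-off k   = absurd h k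

      new-two : ∀ x → P₄ x ≡ true → new x ≡ new p ⊎ new x ≡ new (τ p)
      new-two x h with spot x
      ... | is-p refl  = inj₁ refl
      ... | is-q refl  = inj₁ new-q
      ... | is-τp refl = inj₂ refl
      ... | is-τq refl = inj₂ new-τq
      ... | is-off k   = absurd h k

      old≤2 : nc P₄ old ≤ 2
      old≤2 = nc-two _ _ old-two
      new≤2 : nc P₄ new ≤ 2
      new≤2 = nc-two _ _ new-two
      old≥1 : 1 ≤ nc P₄ old
      old≥1 = nc-≥1 p P₄-p
      new≥1 : 1 ≤ nc P₄ new
      new≥1 = nc-≥1 p P₄-p

      old-one : old p ≡ old q → nc P₄ old ≤ 1
      old-one e = nc-one (old p) λ x h → [ id , (λ k → trans k (symm e)) ]′ (old-two x h)

      lin : ∀ {A B x y d} → A + x ≡ B + y → y ≤ d + x → A ≤ d + B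
      lin {A} {B} {x} {y} {d} e h = ℕP.+-cancelʳ-≤ x A (d + B) (ℕP.≤-trans (ℕP.≤-reflexive e)
        (ℕP.≤-trans (ℕP.+-monoʳ-≤ B h) (ℕP.≤-reflexive (arith B d x))))
        where
        arith : ∀ B d x → B + (d + x) ≡ d + B + x
        arith = solve-∀

    -- Before and after the switch, the four flags involved meet at least one and at most two
    -- classes.
    count-up : nc all new ≤ suc (nc all old)
    count-up = lin (symm balance) (ℕP.≤-trans new≤2 (s≤s old≥1))

    count-down : nc all old ≤ suc (nc all new)
    count-down = lin balance (ℕP.≤-trans old≤2 (s≤s new≥1))

    -- The path that joins p and q is closed up on its own by the switch.
    count-gain : cl₂ a off p ≡ cl₂ a off q → nc all new ≡ suc (nc all old)
    count-gain e = ℕP.≤-antisym count-up (lin balance′ (ℕP.≤-trans (s≤s (old-one (off⊆old e))) (nc-≥2 p (τ p) P₄-p P₄-τp split)))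
      where
      balance′ : suc (nc all old) + nc P₄ new ≡ nc all new + suc (nc P₄ old)
      balance′ = trans (cong suc balance) (symm (ℕP.+-suc _ _))
      ret-p : ret p ≡ q
      ret-p with ret-unique P₄-p P₄-q e
      ... | inj₁ k = ⊥-elim (p≢q (symm k))
      ... | inj₂ k = symm k
      τ-joined : cl₂ a off (τ p) ≡ cl₂ a off (τ q)
      τ-joined with spot (ret (τ p))
      ... | is-p k   = ⊥-elim (q≢τp (trans (symm ret-p) (trans (cong ret (symm k)) (ret-ret P₄-τp))))
      ... | is-q k   = ⊥-elim (fτ p (trans (symm (ret-ret P₄-τp)) (trans (cong ret k) (trans (cong ret (symm ret-p)) (ret-ret P₄-p)))))
      ... | is-τp k  = ⊥-elim (ret-≢ P₄-τp k)
      ... | is-τq k  = trans (symm (ret-cl P₄-τp)) (cong (cl₂ a off) k)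
      ... | is-off k = absurd (ret-P P₄-τp) k
      tight : ∀ {x y} → new x ≡ new y → cl₂ a off x ≡ cl₂ a off y
      tight {x} k = cl₂-elim a sw ia sw-inv (λ z → cl₂ a off x ≡ cl₂ a off z) (λ z h → trans h (symm (cl₂-a a off z))) st k refl
        where
        st : ∀ z → cl₂ a off x ≡ cl₂ a off z → cl₂ a off x ≡ cl₂ a off (sw z)
        st z h with spot z
        ... | is-p refl  = trans h (trans e (cong (cl₂ a off) (symm sw-p)))
        ... | is-q refl  = trans h (trans (symm e) (cong (cl₂ a off) (symm sw-q)))
        ... | is-τp refl = trans h (trans τ-joined (cong (cl₂ a off) (symm sw-τp)))
        ... | is-τq refl = trans h (trans (symm τ-joined) (cong (cl₂ a off) (symm sw-τq)))
        ... | is-off o   = trans h (trans (symm (cl₂-b a off z)) (cong (cl₂ a off) (trans (off-off {z} o) (symm (sw-off {z} o)))))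
      split : new p ≢ new (τ p)
      split k with ret-unique P₄-p P₄-τp (tight k)
      ... | inj₁ l = fτ p l
      ... | inj₂ l = q≢τp (trans (symm ret-p) (symm l))

    ret-cases : ret p ≡ τ p ⊎ old p ≡ old q
    ret-cases with spot (ret p)
    ... | is-p k   = ⊥-elim (ret-≢ P₄-p k)
    ... | is-q k   = inj₂ (symm (trans (cong old (symm k)) (off⊆old (ret-cl P₄-p))))
    ... | is-τp k  = inj₁ k
    ... | is-τq k  = inj₂ (trans (symm (off⊆old (ret-cl P₄-p))) (trans (cong old k) old-τq))
    ... | is-off k = absurd (ret-P P₄-p) k

    -- If the path from p does not end at τ p, then it links p with q or τ q, so the four flags meet
    -- a single old class, and at least one class meets them afterwards.
    count-keep : ret p ≢ τ p → nc all old ≤ nc all new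
    count-keep ne with ret-cases
    ... | inj₁ k = ⊥-elim (ne k)
    ... | inj₂ k = lin balance (ℕP.≤-trans (old-one k) new≥1)

    -- A path from p to τ p, closed up by τ, would be the whole old class of p, and q would not be
    -- on it.
    ret-bent : old p ≡ old q → ret p ≢ τ p
    ret-bent k e = [ (λ h → p≢q (symm h)) , (λ h → q≢τp (trans h e)) ]′ (ret-unique P₄-p P₄-q (tight k))
      where
      ret-q : cl₂ a off q ≡ cl₂ a off (τ q)
      ret-q with spot (ret q)
      ... | is-p h   = ⊥-elim (q≢τp (trans (symm (ret-ret P₄-q)) (trans (cong ret h) e)))
      ... | is-q h   = ⊥-elim (ret-≢ P₄-q h)
      ... | is-τp h  = ⊥-elim (p≢q (trans (symm (ret-ret P₄-p)) (trans (cong ret (trans e (symm h))) (ret-ret P₄-q))))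
      ... | is-τq h  = trans (symm (ret-cl P₄-q)) (cong (cl₂ a off) h)
      ... | is-off o = absurd (ret-P P₄-q) o
      ret-p : cl₂ a off p ≡ cl₂ a off (τ p)
      ret-p = trans (symm (ret-cl P₄-p)) (cong (cl₂ a off) e)
      tight : ∀ {x y} → old x ≡ old y → cl₂ a off x ≡ cl₂ a off y
      tight {x} k = cl₂-elim a τ ia iτ (λ z → cl₂ a off x ≡ cl₂ a off z) (λ z h → trans h (symm (cl₂-a a off z))) st k refl
        where
        st : ∀ z → cl₂ a off x ≡ cl₂ a off z → cl₂ a off x ≡ cl₂ a off (τ z)
        st z h with spot z
        ... | is-p refl  = trans h ret-p
        ... | is-q refl  = trans h ret-q
        ... | is-τp refl = trans h (trans (symm ret-p) (cong (cl₂ a off) (symm (iτ p))))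
        ... | is-τq refl = trans h (trans (symm ret-q) (cong (cl₂ a off) (symm (iτ q))))
        ... | is-off o   = trans h (trans (symm (cl₂-b a off z)) (cong (cl₂ a off) (off-off {z} o)))

    -- The paths then run from p to τ p and from q to τ q, and the switch joins them to one cycle:
    -- classes are merged and never split.
    old⊆new : ret p ≡ τ p → ∀ {x y} → old x ≡ old y → new x ≡ new y
    old⊆new e {x} k = cl₂-elim a τ ia iτ (λ z → new x ≡ new z) (λ z h → trans h (symm (cl₂-a a sw z))) st k refl
      where
      pp : new p ≡ new (τ p)
      pp = trans (symm (off⊆new (ret-cl P₄-p))) (cong new e)
      qq : new q ≡ new (τ q)
      qq = trans new-q (trans pp (symm new-τq))
      st : ∀ z → new x ≡ new z → new x ≡ new (τ z)
      st z h with spot z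
      ... | is-p refl  = trans h pp
      ... | is-q refl  = trans h qq
      ... | is-τp refl = trans h (trans (symm pp) (cong new (symm (iτ p))))
      ... | is-τq refl = trans h (trans (symm qq) (cong new (symm (iτ q))))
      ... | is-off o   = trans h (trans (symm (cl₂-b a sw z)) (cong new (sw-off {z} o)))

-- Ribbon graphs, Euler's inequality and orientability

-- Certificates for linear inequalities: S ≤ T is a sum of multiples of known inequalities, written
-- with `scale` and `_⊕_`, and the equation is an identity checked by the ring solver.
lin-≤ : ∀ (A B : ℕ) {S T : ℕ} → A + T ≡ B + S → S ≤ T → A ≤ B
lin-≤ A B {S} {T} e h = ℕP.+-cancelʳ-≤ T A B (ℕP.≤-trans (ℕP.≤-reflexive e) (ℕP.+-monoʳ-≤ B h))

lin-≤-slack : ∀ (A B : ℕ) {S T : ℕ} → A + T ≤ B + S → S ≤ T → A ≤ B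
lin-≤-slack A B {S} {T} e h = ℕP.+-cancelʳ-≤ T A B (ℕP.≤-trans e (ℕP.+-monoʳ-≤ B h))

infixr 6 _⊕_
_⊕_ : ∀ {a b c d} → a ≤ b → c ≤ d → a + c ≤ b + d
_⊕_ = ℕP.+-mono-≤

scale : ∀ k {a b} → a ≤ b → k * a ≤ k * b
scale k = ℕP.*-monoʳ-≤ k

-- A ribbon graph is given by its flags, two commuting involutions α (change of
-- vertex) and β (change of side) that span the edges, and a rotation τ (change
-- of edge).  The edges stay fixed; only the rotation will vary.
record Frame (m : ℕ) : Set where
  field
    α β : Fin m → Fin m
    α-inv : Involutive α
    β-inv : Involutive β
    α-fpf : FixFree α
    β-fpf : FixFree β
    αβ-comm : ∀ x → α (β x) ≡ β (α x)
    αβ-fpf : ∀ x → α (β x) ≢ x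

record Rotation {m : ℕ} (τ : Fin m → Fin m) : Set where
  constructor rotation
  field
    inv : Involutive τ
    fpf : FixFree τ

module Ribbon {m : ℕ} (fr : Frame m) where
  open Frame fr
    using (α; α-inv; β; β-inv)
  open Rotation

  rV rF rK : (Fin m → Fin m) → Fin m → Fin m
  rV τ = cl₂ β τ
  rF τ = cl₂ α τ
  rK τ = cl₃ α β τ

  #V #F #K : (Fin m → Fin m) → ℕ
  #V τ = nc all (rV τ)
  #F τ = nc all (rF τ)
  #K τ = nc all (rK τ)

  -- The Euler genus 2K - V + E - F does not grow from τ to τ′.
  infix 4 _⊒_
  _⊒_ : (τ τ′ : Fin m → Fin m) → Set
  τ ⊒ τ′ = 2 * #K τ′ + #V τ + #F τ ≤ 2 * #K τ + #V τ′ + #F τ′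

  ⊒-refl : ∀ {τ} → τ ⊒ τ
  ⊒-refl = ℕP.≤-refl

  ⊒-trans : ∀ {τ τ′ τ″} → τ ⊒ τ′ → τ′ ⊒ τ″ → τ ⊒ τ″
  ⊒-trans {τ} {τ′} {τ″} p q = lin-≤ _ _
    (arith (#K τ) (#V τ) (#F τ) (#K τ′) (#V τ′) (#F τ′) (#K τ″) (#V τ″) (#F τ″)) (p ⊕ q)
    where
    arith : ∀ k v f k′ v′ f′ k″ v″ f″ →
      (2 * k″ + v + f) + ((2 * k + v′ + f′) + (2 * k′ + v″ + f″)) ≡
      (2 * k + v″ + f″) + ((2 * k′ + v + f) + (2 * k″ + v′ + f′))
    arith = solve-∀

  Colouring : (Fin m → Fin m) → Set
  Colouring τ = Σ[ c ∈ (Fin m → Bool) ]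
    ((∀ x → c (α x) ≡ not (c x)) × (∀ x → c (β x) ≡ not (c x)) × (∀ x → c (τ x) ≡ not (c x)))

  rK-elim : ∀ {τ} → Rotation τ → (Q : Fin m → Set) → (∀ z → Q z → Q (α z)) → (∀ z → Q z → Q (β z)) →
    (∀ z → Q z → Q (τ z)) → ∀ {x y} → rK τ x ≡ rK τ y → Q x → Q y
  rK-elim {τ} r = cl₃-elim α β τ α-inv β-inv (inv r)

  rV-elim : ∀ {τ} → Rotation τ → (Q : Fin m → Set) → (∀ z → Q z → Q (β z)) →
    (∀ z → Q z → Q (τ z)) → ∀ {x y} → rV τ x ≡ rV τ y → Q x → Q y
  rV-elim {τ} r = cl₂-elim β τ β-inv (inv r)

  rF-elim : ∀ {τ} → Rotation τ → (Q : Fin m → Set) → (∀ z → Q z → Q (α z)) →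
    (∀ z → Q z → Q (τ z)) → ∀ {x y} → rF τ x ≡ rF τ y → Q x → Q y
  rF-elim {τ} r = cl₂-elim α τ α-inv (inv r)

module Dismantle {m : ℕ} (fr : Frame m) where
  open Frame fr
    using (α; α-fpf; α-inv; αβ-comm; β; β-fpf; β-inv)
  open Ribbon fr
    using (#F; #K; #V; Colouring; _⊒_; rF; rK; rK-elim; rV; ⊒-refl; ⊒-trans)
  open Rotation

  -- Moving one end of an edge to a vertex of its own.
  module Detach (τ : Fin m → Fin m) (r : Rotation τ) (p : Fin m) (ne : τ p ≢ β p) where
    open Switch τ (inv r) (fpf r) p (β p) (β-fpf p ∘ symm) (ne ∘ symm)
      using (P₄; P₄-p; P₄-q; P₄-τ; P₄-τp; P₄-τq; Spot; is-off; is-p; is-q; is-τp; is-τq; p≢τq; spot; sw; sw-fpf; sw-inv; sw-label; sw-off; sw-p; sw-q; sw-τp; module Count) public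

    q : Fin m
    q = β p

    detach-rot : Rotation sw
    detach-rot = rotation sw-inv sw-fpf

    private
      module CV = Count β β-inv β-fpf
        using (count-gain; off)
      module CF = Count α α-inv α-fpf
        using (count-down; count-gain; count-keep; off; off-inv; off-off; off-on; ret; ret-P; ret-cl; ret-colour; ret-≢)

      k k′ : Fin m → Fin m
      k  = rK τ
      k′ = rK sw

      k′-sw : ∀ x → k′ (sw x) ≡ k′ x
      k′-sw = cl₃-c α β sw

      k′-q : k′ q ≡ k′ p
      k′-q = cl₃-b α β sw p

      k′-τq : k′ (τ q) ≡ k′ (τ p)
      k′-τq = trans (cong k′ (symm sw-τp)) (k′-sw (τ p))

      off⊆k′ : ∀ {x y} → cl₂ α CF.off x ≡ cl₂ α CF.off y → k′ x ≡ k′ y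
      off⊆k′ {x} e = cl₂-elim α CF.off α-inv CF.off-inv (λ z → k′ x ≡ k′ z)
        (λ z h → trans h (symm (cl₃-a α β sw z))) st e refl
        where
        st : ∀ z → k′ x ≡ k′ z → k′ x ≡ k′ (CF.off z)
        st z h with bool-cases (P₄ z)
        ... | inj₁ o = trans h (cong k′ (symm (CF.off-on {z} o)))
        ... | inj₂ o = trans h (trans (symm (k′-sw z)) (cong k′ (trans (sw-off {z} o) (symm (CF.off-off {z} o)))))

      V-gain : #V sw ≡ suc (#V τ)
      V-gain = CV.count-gain (symm (cl₂-a β CV.off p))

      K-joined : k′ p ≡ k′ (τ p) → #K sw ≤ #K τ
      K-joined e = nc-coarser λ x y _ _ h → rK-elim r (λ z → k′ x ≡ k′ z)
        (λ z g → trans g (symm (cl₃-a α β sw z))) (λ z g → trans g (symm (cl₃-b α β sw z))) st h refl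
        where
        st : ∀ {x} z → k′ x ≡ k′ z → k′ x ≡ k′ (τ z)
        st z g with spot z
        ... | is-p refl  = trans g e
        ... | is-q refl  = trans g (trans k′-q (trans e (symm k′-τq)))
        ... | is-τp refl = trans g (trans (symm e) (cong k′ (symm (inv r p))))
        ... | is-τq refl = trans g (trans k′-τq (trans (symm e) (trans (symm k′-q) (cong k′ (symm (inv r q))))))
        ... | is-off o   = trans g (trans (symm (k′-sw z)) (cong k′ (sw-off {z} o)))

      K-up : k′ p ≢ k′ (τ p) → #K sw ≤ suc (#K τ)
      K-up apart = ℕP.≤-trans (ℕP.≤-reflexive (nc-split all S k′ (λ x y e → cong (_== k′ p) e)))
        (nc-one (k′ p) (λ x h → ==-sound h) ⊕ nc-≤ (λ x _ → x) (λ _ _ → refl) same)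
        where
        S : Fin m → Bool
        S x = k′ x == k′ p
        same : ∀ x y → not (S x) ≡ true → not (S y) ≡ true → k x ≡ k y → k′ x ≡ k′ y
        same x y nx ny e with rK-elim r Q
            (λ { z (inj₁ g) → inj₁ (trans (cl₃-a α β sw z) g) ; z (inj₂ (g , h)) → inj₂ (g , trans (cl₃-a α β sw z) h) })
            (λ { z (inj₁ g) → inj₁ (trans (cl₃-b α β sw z) g) ; z (inj₂ (g , h)) → inj₂ (g , trans (cl₃-b α β sw z) h) })
            st e (inj₁ refl)
          where
          -- An old component is a union of at most two new ones, that of p and that of τ p.
          -- Starting from x outside the component of p, the walk may only cross from the second
          -- into the first.
          Q : Fin m → Set
          Q z = k′ z ≡ k′ x ⊎ (k′ x ≡ k′ (τ p) × k′ z ≡ k′ p)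
          x≁p : k′ p ≢ k′ x
          x≁p g = ==-refute (not-elim nx) (symm g)
          st : ∀ z → Q z → Q (τ z)
          st z g with spot z
          st z (inj₁ g)       | is-p refl  = ⊥-elim (x≁p g)
          st z (inj₂ (g , _)) | is-p refl  = inj₁ (symm g)
          st z (inj₁ g)       | is-q refl  = ⊥-elim (x≁p (trans (symm k′-q) g))
          st z (inj₂ (g , _)) | is-q refl  = inj₁ (trans k′-τq (symm g))
          st z (inj₁ g)       | is-τp refl = inj₂ (symm g , cong k′ (inv r p))
          st z (inj₂ (_ , h)) | is-τp refl = ⊥-elim (apart (symm h))
          st z (inj₁ g)       | is-τq refl = inj₂ (trans (symm g) k′-τq , trans (cong k′ (inv r q)) k′-q)
          st z (inj₂ (_ , h)) | is-τq refl = ⊥-elim (apart (trans (symm h) k′-τq))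
          st z (inj₁ g)       | is-off o   = inj₁ (trans (cong k′ (symm (sw-off {z} o))) (trans (k′-sw z) g))
          st z (inj₂ (g , h)) | is-off o   = inj₂ (g , trans (cong k′ (symm (sw-off {z} o))) (trans (k′-sw z) h))
        ... | inj₁ g = symm g
        ... | inj₂ (_ , g) = ⊥-elim (==-refute (not-elim ny) g)

      -- The face segment that starts at p stays in its new component, hence cannot end at τ p or τ
      -- q. It ends at q, and the switch closes it to a face of its own.
      F-apart : k′ p ≢ k′ (τ p) → #F sw ≡ suc (#F τ)
      F-apart apart = CF.count-gain joined
        where
        joined : cl₂ α CF.off p ≡ cl₂ α CF.off q
        joined with spot (CF.ret p)
        ... | is-p e   = ⊥-elim (CF.ret-≢ P₄-p e)
        ... | is-q e   = trans (symm (CF.ret-cl P₄-p)) (cong (cl₂ α CF.off) e)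
        ... | is-τp e  = ⊥-elim (apart (trans (symm (off⊆k′ (CF.ret-cl P₄-p))) (cong k′ e)))
        ... | is-τq e  = ⊥-elim (apart (trans (symm (off⊆k′ (CF.ret-cl P₄-p))) (trans (cong k′ e) k′-τq)))
        ... | is-off o = absurd (CF.ret-P P₄-p) o

    -- V grows by one. If p and τ p stay connected, K does not grow and F drops by at most one;
    -- otherwise K grows by at most one and F by exactly one.
    detach-genus : τ ⊒ sw
    detach-genus rewrite V-gain with k′ p ≟ k′ (τ p)
    ... | yes e = lin-≤ _ _ (arith (#K sw) (#V τ) (#F τ) (#K τ) (#F sw)) (scale 2 (K-joined e) ⊕ CF.count-down)
      where
      arith : ∀ a v f b f′ → (2 * a + v + f) + (2 * b + suc f′) ≡ (2 * b + suc v + f′) + (2 * a + f)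
      arith = solve-∀
    ... | no n rewrite F-apart n = lin-≤ _ _ (arith (#K sw) (#V τ) (#F τ) (#K τ)) (scale 2 (K-up n))
      where
      arith : ∀ a v f b → (2 * a + v + f) + (2 * suc b) ≡ (2 * b + suc v + suc f) + 2 * a
      arith = solve-∀

    -- Only the restored pairs can spoil the colouring. If p and τ p lie in different components,
    -- flipping the colours on one of them repairs it. If they stay connected, constancy of the
    -- genus forces F to drop, so the face segment from p ends at τ p, and it alternates colours.
    detach-colour : sw ⊒ τ → Colouring sw → Colouring τ
    detach-colour back (c , cα , cβ , cs) = go (k′ p ≟ k′ (τ p)) (bool-cases′ (c (τ p)) (c p))
      where
      bool-cases′ : ∀ a b → a ≡ not b ⊎ a ≡ b
      bool-cases′ true  true  = inj₂ refl
      bool-cases′ true  false = inj₁ refl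
      bool-cases′ false true  = inj₁ refl
      bool-cases′ false false = inj₂ refl
      finish : (d : Fin m → Bool) → (∀ x → d (β x) ≡ not (d x)) → (∀ x → P₄ x ≡ false → d (τ x) ≡ not (d x)) →
        d (τ p) ≡ not (d p) → d (τ q) ≡ not (d q) → ∀ x → d (τ x) ≡ not (d x)
      finish d dβ dt ep eq x with spot x
      ... | is-p refl  = ep
      ... | is-q refl  = eq
      ... | is-τp refl = trans (cong d (inv r p)) (trans (symm (BP.not-involutive _)) (cong not (symm ep)))
      ... | is-τq refl = trans (cong d (inv r q)) (trans (symm (BP.not-involutive _)) (cong not (symm eq)))
      ... | is-off o   = dt x o
      c-off : ∀ x → P₄ x ≡ false → c (τ x) ≡ not (c x)
      c-off x o = trans (cong c (symm (sw-off {x} o))) (cs x)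
      c-τq : c (τ q) ≡ not (c (τ p))
      c-τq = trans (cong c (symm sw-τp)) (cs (τ p))
      good : c (τ p) ≡ not (c p) → Colouring τ
      good e = c , cα , cβ , finish c cβ c-off e (trans c-τq (cong not (trans e (symm (cβ p)))))
      go : Dec (k′ p ≡ k′ (τ p)) → c (τ p) ≡ not (c p) ⊎ c (τ p) ≡ c p → Colouring τ
      go _ (inj₁ e) = good e
      go (yes j) (inj₂ _) = good (trans (cong c (symm ret≡)) (CF.ret-colour c cα c-off P₄-p))
        where
        F-drop : suc (#F sw) ≤ #F τ
        F-drop = lin-≤ _ _ (arith (#F sw) (#K τ) (#K sw) (#V τ) (#F τ) (#V sw) V-gain) (scale 2 (K-joined j) ⊕ back)
          where
          arith : ∀ f′ a b v f v′ → v′ ≡ suc v → suc f′ + (2 * a + (2 * b + v + f)) ≡ f + (2 * b + (2 * a + v′ + f′))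
          arith f′ a b v f _ refl = arith′ f′ a b v f
            where
            arith′ : ∀ f′ a b v f → suc f′ + (2 * a + (2 * b + v + f)) ≡ f + (2 * b + (2 * a + suc v + f′))
            arith′ = solve-∀
        ret≡ : CF.ret p ≡ τ p
        ret≡ with CF.ret p ≟ τ p
        ... | yes e = e
        ... | no n  = ⊥-elim (ℕP.<-irrefl refl (ℕP.≤-trans F-drop (CF.count-keep n)))
      go (no n) (inj₂ e) = d , dα , dβ , finish d dβ d-off (trans d-out (trans e (trans (symm (BP.not-involutive _)) (cong not (symm d-in)))))
          (trans d-out′ (trans c-τq (cong not (trans e (trans (symm (BP.not-involutive (c p))) (trans (cong not (symm (cβ p))) (symm d-in′)))))))
        where
        d : Fin m → Bool
        d x = if k′ x == k′ p then not (c x) else c x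
        inside : ∀ x → k′ x ≡ k′ p → d x ≡ not (c x)
        inside x h rewrite ==-complete h = refl
        outside : ∀ x → k′ x ≢ k′ p → d x ≡ c x
        outside x h rewrite ==-false h = refl
        d-in : d p ≡ not (c p)
        d-in = inside p refl
        d-in′ : d q ≡ not (c q)
        d-in′ = inside q k′-q
        d-out : d (τ p) ≡ c (τ p)
        d-out = outside (τ p) (n ∘ symm)
        d-out′ : d (τ q) ≡ c (τ q)
        d-out′ = outside (τ q) (λ h → n (symm (trans (symm k′-τq) h)))
        transport : ∀ x y → k′ y ≡ k′ x → c y ≡ not (c x) → d y ≡ not (d x)
        transport x y h g = tr (k′ x ≟ k′ p)
          where
          tr : Dec (k′ x ≡ k′ p) → d y ≡ not (d x)
          tr (yes i) = trans (inside y (trans h i)) (trans (cong not g) (cong not (symm (inside x i))))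
          tr (no o)  = trans (outside y (λ i → o (trans (symm h) i))) (trans g (cong not (symm (outside x o))))
        dα : ∀ x → d (α x) ≡ not (d x)
        dα x = transport x (α x) (cl₃-a α β sw x) (cα x)
        dβ : ∀ x → d (β x) ≡ not (d x)
        dβ x = transport x (β x) (cl₃-b α β sw x) (cβ x)
        d-off : ∀ x → P₄ x ≡ false → d (τ x) ≡ not (d x)
        d-off x o = transport x (τ x) (trans (cong k′ (symm (sw-off {x} o))) (k′-sw x)) (c-off x o)

  record Detached (dead : Fin m → Bool) (Ψ : (Fin m → Fin m) → Set) (τ : Fin m → Fin m) : Set where
    field
      rot      : Fin m → Fin m
      rot-ok   : Rotation rot
      keeps    : Ψ rot
      genus    : τ ⊒ rot
      colour   : rot ⊒ τ → Colouring rot → Colouring τ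
      detached : ∀ p → dead p ≡ true → rot p ≡ β p

  -- A detached flag is never reattached by later switches, so one pass over all flags suffices. Ψ
  -- is whatever invariant the caller wants to carry along.
  detach-all : ∀ dead (Ψ : (Fin m → Fin m) → Set) →
    (∀ τ (r : Rotation τ) p (ne : τ p ≢ β p) → dead p ≡ true → Ψ τ → Ψ (Detach.sw τ r p ne)) →
    ∀ τ → Rotation τ → Ψ τ → Detached dead Ψ τ
  detach-all dead Ψ step τ r ψ = let τ′ , r′ , ψ′ , g , o , _ , d = go (allFin m) τ r ψ in
    record { rot = τ′ ; rot-ok = r′ ; keeps = ψ′ ; genus = g ; colour = o ; detached = λ p → d p (LM.∈-allFin p) }
    where
    Goal : List (Fin m) → (Fin m → Fin m) → Set
    Goal l τ = Σ[ τ′ ∈ (Fin m → Fin m) ] (Rotation τ′ × Ψ τ′ × (τ ⊒ τ′) × (τ′ ⊒ τ → Colouring τ′ → Colouring τ) ×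
      (∀ p → τ p ≡ β p → τ′ p ≡ β p) × (∀ p → p ∈ l → dead p ≡ true → τ′ p ≡ β p))
    go : ∀ l τ → Rotation τ → Ψ τ → Goal l τ
    go [] τ r ψ = τ , r , ψ , ⊒-refl {τ} , (λ _ c → c) , (λ _ e → e) , λ _ ()
    go (p ∷ l) τ r ψ with bool-cases (dead p) | τ p ≟ β p
    ... | inj₂ alive | _ = let τ′ , r′ , ψ′ , g , o , k , d = go l τ r ψ in
        τ′ , r′ , ψ′ , g , o , k , λ { x (here refl) dx → absurd dx alive ; x (there i) dx → d x i dx }
    ... | inj₁ dp | yes e = let τ′ , r′ , ψ′ , g , o , k , d = go l τ r ψ in
        τ′ , r′ , ψ′ , g , o , k , λ { x (here refl) dx → k p e ; x (there i) dx → d x i dx }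
    ... | inj₁ dp | no ne =
        let open Detach τ r p ne
              using (detach-colour; detach-genus; detach-rot; sw)
            τ′ , r′ , ψ′ , g , o , k , d = go l sw detach-rot (step τ r p ne dp ψ)
        in τ′ , r′ , ψ′ , ⊒-trans {τ} {sw} {τ′} detach-genus g ,
           (λ back c → detach-colour (⊒-trans {sw} {τ′} {τ} g back) (o (⊒-trans {τ′} {τ} {sw} back detach-genus) c)) ,
           (λ x e → k x (keep τ r p ne x e)) ,
           λ { x (here refl) dx → k p (Detach.sw-p τ r p ne) ; x (there i) dx → d x i dx }
      where
      keep : ∀ τ (r : Rotation τ) p (ne : τ p ≢ β p) x → τ x ≡ β x → Detach.sw τ r p ne x ≡ β x
      keep τ r p ne x e with Detach.spot τ r p ne x
      ... | Switch.is-p refl   = Detach.sw-p τ r p ne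
      ... | Switch.is-q refl   = trans (Detach.sw-q τ r p ne) (symm (β-inv p))
      ... | Switch.is-τp refl  = ⊥-elim (ne (inv-flip β β-inv (trans (symm e) (inv r p))))
      ... | Switch.is-τq refl  = ⊥-elim (ne (trans (cong τ (symm (inv-injective β β-inv (trans (symm e) (inv r (β p)))))) (inv r (β p))))
      ... | Switch.is-off o    = trans (Detach.sw-off τ r p ne {x} o) e

  private
    quad : Fin m → Fin 4 → Fin m
    quad x zero                   = x
    quad x (suc zero)             = β x
    quad x (suc (suc zero))       = α x
    quad x (suc (suc (suc zero))) = α (β x)

    edge-classes : ∀ τ → Rotation τ → (∀ x → τ x ≡ β x) → m ≤ #K τ * 4
    edge-classes τ r e = subst (_≤ #K τ * 4) (card-full m) (nc-small 4 all (rK τ) quad λ x y _ _ h →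
      rK-elim r (λ y → ∃[ j ] quad x j ≡ y) (qα x) (qβ x) (λ z g → subst (λ w → ∃[ j ] quad x j ≡ w) (symm (e z)) (qβ x z g)) (symm h) (zero , refl))
      where
      qα : ∀ x z → ∃[ j ] quad x j ≡ z → ∃[ j ] quad x j ≡ α z
      qα x z (zero , refl)                   = suc (suc zero) , refl
      qα x z (suc zero , refl)               = suc (suc (suc zero)) , refl
      qα x z (suc (suc zero) , refl)         = zero , symm (α-inv x)
      qα x z (suc (suc (suc zero)) , refl)   = suc zero , symm (α-inv _)
      qβ : ∀ x z → ∃[ j ] quad x j ≡ z → ∃[ j ] quad x j ≡ β z
      qβ x z (zero , refl)                   = suc zero , refl
      qβ x z (suc zero , refl)               = zero , symm (β-inv x)
      qβ x z (suc (suc zero) , refl)         = suc (suc (suc zero)) , αβ-comm x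
      qβ x z (suc (suc (suc zero)) , refl)   = suc (suc zero) , trans (symm (cong α (β-inv x))) (αβ-comm (β x))

    faces-detached : ∀ τ → Rotation τ → (∀ x → τ x ≡ β x) → #F τ ≤ #K τ
    faces-detached τ r e = nc-coarser λ x y _ _ → λ h → rK-elim r (λ z → rF τ x ≡ rF τ z)
      (λ z g → trans g (symm (cl₂-a α τ z)))
      (λ z g → trans g (trans (symm (cl₂-b α τ z)) (cong (rF τ) (e z))))
      (λ z g → trans g (symm (cl₂-b α τ z))) h refl

    pair : (Fin m → Fin m) → Fin m → Fin 2 → Fin m
    pair f x zero       = x
    pair f x (suc zero) = f x

    vertices-≤ : ∀ τ → #V τ * 2 ≤ m
    vertices-≤ τ = subst (#V τ * 2 ≤_) (card-full m) (nc-large 2 all (rV τ) (pair β)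
      (λ { x zero _ → refl , refl ; x (suc zero) _ → refl , cl₂-a β τ x })
      (λ { x zero zero _ _ → refl ; x zero (suc zero) _ e → ⊥-elim (β-fpf x (symm e))
         ; x (suc zero) zero _ e → ⊥-elim (β-fpf x e) ; x (suc zero) (suc zero) _ _ → refl }))

    euler-detached : ∀ τ → Rotation τ → (∀ x → τ x ≡ β x) → 4 * #V τ + 4 * #F τ ≤ 8 * #K τ + m
    euler-detached τ r e = lin-≤ _ _ (arith (#V τ) (#F τ) (#K τ) m)
      (scale 2 (vertices-≤ τ) ⊕ (scale 4 (faces-detached τ r e) ⊕ edge-classes τ r e))
      where
      arith : ∀ v f k m → (4 * v + 4 * f) + (2 * m + (4 * k + k * 4)) ≡ (8 * k + m) + (2 * (v * 2) + (4 * f + m))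
      arith = solve-∀

    dismantle : ∀ τ → Rotation τ → Detached all (λ _ → ⊤) τ
    dismantle τ r = detach-all all (λ _ → ⊤) (λ _ _ _ _ _ _ → tt) τ r tt

  -- That is, V - E + F ≤ 2K. Detaching all edges does not increase the genus, and for isolated
  -- edges the inequality follows from counting the flags of vertices and components.
  euler : ∀ τ → Rotation τ → 4 * #V τ + 4 * #F τ ≤ 8 * #K τ + m
  euler τ r = lin-≤ _ _ (arith (#V τ) (#F τ) (#K τ) (#V τ′) (#F τ′) (#K τ′) m)
      (ℕP.*-monoʳ-≤ 4 genus ⊕ euler-detached τ′ rot-ok (λ x → detached x refl))
    where
    open Detached (dismantle τ r) renaming (rot to τ′)
    arith : ∀ v f k v′ f′ k′ m → (4 * v + 4 * f) + (4 * (2 * k + v′ + f′) + (8 * k′ + m)) ≡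
      (8 * k + m) + (4 * (2 * k′ + v + f) + (4 * v′ + 4 * f′))
    arith = solve-∀

  -- The flags of a single edge are coloured through the smaller element of
  -- each of the two pairs {x , αβx}.
  private
    detached-colouring : ∀ τ → (∀ x → τ x ≡ β x) → Colouring τ
    detached-colouring τ e = c , (λ x → trans (cong₂ (λ a b → ⌊ a <? b ⌋) (pr-α x) (pr-αβ x)) (flip x)) , flip′ ,
        λ x → trans (cong c (e x)) (flip′ x)
      where
      pr : Fin m → ℕ
      pr x = toℕ x ℕ.⊓ toℕ (α (β x))
      c : Fin m → Bool
      c x = ⌊ pr x <? pr (β x) ⌋
      pr-α : ∀ x → pr (α x) ≡ pr (β x)
      pr-α x = trans (cong₂ ℕ._⊓_ (cong toℕ (cong α (symm (β-inv x))))
        (cong toℕ (trans (cong α (symm (αβ-comm x))) (α-inv (β x))))) (ℕP.⊓-comm _ _)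
      pr-αβ : ∀ x → pr (β (α x)) ≡ pr x
      pr-αβ x = trans (cong pr (symm (αβ-comm x))) (trans (pr-α (β x)) (cong pr (β-inv x)))
      distinct : ∀ x → pr x ≢ pr (β x)
      distinct x h with ℕP.⊓-sel (toℕ x) (toℕ (α (β x))) | ℕP.⊓-sel (toℕ (β x)) (toℕ (α (β (β x))))
      ... | inj₁ a | inj₁ b = β-fpf x (symm (FP.toℕ-injective (trans (symm a) (trans h b))))
      ... | inj₁ a | inj₂ b = α-fpf x (trans (cong α (symm (β-inv x))) (symm (FP.toℕ-injective (trans (symm a) (trans h b)))))
      ... | inj₂ a | inj₁ b = α-fpf (β x) (FP.toℕ-injective (trans (symm a) (trans h b)))
      ... | inj₂ a | inj₂ b = β-fpf x (trans (inv-injective α α-inv (FP.toℕ-injective (trans (symm a) (trans h b)))) (β-inv x))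
      cmp : ∀ a b → a ≢ b → ⌊ b <? a ⌋ ≡ not ⌊ a <? b ⌋
      cmp a b ne = bool-iff
        (λ h → not-intro (≢true λ k → ℕP.<-asym (⌊⌋-sound (a <? b) k) (⌊⌋-sound (b <? a) h)))
        (λ h → ⌊⌋-complete (b <? a) (ℕP.≤∧≢⇒< (ℕP.≮⇒≥ λ l → absurd (⌊⌋-complete (a <? b) l) (not-elim h)) (ne ∘ symm)))
      flip : ∀ x → ⌊ pr (β x) <? pr x ⌋ ≡ not (c x)
      flip x = cmp (pr x) (pr (β x)) (distinct x)
      flip′ : ∀ x → c (β x) ≡ not (c x)
      flip′ x = trans (cong (λ y → ⌊ pr (β x) <? pr y ⌋) (β-inv x)) (flip x)

  -- Genus zero leaves no room for a drop during the dismantling, so `colour` carries the colouring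
  -- of the isolated edges back to τ.
  planar-orientable : ∀ τ → Rotation τ → 8 * #K τ + m ≤ 4 * #V τ + 4 * #F τ → Colouring τ
  planar-orientable τ r h = colour back (detached-colouring τ′ (λ x → detached x refl))
    where
    open Detached (dismantle τ r) renaming (rot to τ′)
    back : τ′ ⊒ τ
    back = ℕP.*-cancelˡ-≤ 4 (lin-≤ _ _ (arith (#V τ) (#F τ) (#K τ) (#V τ′) (#F τ′) (#K τ′) m)
      (h ⊕ euler-detached τ′ rot-ok (λ x → detached x refl)))
      where
      arith : ∀ v f k v′ f′ k′ m → 4 * (2 * k + v′ + f′) + ((4 * v + 4 * f) + (8 * k′ + m)) ≡
        4 * (2 * k′ + v + f) + ((8 * k + m) + (4 * v′ + 4 * f′))
      arith = solve-∀

-- Restriction to a union of components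

module Subset {m : ℕ} (L : Fin m → Bool) where
  e : Fin (card L) → Fin m
  e = enum L

  e-in : ∀ i → L (e i) ≡ true
  e-in = enum-true L

  e-inj : ∀ {i j} → e i ≡ e j → i ≡ j
  e-inj = enum-injective L _ _

  module _ (a : Fin m → Fin m) (La : ∀ x → L (a x) ≡ L x) where
    abstract
      cut : Fin (card L) → Fin (card L)
      cut i = index L (a (e i)) (trans (La (e i)) (e-in i))

      e-cut : ∀ i → e (cut i) ≡ a (e i)
      e-cut i = enum-index L _ _

    cut-inv : Involutive a → Involutive cut
    cut-inv ia i = e-inj (trans (e-cut (cut i)) (trans (cong a (e-cut i)) (ia (e i))))

    cut-fpf : FixFree a → FixFree cut
    cut-fpf fa i h = fa (e i) (trans (symm (e-cut i)) (cong e h))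

  lift : ∀ x → L x ≡ true → ∃[ i ] e i ≡ x
  lift = enum-onto L

  module _ (a b : Fin m → Fin m) (La : ∀ x → L (a x) ≡ L x) (Lb : ∀ x → L (b x) ≡ L x)
    (ia : Involutive a) (ib : Involutive b) where

    cut₂-⇒ : ∀ {i j} → cl₂ (cut a La) (cut b Lb) i ≡ cl₂ (cut a La) (cut b Lb) j → cl₂ a b (e i) ≡ cl₂ a b (e j)
    cut₂-⇒ {i} h = cl₂-elim (cut a La) (cut b Lb) (cut-inv a La ia) (cut-inv b Lb ib) (λ z → cl₂ a b (e i) ≡ cl₂ a b (e z))
      (λ z g → trans g (symm (trans (cong (cl₂ a b) (e-cut a La z)) (cl₂-a a b (e z)))))
      (λ z g → trans g (symm (trans (cong (cl₂ a b) (e-cut b Lb z)) (cl₂-b a b (e z))))) h refl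

    cut₂-⇐ : ∀ {i j} → cl₂ a b (e i) ≡ cl₂ a b (e j) → cl₂ (cut a La) (cut b Lb) i ≡ cl₂ (cut a La) (cut b Lb) j
    cut₂-⇐ {i} {j} h = let k , ek , g = cl₂-elim a b ia ib (λ y → ∃[ k ] (e k ≡ y × r i ≡ r k))
                             (λ { _ (k , refl , g) → cut a La k , e-cut a La k , trans g (symm (cl₂-a (cut a La) (cut b Lb) k)) })
                             (λ { _ (k , refl , g) → cut b Lb k , e-cut b Lb k , trans g (symm (cl₂-b (cut a La) (cut b Lb) k)) })
                             h (i , refl , refl)
                       in trans g (cong r (e-inj ek))
      where
      r = cl₂ (cut a La) (cut b Lb)

    cut₂-count : nc all (cl₂ (cut a La) (cut b Lb)) ≡ nc L (cl₂ a b)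
    cut₂-count = ℕP.≤-antisym (nc-≤ (λ i _ → e i) (λ i _ → e-in i) (λ i j _ _ → cut₂-⇐))
      (nc-≤ (λ x p → proj₁ (lift x p)) (λ _ _ → refl) (λ x y p q h →
        subst₂ (λ u v → cl₂ a b u ≡ cl₂ a b v) (proj₂ (lift x p)) (proj₂ (lift y q)) (cut₂-⇒ h)))

  module _ (a b c : Fin m → Fin m) (La : ∀ x → L (a x) ≡ L x) (Lb : ∀ x → L (b x) ≡ L x) (Lc : ∀ x → L (c x) ≡ L x)
    (ia : Involutive a) (ib : Involutive b) (ic : Involutive c) where

    private
      r′ = cl₃ (cut a La) (cut b Lb) (cut c Lc)
      r  = cl₃ a b c

    cut₃-⇐ : ∀ {i j} → r (e i) ≡ r (e j) → r′ i ≡ r′ j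
    cut₃-⇐ {i} {j} h = let k , ek , g = cl₃-elim a b c ia ib ic (λ y → ∃[ k ] (e k ≡ y × r′ i ≡ r′ k))
                             (λ { _ (k , refl , g) → cut a La k , e-cut a La k , trans g (symm (cl₃-a (cut a La) (cut b Lb) (cut c Lc) k)) })
                             (λ { _ (k , refl , g) → cut b Lb k , e-cut b Lb k , trans g (symm (cl₃-b (cut a La) (cut b Lb) (cut c Lc) k)) })
                             (λ { _ (k , refl , g) → cut c Lc k , e-cut c Lc k , trans g (symm (cl₃-c (cut a La) (cut b Lb) (cut c Lc) k)) })
                             h (i , refl , refl)
                       in trans g (cong r′ (e-inj ek))

    cut₃-⇒ : ∀ {i j} → r′ i ≡ r′ j → r (e i) ≡ r (e j)
    cut₃-⇒ {i} h = cl₃-elim (cut a La) (cut b Lb) (cut c Lc) (cut-inv a La ia) (cut-inv b Lb ib) (cut-inv c Lc ic)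
      (λ z → r (e i) ≡ r (e z))
      (λ z g → trans g (symm (trans (cong r (e-cut a La z)) (cl₃-a a b c (e z)))))
      (λ z g → trans g (symm (trans (cong r (e-cut b Lb z)) (cl₃-b a b c (e z)))))
      (λ z g → trans g (symm (trans (cong r (e-cut c Lc z)) (cl₃-c a b c (e z))))) h refl

    cut₃-count : nc all r′ ≡ nc L r
    cut₃-count = ℕP.≤-antisym (nc-≤ (λ i _ → e i) (λ i _ → e-in i) (λ i j _ _ → cut₃-⇐))
      (nc-≤ (λ x p → proj₁ (lift x p)) (λ _ _ → refl) (λ x y p q h →
        subst₂ (λ u v → r u ≡ r v) (proj₂ (lift x p)) (proj₂ (lift y q)) (cut₃-⇒ h)))

module Sub {m : ℕ} (fr : Frame m) (τ : Fin m → Fin m) (ro : Rotation τ) (L : Fin m → Bool)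
  (Lα : ∀ x → L (Frame.α fr x) ≡ L x) (Lβ : ∀ x → L (Frame.β fr x) ≡ L x) (Lτ : ∀ x → L (τ x) ≡ L x) where
  open Frame fr
    using (α; α-fpf; α-inv; αβ-comm; αβ-fpf; β; β-fpf; β-inv)
  open Ribbon fr
    using (#F; #K; #V; rF; rK; rV)
  open Rotation
  open Subset L
    using (cut; cut-fpf; cut-inv; cut₂-count; cut₂-⇐; cut₂-⇒; cut₃-count; cut₃-⇐; cut₃-⇒; e; e-cut; e-in; e-inj; lift) public

  sub-frame : Frame (card L)
  sub-frame = record
    { α = cut α Lα ; β = cut β Lβ ; α-inv = cut-inv α Lα α-inv ; β-inv = cut-inv β Lβ β-inv
    ; α-fpf = cut-fpf α Lα α-fpf ; β-fpf = cut-fpf β Lβ β-fpf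
    ; αβ-comm = λ i → e-inj (trans (e-cut α Lα _) (trans (cong α (e-cut β Lβ i)) (trans (αβ-comm (e i))
        (trans (cong β (symm (e-cut α Lα i))) (symm (e-cut β Lβ _))))))
    ; αβ-fpf = λ i h → αβ-fpf (e i) (trans (cong α (symm (e-cut β Lβ i))) (trans (symm (e-cut α Lα _)) (cong e h))) }

  τ-cut : Fin (card L) → Fin (card L)
  τ-cut = cut τ Lτ

  sub-rot : Rotation τ-cut
  sub-rot = rotation (cut-inv τ Lτ (inv ro)) (cut-fpf τ Lτ (fpf ro))

  sub-V : Ribbon.#V sub-frame τ-cut ≡ nc L (rV τ)
  sub-V = cut₂-count β τ Lβ Lτ β-inv (inv ro)

  sub-F : Ribbon.#F sub-frame τ-cut ≡ nc L (rF τ)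
  sub-F = cut₂-count α τ Lα Lτ α-inv (inv ro)

  sub-K : Ribbon.#K sub-frame τ-cut ≡ nc L (rK τ)
  sub-K = cut₃-count α β τ Lα Lβ Lτ α-inv β-inv (inv ro)

  euler-on : 4 * nc L (rV τ) + 4 * nc L (rF τ) ≤ 8 * nc L (rK τ) + card L
  euler-on = subst₂ _≤_ (cong₂ (λ v f → 4 * v + 4 * f) sub-V sub-F) (cong (λ k → 8 * k + card L) sub-K)
    (Dismantle.euler sub-frame τ-cut sub-rot)

-- What is used of `Sub`, in a sealed form: `e` embeds the flags of the smaller frame, and classes
-- there correspond to classes in the ambient ribbon graph.
record Restriction {m : ℕ} (fr : Frame m) (τ : Fin m → Fin m) (L : Fin m → Bool) : Set where
  field
    frame  : Frame (card L)
    τ̂      : Fin (card L) → Fin (card L)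
    rot    : Rotation τ̂
    e      : Fin (card L) → Fin m
    e-in   : ∀ i → L (e i) ≡ true
    e-inj  : ∀ {i j} → e i ≡ e j → i ≡ j
    lift   : ∀ x → L x ≡ true → ∃[ i ] e i ≡ x
    e-α    : ∀ i → e (Frame.α frame i) ≡ Frame.α fr (e i)
    e-β    : ∀ i → e (Frame.β frame i) ≡ Frame.β fr (e i)
    e-τ    : ∀ i → e (τ̂ i) ≡ τ (e i)
    V-⇐    : ∀ {i j} → Ribbon.rV fr τ (e i) ≡ Ribbon.rV fr τ (e j) → Ribbon.rV frame τ̂ i ≡ Ribbon.rV frame τ̂ j
    V-⇒    : ∀ {i j} → Ribbon.rV frame τ̂ i ≡ Ribbon.rV frame τ̂ j → Ribbon.rV fr τ (e i) ≡ Ribbon.rV fr τ (e j)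
    F-⇐    : ∀ {i j} → Ribbon.rF fr τ (e i) ≡ Ribbon.rF fr τ (e j) → Ribbon.rF frame τ̂ i ≡ Ribbon.rF frame τ̂ j
    K-⇐    : ∀ {i j} → Ribbon.rK fr τ (e i) ≡ Ribbon.rK fr τ (e j) → Ribbon.rK frame τ̂ i ≡ Ribbon.rK frame τ̂ j
    K-⇒    : ∀ {i j} → Ribbon.rK frame τ̂ i ≡ Ribbon.rK frame τ̂ j → Ribbon.rK fr τ (e i) ≡ Ribbon.rK fr τ (e j)
    count-V : Ribbon.#V frame τ̂ ≡ nc L (Ribbon.rV fr τ)
    count-F : Ribbon.#F frame τ̂ ≡ nc L (Ribbon.rF fr τ)

abstract
  restriction : ∀ {m} (fr : Frame m) (τ : Fin m → Fin m) → Rotation τ → (L : Fin m → Bool) →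
    (∀ x → L (Frame.α fr x) ≡ L x) → (∀ x → L (Frame.β fr x) ≡ L x) → (∀ x → L (τ x) ≡ L x) → Restriction fr τ L
  restriction fr τ ro L Lα Lβ Lτ = record
    { frame = sub-frame ; τ̂ = τ-cut ; rot = sub-rot ; e = e ; e-in = e-in ; e-inj = e-inj ; lift = lift
    ; e-α = e-cut α Lα ; e-β = e-cut β Lβ ; e-τ = e-cut τ Lτ
    ; V-⇐ = cut₂-⇐ β τ Lβ Lτ β-inv inv ; V-⇒ = cut₂-⇒ β τ Lβ Lτ β-inv inv ; F-⇐ = cut₂-⇐ α τ Lα Lτ α-inv inv
    ; K-⇐ = cut₃-⇐ α β τ Lα Lβ Lτ α-inv β-inv inv ; K-⇒ = cut₃-⇒ α β τ Lα Lβ Lτ α-inv β-inv inv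
    ; count-V = sub-V ; count-F = sub-F }
    where
    open Frame fr using (α; β; α-inv; β-inv)
    open Rotation ro using (inv)
    open Sub fr τ ro L Lα Lβ Lτ
      using (sub-frame; τ-cut; sub-rot; e; e-in; e-inj; lift; e-cut; cut₂-⇐; cut₂-⇒; cut₃-⇐; cut₃-⇒; sub-V; sub-F)

module _ {m : ℕ} (fr : Frame m) where
  open Frame fr
    using (α; β; β-inv)
  open Ribbon fr
    using (#F; #K; #V; rF; rF-elim; rK; rK-elim; rV; rV-elim)
  open Rotation

  module _ (τ : Fin m → Fin m) (ro : Rotation τ) (L : Fin m → Bool)
    (Lα : ∀ x → L (α x) ≡ L x) (Lβ : ∀ x → L (β x) ≡ L x) (Lτ : ∀ x → L (τ x) ≡ L x) where

    private
      respect : ∀ {x y} → rK τ x ≡ rK τ y → L x ≡ L y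
      respect {x} h = rK-elim ro (λ z → L x ≡ L z) (λ z g → trans g (symm (Lα z))) (λ z g → trans g (symm (Lβ z)))
        (λ z g → trans g (symm (Lτ z))) h refl

    V⊆K : ∀ {x y} → rV τ x ≡ rV τ y → rK τ x ≡ rK τ y
    V⊆K {x} h = rV-elim ro (λ z → rK τ x ≡ rK τ z) (λ z g → trans g (symm (cl₃-b α β τ z)))
      (λ z g → trans g (symm (cl₃-c α β τ z))) h refl

    F⊆K : ∀ {x y} → rF τ x ≡ rF τ y → rK τ x ≡ rK τ y
    F⊆K {x} h = rF-elim ro (λ z → rK τ x ≡ rK τ z) (λ z g → trans g (symm (cl₃-a α β τ z)))
      (λ z g → trans g (symm (cl₃-c α β τ z))) h refl

    -- The complement of L satisfies Euler's inequality; subtracting it from the bound for the whole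
    -- leaves the same g for L.
    genus-on : ∀ g → 8 * #K τ + m ≤ 4 * #V τ + 4 * #F τ + 4 * g →
      8 * nc L (rK τ) + card L ≤ 4 * nc L (rV τ) + 4 * nc L (rF τ) + 4 * g
    genus-on g h = lin-≤ _ _ (arith (nc L (rK τ)) (card L) (nc L (rV τ)) (nc L (rF τ)) g
         (nc D (rK τ)) (card D) (nc D (rV τ)) (nc D (rF τ)))
        (subst₂ _≤_ (cong₂ (λ a b → 8 * a + b) (nc-split all L (rK τ) (λ _ _ → respect)) (trans (symm (card-full m)) (card-split all L)))
            (cong₂ (λ a b → 4 * a + 4 * b + 4 * g) (nc-split all L (rV τ) (λ _ _ e → respect (V⊆K e)))
               (nc-split all L (rF τ) (λ _ _ e → respect (F⊆K e)))) h
         ⊕ Sub.euler-on fr τ ro D (λ x → cong not (Lα x)) (λ x → cong not (Lβ x)) (λ x → cong not (Lτ x)))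
      where
      D : Fin m → Bool
      D x = not (L x)
      arith : ∀ k c v f g k′ c′ v′ f′ → (8 * k + c) + ((4 * (v + v′) + 4 * (f + f′) + 4 * g) + (8 * k′ + c′)) ≡
         (4 * v + 4 * f + 4 * g) + ((8 * (k + k′) + (c + c′)) + (4 * v′ + 4 * f′))
      arith = solve-∀

  module _ (τ : Fin m → Fin m) (ro : Rotation τ) (p : Fin m) (ne : τ p ≢ β p) where
    open Dismantle.Detach fr τ ro p ne
      using (P₄; P₄-p; P₄-q; P₄-τ; is-off; is-p; is-q; is-τp; is-τq; p≢τq; q; spot; sw; sw-off; sw-τp)

    -- Where the old rotation passes through p and q, the new one goes directly from τ p to τ q. So
    -- the other flags of the vertex stay together.
    detach-vertex : ∀ {x y} → x ≢ p → x ≢ q → y ≢ p → y ≢ q → rV τ x ≡ rV τ y → rV sw x ≡ rV sw y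
    detach-vertex {x} {y} x≢p x≢q y≢p y≢q h = finish (rV-elim ro Q sb st h (inj₂ (x≢p , x≢q , refl)))
      where
      w = rV sw
      Q : Fin m → Set
      Q z = ((z ≡ p ⊎ z ≡ q) × w x ≡ w (τ p)) ⊎ (z ≢ p × z ≢ q × w x ≡ w z)
      w-sw : ∀ z → w (sw z) ≡ w z
      w-sw = cl₂-b β sw
      w-τq : w (τ q) ≡ w (τ p)
      w-τq = trans (cong w (symm sw-τp)) (w-sw (τ p))
      sb : ∀ z → Q z → Q (β z)
      sb z (inj₁ (inj₁ refl , g)) = inj₁ (inj₂ refl , g)
      sb z (inj₁ (inj₂ refl , g)) = inj₁ (inj₁ (β-inv p) , g)
      sb z (inj₂ (a , b , g)) = inj₂ ((λ c → b (inv-flip β β-inv c)) , (λ c → a (inv-injective β β-inv c)) ,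
        trans g (symm (cl₂-a β sw z)))
      st : ∀ z → Q z → Q (τ z)
      st z k with spot z
      st z (inj₁ (_ , g))     | is-p refl  = inj₂ (fpf ro p , ne , g)
      st z (inj₂ (a , _))     | is-p e     = ⊥-elim (a e)
      st z (inj₁ (_ , g))     | is-q refl  = inj₂ (p≢τq ∘ symm , fpf ro q , trans g (symm w-τq))
      st z (inj₂ (_ , b , _)) | is-q e     = ⊥-elim (b e)
      st z (inj₂ (_ , _ , g)) | is-τp refl = inj₁ (inj₁ (inv ro p) , g)
      st z (inj₁ (_ , g))     | is-τp refl = inj₁ (inj₁ (inv ro p) , g)
      st z (inj₂ (_ , _ , g)) | is-τq refl = inj₁ (inj₂ (inv ro q) , trans g w-τq)
      st z (inj₁ (_ , g))     | is-τq refl = inj₁ (inj₂ (inv ro q) , g)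
      st z (inj₁ (inj₁ refl , _)) | is-off o = absurd P₄-p o
      st z (inj₁ (inj₂ refl , _)) | is-off o = absurd P₄-q o
      st z (inj₂ (_ , _ , g)) | is-off o =
        inj₂ ((λ c → absurd (trans (symm (P₄-τ z)) (trans (cong P₄ c) P₄-p)) o) ,
              (λ c → absurd (trans (symm (P₄-τ z)) (trans (cong P₄ c) P₄-q)) o) ,
              trans g (trans (symm (w-sw z)) (cong w (sw-off {z} o))))
      finish : Q y → w x ≡ w y
      finish (inj₁ (inj₁ e , _)) = ⊥-elim (y≢p e)
      finish (inj₁ (inj₂ e , _)) = ⊥-elim (y≢q e)
      finish (inj₂ (_ , _ , g))  = g

-- A ribbon graph of Euler genus at most g drawn on the edges D, with exactly
-- one ribbon for each edge of D.
record Drawing (n g : ℕ) (D : Fin n → Fin n → Bool) : Set where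
  field
    #fl   : ℕ
    frame : Frame #fl
  open Frame frame
    using (α; α-fpf; α-inv; αβ-comm; αβ-fpf; β; β-fpf; β-inv) public
  open Ribbon frame
    using (#F; #K; #V; rF; rF-elim; rK; rK-elim; rV; rV-elim) public
  field
    τ       : Fin #fl → Fin #fl
    rot     : Rotation τ
    lab     : Fin #fl → Fin n
    lab-β   : ∀ x → lab (β x) ≡ lab x
    lab-τ   : ∀ x → lab (τ x) ≡ lab x
    lab-class : ∀ x y → lab x ≡ lab y → rV τ x ≡ rV τ y
    edge-of : ∀ x → D (lab x) (lab (α x)) ≡ true
    flag-of : ∀ u v → D u v ≡ true → ∃[ x ] (lab x ≡ u × lab (α x) ≡ v)
    simple  : ∀ x y → lab x ≡ lab y → lab (α x) ≡ lab (α y) → y ≡ x ⊎ y ≡ β x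
    genus   : 8 * #K τ + #fl ≤ 4 * #V τ + 4 * #F τ + 4 * g

-- Drawings obtained from embeddings in a surface

module FromMap (M : Map) where
  map-frame : Frame (m M)
  map-frame = record { α = τ₀ M ; β = τ₂ M ; α-inv = inv₀ M ; β-inv = inv₂ M ; α-fpf = fpf₀ M ; β-fpf = fpf₂ M
                     ; αβ-comm = comm₀₂ M ; αβ-fpf = fpf₀₂ M }

  map-rot : Rotation (τ₁ M)
  map-rot = rotation (inv₁ M) (fpf₁ M)

  open Frame map-frame
    using (α; α-fpf; α-inv; αβ-comm; αβ-fpf; β; β-fpf; β-inv) public
  open Ribbon map-frame
    using (#F; #K; #V; rF; rF-elim; rK; rK-elim; rV; rV-elim) public

  vtx-β : ∀ x → vtx M (β x) ≡ vtx M x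
  vtx-β x = symm (vtx-orb₂ M x (β x) (stepb here))

  vtx-τ : ∀ x → vtx M (τ₁ M x) ≡ vtx M x
  vtx-τ x = symm (vtx-orb₂ M x (τ₁ M x) (stepa here))

  vtx-class : ∀ x y → vtx M x ≡ vtx M y → rV (τ₁ M) x ≡ rV (τ₁ M) y
  vtx-class x y e = go (vtx-orb₁ M x y e)
    where
    go : ∀ {y} → Reach₂ (τ₁ M) β x y → rV (τ₁ M) x ≡ rV (τ₁ M) y
    go here      = refl
    go (stepa p) = trans (go p) (symm (cl₂-b β (τ₁ M) _))
    go (stepb p) = trans (go p) (symm (cl₂-a β (τ₁ M) _))

  private
    classes-≥ : ∀ {k} (q : Fin (m M) → Fin k) (r : Fin (m M) → Fin (m M)) → (∀ i → ∃[ x ] q x ≡ i) →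
      (∀ {x y} → r x ≡ r y → q x ≡ q y) → k ≤ nc all r
    classes-≥ {k} q r onto sound = subst (_≤ nc all r) (nc-id k)
      (nc-≤ (λ i _ → proj₁ (onto i)) (λ _ _ → refl)
        (λ i j _ _ h → trans (symm (proj₂ (onto i))) (trans (sound h) (proj₂ (onto j)))))

    V-≥ : nV M ≤ #V (τ₁ M)
    V-≥ = classes-≥ (vtx M) (rV (τ₁ M)) (vtx-surj M) λ {x} h →
      rV-elim map-rot (λ z → vtx M x ≡ vtx M z) (λ z e → trans e (symm (vtx-β z))) (λ z e → trans e (symm (vtx-τ z))) h refl

    F-≥ : nF M ≤ #F (τ₁ M)
    F-≥ = classes-≥ (fac M) (rF (τ₁ M)) (fac-surj M) λ {x} h →
      rF-elim map-rot (λ z → fac M x ≡ fac M z) (λ z e → trans e (fac-orb₂ M _ _ (stepa here)))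
        (λ z e → trans e (fac-orb₂ M _ _ (stepb here))) h refl

    K-≤ : #K (τ₁ M) ≤ 1
    K-≤ = nc-one (rK (τ₁ M) (flag₀ M)) λ x _ → symm (go (connected M (flag₀ M) x))
      where
      go : ∀ {y} → Reach₃ α (τ₁ M) β (flag₀ M) y → rK (τ₁ M) (flag₀ M) ≡ rK (τ₁ M) y
      go here      = refl
      go (stepa p) = trans (go p) (symm (cl₃-a α β (τ₁ M) _))
      go (stepb p) = trans (go p) (symm (cl₃-c α β (τ₁ M) _))
      go (stepc p) = trans (go p) (symm (cl₃-b α β (τ₁ M) _))

    E-≥ : m M ≤ nE M * 4
    E-≥ = ℕP.≤-trans (subst (_≤ nc all (edg M) * 4) (card-full (m M)) (nc-small 4 all (edg M) quad cover))
      (ℕP.*-monoˡ-≤ 4 (nc-bound {P = all} {r = edg M}))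
      where
      quad : Fin (m M) → Fin 4 → Fin (m M)
      quad x zero                   = x
      quad x (suc zero)             = β x
      quad x (suc (suc zero))       = α x
      quad x (suc (suc (suc zero))) = α (β x)
      cover : ∀ x y → true ≡ true → true ≡ true → edg M y ≡ edg M x → ∃[ j ] quad x j ≡ y
      cover x y _ _ e = go (edg-orb₁ M x y (symm e))
        where
        go : ∀ {y} → Reach₂ α β x y → ∃[ j ] quad x j ≡ y
        go here = zero , refl
        go (stepa p) with go p
        ... | zero , refl                 = suc (suc zero) , refl
        ... | suc zero , refl             = suc (suc (suc zero)) , refl
        ... | suc (suc zero) , refl       = zero , symm (α-inv x)
        ... | suc (suc (suc zero)) , refl = suc zero , symm (α-inv _)
        go (stepb p) with go p
        ... | zero , refl                 = suc zero , refl
        ... | suc zero , refl             = zero , symm (β-inv x)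
        ... | suc (suc zero) , refl       = suc (suc (suc zero)) , αβ-comm x
        ... | suc (suc (suc zero)) , refl = suc (suc zero) , trans (symm (cong α (β-inv x))) (αβ-comm (β x))

    euler-formula : ∀ S → CellularIn M S → nV M + nF M + eulerGenus S ≡ nE M + 2
    euler-formula (handles h)   (_ , e) = e
    euler-formula (crosscaps c) (_ , e) = e

  -- Euler's formula times four. Vertices and faces of the map are no more than the orbits,
  -- connectedness gives K ≤ 1, and an edge has at most four flags.
  map-genus : ∀ S → CellularIn M S → 8 * #K (τ₁ M) + m M ≤ 4 * #V (τ₁ M) + 4 * #F (τ₁ M) + 4 * eulerGenus S
  map-genus S c = lin-≤ _ _ (arith (#K (τ₁ M)) (m M) (#V (τ₁ M)) (#F (τ₁ M)) (eulerGenus S) (nV M) (nF M) (nE M) (euler-formula S c))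
    (scale 8 K-≤ ⊕ E-≥ ⊕ scale 4 V-≥ ⊕ scale 4 F-≥)
    where
    arith : ∀ k m v f g v′ f′ e → v′ + f′ + g ≡ e + 2 →
      (8 * k + m) + (8 * 1 + (e * 4 + (4 * v + 4 * f))) ≡ (4 * v + 4 * f + 4 * g) + (8 * k + (m + (4 * v′ + 4 * f′)))
    arith k m v f g v′ f′ e h = trans (a₁ k m v f e) (trans (cong (λ t → 8 * k + m + 4 * t + (4 * v + 4 * f)) (symm h)) (a₂ k m v f g v′ f′))
      where
      a₁ : ∀ k m v f e → (8 * k + m) + (8 * 1 + (e * 4 + (4 * v + 4 * f))) ≡ 8 * k + m + 4 * (e + 2) + (4 * v + 4 * f)
      a₁ = solve-∀
      a₂ : ∀ k m v f g v′ f′ → 8 * k + m + 4 * (v′ + f′ + g) + (4 * v + 4 * f) ≡ (4 * v + 4 * f + 4 * g) + (8 * k + (m + (4 * v′ + 4 * f′)))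
      a₂ = solve-∀

-- One flag is selected for every edge of D; all other edges of the map are
-- detached and discarded.
module _ {n : ℕ} {V : Fin n → Bool} {E : Fin n → Fin n → Bool} {S : Surface} (emb : EmbedsSub n V E S)
  (D : Fin n → Fin n → Bool) (D-sym : ∀ u v → D u v ≡ true → D v u ≡ true) (D-irr : ∀ u v → D u v ≡ true → u ≢ v)
  (D-sub : ∀ u v → D u v ≡ true → V u ≡ true × V v ≡ true × E u v ≡ true) where

  private
    M = proj₁ emb
    f = proj₁ (proj₂ (proj₂ emb))
    f-inj = proj₁ (proj₂ (proj₂ (proj₂ emb)))
    f-adj = proj₂ (proj₂ (proj₂ (proj₂ emb)))
    open FromMap M
      using (#F; #K; #V; map-frame; map-genus; map-rot; rV; vtx-class; vtx-β; vtx-τ; α; α-inv; αβ-comm; β; β-inv)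

    pick′ : ∀ u v b → D u v ≡ b → Fin (m M)
    pick′ u v true  d = let a , b , c = D-sub u v d in proj₁ (f-adj u v a b c)
    pick′ u v false d = flag₀ M

    pick : Fin n → Fin n → Fin (m M)
    pick u v = pick′ u v (D u v) refl

    pick-ends : ∀ u v → D u v ≡ true → vtx M (pick u v) ≡ f u × vtx M (α (pick u v)) ≡ f v
    pick-ends u v d = go (D u v) refl d
      where
      go : ∀ b (e : D u v ≡ b) → b ≡ true → vtx M (pick′ u v b e) ≡ f u × vtx M (α (pick′ u v b e)) ≡ f v
      go true e _ = let a , b , c = D-sub u v e in proj₂ (f-adj u v a b c)

    -- `pick u v` and `pick v u` may lie on different parallel edges of the map; the condition u < v
    -- selects one of them. `near` and `far` are the two sides at the two ends.
    near far on : Fin n → Fin n → Fin (m M) → Bool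
    near u v z = (z == pick u v) ∨ (z == β (pick u v))
    far  u v z = (z == α (pick u v)) ∨ (z == α (β (pick u v)))
    on u v z = (D u v ∧ ⌊ toℕ u <? toℕ v ⌋) ∧ (near u v z ∨ far u v z)

    L : Fin (m M) → Bool
    L z = ex (λ u → ex (λ v → on u v z))

    record At (z : Fin (m M)) : Set where
      constructor at
      field
        u v : Fin n
        d   : D u v ≡ true
        u<v : toℕ u < toℕ v
        side : (z ≡ pick u v ⊎ z ≡ β (pick u v)) ⊎ (z ≡ α (pick u v) ⊎ z ≡ α (β (pick u v)))

    L-elim : ∀ {z} → L z ≡ true → At z
    L-elim {z} h =
      let u , h₁ = ex-elim h
          v , h₂ = ex-elim h₁
          h₃ , h₄ = ∧-elim {D u v ∧ ⌊ toℕ u <? toℕ v ⌋} h₂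
          d , lt = ∧-elim h₃
      in at u v d (⌊⌋-sound (toℕ u <? toℕ v) lt) (sides u v (∨-elim {near u v z} h₄))
      where
      sides : ∀ u v → near u v z ≡ true ⊎ far u v z ≡ true → _
      sides u v (inj₁ k) = inj₁ ([ inj₁ ∘ ==-sound , inj₂ ∘ ==-sound ]′ (∨-elim {z == pick u v} k))
      sides u v (inj₂ k) = inj₂ ([ inj₁ ∘ ==-sound , inj₂ ∘ ==-sound ]′ (∨-elim {z == α (pick u v)} k))

    L-intro : ∀ {z} → At z → L z ≡ true
    L-intro {z} (at u v d lt side) = ex-intro u (ex-intro v (∧-intro (∧-intro d (⌊⌋-complete (toℕ u <? toℕ v) lt)) (go side)))
      where
      go : (z ≡ pick u v ⊎ z ≡ β (pick u v)) ⊎ (z ≡ α (pick u v) ⊎ z ≡ α (β (pick u v))) → near u v z ∨ far u v z ≡ true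
      go (inj₁ (inj₁ e)) = ∨-introˡ (∨-introˡ (==-complete e))
      go (inj₁ (inj₂ e)) = ∨-introˡ (∨-introʳ {z == pick u v} (==-complete e))
      go (inj₂ (inj₁ e)) = ∨-introʳ {near u v z} (∨-introˡ (==-complete e))
      go (inj₂ (inj₂ e)) = ∨-introʳ {near u v z} (∨-introʳ {z == α (pick u v)} (==-complete e))

    At-α : ∀ {z} → At z → At (α z)
    At-α (at u v d lt (inj₁ (inj₁ refl))) = at u v d lt (inj₂ (inj₁ refl))
    At-α (at u v d lt (inj₁ (inj₂ refl))) = at u v d lt (inj₂ (inj₂ refl))
    At-α (at u v d lt (inj₂ (inj₁ refl))) = at u v d lt (inj₁ (inj₁ (α-inv _)))
    At-α (at u v d lt (inj₂ (inj₂ refl))) = at u v d lt (inj₁ (inj₂ (α-inv _)))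

    βαβ : ∀ z → β (α (β z)) ≡ α z
    βαβ z = trans (symm (αβ-comm (β z))) (cong α (β-inv z))

    At-β : ∀ {z} → At z → At (β z)
    At-β (at u v d lt (inj₁ (inj₁ refl))) = at u v d lt (inj₁ (inj₂ refl))
    At-β (at u v d lt (inj₁ (inj₂ refl))) = at u v d lt (inj₁ (inj₁ (β-inv _)))
    At-β (at u v d lt (inj₂ (inj₁ refl))) = at u v d lt (inj₂ (inj₂ (symm (αβ-comm _))))
    At-β (at u v d lt (inj₂ (inj₂ refl))) = at u v d lt (inj₂ (inj₁ (βαβ _)))

    Lα : ∀ x → L (α x) ≡ L x
    Lα x = bool-iff (λ h → subst (λ z → L z ≡ true) (α-inv x) (L-intro (At-α (L-elim h)))) (L-intro ∘ At-α ∘ L-elim)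

    Lβ : ∀ x → L (β x) ≡ L x
    Lβ x = bool-iff (λ h → subst (λ z → L z ≡ true) (β-inv x) (L-intro (At-β (L-elim h)))) (L-intro ∘ At-β ∘ L-elim)

    vtx-αβ : ∀ x → vtx M (α (β x)) ≡ vtx M (α x)
    vtx-αβ x = trans (cong (vtx M) (αβ-comm x)) (vtx-β (α x))

    Ends : Fin (m M) → Fin n → Fin n → Set
    Ends z a b = vtx M z ≡ f a × vtx M (α z) ≡ f b × D a b ≡ true

    ends : ∀ {z} → At z → ∃[ a ] ∃[ b ] Ends z a b
    ends (at u v d lt (inj₁ (inj₁ refl))) = let p , q = pick-ends u v d in u , v , p , q , d
    ends (at u v d lt (inj₁ (inj₂ refl))) = let p , q = pick-ends u v d in u , v , trans (vtx-β _) p , trans (vtx-αβ _) q , d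
    ends (at u v d lt (inj₂ (inj₁ refl))) = let p , q = pick-ends u v d in
      v , u , q , trans (cong (vtx M) (α-inv _)) p , D-sym u v d
    ends (at u v d lt (inj₂ (inj₂ refl))) = let p , q = pick-ends u v d in
      v , u , trans (vtx-αβ _) q , trans (cong (vtx M) (α-inv _)) (trans (vtx-β _) p) , D-sym u v d

    f-inj′ : ∀ {a b c d} → D a b ≡ true → D c d ≡ true → f a ≡ f c → a ≡ c
    f-inj′ {a} {b} {c} {d} p q e = f-inj a c (proj₁ (D-sub a b p)) (proj₁ (D-sub c d q)) e

    unique : ∀ {z w} (p : At z) (q : At w) → vtx M z ≡ vtx M w → vtx M (α z) ≡ vtx M (α w) → w ≡ z ⊎ w ≡ β z
    unique {z} {w} p q e e′ = go p q
      where
      same : ∀ {u v u′ v′} → D u v ≡ true → D u′ v′ ≡ true → f u ≡ f u′ → f v ≡ f v′ → u ≡ u′ × v ≡ v′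
      same d d′ h k = f-inj′ d d′ h , f-inj′ (D-sym _ _ d) (D-sym _ _ d′) k
      near-ends : ∀ {z u v} → D u v ≡ true → z ≡ pick u v ⊎ z ≡ β (pick u v) → vtx M z ≡ f u × vtx M (α z) ≡ f v
      near-ends d (inj₁ refl) = pick-ends _ _ d
      near-ends d (inj₂ refl) = let p , q = pick-ends _ _ d in trans (vtx-β _) p , trans (vtx-αβ _) q
      far-ends : ∀ {z u v} → D u v ≡ true → z ≡ α (pick u v) ⊎ z ≡ α (β (pick u v)) → vtx M z ≡ f v × vtx M (α z) ≡ f u
      far-ends d (inj₁ refl) = let p , q = pick-ends _ _ d in q , trans (cong (vtx M) (α-inv _)) p
      far-ends d (inj₂ refl) = let p , q = pick-ends _ _ d in trans (vtx-αβ _) q , trans (cong (vtx M) (α-inv _)) (trans (vtx-β _) p)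
      pairs : ∀ {x z w : Fin (m M)} → z ≡ x ⊎ z ≡ β x → w ≡ x ⊎ w ≡ β x → w ≡ z ⊎ w ≡ β z
      pairs (inj₁ a) (inj₁ b) = inj₁ (trans b (symm a))
      pairs (inj₁ refl) (inj₂ b) = inj₂ b
      pairs (inj₂ refl) (inj₁ refl) = inj₂ (symm (β-inv _))
      pairs (inj₂ a) (inj₂ b) = inj₁ (trans b (symm a))
      twist : ∀ {x z} → z ≡ α x ⊎ z ≡ α (β x) → z ≡ α x ⊎ z ≡ β (α x)
      twist (inj₁ h) = inj₁ h
      twist (inj₂ h) = inj₂ (trans h (αβ-comm _))
      go : At z → At w → w ≡ z ⊎ w ≡ β z
      go (at u v d lt (inj₁ s)) (at u′ v′ d′ lt′ (inj₁ s′)) with near-ends d s | near-ends d′ s′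
      ... | a , b | a′ , b′ with same d d′ (trans (symm a) (trans e a′)) (trans (symm b) (trans e′ b′))
      ...   | refl , refl = pairs s s′
      go (at u v d lt (inj₂ s)) (at u′ v′ d′ lt′ (inj₂ s′)) with far-ends d s | far-ends d′ s′
      ... | a , b | a′ , b′ with same d d′ (trans (symm b) (trans e′ b′)) (trans (symm a) (trans e a′))
      ...   | refl , refl = pairs (twist s) (twist s′)
      go (at u v d lt (inj₁ s)) (at u′ v′ d′ lt′ (inj₂ s′)) with near-ends d s | far-ends d′ s′
      ... | a , b | a′ , b′ with same d (D-sym _ _ d′) (trans (symm a) (trans e a′)) (trans (symm b) (trans e′ b′))
      ...   | refl , refl = ⊥-elim (ℕP.<-asym lt lt′)
      go (at u v d lt (inj₂ s)) (at u′ v′ d′ lt′ (inj₁ s′)) with far-ends d s | near-ends d′ s′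
      ... | a , b | a′ , b′ with same d (D-sym _ _ d′) (trans (symm b) (trans e′ b′)) (trans (symm a) (trans e a′))
      ...   | refl , refl = ⊥-elim (ℕP.<-asym lt lt′)

    -- The invariant of the detachment: rotations respect the vertices of the map, and selected
    -- flags at one vertex of the map stay at one vertex of the ribbon graph.
    Ψ : (Fin (m M) → Fin (m M)) → Set
    Ψ τ = (∀ x → vtx M (τ x) ≡ vtx M x) × (∀ x y → L x ≡ true → L y ≡ true → vtx M x ≡ vtx M y → rV τ x ≡ rV τ y)

    Ψ-step : ∀ τ (r : Rotation τ) p (ne : τ p ≢ β p) → not (L p) ≡ true → Ψ τ → Ψ (Dismantle.Detach.sw map-frame τ r p ne)
    Ψ-step τ r p ne dp (ψ₁ , ψ₂) = Dismantle.Detach.sw-label map-frame τ r p ne (vtx M) ψ₁ (symm (vtx-β p)) ,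
      λ x y lx ly e → detach-vertex map-frame τ r p ne (off-p lx) (off-q lx) (off-p ly) (off-q ly) (ψ₂ x y lx ly e)
      where
      off-p : ∀ {x} → L x ≡ true → x ≢ p
      off-p l refl = absurd l (not-elim dp)
      off-q : ∀ {x} → L x ≡ true → x ≢ β p
      off-q l refl = absurd l (trans (Lβ p) (not-elim dp))

    abstract
      det : Dismantle.Detached map-frame (λ x → not (L x)) Ψ (τ₁ M)
      det = Dismantle.detach-all map-frame (λ x → not (L x)) Ψ Ψ-step (τ₁ M) map-rot
        (vtx-τ , λ x y _ _ → vtx-class x y)

    open Dismantle.Detached det using (rot-ok; keeps; detached) renaming (rot to σ; genus to gen)

    -- Discarded flags are matched to their β-partners, which are discarded too, so the final
    -- rotation never leaves L.
    Lσ : ∀ x → L (σ x) ≡ L x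
    Lσ x with bool-cases (L x)
    ... | inj₂ dx = trans (cong L (detached x (not-intro dx))) (Lβ x)
    ... | inj₁ lx with bool-cases (L (σ x))
    ...   | inj₁ l = trans l (symm lx)
    ...   | inj₂ d = absurd (trans (cong L (trans (symm (detached (σ x) (not-intro d))) (Rotation.inv rot-ok x))) lx) (trans (Lβ (σ x)) d)

    module R = Sub map-frame σ rot-ok L Lα Lβ Lσ
      using (cut; cut₂-⇐; e; e-cut; e-in; e-inj; lift; sub-F; sub-K; sub-V; sub-frame; sub-rot; τ-cut)

    abstract
      end : ∀ i → ∃[ a ] ∃[ b ] Ends (R.e i) a b
      end i = ends (L-elim (R.e-in i))

    lab : Fin (card L) → Fin n
    lab i = proj₁ (end i)

    lab-vtx : ∀ i → vtx M (R.e i) ≡ f (lab i)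
    lab-vtx i = proj₁ (proj₂ (proj₂ (end i)))

    lab-unique : ∀ i {a b} → D a b ≡ true → vtx M (R.e i) ≡ f a → lab i ≡ a
    lab-unique i d e = f-inj′ (proj₂ (proj₂ (proj₂ (proj₂ (end i))))) d (trans (symm (lab-vtx i)) e)

    same-lab : ∀ i j → vtx M (R.e i) ≡ vtx M (R.e j) → lab i ≡ lab j
    same-lab i j e = lab-unique i (proj₂ (proj₂ (proj₂ (proj₂ (end j))))) (trans e (lab-vtx j))

    lab-α : ∀ i → lab (R.cut α Lα i) ≡ proj₁ (proj₂ (end i))
    lab-α i = let a , b , p , q , d = end i in
      lab-unique (R.cut α Lα i) (D-sym a b d) (trans (cong (vtx M) (R.e-cut α Lα i)) q)

    find : ∀ u v → D u v ≡ true → ∃[ x ] (L x ≡ true × vtx M x ≡ f u × vtx M (α x) ≡ f v)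
    find u v d with ℕP.<-cmp (toℕ u) (toℕ v)
    ... | tri< lt _ _ = pick u v , L-intro (at u v d lt (inj₁ (inj₁ refl))) , pick-ends u v d
    ... | tri≈ _ e _  = ⊥-elim (D-irr u v d (FP.toℕ-injective e))
    ... | tri> _ _ gt = let p , q = pick-ends v u (D-sym u v d) in
      α (pick v u) , L-intro (at v u (D-sym u v d) gt (inj₂ (inj₁ refl))) , q , trans (cong (vtx M) (α-inv _)) p

    total : 8 * #K σ + m M ≤ 4 * #V σ + 4 * #F σ + 4 * eulerGenus S
    total = lin-≤ _ _ (arith (#K σ) (m M) (#V σ) (#F σ) (eulerGenus S) (#K (τ₁ M)) (#V (τ₁ M)) (#F (τ₁ M)))
      (map-genus S (proj₁ (proj₂ emb)) ⊕ scale 4 gen)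
      where
      arith : ∀ k m v f g k′ v′ f′ →
        (8 * k + m) + ((4 * v′ + 4 * f′ + 4 * g) + 4 * (2 * k′ + v + f)) ≡
        (4 * v + 4 * f + 4 * g) + ((8 * k′ + m) + 4 * (2 * k + v′ + f′))
      arith = solve-∀

  drawing : Drawing n (eulerGenus S) D
  drawing = record
    { #fl = card L ; frame = R.sub-frame ; τ = R.τ-cut ; rot = R.sub-rot ; lab = lab
    ; lab-β = λ i → same-lab _ i (trans (cong (vtx M) (R.e-cut β Lβ i)) (vtx-β _))
    ; lab-τ = λ i → same-lab _ i (trans (cong (vtx M) (R.e-cut σ Lσ i)) (proj₁ keeps _))
    ; lab-class = λ i j e → R.cut₂-⇐ β σ Lβ Lσ β-inv (Rotation.inv rot-ok)
        (proj₂ keeps _ _ (R.e-in i) (R.e-in j) (trans (lab-vtx i) (trans (cong f e) (symm (lab-vtx j)))))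
    ; edge-of = λ i → subst (λ b → D (lab i) b ≡ true) (symm (lab-α i)) (proj₂ (proj₂ (proj₂ (proj₂ (end i)))))
    ; flag-of = λ u v d → let x , lx , p , q = find u v d ; i , ei = R.lift x lx in
        i , lab-unique i d (trans (cong (vtx M) ei) p) ,
        lab-unique (R.cut α Lα i) (D-sym u v d) (trans (cong (vtx M) (trans (R.e-cut α Lα i) (cong α ei))) q)
    ; simple = λ i j e e′ → [ (λ h → inj₁ (R.e-inj h)) , (λ h → inj₂ (R.e-inj (trans h (symm (R.e-cut β Lβ i))))) ]′
        (unique (L-elim (R.e-in i)) (L-elim (R.e-in j))
          (trans (lab-vtx i) (trans (cong f e) (symm (lab-vtx j))))
          (trans (cong (vtx M) (symm (R.e-cut α Lα i))) (trans (trans (lab-vtx _) (trans (cong f e′) (symm (lab-vtx _)))) (cong (vtx M) (R.e-cut α Lα j)))))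
    ; genus = subst₂ _≤_ (cong (λ k → 8 * k + card L) (symm R.sub-K))
        (cong₂ (λ v f → 4 * v + 4 * f + 4 * eulerGenus S) (symm R.sub-V) (symm R.sub-F))
        (genus-on map-frame σ rot-ok L Lα Lβ Lσ (eulerGenus S) total) }

-- Edge counts, and maps on the sphere from planar ribbon graphs

lookup-injective : ∀ {A : Set} {xs : List A} → AllPairs _≢_ xs → ∀ i j → lookup xs i ≡ lookup xs j → i ≡ j
lookup-injective (_ ∷ _) zero zero e = refl
lookup-injective (h ∷ _) zero (suc j) e = ⊥-elim (All.lookup h (LM.∈-lookup j) e)
lookup-injective (h ∷ _) (suc i) zero e = ⊥-elim (All.lookup h (LM.∈-lookup i) (symm e))
lookup-injective (_ ∷ p) (suc i) (suc j) e = cong suc (lookup-injective p i j e)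

nc-large′ : ∀ {m k} (P : Fin m → Bool) (r : Fin m → Fin k) (q : ℕ) (orbit : Fin m → List (Fin m)) →
  (∀ x → length (orbit x) ≡ q) → (∀ x → P x ≡ true → AllPairs _≢_ (orbit x)) →
  (∀ x → P x ≡ true → All (λ y → P y ≡ true × r y ≡ r x) (orbit x)) → nc P r * q ≤ card P
nc-large′ P r q orbit len dis ins = nc-large q P r (λ x j → lookup (orbit x) (subst Fin (symm (len x)) j))
  (λ x j p → All.lookup (ins x p) (LM.∈-lookup (subst Fin (symm (len x)) j)))
  (λ x i j p e → subst-inj (len x) (lookup-injective (dis x p) _ _ e))
  where
  subst-inj : ∀ {l q} (e : l ≡ q) {i j : Fin q} → subst Fin (symm e) i ≡ subst Fin (symm e) j → i ≡ j
  subst-inj refl h = h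

nc≤card : ∀ {m k} (P : Fin m → Bool) (r : Fin m → Fin k) → nc P r ≤ card P
nc≤card P r = ℕP.≤-trans (ℕP.≤-reflexive (symm (ℕP.*-identityʳ _)))
  (nc-large′ P r 1 (λ x → x ∷ []) (λ _ → refl) (λ _ _ → [] ∷ []) (λ x p → (p , refl) ∷ []))

card≤nc : ∀ {m k} (P : Fin m → Bool) (r : Fin m → Fin k) →
  (∀ x y → P x ≡ true → P y ≡ true → r y ≡ r x → y ≡ x) → card P ≤ nc P r
card≤nc P r inj = ℕP.≤-trans (nc-small 1 P r (λ x _ → x) (λ x y p q e → zero , symm (inj x y p q e)))
  (ℕP.≤-reflexive (ℕP.*-identityʳ _))

card-≤1 : ∀ {n} {f : Fin n → Bool} w → (∀ x → f x ≡ true → x ≡ w) → card f ≤ 1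
card-≤1 {f = f} w h = card-inj {n = 1} f (λ _ → true) (λ _ _ → zero) (λ _ _ → refl) (λ x y p q _ → trans (h x p) (symm (h y q)))

module Edges {m : ℕ} (fr : Frame m) where
  open Frame fr
    using (α; α-fpf; α-inv; αβ-comm; αβ-fpf; β; β-fpf; β-inv)

  rE : Fin m → Fin m
  rE = cl₂ α β

  #E : ℕ
  #E = nc all rE

  E-≤ : #E * 4 ≤ m
  E-≤ = subst (#E * 4 ≤_) (card-full m) (nc-large′ all rE 4 (λ x → x ∷ β x ∷ α x ∷ α (β x) ∷ []) (λ _ → refl)
    (λ x _ → ((β-fpf x ∘ symm) ∷ (α-fpf x ∘ symm) ∷ (αβ-fpf x ∘ symm) ∷ []) ∷
             ((λ e → αβ-fpf x (trans (cong α e) (α-inv x))) ∷ (α-fpf (β x) ∘ symm) ∷ []) ∷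
             ((λ e → β-fpf x (symm (inv-injective α α-inv e))) ∷ []) ∷ [] ∷ [])
    (λ x _ → (refl , refl) ∷ (refl , cl₂-b α β x) ∷ (refl , cl₂-a α β x) ∷ (refl , trans (cl₂-a α β (β x)) (cl₂-b α β x)) ∷ []))

  quad : Fin m → Fin 4 → Fin m
  quad x zero                   = x
  quad x (suc zero)             = β x
  quad x (suc (suc zero))       = α x
  quad x (suc (suc (suc zero))) = α (β x)

  in-quad : ∀ {x y} → rE x ≡ rE y → ∃[ j ] quad x j ≡ y
  in-quad {x} h = cl₂-elim α β α-inv β-inv (λ y → ∃[ j ] quad x j ≡ y) qα qβ h (zero , refl)
    where
    qα : ∀ z → ∃[ j ] quad x j ≡ z → ∃[ j ] quad x j ≡ α z
    qα z (zero , refl)                   = suc (suc zero) , refl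
    qα z (suc zero , refl)               = suc (suc (suc zero)) , refl
    qα z (suc (suc zero) , refl)         = zero , symm (α-inv x)
    qα z (suc (suc (suc zero)) , refl)   = suc zero , symm (α-inv _)
    qβ : ∀ z → ∃[ j ] quad x j ≡ z → ∃[ j ] quad x j ≡ β z
    qβ z (zero , refl)                   = suc zero , refl
    qβ z (suc zero , refl)               = zero , symm (β-inv x)
    qβ z (suc (suc zero) , refl)         = suc (suc (suc zero)) , αβ-comm x
    qβ z (suc (suc (suc zero)) , refl)   = suc (suc zero) , trans (symm (cong α (β-inv x))) (αβ-comm (β x))

  E-small : ∀ P → card P ≤ nc P rE * 4
  E-small P = nc-small 4 P rE quad λ x y _ _ h → in-quad (symm h)

  E-≥ : m ≤ #E * 4
  E-≥ = subst (_≤ #E * 4) (card-full m) (E-small all)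

  E-count : #E * 4 ≡ m
  E-count = ℕP.≤-antisym E-≤ E-≥

module ToMap {m : ℕ} (fr : Frame m) (τ : Fin m → Fin m) (ro : Rotation τ) (x₀ : Fin m)
  (conn : ∀ x y → Ribbon.rK fr τ x ≡ Ribbon.rK fr τ y)
  (planar : 8 + m ≤ 4 * Ribbon.#V fr τ + 4 * Ribbon.#F fr τ) where
  open Frame fr
    using (α; α-fpf; α-inv; αβ-comm; αβ-fpf; β; β-fpf; β-inv)
  open Ribbon fr
    using (#F; #K; #V; rF; rK; rK-elim; rV; rV-elim)
  open Rotation ro

  open Edges fr
    using (#E; E-≤; E-≥; rE)

  private
    K-≤1 : #K τ ≤ 1
    K-≤1 = nc-one (rK τ x₀) λ x _ → conn x x₀

    -- One inequality is the hypothesis `planar`, the other is Euler's inequality for a connected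
    -- ribbon graph.
    formula : #V τ + #F τ + 0 ≡ #E + 2
    formula = ℕP.*-cancelˡ-≡ _ _ 4 (ℕP.≤-antisym
      (lin-≤ _ _ (a₁ (#V τ) (#F τ) #E (#K τ) m) (Dismantle.euler fr τ ro ⊕ scale 8 K-≤1 ⊕ E-≥))
      (lin-≤ _ _ (a₂ (#V τ) (#F τ) #E m) (planar ⊕ E-≤)))
      where
      a₁ : ∀ v f e k m → 4 * (v + f + 0) + ((8 * k + m) + (8 * 1 + e * 4)) ≡ 4 * (e + 2) + ((4 * v + 4 * f) + (8 * k + m))
      a₁ = solve-∀
      a₂ : ∀ v f e m → 4 * (e + 2) + ((4 * v + 4 * f) + m) ≡ 4 * (v + f + 0) + ((8 + m) + e * 4)
      a₂ = solve-∀

    reach₂ : ∀ (a b : Fin m → Fin m) → Involutive a → Involutive b → ∀ {x y} → cl₂ a b x ≡ cl₂ a b y → Reach₂ a b x y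
    reach₂ a b ia ib {x} h = cl₂-elim a b ia ib (Reach₂ a b x) (λ _ → stepa) (λ _ → stepb) h here

    unreach₂ : ∀ (a b : Fin m → Fin m) {x y} → Reach₂ a b x y → cl₂ a b x ≡ cl₂ a b y
    unreach₂ a b here      = refl
    unreach₂ a b (stepa p) = trans (unreach₂ a b p) (symm (cl₂-a a b _))
    unreach₂ a b (stepb p) = trans (unreach₂ a b p) (symm (cl₂-b a b _))

    swap₂ : ∀ {a b : Fin m → Fin m} {x y} → Reach₂ a b x y → Reach₂ b a x y
    swap₂ here      = here
    swap₂ (stepa p) = stepb (swap₂ p)
    swap₂ (stepb p) = stepa (swap₂ p)

    reach₃ : ∀ x y → Reach₃ α τ β x y
    reach₃ x y = rK-elim ro (Reach₃ α τ β x) (λ _ → stepa) (λ _ → stepc) (λ _ → stepb) (conn x y) here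

  map : Map
  map = record
    { m = m ; flag₀ = x₀ ; τ₀ = α ; τ₁ = τ ; τ₂ = β ; inv₀ = α-inv ; inv₁ = inv ; inv₂ = β-inv
    ; fpf₀ = α-fpf ; fpf₁ = fpf ; fpf₂ = β-fpf ; comm₀₂ = αβ-comm ; fpf₀₂ = αβ-fpf
    ; connected = reach₃ ; nV = #V τ ; nE = #E ; nF = #F τ
    ; vtx = class-of (rV τ) ; edg = class-of rE ; fac = class-of (rF τ)
    ; vtx-surj = class-of-onto (rV τ) ; edg-surj = class-of-onto rE ; fac-surj = class-of-onto (rF τ)
    ; vtx-orb₁ = λ x y e → swap₂ (reach₂ β τ β-inv inv (class-of-sound (rV τ) e))
    ; vtx-orb₂ = λ x y p → class-of-≡ (rV τ) (unreach₂ β τ (swap₂ p))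
    ; edg-orb₁ = λ x y e → reach₂ α β α-inv β-inv (class-of-sound rE e)
    ; edg-orb₂ = λ x y p → class-of-≡ rE (unreach₂ α β p)
    ; fac-orb₁ = λ x y e → reach₂ α τ α-inv inv (class-of-sound (rF τ) e)
    ; fac-orb₂ = λ x y p → class-of-≡ (rF τ) (unreach₂ α τ p) }

  map-sphere : CellularIn map sphere
  map-sphere = (let c , cα , cβ , cτ = Dismantle.planar-orientable fr τ ro (ℕP.≤-trans (ℕP.+-monoˡ-≤ m (ℕP.*-monoʳ-≤ 8 K-≤1)) planar)
                in c , cα , cτ , cβ) , formula

  sphere-embedding : ∀ {n} (lab : Fin m → Fin n) → (∀ x → lab (β x) ≡ lab x) → (∀ x → lab (τ x) ≡ lab x) →
    (V : Fin n → Bool) (E : Fin n → Fin n → Bool) →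
    (∀ x y → lab x ≡ lab y → rV τ x ≡ rV τ y) → (∀ u → V u ≡ true → ∃[ x ] lab x ≡ u) →
    (∀ u v → V u ≡ true → V v ≡ true → E u v ≡ true → ∃[ x ] (lab x ≡ u × lab (α x) ≡ v)) → EmbedsSub n V E sphere
  sphere-embedding {n} lab lab-β lab-τ V E one vert edge = map , map-sphere , f , f-inj , f-adj
    where
    flag′ : ∀ u b → V u ≡ b → Fin m
    flag′ u true  p = proj₁ (vert u p)
    flag′ u false p = x₀
    f : Fin n → Fin (#V τ)
    f u = class-of (rV τ) (flag′ u (V u) refl)
    flag-lab : ∀ u → V u ≡ true → lab (flag′ u (V u) refl) ≡ u
    flag-lab u p = go (V u) refl p
      where
      go : ∀ b (e : V u ≡ b) → b ≡ true → lab (flag′ u b e) ≡ u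
      go true e _ = proj₂ (vert u e)
    f-lab : ∀ {x} → V (lab x) ≡ true → class-of (rV τ) x ≡ f (lab x)
    f-lab {x} p = class-of-≡ (rV τ) (one _ _ (symm (flag-lab (lab x) p)))
    f-inj : ∀ u v → V u ≡ true → V v ≡ true → f u ≡ f v → u ≡ v
    f-inj u v p q e = trans (symm (flag-lab u p)) (trans
      (rV-elim ro (λ z → lab (flag′ u (V u) refl) ≡ lab z) (λ z g → trans g (symm (lab-β z))) (λ z g → trans g (symm (lab-τ z)))
        (class-of-sound (rV τ) e) refl) (flag-lab v q))
    f-adj : ∀ u v → V u ≡ true → V v ≡ true → E u v ≡ true → MapAdj map (f u) (f v)
    f-adj u v p q e with edge u v p q e
    ... | x , refl , refl = x , f-lab p , f-lab q

EmbedsSub-mono : ∀ {n} {V V′ : Fin n → Bool} {E E′ : Fin n → Fin n → Bool} {S} →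
  (∀ u → V′ u ≡ true → V u ≡ true) → (∀ u v → V′ u ≡ true → V′ v ≡ true → E′ u v ≡ true → E u v ≡ true) →
  EmbedsSub n V E S → EmbedsSub n V′ E′ S
EmbedsSub-mono hv he (M , c , f , inj , ad) = M , c , f , (λ u v p q → inj u v (hv u p) (hv v q)) ,
  λ u v p q e → ad u v (hv u p) (hv v q) (he u v p q e)

EmbedsSub-pull : ∀ {h n} {V : Fin n → Bool} {E : Fin n → Fin n → Bool} {S} (ψ : Fin h → Fin n) → (∀ i j → ψ i ≡ ψ j → i ≡ j) →
  EmbedsSub n V E S → EmbedsSub h (V ∘ ψ) (λ i j → E (ψ i) (ψ j)) S
EmbedsSub-pull ψ ψ-inj (M , c , f , inj , ad) = M , c , f ∘ ψ , (λ u v p q e → ψ-inj u v (inj _ _ p q e)) ,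
  λ u v → ad (ψ u) (ψ v)

-- Graphs in a surface have vertices of small degree

module Sparse {n g : ℕ} {D : Fin n → Fin n → Bool} (dr : Drawing n g D) (D-irr : ∀ u v → D u v ≡ true → u ≢ v)
  (S : Fin n → Bool) (D-S : ∀ u v → D u v ≡ true → S u ≡ true) (u₀ : Fin n) (u₀∈ : S u₀ ≡ true)
  (deg : ∀ u → S u ≡ true → 7 + 6 * g ≤ card (D u)) where
  open Drawing dr
    using (#F; #K; #V; #fl; edge-of; flag-of; genus; lab; lab-class; lab-β; lab-τ; rF; rV-elim; rot; simple; α; α-inv; αβ-comm; β; β-fpf; β-inv; τ)
  open Rotation rot

  private
    S-lab : ∀ x → S (lab x) ≡ true
    S-lab x = D-S _ _ (edge-of x)

    -- If τ w = β w, then w and β w are the only flags at their vertex, which would have degree one.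
    no-leaf : ∀ w → τ w ≢ β w
    no-leaf w e = ℕP.<⇒≱ (s≤s (s≤s z≤n)) (ℕP.≤-trans (deg (lab w) (S-lab w)) (card-≤1 (lab (α w)) only))
      where
      Q : Fin #fl → Set
      Q z = z ≡ w ⊎ z ≡ β w
      only : ∀ v → D (lab w) v ≡ true → v ≡ lab (α w)
      only v d with flag-of (lab w) v d
      ... | x , lx , refl with rV-elim rot Q
            (λ { z (inj₁ refl) → inj₂ refl ; z (inj₂ refl) → inj₁ (β-inv w) })
            (λ { z (inj₁ refl) → inj₂ e ; z (inj₂ refl) → inj₁ (trans (cong τ (symm e)) (inv w)) })
            (lab-class w x (symm lx)) (inj₁ refl)
      ...   | inj₁ refl = refl
      ...   | inj₂ refl = trans (cong lab (αβ-comm w)) (lab-β (α w))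

    ends≢ : ∀ x → lab x ≢ lab (α x)
    ends≢ x = D-irr _ _ (edge-of x)

    -- A face walk that returns to its starting vertex after two edges would, by simplicity, run
    -- back along the same edge and so turn at a leaf.
    turn≢ : ∀ x → lab x ≢ lab (α (τ (α x)))
    turn≢ x e with simple (α x) (τ (α x)) (symm (lab-τ (α x))) (trans (cong lab (α-inv x)) e)
    ... | inj₁ h = fpf (α x) h
    ... | inj₂ h = no-leaf (α x) h

    -- The flags met in three steps along a face. They are distinct, as a simple graph without
    -- leaves has no face of length one or two.
    face : Fin #fl → List (Fin #fl)
    face x = x ∷ α x ∷ τ (α x) ∷ α (τ (α x)) ∷ τ (α (τ (α x))) ∷ α (τ (α (τ (α x)))) ∷ []

    apart : ∀ {x y} → lab x ≢ lab y → x ≢ y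
    apart ne e = ne (cong lab e)

    faces : #F τ * 6 ≤ #fl
    faces = subst (#F τ * 6 ≤_) (card-full #fl) (nc-large′ all (rF τ) 6 face (λ _ → refl) (λ x _ → dis x) (λ x _ → ins x))
      where
      ins : ∀ x → All (λ y → true ≡ true × rF τ y ≡ rF τ x) (face x)
      ins x = (refl , refl) ∷ (refl , e₁) ∷ (refl , e₂) ∷ (refl , e₃) ∷ (refl , e₄) ∷ (refl , trans (cl₂-a α τ _) e₄) ∷ []
        where
        e₁ = cl₂-a α τ x
        e₂ = trans (cl₂-b α τ (α x)) e₁
        e₃ = trans (cl₂-a α τ (τ (α x))) e₂
        e₄ = trans (cl₂-b α τ (α (τ (α x)))) e₃
      dis : ∀ x → AllPairs _≢_ (face x)
      dis x = (apart a≢b ∷ apart (λ e → a≢b (trans e lab₂)) ∷ apart a≢c ∷ apart (λ e → a≢c (trans e lab₄)) ∷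
                 (λ e → b≢c (trans (cong lab (trans (cong α e) (α-inv y₄))) lab₄)) ∷ []) ∷
              ((fpf y₁ ∘ symm) ∷ apart b≢c ∷ apart (λ e → b≢c (trans e lab₄)) ∷ apart b≢d ∷ []) ∷
              (apart (λ e → b≢c (trans (symm lab₂) e)) ∷ apart (λ e → b≢c (trans (symm lab₂) (trans e lab₄))) ∷
                 apart (λ e → b≢d (trans (symm lab₂) e)) ∷ []) ∷
              ((fpf y₃ ∘ symm) ∷ apart (λ e → c≢d (trans lab₄ e)) ∷ []) ∷
              (apart c≢d ∷ []) ∷ [] ∷ []
        where
        y₁ = α x
        y₂ = τ y₁
        y₃ = α y₂
        y₄ = τ y₃
        y₅ = α y₄
        lab₂ : lab y₂ ≡ lab y₁
        lab₂ = lab-τ y₁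
        lab₄ : lab y₄ ≡ lab y₃
        lab₄ = lab-τ y₃
        a≢b : lab x ≢ lab y₁
        a≢b = ends≢ x
        b≢c : lab y₁ ≢ lab y₃
        b≢c e = ends≢ y₂ (trans lab₂ e)
        c≢d : lab y₄ ≢ lab y₅
        c≢d = ends≢ y₄
        a≢c : lab x ≢ lab y₃
        a≢c = turn≢ x
        b≢d : lab y₁ ≢ lab y₅
        b≢d e = turn≢ y₂ (trans lab₂ e)

    vertices : #V τ ≤ card S
    vertices = ℕP.≤-trans (nc-≤ {Q = S} {r′ = id} (λ x _ → lab x) (λ x _ → S-lab x) (λ x y _ _ → lab-class x y)) (nc≤card S id)

    flags : card S * (2 * (7 + 6 * g)) ≤ #fl
    flags = ℕP.≤-trans (sumF-bound S (2 * (7 + 6 * g)) (λ u → card (λ x → all x ∧ (lab x == u))) star)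
      (ℕP.≤-reflexive (trans (symm (card-fibres all lab)) (card-full #fl)))
      where
      star : ∀ u → S u ≡ true → 2 * (7 + 6 * g) ≤ card (λ x → all x ∧ (lab x == u))
      star u s = ℕP.≤-trans (ℕP.*-monoʳ-≤ 2 (ℕP.≤-trans (deg u s) (ℕP.≤-trans (card≤nc (D u) id (λ _ _ _ _ e → e)) spread)))
        (ℕP.≤-trans (ℕP.≤-reflexive (ℕP.*-comm 2 (nc P r))) (nc-large′ P r 2 (λ x → x ∷ β x ∷ []) (λ _ → refl)
          (λ x _ → ((β-fpf x ∘ symm) ∷ []) ∷ [] ∷ [])
          (λ x p → (p , refl) ∷ (==-complete (trans (lab-β x) (==-sound p)) , trans (cong lab (αβ-comm x)) (lab-β (α x))) ∷ [])))
        where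
        P : Fin #fl → Bool
        P x = lab x == u
        r : Fin #fl → Fin n
        r x = lab (α x)
        spread : nc (D u) id ≤ nc P r
        spread = nc-≤ (λ v d → proj₁ (flag-of u v d)) (λ v d → ==-complete (proj₁ (proj₂ (flag-of u v d))))
          (λ v w d d′ e → trans (symm (proj₂ (proj₂ (flag-of u v d)))) (trans e (proj₂ (proj₂ (flag-of u w d′)))))

  -- Let s ≥ 1 be the size of S. There are at least (14 + 12g)s flags and each face has at least
  -- six, so the genus bound makes a third of the flags at most 4s + 4g, while the degrees make it
  -- at least (14/3 + 4g)s.
  too-dense : ⊥
  too-dense = impossible (card S) {f = #F τ} {k = #K τ} (card-≥1 u₀ u₀∈) flags faces vertices genus
    where
    impossible : ∀ s {m f v k} → 1 ≤ s → s * (2 * (7 + 6 * g)) ≤ m → f * 6 ≤ m → v ≤ s → 8 * k + m ≤ 4 * v + 4 * f + 4 * g → ⊥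
    impossible (suc s) {m} {f} {v} {k} _ a b c d = ℕP.m+1+n≰m (m + (2 * m + (12 * suc s + 3 * (4 * v + 4 * f + 4 * g))))
      (ℕP.≤-trans (ℕP.≤-reflexive (arith s g m f v k)) (a ⊕ scale 2 b ⊕ scale 12 c ⊕ scale 3 d))
      where
      arith : ∀ s g m f v k → m + (2 * m + (12 * suc s + 3 * (4 * v + 4 * f + 4 * g))) + suc (1 + 2 * s + 12 * (s * g) + 24 * k) ≡
        suc s * (2 * (7 + 6 * g)) + (2 * (f * 6) + (12 * v + 3 * (8 * k + m)))
      arith = solve-∀

-- Adding an edge across a face of a planar part

-- The loss of 8 in `count` is that of two vertices: each attached end of the edge merges two
-- vertices, while the first attachment merges two faces and the second splits one.
record Inserted {m : ℕ} (fr : Frame m) (ρ : Fin m → Fin m) (u v q : Fin m) : Set where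
  open Frame fr using (α; β)
  open Ribbon fr using (#V; #F; rV)
  field
    ρ₂     : Fin m → Fin m
    ro₂    : Rotation ρ₂
    count  : 4 * #V ρ + 4 * #F ρ ≤ 4 * #V ρ₂ + 4 * #F ρ₂ + 8
    grow   : ∀ {x y} → rV ρ x ≡ rV ρ y → rV ρ₂ x ≡ rV ρ₂ y
    at-u   : rV ρ₂ u ≡ rV ρ₂ q
    at-v   : rV ρ₂ v ≡ rV ρ₂ (α q)
    keeps  : ∀ {k} (c : Fin m → Fin k) → (∀ x → c (β x) ≡ c x) → (∀ x → c (ρ x) ≡ c x) → c u ≡ c q → c v ≡ c (α q) →
             ∀ x → c (ρ₂ x) ≡ c x

-- Adding the isolated edge of the flag q across a face that contains corners
-- u and v of different vertices.  Of the two ways to attach the second end,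
-- the one that splits the face is chosen.
module Insert {m : ℕ} (fr : Frame m) (ρ : Fin m → Fin m) (ro : Rotation ρ) (u v q : Fin m)
  (ρq : ρ q ≡ Frame.β fr q) (ρq′ : ρ (Frame.α fr q) ≡ Frame.β fr (Frame.α fr q))
  (apart : Ribbon.rK fr ρ u ≢ Ribbon.rK fr ρ q) (V≢ : Ribbon.rV fr ρ u ≢ Ribbon.rV fr ρ v)
  (F≡ : Ribbon.rF fr ρ u ≡ Ribbon.rF fr ρ v) where
  open Frame fr
    using (α; α-fpf; α-inv; αβ-fpf; β; β-fpf; β-inv)
  open Ribbon fr
    using (#F; #V; rF; rK; rV; rV-elim)
  open Rotation ro

  private
    L⊤ = λ (x : Fin m) → true
    V-K : ∀ {x y} → rV ρ x ≡ rV ρ y → rK ρ x ≡ rK ρ y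
    V-K = V⊆K fr ρ ro L⊤ (λ _ → refl) (λ _ → refl) (λ _ → refl)
    F-K : ∀ {x y} → rF ρ x ≡ rF ρ y → rK ρ x ≡ rK ρ y
    F-K = F⊆K fr ρ ro L⊤ (λ _ → refl) (λ _ → refl) (λ _ → refl)

    q′ : Fin m
    q′ = α q

    K-ρ : ∀ x → rK ρ (ρ x) ≡ rK ρ x
    K-ρ = cl₃-c α β ρ
    K-q′ : rK ρ q′ ≡ rK ρ q
    K-q′ = cl₃-a α β ρ q
    K-v : rK ρ v ≡ rK ρ u
    K-v = symm (F-K F≡)

    off-q : ∀ {x y} → rK ρ x ≡ rK ρ u → rK ρ y ≡ rK ρ q → x ≢ y
    off-q h k refl = apart (trans (symm h) k)

    module S₁ = Switch ρ inv fpf u q (off-q refl refl) (λ e → apart (trans (symm (K-ρ u)) (cong (rK ρ) (symm e))))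
      using (is-off; is-p; is-q; is-τp; is-τq; spot; sw; sw-fpf; sw-inv; sw-label; sw-off; sw-p; module Count)
    module V₁ = S₁.Count β β-inv β-fpf
      using (count-down; old⊆new; ret-cases)
    module F₁ = S₁.Count α α-inv α-fpf
      using (count-down; old⊆new; ret-cases)

    ρ₁ : Fin m → Fin m
    ρ₁ = S₁.sw

    ro₁ : Rotation ρ₁
    ro₁ = rotation S₁.sw-inv S₁.sw-fpf

    -- The edge of q lies in another component, so u and q share no class, and attaching q can only
    -- merge classes.
    grow-V₁ : ∀ {x y} → rV ρ x ≡ rV ρ y → rV ρ₁ x ≡ rV ρ₁ y
    grow-V₁ with V₁.ret-cases
    ... | inj₁ e = V₁.old⊆new e
    ... | inj₂ e = ⊥-elim (apart (V-K e))

    grow-F₁ : ∀ {x y} → rF ρ x ≡ rF ρ y → rF ρ₁ x ≡ rF ρ₁ y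
    grow-F₁ with F₁.ret-cases
    ... | inj₁ e = F₁.old⊆new e
    ... | inj₂ e = ⊥-elim (apart (F-K e))

    ρ₁q′ : ρ₁ q′ ≡ β q′
    ρ₁q′ with S₁.spot q′
    ... | S₁.is-p e   = ⊥-elim (apart (trans (cong (rK ρ) (symm e)) K-q′))
    ... | S₁.is-q e   = ⊥-elim (α-fpf q e)
    ... | S₁.is-τp e  = ⊥-elim (apart (trans (symm (K-ρ u)) (trans (cong (rK ρ) (symm e)) K-q′)))
    ... | S₁.is-τq e  = ⊥-elim (αβ-fpf q (trans (cong α (symm (trans e ρq))) (α-inv q)))
    ... | S₁.is-off o = trans (S₁.sw-off {q′} o) ρq′

    pendant : ∀ {z} → rV ρ₁ q′ ≡ rV ρ₁ z → z ≡ q′ ⊎ z ≡ β q′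
    pendant h = rV-elim ro₁ (λ z → z ≡ q′ ⊎ z ≡ β q′)
      (λ { z (inj₁ refl) → inj₂ refl ; z (inj₂ refl) → inj₁ (β-inv q′) })
      (λ { z (inj₁ refl) → inj₂ ρ₁q′ ; z (inj₂ refl) → inj₁ (symm (inv-flip ρ₁ (Rotation.inv ro₁) ρ₁q′)) }) h (inj₁ refl)

    v≢ : ∀ {t} → t ≡ q′ ⊎ t ≡ β q′ → v ≢ t
    v≢ (inj₁ refl) = off-q K-v K-q′
    v≢ (inj₂ refl) = off-q K-v (trans (cl₃-b α β ρ q′) K-q′)

    V-apart : ∀ {t} → t ≡ q′ ⊎ t ≡ β q′ → rV ρ₁ v ≢ rV ρ₁ t
    V-apart (inj₁ refl) h = [ v≢ (inj₁ refl) , v≢ (inj₂ refl) ]′ (pendant (symm h))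
    V-apart (inj₂ refl) h = [ v≢ (inj₁ refl) , v≢ (inj₂ refl) ]′ (pendant (symm (trans h (cl₂-a β ρ₁ q′))))

    flip-t : ∀ {t} → t ≡ q′ ⊎ t ≡ β q′ → ρ₁ t ≡ q′ ⊎ ρ₁ t ≡ β q′
    flip-t (inj₁ refl) = inj₂ ρ₁q′
    flip-t (inj₂ refl) = inj₁ (symm (inv-flip ρ₁ (Rotation.inv ro₁) ρ₁q′))

    t≢ρ₁v : ∀ {t} → t ≡ q′ ⊎ t ≡ β q′ → t ≢ ρ₁ v
    t≢ρ₁v h e = v≢ (flip-t h) (symm (trans (cong ρ₁ e) (Rotation.inv ro₁ v)))

    module Second (t : Fin m) (t∈ : t ≡ q′ ⊎ t ≡ β q′) where
      open Switch ρ₁ (Rotation.inv ro₁) (Rotation.fpf ro₁) v t (v≢ t∈) (t≢ρ₁v t∈)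
        using (P₄; P₄-p; P₄-q; P₄-τp; P₄-τq; Spot; is-off; is-p; is-q; is-τp; is-τq; spot; sw; sw-fpf; sw-inv; sw-label; sw-off; sw-p; sw-q; module Count) public
      module CV = Count β β-inv β-fpf
        using (count-down; old⊆new; ret-cases)
      module CF = Count α α-inv α-fpf
        using (count-gain; off; off-inv; off-off; off-on; ret; ret-P; ret-bent; ret-cl; ret-≢)

      V-t : ∀ σ → rV σ t ≡ rV σ q′
      V-t σ = [ cong (rV σ) , (λ e → trans (cong (rV σ) e) (cl₂-a β σ q′)) ]′ t∈

      finish : cl₂ α CF.off v ≡ cl₂ α CF.off t → Inserted fr ρ u v q
      finish joined = record { ρ₂ = sw ; ro₂ = rotation sw-inv sw-fpf
        ; count = lin-≤ _ _ (arith (#V ρ) (#F ρ) (#V ρ₁) (#F ρ₁) (#V sw) (#F sw) (CF.count-gain joined))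
            (scale 4 V₁.count-down ⊕ scale 4 F₁.count-down ⊕ scale 4 CV.count-down)
        ; grow = λ h → grow₂ (grow-V₁ h)
        ; at-u = grow₂ (trans (symm (cl₂-b β ρ₁ u)) (cong (rV ρ₁) S₁.sw-p))
        ; at-v = trans (trans (symm (cl₂-b β sw v)) (cong (rV sw) sw-p)) (V-t sw)
        ; keeps = λ c cβ cρ cu cv → sw-label c (S₁.sw-label c cρ cu) (trans cv (symm (c-t c cβ))) }
        where
        arith : ∀ v f v₁ f₁ v₂ f₂ → f₂ ≡ suc f₁ → (4 * v + 4 * f) + (4 * suc v₁ + (4 * suc f₁ + 4 * suc v₂)) ≡
          (4 * v₂ + 4 * f₂ + 8) + (4 * v + (4 * f + 4 * v₁))
        arith v f v₁ f₁ v₂ _ refl = arith′ v f v₁ f₁ v₂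
          where
          arith′ : ∀ v f v₁ f₁ v₂ → (4 * v + 4 * f) + (4 * suc v₁ + (4 * suc f₁ + 4 * suc v₂)) ≡
            (4 * v₂ + 4 * suc f₁ + 8) + (4 * v + (4 * f + 4 * v₁))
          arith′ = solve-∀
        c-t : {A : Set} (c : Fin m → A) → (∀ x → c (β x) ≡ c x) → c t ≡ c q′
        c-t c cβ = [ cong c , (λ e → trans (cong c e) (cβ q′)) ]′ t∈
        grow₂ : ∀ {x y} → rV ρ₁ x ≡ rV ρ₁ y → rV sw x ≡ rV sw y
        grow₂ with CV.ret-cases
        ... | inj₁ e = CV.old⊆new e
        ... | inj₂ e = ⊥-elim (V-apart t∈ e)

  abstract
    inserted : Inserted fr ρ u v q
    inserted = go (A₁.spot (A₁.CF.ret v))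
      where
      module A₁ = Second q′ (inj₁ refl)
        using (P₄; P₄-p; P₄-q; P₄-τp; P₄-τq; Spot; finish; is-off; is-p; is-q; is-τp; is-τq; spot; module CF)
      module B₁ = Second (β q′) (inj₂ refl)
        using (Spot; P₄; finish; is-off; is-p; is-q; is-τp; is-τq; spot; module CF)
      face : rF ρ₁ v ≡ rF ρ₁ q′
      face = trans (symm (grow-F₁ F≡)) (trans (trans (symm (cl₂-b α ρ₁ u)) (cong (rF ρ₁) S₁.sw-p)) (symm (cl₂-a α ρ₁ q)))
      B⊆A : ∀ z → B₁.P₄ z ≡ true → A₁.P₄ z ≡ true
      B⊆A z h = go (B₁.spot z)
        where
        go : B₁.Spot z → A₁.P₄ z ≡ true
        go (B₁.is-p refl)  = A₁.P₄-p
        go (B₁.is-q e)     = trans (cong A₁.P₄ (trans e (symm ρ₁q′))) A₁.P₄-τq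
        go (B₁.is-τp refl) = A₁.P₄-τp
        go (B₁.is-τq e)    = trans (cong A₁.P₄ (trans e (symm (inv-flip ρ₁ (Rotation.inv ro₁) {q′} ρ₁q′)))) A₁.P₄-q
        go (B₁.is-off o)   = absurd h o
      A⊆B : ∀ {x y} → cl₂ α A₁.CF.off x ≡ cl₂ α A₁.CF.off y → cl₂ α B₁.CF.off x ≡ cl₂ α B₁.CF.off y
      A⊆B {x} e = cl₂-elim α A₁.CF.off α-inv A₁.CF.off-inv (λ z → cl₂ α B₁.CF.off x ≡ cl₂ α B₁.CF.off z)
        (λ z h → trans h (symm (cl₂-a α B₁.CF.off z))) st e refl
        where
        st : ∀ z → cl₂ α B₁.CF.off x ≡ cl₂ α B₁.CF.off z → cl₂ α B₁.CF.off x ≡ cl₂ α B₁.CF.off (A₁.CF.off z)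
        st z h with bool-cases (A₁.P₄ z)
        ... | inj₁ p = trans h (cong (cl₂ α B₁.CF.off) (symm (A₁.CF.off-on {z} p)))
        ... | inj₂ p = trans h (trans (symm (cl₂-b α B₁.CF.off z)) (cong (cl₂ α B₁.CF.off)
                (trans (B₁.CF.off-off {z} (≢true (λ k → absurd (B⊆A z k) p))) (symm (A₁.CF.off-off {z} p)))))
      -- After the first attachment v and q′ lie on one face, so the segment from v does not end at
      -- `ρ₁` of v. It arrives at q′ or at its other side β q′; the second switch is made on that
      -- side and closes the segment, a gain of one face.
      go : A₁.Spot (A₁.CF.ret v) → Inserted fr ρ u v q
      go (A₁.is-p e)   = ⊥-elim (A₁.CF.ret-≢ A₁.P₄-p e)
      go (A₁.is-q e)   = A₁.finish (trans (symm (A₁.CF.ret-cl A₁.P₄-p)) (cong (cl₂ α A₁.CF.off) e))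
      go (A₁.is-τp e)  = ⊥-elim (A₁.CF.ret-bent face e)
      go (A₁.is-τq e)  = B₁.finish (A⊆B (trans (symm (A₁.CF.ret-cl A₁.P₄-p)) (cong (cl₂ α A₁.CF.off) (trans e ρ₁q′))))
      go (A₁.is-off o) = absurd (A₁.CF.ret-P A₁.P₄-p) o

-- The spare edge brings two vertices, one face and at most four flags; its insertion costs 8. The
-- bound for genus zero is exactly maintained.
attach-count : ∀ v f m l v₁ f₁ v₂ f₂ → 8 + m ≤ 4 * v + 4 * f → v + 2 ≤ v₁ → f + 1 ≤ f₁ → l ≤ m + 4 →
  4 * v₁ + 4 * f₁ ≤ 4 * v₂ + 4 * f₂ + 8 → 8 + l ≤ 4 * v₂ + 4 * f₂
attach-count v f m l v₁ f₁ v₂ f₂ a b c d e = lin-≤ _ _ (arith v f m l v₁ f₁ v₂ f₂) (a ⊕ scale 4 b ⊕ scale 4 c ⊕ d ⊕ e)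
  where
  arith : ∀ v f m l v₁ f₁ v₂ f₂ → (8 + l) + ((4 * v + 4 * f) + (4 * v₁ + (4 * f₁ + ((m + 4) + (4 * v₂ + 4 * f₂ + 8))))) ≡
    (4 * v₂ + 4 * f₂) + ((8 + m) + (4 * (v + 2) + (4 * (f + 1) + (l + (4 * v₁ + 4 * f₁)))))
  arith = solve-∀

module Join {m n : ℕ} (fr : Frame m) (ρ : Fin m → Fin m) (ro : Rotation ρ) (lab : Fin m → Fin n)
  (lab-β : ∀ x → lab (Frame.β fr x) ≡ lab x) (lab-ρ : ∀ x → lab (ρ x) ≡ lab x) (I : Fin m → Bool)
  (Iα : ∀ x → I (Frame.α fr x) ≡ I x) (Iβ : ∀ x → I (Frame.β fr x) ≡ I x) (Iρ : ∀ x → I (ρ x) ≡ I x)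
  (conn : ∀ x y → I x ≡ true → I y ≡ true → Ribbon.rK fr ρ x ≡ Ribbon.rK fr ρ y)
  (planar : 8 + card I ≤ 4 * nc I (Ribbon.rV fr ρ) + 4 * nc I (Ribbon.rF fr ρ))
  (one-vertex : ∀ x y → I x ≡ true → I y ≡ true → lab x ≡ lab y → Ribbon.rV fr ρ x ≡ Ribbon.rV fr ρ y)
  (V⁺ : Fin n → Bool) (E⁺ : Fin n → Fin n → Bool)
  (vert : ∀ u → V⁺ u ≡ true → ∃[ x ] (I x ≡ true × lab x ≡ u)) where
  open Frame fr
    using (α; α-fpf; α-inv; αβ-comm; αβ-fpf; β; β-fpf; β-inv)
  open Ribbon fr
    using (#F; #V; rF; rF-elim; rK; rK-elim; rV; rV-elim)

  module Alone (edge : ∀ u v → V⁺ u ≡ true → V⁺ v ≡ true → E⁺ u v ≡ true → ∃[ x ] (I x ≡ true × lab x ≡ u × lab (α x) ≡ v))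
    (x₀ : Fin m) (x₀-in : I x₀ ≡ true) where
    result : EmbedsSub n V⁺ E⁺ sphere
    result = ToMap.sphere-embedding frame τ̂ rot (proj₁ (lift x₀ x₀-in)) (λ a b → K-⇐ (conn (e a) (e b) (e-in a) (e-in b)))
      (subst₂ (λ a b → 8 + card I ≤ 4 * a + 4 * b) (symm count-V) (symm count-F) planar)
      (lab ∘ e) (λ x → trans (cong lab (e-β x)) (lab-β _)) (λ x → trans (cong lab (e-τ x)) (lab-ρ _)) V⁺ E⁺
      (λ a b h → V-⇐ (one-vertex _ _ (e-in a) (e-in b) h))
      (λ u h → let x , px , lx = vert u h ; k , ek = lift x px in k , trans (cong lab ek) lx)
      λ u v h k uv → let x , px , lx , lαx = edge u v h k uv ; a , ea = lift x px in
        a , trans (cong lab ea) lx , trans (cong lab (trans (e-α a) (cong α ea))) lαx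
      where
      open Restriction (restriction fr ρ ro I Iα Iβ Iρ)

  -- No flags are created for the new edge: the edge of q, outside I, is recycled. `σ′` isolates all
  -- edges outside I, L adds the one of q to I, and this edge is then inserted between u and v.
  module Across (u v q : Fin m) (pin : I u ≡ true) (piv : I v ≡ true) (uv : lab u ≢ lab v) (fuv : rF ρ u ≡ rF ρ v) (q-out : I q ≡ false)
    (edge : ∀ a b → V⁺ a ≡ true → V⁺ b ≡ true → E⁺ a b ≡ true →
      (∃[ x ] (I x ≡ true × lab x ≡ a × lab (α x) ≡ b)) ⊎ (a ≡ lab u × b ≡ lab v) ⊎ (a ≡ lab v × b ≡ lab u)) where

    lab-V : ∀ {x y} → rV ρ x ≡ rV ρ y → lab x ≡ lab y
    lab-V {x} h = rV-elim ro (λ z → lab x ≡ lab z) (λ z e → trans e (symm (lab-β z))) (λ z e → trans e (symm (lab-ρ z))) h refl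

    L : Fin m → Bool
    rE : Fin m → Fin m
    rE = Edges.rE fr
    L z = I z ∨ (rE z == rE q)

    σ′ : Fin m → Fin m
    σ′ z = if I z then ρ z else β z

    σ-in : ∀ {z} → I z ≡ true → σ′ z ≡ ρ z
    σ-in h rewrite h = refl
    σ-out : ∀ {z} → I z ≡ false → σ′ z ≡ β z
    σ-out h rewrite h = refl

    Iσ : ∀ x → I (σ′ x) ≡ I x
    Iσ x with bool-cases (I x)
    ... | inj₁ h = trans (cong I (σ-in {x} h)) (Iρ x)
    ... | inj₂ h = trans (cong I (σ-out {x} h)) (Iβ x)

    σ-rot : Rotation σ′
    σ-rot = rotation σ-inv σ-fpf
      where
      σ-inv : Involutive σ′
      σ-inv x with bool-cases (I x)
      ... | inj₁ h = trans (σ-in {σ′ x} (trans (Iσ x) h)) (trans (cong ρ (σ-in {x} h)) (Rotation.inv ro x))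
      ... | inj₂ h = trans (σ-out {σ′ x} (trans (Iσ x) h)) (trans (cong β (σ-out {x} h)) (β-inv x))
      σ-fpf : FixFree σ′
      σ-fpf x e with bool-cases (I x)
      ... | inj₁ h = Rotation.fpf ro x (trans (symm (σ-in {x} h)) e)
      ... | inj₂ h = β-fpf x (trans (symm (σ-out {x} h)) e)

    Lα : ∀ x → L (α x) ≡ L x
    Lα x = cong₂ _∨_ (Iα x) (cong (_== rE q) (cl₂-a α β x))
    Lβ : ∀ x → L (β x) ≡ L x
    Lβ x = cong₂ _∨_ (Iβ x) (cong (_== rE q) (cl₂-b α β x))
    Lσ : ∀ x → L (σ′ x) ≡ L x
    Lσ x with bool-cases (I x)
    ... | inj₁ h = trans (∨-introˡ (trans (Iσ x) h)) (symm (∨-introˡ h))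
    ... | inj₂ h = trans (cong L (σ-out {x} h)) (Lβ x)

    V-in : ∀ {x y} → I x ≡ true → rV ρ x ≡ rV ρ y → rV σ′ x ≡ rV σ′ y
    V-in {x} ix h = proj₂ (rV-elim ro (λ z → I z ≡ true × rV σ′ x ≡ rV σ′ z)
      (λ z (p , e) → trans (Iβ z) p , trans e (symm (cl₂-a β σ′ z)))
      (λ z (p , e) → trans (Iρ z) p , trans e (trans (symm (cl₂-b β σ′ z)) (cong (rV σ′) (σ-in {z} p)))) h (ix , refl))
    V-out : ∀ {x y} → I x ≡ true → rV σ′ x ≡ rV σ′ y → rV ρ x ≡ rV ρ y
    V-out {x} ix h = proj₂ (rV-elim σ-rot (λ z → I z ≡ true × rV ρ x ≡ rV ρ z)
      (λ z (p , e) → trans (Iβ z) p , trans e (symm (cl₂-a β ρ z)))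
      (λ z (p , e) → trans (Iσ z) p , trans e (trans (symm (cl₂-b β ρ z)) (cong (rV ρ) (symm (σ-in {z} p))))) h (ix , refl))
    F-in : ∀ {x y} → I x ≡ true → rF ρ x ≡ rF ρ y → rF σ′ x ≡ rF σ′ y
    F-in {x} ix h = proj₂ (rF-elim ro (λ z → I z ≡ true × rF σ′ x ≡ rF σ′ z)
      (λ z (p , e) → trans (Iα z) p , trans e (symm (cl₂-a α σ′ z)))
      (λ z (p , e) → trans (Iρ z) p , trans e (trans (symm (cl₂-b α σ′ z)) (cong (rF σ′) (σ-in {z} p)))) h (ix , refl))
    F-out : ∀ {x y} → I x ≡ true → rF σ′ x ≡ rF σ′ y → rF ρ x ≡ rF ρ y
    F-out {x} ix h = proj₂ (rF-elim σ-rot (λ z → I z ≡ true × rF ρ x ≡ rF ρ z)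
      (λ z (p , e) → trans (Iα z) p , trans e (symm (cl₂-a α ρ z)))
      (λ z (p , e) → trans (Iσ z) p , trans e (trans (symm (cl₂-b α ρ z)) (cong (rF ρ) (symm (σ-in {z} p))))) h (ix , refl))
    K-in : ∀ {x y} → I x ≡ true → I y ≡ true → rK σ′ x ≡ rK σ′ y
    K-in {x} {y} ix iy = proj₂ (rK-elim ro (λ z → I z ≡ true × rK σ′ x ≡ rK σ′ z)
      (λ z (p , e) → trans (Iα z) p , trans e (symm (cl₃-a α β σ′ z)))
      (λ z (p , e) → trans (Iβ z) p , trans e (symm (cl₃-b α β σ′ z)))
      (λ z (p , e) → trans (Iρ z) p , trans e (trans (symm (cl₃-c α β σ′ z)) (cong (rK σ′) (σ-in {z} p))))
      (conn x y ix iy) (ix , refl))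

    I-K : ∀ {x y} → rK σ′ x ≡ rK σ′ y → I x ≡ I y
    I-K {x} h = rK-elim σ-rot (λ z → I x ≡ I z) (λ z e → trans e (symm (Iα z))) (λ z e → trans e (symm (Iβ z)))
      (λ z e → trans e (symm (Iσ z))) h refl

    E-K : ∀ {x y} → rE x ≡ rE y → rK σ′ x ≡ rK σ′ y
    E-K {x} h = cl₂-elim α β α-inv β-inv (λ z → rK σ′ x ≡ rK σ′ z)
      (λ z e → trans e (symm (cl₃-a α β σ′ z))) (λ z e → trans e (symm (cl₃-b α β σ′ z))) h refl

    L-count : card L ≤ card I + 4
    L-count = ℕP.≤-trans (ℕP.≤-reflexive (card-split L I)) (card-mono (λ x h → proj₂ (∧-elim {L x} h)) ⊕
      ℕP.≤-trans (card-mono {g = λ x → rE x == rE q} (λ x h → [ (λ k → absurd k (not-elim (proj₂ (∧-elim {L x} h)))) , id ]′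
          (∨-elim {I x} (proj₁ (∧-elim {L x} h)))))
        (ℕP.≤-trans (Edges.E-small fr _) (ℕP.*-monoˡ-≤ 4 (nc-one (rE q) λ x h → ==-sound h))))

    near : Fin m → Bool
    near z = (z == q) ∨ (z == β q)

    labₑ : Fin m → Fin n
    labₑ z = if I z then lab z else (if near z then lab u else lab v)

    labₑ-in : ∀ {z} → I z ≡ true → labₑ z ≡ lab z
    labₑ-in h rewrite h = refl

    near-β : ∀ z → near (β z) ≡ near z
    near-β z = bool-iff (λ h → go (∨-elim {β z == q} h)) (λ h → back (∨-elim {z == q} h))
      where
      go : (β z == q) ≡ true ⊎ (β z == β q) ≡ true → near z ≡ true
      go (inj₁ e) = ∨-introʳ {z == q} (==-complete (inv-flip β β-inv (==-sound e)))
      go (inj₂ e) = ∨-introˡ (==-complete (inv-injective β β-inv (==-sound e)))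
      back : (z == q) ≡ true ⊎ (z == β q) ≡ true → near (β z) ≡ true
      back (inj₁ e) = ∨-introʳ {β z == q} (==-complete (cong β (==-sound e)))
      back (inj₂ e) = ∨-introˡ (==-complete (trans (cong β (==-sound e)) (β-inv q)))

    labₑ-β : ∀ z → labₑ (β z) ≡ labₑ z
    labₑ-β z rewrite Iβ z | near-β z | lab-β z = refl

    labₑ-σ : ∀ z → labₑ (σ′ z) ≡ labₑ z
    labₑ-σ z with bool-cases (I z)
    ... | inj₁ h = trans (cong labₑ (σ-in {z} h)) (trans (labₑ-in {ρ z} (trans (Iρ z) h)) (trans (lab-ρ z) (symm (labₑ-in {z} h))))
    ... | inj₂ h = trans (cong labₑ (σ-out {z} h)) (labₑ-β z)

    lab-q : labₑ q ≡ lab u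
    lab-q rewrite q-out | ==-refl q = refl

    lab-αq : labₑ (α q) ≡ lab v
    lab-αq rewrite Iα q | q-out | ==-false (α-fpf q) | ==-false {u = α q} {v = β q} (λ e → αβ-fpf q (trans (cong α (symm e)) (α-inv q))) = refl

    module Restricted (re : Restriction fr σ′ L) where
      open Restriction re
        using (e; e-in; e-inj; lift; e-α; e-β; e-τ; V-⇐; V-⇒; F-⇐; K-⇐; K-⇒; count-V; count-F) renaming (frame to fr̂; τ̂ to σ̂; rot to rot̂)
      open Frame fr̂ using () renaming (α to α̂; β to β̂)
      module R̂ = Ribbon fr̂
        using (#F; #V; rK; rK-elim; rV)

      û v̂ q̂ : Fin (card L)
      û = proj₁ (lift u (∨-introˡ pin))
      v̂ = proj₁ (lift v (∨-introˡ piv))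
      q̂ = proj₁ (lift q (∨-introʳ {I q} (==-refl (rE q))))
      eû : e û ≡ u
      eû = proj₂ (lift u (∨-introˡ pin))
      ev̂ : e v̂ ≡ v
      ev̂ = proj₂ (lift v (∨-introˡ piv))
      eq̂ : e q̂ ≡ q
      eq̂ = proj₂ (lift q (∨-introʳ {I q} (==-refl (rE q))))

      eα̂ : e (α̂ q̂) ≡ α q
      eα̂ = trans (e-α q̂) (cong α eq̂)

      inserted : Inserted fr̂ σ̂ û v̂ q̂
      inserted = Insert.inserted fr̂ σ̂ rot̂ û v̂ q̂
        (e-inj (trans (e-τ q̂) (trans (cong σ′ eq̂) (trans (σ-out {q} q-out) (trans (cong β (symm eq̂)) (symm (e-β q̂)))))))
        (e-inj (trans (e-τ (α̂ q̂)) (trans (cong σ′ eα̂) (trans (σ-out {α q} (trans (Iα q) q-out))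
          (trans (cong β (symm eα̂)) (symm (e-β (α̂ q̂))))))))
        (λ h → absurd pin (trans (I-K (subst₂ (λ a b → rK σ′ a ≡ rK σ′ b) eû eq̂ (K-⇒ h))) q-out))
        (λ h → uv (lab-V (V-out pin (subst₂ (λ a b → rV σ′ a ≡ rV σ′ b) eû ev̂ (V-⇒ h)))))
        (F-⇐ (subst₂ (λ a b → rF σ′ a ≡ rF σ′ b) (symm eû) (symm ev̂) (F-in pin fuv)))

      V-count : nc I (rV ρ) + 2 ≤ R̂.#V σ̂
      V-count = subst (nc I (rV ρ) + 2 ≤_) (trans (symm (nc-split L I (rV σ′) (λ a b h → I-V h))) (symm count-V)) (inside ⊕ outside)
        where
        I-V : ∀ {x y} → rV σ′ x ≡ rV σ′ y → I x ≡ I y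
        I-V {x} h = rV-elim σ-rot (λ z → I x ≡ I z) (λ z e → trans e (symm (Iβ z))) (λ z e → trans e (symm (Iσ z))) h refl
        inside : nc I (rV ρ) ≤ nc (λ x → L x ∧ I x) (rV σ′)
        inside = nc-≤ (λ x _ → x) (λ x h → ∧-intro (∨-introˡ h) h) (λ x y h _ → V-out h)
        outside : 2 ≤ nc (λ x → L x ∧ not (I x)) (rV σ′)
        outside = nc-≥2 q (α q) (∧-intro (∨-introʳ {I q} (==-refl (rE q))) (not-intro q-out))
          (∧-intro (trans (Lα q) (∨-introʳ {I q} (==-refl (rE q)))) (not-intro (trans (Iα q) q-out)))
          (λ h → [ α-fpf q , (λ e → αβ-fpf q (trans (cong α (symm e)) (α-inv q))) ]′
            (rV-elim σ-rot (λ z → z ≡ q ⊎ z ≡ β q)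
              (λ { z (inj₁ refl) → inj₂ refl ; z (inj₂ refl) → inj₁ (β-inv q) })
              (λ { z (inj₁ refl) → inj₂ (σ-out {q} q-out) ; z (inj₂ refl) → inj₁ (trans (σ-out {β q} (trans (Iβ q) q-out)) (β-inv q)) })
              h (inj₁ refl)))

      F-count : nc I (rF ρ) + 1 ≤ R̂.#F σ̂
      F-count = subst (nc I (rF ρ) + 1 ≤_) (trans (symm (nc-split L I (rF σ′) (λ a b h → I-F h))) (symm count-F)) (inside ⊕ outside)
        where
        I-F : ∀ {x y} → rF σ′ x ≡ rF σ′ y → I x ≡ I y
        I-F {x} h = rF-elim σ-rot (λ z → I x ≡ I z) (λ z e → trans e (symm (Iα z))) (λ z e → trans e (symm (Iσ z))) h refl
        inside : nc I (rF ρ) ≤ nc (λ x → L x ∧ I x) (rF σ′)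
        inside = nc-≤ (λ x _ → x) (λ x h → ∧-intro (∨-introˡ h) h) (λ x y h _ → F-out h)
        outside : 1 ≤ nc (λ x → L x ∧ not (I x)) (rF σ′)
        outside = nc-≥1 q (∧-intro (∨-introʳ {I q} (==-refl (rE q))) (not-intro q-out))

      module Attached (ins : Inserted fr̂ σ̂ û v̂ q̂) where
        open Inserted ins

        Grow : ∀ {a b} → R̂.rK σ̂ a ≡ R̂.rK σ̂ b → R̂.rK ρ₂ a ≡ R̂.rK ρ₂ b
        Grow {a} h = R̂.rK-elim rot̂ (λ z → R̂.rK ρ₂ a ≡ R̂.rK ρ₂ z) (λ z e → trans e (symm (cl₃-a α̂ β̂ ρ₂ z)))
          (λ z e → trans e (symm (cl₃-b α̂ β̂ ρ₂ z))) (λ z e → trans e (V-K (grow (symm (cl₂-b β̂ σ̂ z))))) h refl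
          where
          V-K : ∀ {x y} → R̂.rV ρ₂ x ≡ R̂.rV ρ₂ y → R̂.rK ρ₂ x ≡ R̂.rK ρ₂ y
          V-K = V⊆K fr̂ ρ₂ ro₂ (λ _ → true) (λ _ → refl) (λ _ → refl) (λ _ → refl)

        q-to-u : R̂.rK ρ₂ q̂ ≡ R̂.rK ρ₂ û
        q-to-u = symm (V⊆K fr̂ ρ₂ ro₂ (λ _ → true) (λ _ → refl) (λ _ → refl) (λ _ → refl) at-u)

        to-u : ∀ a → R̂.rK ρ₂ a ≡ R̂.rK ρ₂ û
        to-u a = [ inside , outside ]′ (∨-elim {I (e a)} (e-in a))
          where
          inside : I (e a) ≡ true → R̂.rK ρ₂ a ≡ R̂.rK ρ₂ û
          inside ia = Grow (K-⇐ (K-in ia (trans (cong I eû) pin)))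
          outside : (rE (e a) == rE q) ≡ true → R̂.rK ρ₂ a ≡ R̂.rK ρ₂ û
          outside ea = trans (Grow (K-⇐ (E-K (trans (==-sound ea) (cong rE (symm eq̂)))))) q-to-u

        conn₂ : ∀ a b → R̂.rK ρ₂ a ≡ R̂.rK ρ₂ b
        conn₂ a b = trans (to-u a) (symm (to-u b))

        planar₂ : 8 + card L ≤ 4 * R̂.#V ρ₂ + 4 * R̂.#F ρ₂
        planar₂ = attach-count (nc I (rV ρ)) (nc I (rF ρ)) (card I) (card L) (R̂.#V σ̂) (R̂.#F σ̂) (R̂.#V ρ₂) (R̂.#F ρ₂)
          planar V-count F-count L-count count

        lab̂ : Fin (card L) → Fin n
        lab̂ a = labₑ (e a)

        lab-u : lab̂ û ≡ lab u
        lab-u = trans (cong labₑ eû) (labₑ-in {u} pin)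
        lab-v : lab̂ v̂ ≡ lab v
        lab-v = trans (cong labₑ ev̂) (labₑ-in {v} piv)

        lab̂-β : ∀ a → lab̂ (β̂ a) ≡ lab̂ a
        lab̂-β a = trans (cong labₑ (e-β a)) (labₑ-β (e a))

        lab̂-ρ : ∀ a → lab̂ (ρ₂ a) ≡ lab̂ a
        lab̂-ρ = keeps lab̂ lab̂-β (λ a → trans (cong labₑ (e-τ a)) (labₑ-σ (e a)))
          (trans lab-u (symm (trans (cong labₑ eq̂) lab-q))) (trans lab-v (symm (trans (cong labₑ eα̂) lab-αq)))

        -- A companion in I at the same vertex and with the same label. It reduces the uniqueness of
        -- vertices after the insertion to `one-vertex` on I.
        Home : Fin (card L) → Set
        Home a = ∃[ b ] (I (e b) ≡ true × lab (e b) ≡ lab̂ a × R̂.rV ρ₂ a ≡ R̂.rV ρ₂ b)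

        u-home : ∀ c → R̂.rV ρ₂ c ≡ R̂.rV ρ₂ û → lab̂ c ≡ lab u → Home c
        u-home c h l = û , trans (cong I eû) pin , trans (cong lab eû) (symm l) , h

        v-home : ∀ c → R̂.rV ρ₂ c ≡ R̂.rV ρ₂ v̂ → lab̂ c ≡ lab v → Home c
        v-home c h l = v̂ , trans (cong I ev̂) piv , trans (cong lab ev̂) (symm l) , h

        eq-lab : lab̂ q̂ ≡ lab u
        eq-lab = trans (cong labₑ eq̂) lab-q

        eα-lab : lab̂ (α̂ q̂) ≡ lab v
        eα-lab = trans (cong labₑ eα̂) lab-αq

        home-q : Home q̂
        home-q = u-home q̂ (symm at-u) eq-lab

        home-βq : Home (β̂ q̂)
        home-βq = u-home (β̂ q̂) (trans (cl₂-a β̂ ρ₂ q̂) (symm at-u)) (trans (lab̂-β q̂) eq-lab)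

        home-αq : Home (α̂ q̂)
        home-αq = v-home (α̂ q̂) (symm at-v) eα-lab

        home-βαq : Home (β̂ (α̂ q̂))
        home-βαq = v-home (β̂ (α̂ q̂)) (trans (cl₂-a β̂ ρ₂ (α̂ q̂)) (symm at-v)) (trans (lab̂-β (α̂ q̂)) eα-lab)

        at : ∀ a c {z} → z ≡ e a → e c ≡ z → Home c → Home a
        at a c p r = subst Home (e-inj (trans r p))

        home-in : ∀ a → I (e a) ≡ true → Home a
        home-in a ia = a , ia , symm (labₑ-in {e a} ia) , refl

        home-out : ∀ a → ∃[ j ] Edges.quad fr q j ≡ e a → Home a
        home-out a (zero , e) = at a q̂ e eq̂ home-q
        home-out a (suc zero , e) = at a (β̂ q̂) e (trans (e-β q̂) (cong β eq̂)) home-βq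
        home-out a (suc (suc zero) , e) = at a (α̂ q̂) e eα̂ home-αq
        home-out a (suc (suc (suc zero)) , e) = at a (β̂ (α̂ q̂)) e
          (trans (e-β (α̂ q̂)) (trans (cong β eα̂) (symm (αβ-comm q)))) home-βαq

        home : ∀ a → Home a
        home a = [ home-in a , (λ ea → home-out a (Edges.in-quad fr (symm (==-sound ea)))) ]′ (∨-elim {I (e a)} (e-in a))

        one : ∀ a b → lab̂ a ≡ lab̂ b → R̂.rV ρ₂ a ≡ R̂.rV ρ₂ b
        one a b h = let a′ , ia , la , ra = home a ; b′ , ib , lb , rb = home b in
          trans ra (trans (grow (V-⇐ (V-in ia (one-vertex _ _ ia ib (trans la (trans h (symm lb))))))) (symm rb))

        flag-up : ∀ x → I x ≡ true → ∃[ k ] (lab̂ k ≡ lab x × lab̂ (α̂ k) ≡ lab (α x))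
        flag-up x px = k , trans (cong labₑ ek) (labₑ-in {x} ix) ,
            trans (cong labₑ (trans (e-α k) (cong α ek))) (labₑ-in {α x} (trans (Iα x) ix))
          where
          ix = px
          k : Fin (card L)
          k = proj₁ (lift x (∨-introˡ ix))
          ek : e k ≡ x
          ek = proj₂ (lift x (∨-introˡ ix))

        vert-up : ∀ w → V⁺ w ≡ true → ∃[ k ] lab̂ k ≡ w
        vert-up w h = go (vert w h)
          where
          go : ∃[ x ] (I x ≡ true × lab x ≡ w) → ∃[ k ] lab̂ k ≡ w
          go (x , px , lx) = proj₁ (flag-up x px) , trans (proj₁ (proj₂ (flag-up x px))) lx

        edge-up : ∀ a b → V⁺ a ≡ true → V⁺ b ≡ true → E⁺ a b ≡ true → ∃[ k ] (lab̂ k ≡ a × lab̂ (α̂ k) ≡ b)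
        edge-up a b ha hb ab = go (edge a b ha hb ab)
          where
          go : (∃[ x ] (I x ≡ true × lab x ≡ a × lab (α x) ≡ b)) ⊎ (a ≡ lab u × b ≡ lab v) ⊎ (a ≡ lab v × b ≡ lab u) →
            ∃[ k ] (lab̂ k ≡ a × lab̂ (α̂ k) ≡ b)
          go (inj₁ (x , px , lx , lαx)) = proj₁ (flag-up x px) , trans (proj₁ (proj₂ (flag-up x px))) lx ,
            trans (proj₂ (proj₂ (flag-up x px))) lαx
          go (inj₂ (inj₁ (refl , refl))) = q̂ , eq-lab , eα-lab
          go (inj₂ (inj₂ (refl , refl))) = α̂ q̂ , eα-lab ,
            trans (cong labₑ (trans (e-α (α̂ q̂)) (trans (cong α eα̂) (α-inv q)))) lab-q

        result : EmbedsSub n V⁺ E⁺ sphere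
        result = ToMap.sphere-embedding fr̂ ρ₂ ro₂ û conn₂ planar₂ lab̂ lab̂-β lab̂-ρ V⁺ E⁺ one vert-up edge-up

    result : EmbedsSub n V⁺ E⁺ sphere
    result = Restricted.Attached.result re (Restricted.inserted re)
      where
      re = restriction fr σ′ σ-rot L Lα Lβ Lσ

-- Rounding: m is a multiple of 4, so 4V + 4F - m is one too, and being at least 7 it is at least 8.
planar-from : ∀ v f {m} e → m ≡ e * 4 → m + 7 ≤ 4 * v + 4 * f → 8 + m ≤ 4 * v + 4 * f
planar-from v f e refl h with e + 2 ≤? v + f
... | yes k = ℕP.≤-trans (ℕP.≤-reflexive (arith e)) (ℕP.≤-trans (scale 4 k) (ℕP.≤-reflexive (ℕP.*-distribˡ-+ 4 v f)))
  where
  arith : ∀ e → 8 + e * 4 ≡ 4 * (e + 2)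
  arith = solve-∀
... | no k  = ⊥-elim (ℕP.m+1+n≰m (4 * (v + f)) (lin-≤ (4 * (v + f) + 3) (4 * (v + f)) (arith e v f) (h ⊕ scale 4 (ℕP.≰⇒> k))))
  where
  arith : ∀ e v f → (4 * (v + f) + 3) + ((4 * v + 4 * f) + 4 * (e + 2)) ≡ 4 * (v + f) + (((e * 4) + 7) + 4 * suc (v + f))
  arith = solve-∀

==-sym : ∀ {n} (u v : Fin n) → (u == v) ≡ (v == u)
==-sym u v = bool-iff (λ e → ==-complete (symm (==-sound e))) (λ e → ==-complete (symm (==-sound e)))

-- The drawn graph is a union of parts, glued along the vertex set X; outside
-- X each part is connected, and each part meets every vertex of X.
record Amalgam {n g s : ℕ} {D : Fin n → Fin n → Bool} (dr : Drawing n g D) : Set where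
  open Drawing dr
    using (#fl; lab; α)
  field
    X     : Fin n → Bool
    κ     : Fin n → Fin s
    noXX  : ∀ x → X (lab x) ≡ true → X (lab (α x)) ≡ false
    sameκ : ∀ x → X (lab x) ≡ false → X (lab (α x)) ≡ false → κ (lab (α x)) ≡ κ (lab x)
    star  : ∀ x y → X (lab x) ≡ false → X (lab y) ≡ false → κ (lab x) ≡ κ (lab y) →
            Star (λ a b → D a b ∧ (not (X a) ∧ not (X b))) (lab x) (lab y)

  Xf : Fin #fl → Bool
  Xf x = X (lab x)

  part : Fin #fl → Fin s
  part x = if Xf x then κ (lab (α x)) else κ (lab x)

  field
    cover : ∀ i u → X u ≡ true → ∃[ x ] (lab x ≡ u × part x ≡ i)

-- Cutting an amalgam apart along X

module Split {n g s : ℕ} {D : Fin n → Fin n → Bool} (dr : Drawing n g D) (am : Amalgam {n} {g} {s} dr) where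
  open Drawing dr
    using (#F; #K; #V; #fl; edge-of; flag-of; frame; genus; lab; lab-class; lab-β; lab-τ; rF; rF-elim; rK; rK-elim; rV; rV-elim; rot; α; α-fpf; α-inv; αβ-comm; αβ-fpf; β; β-fpf; β-inv; τ) public
  open Amalgam am
    using (X; Xf; cover; noXX; part; sameκ; star; κ) public

  part-X : ∀ {x} → Xf x ≡ true → part x ≡ κ (lab (α x))
  part-X h rewrite h = refl

  part-C : ∀ {x} → Xf x ≡ false → part x ≡ κ (lab x)
  part-C h rewrite h = refl

  part-α : ∀ x → part (α x) ≡ part x
  part-α x with bool-cases (Xf x) | bool-cases (Xf (α x))
  ... | inj₁ p | inj₁ q = absurd q (noXX x p)
  ... | inj₁ p | inj₂ q = trans (part-C {α x} q) (symm (part-X {x} p))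
  ... | inj₂ p | inj₁ q = trans (part-X {α x} q) (trans (cong (κ ∘ lab) (α-inv x)) (symm (part-C {x} p)))
  ... | inj₂ p | inj₂ q = trans (part-C {α x} q) (trans (sameκ x p q) (symm (part-C {x} p)))

  lab-αβ : ∀ x → lab (α (β x)) ≡ lab (α x)
  lab-αβ x = trans (cong lab (αβ-comm x)) (lab-β (α x))

  part-β : ∀ x → part (β x) ≡ part x
  part-β x with bool-cases (Xf x)
  ... | inj₁ p = trans (part-X {β x} (trans (cong X (lab-β x)) p)) (trans (cong κ (lab-αβ x)) (symm (part-X {x} p)))
  ... | inj₂ p = trans (part-C {β x} (trans (cong X (lab-β x)) p)) (trans (cong κ (lab-β x)) (symm (part-C {x} p)))

  -- Rotations are altered at X only, so that vertices outside X, and with them the connectedness of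
  -- each part, survive every change.
  record State (σ : Fin #fl → Fin #fl) : Set where
    field
      ok    : Rotation σ
      lab-σ : ∀ x → lab (σ x) ≡ lab x
      fixed : ∀ x → Xf x ≡ false → σ x ≡ τ x

  mixed : (Fin #fl → Fin #fl) → Fin #fl → Bool
  mixed σ x = not (part (σ x) == part x)

  module Phase (σ : Fin #fl → Fin #fl) (st : State σ) where
    open State st public
    open Rotation ok public

    P : Fin #fl → Bool
    P = mixed σ

    P-elim : ∀ {x} → P x ≡ true → part (σ x) ≢ part x
    P-elim h = ==-refute (not-elim h)

    P-off : ∀ {x} → P x ≡ false → part (σ x) ≡ part x
    P-off {x} h with bool-cases (part (σ x) == part x)
    ... | inj₁ e = ==-sound e
    ... | inj₂ e = absurd (not-intro e) h

    P-σ : ∀ x → P (σ x) ≡ P x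
    P-σ x = cong not (trans (cong (λ y → part y == part (σ x)) (inv x)) (==-sym (part x) (part (σ x))))

    P-X : ∀ {x} → P x ≡ true → Xf x ≡ true
    P-X {x} h with bool-cases (Xf x)
    ... | inj₁ p = p
    ... | inj₂ p = ⊥-elim (P-elim {x} h (trans (part-C {σ x} (trans (cong X (lab-σ x)) p)) (trans (cong κ (lab-σ x)) (symm (part-C {x} p)))))

    -- With the corners between different parts left out, a path along a face (PF) or round a vertex
    -- (PV) is a maximal segment inside one part, and `ret` is its other end.
    module PF = Pairing α σ P α-inv inv α-fpf fpf P-σ
      using (off; off-inv; off-off; off-on; off⊆; ret; ret-P; ret-cl; ret-inv; ret-≢)
    module PV = Pairing β σ P β-inv inv β-fpf fpf P-σ
      using (off; off-off; ret; ret-P; ret-cl; ret-inv; ret-ret; ret-unique; ret-≢)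

    retF-part : ∀ {u} → P u ≡ true → part (PF.ret u) ≡ part u
    retF-part = PF.ret-inv part part-α (λ x h → P-off {x} h)

    retV-part : ∀ {u} → P u ≡ true → part (PV.ret u) ≡ part u
    retV-part = PV.ret-inv part part-β (λ x h → P-off {x} h)

    retV-lab : ∀ {u} → P u ≡ true → lab (PV.ret u) ≡ lab u
    retV-lab = PV.ret-inv lab lab-β (λ x _ → lab-σ x)

    lab-V : ∀ {x y} → rV σ x ≡ rV σ y → lab x ≡ lab y
    lab-V {x} h = rV-elim ok (λ z → lab x ≡ lab z) (λ z e → trans e (symm (lab-β z))) (λ z e → trans e (symm (lab-σ z))) h refl

    V-C : ∀ x y → Xf x ≡ false → lab x ≡ lab y → rV σ x ≡ rV σ y
    V-C x y c e = proj₂ (rV-elim rot (λ z → Xf z ≡ false × rV σ x ≡ rV σ z)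
      (λ z (p , h) → trans (cong X (lab-β z)) p , trans h (symm (cl₂-a β σ z)))
      (λ z (p , h) → trans (cong X (lab-τ z)) p , trans h (trans (symm (cl₂-b β σ z)) (cong (rV σ) (fixed z p))))
      (lab-class x y e) (c , refl))

    private
      V-K : ∀ {x y} → rV σ x ≡ rV σ y → rK σ x ≡ rK σ y
      V-K {x} h = rV-elim ok (λ z → rK σ x ≡ rK σ z) (λ z e → trans e (symm (cl₃-b α β σ z)))
        (λ z e → trans e (symm (cl₃-c α β σ z))) h refl

      walk : ∀ {a b} → Star (λ a b → D a b ∧ (not (X a) ∧ not (X b))) a b → ∀ x y → lab x ≡ a → Xf x ≡ false → lab y ≡ b → rK σ x ≡ rK σ y
      walk ε x y p c q = V-K (V-C x y c (trans p (symm q)))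
      walk (w ▻ r) x y p c q with ∧-elim r
      ... | d , r′ with flag-of _ _ d
      ...   | z , lz , lαz = trans (walk w x z p c lz) (trans (symm (cl₃-a α β σ z))
                (V-K (V-C (α z) y (trans (cong X lαz) (not-elim (proj₂ (∧-elim r′)))) (trans lαz (symm q)))))

      core : ∀ x → ∃[ c ] (Xf c ≡ false × κ (lab c) ≡ part x × rK σ c ≡ rK σ x)
      core x with bool-cases (Xf x)
      ... | inj₁ p = α x , noXX x p , symm (part-X {x} p) , cl₃-a α β σ x
      ... | inj₂ p = x , p , symm (part-C {x} p) , refl

    -- From a flag at X one step of α leads outside X, and there the part is joined by walks through
    -- unchanged vertices.
    part-connected : ∀ x y → part x ≡ part y → rK σ x ≡ rK σ y
    part-connected x y e with core x | core y
    ... | a , a-C , a-κ , a-K | b , b-C , b-κ , b-K =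
      trans (symm a-K) (trans (walk (star a b a-C b-C (trans a-κ (trans e (symm b-κ)))) a b refl a-C refl) b-K)

  start : State τ
  start = record { ok = rot ; lab-σ = lab-τ ; fixed = λ _ _ → refl }

  -- The state in which every face segment with marked ends joins two different vertices of X. By
  -- `bal`, the vertices gained on the way are no more than the faces gained.
  record Ready : Set where
    field
      σ     : Fin #fl → Fin #fl
      st    : State σ
      apart : ∀ u → mixed σ u ≡ true → lab (Phase.PF.ret σ st u) ≢ lab u
      bal   : #F τ + #V σ ≤ #F σ + #V τ

  -- A face that leaves and re-enters a part at corners of the same vertex is
  -- split in two by reconnecting the rotation at these corners.
  module Recut (σ : Fin #fl → Fin #fl) (st : State σ) (u : Fin #fl) (mu : mixed σ u ≡ true)
    (same : lab (Phase.PF.ret σ st u) ≡ lab u) where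
    open Phase σ st
      using (P; P-X; P-elim; P-σ; fixed; fpf; inv; lab-σ; ok; retF-part; module PF)

    v : Fin #fl
    v = PF.ret u

    mv : P v ≡ true
    mv = PF.ret-P mu

    open Switch σ inv fpf u v (PF.ret-≢ mu ∘ symm)
      (λ e → P-elim {u} mu (trans (cong part (symm e)) (retF-part mu)))
      using (P₄; Spot; is-off; is-p; is-q; is-τp; is-τq; spot; sw; sw-fpf; sw-inv; sw-label; sw-off; sw-p; sw-q; module Count) public

    P₄⊆P : ∀ x → P₄ x ≡ true → P x ≡ true
    P₄⊆P x h = go (spot x)
      where
      go : Spot x → P x ≡ true
      go (is-p refl)  = mu
      go (is-q refl)  = mv
      go (is-τp refl) = trans (P-σ u) mu
      go (is-τq refl) = trans (P-σ v) mv
      go (is-off o)   = absurd h o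

    module CF = Count α α-inv α-fpf
      using (count-gain; off; off-off)
    module CV = Count β β-inv β-fpf
      using (count-up)

    finer : ∀ {x y} → cl₂ α PF.off x ≡ cl₂ α PF.off y → cl₂ α CF.off x ≡ cl₂ α CF.off y
    finer {x} e = cl₂-elim α PF.off α-inv PF.off-inv (λ z → cl₂ α CF.off x ≡ cl₂ α CF.off z)
      (λ z h → trans h (symm (cl₂-a α CF.off z))) go e refl
      where
      go : ∀ z → cl₂ α CF.off x ≡ cl₂ α CF.off z → cl₂ α CF.off x ≡ cl₂ α CF.off (PF.off z)
      go z h with bool-cases (P z)
      ... | inj₁ p = trans h (cong (cl₂ α CF.off) (symm (PF.off-on {z} p)))
      ... | inj₂ p = trans h (trans (symm (cl₂-b α CF.off z)) (cong (cl₂ α CF.off)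
              (trans (CF.off-off {z} (≢true (λ q → absurd (P₄⊆P z q) p))) (symm (PF.off-off {z} p)))))

    next : State sw
    next = record { ok = rotation sw-inv sw-fpf ; lab-σ = sw-label lab lab-σ (symm same)
      ; fixed = λ x c → trans (sw-off {x} (≢true (λ q → absurd (P-X {x} (P₄⊆P x q)) c))) (fixed x c) }

    gain : #F sw ≡ suc (#F σ)
    gain = CF.count-gain (finer (symm (PF.ret-cl mu)))

    loss : #V sw ≤ suc (#V σ)
    loss = CV.count-up

    -- The new pair u, v lies in one part, so both lose their mark, and no flag acquires one. This
    -- is the measure that makes the recutting stop.
    fewer : card (mixed sw) < card P
    fewer = subst (card (mixed sw) <_) (symm (card-remove P u mu)) (s≤s (card-mono go))
      where
      uv : ∀ {x} → x ≡ u ⊎ x ≡ v → mixed sw x ≡ false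
      uv (inj₁ refl) = cong not (==-complete (trans (cong part sw-p) (retF-part mu)))
      uv (inj₂ refl) = cong not (==-complete (trans (cong part sw-q) (symm (retF-part mu))))
      go : ∀ x → mixed sw x ≡ true → P x ∧ not (x == u) ≡ true
      go x h = ∧-intro (inP (spot x)) (not-intro (==-false λ e → absurd h (uv (inj₁ e))))
        where
        inP : Spot x → P x ≡ true
        inP (is-p e)   = absurd h (uv (inj₁ e))
        inP (is-q e)   = absurd h (uv (inj₂ e))
        inP (is-τp refl) = trans (P-σ u) mu
        inP (is-τq refl) = trans (P-σ v) mv
        inP (is-off o) = trans (cong (λ y → not (part y == part x)) (symm (sw-off {x} o))) h

  again : ∀ σ → State σ → Fin #fl → Bool
  again σ st u = mixed σ u ∧ (lab (Phase.PF.ret σ st u) == lab u)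

  abstract
    ready : Ready
    ready = go (suc (card (mixed τ))) τ start ℕP.≤-refl ℕP.≤-refl
      where
      go : ∀ fuel σ (st : State σ) → card (mixed σ) < fuel → #F τ + #V σ ≤ #F σ + #V τ → Ready
      go (suc fuel) σ st (s≤s b) bal with bool-cases (ex (again σ st))
      ... | inj₂ none = record { σ = σ ; st = st ; bal = bal
            ; apart = λ u mu e → absurd (∧-intro mu (==-complete e)) (ex-none none u) }
      ... | inj₁ some = go fuel (R.sw) R.next (ℕP.<-≤-trans R.fewer b) (lin-≤-slack _ _ {#V R.sw} {suc (#V σ)}
                (ℕP.≤-trans (ℕP.≤-reflexive (a₁ (#F τ) (#V R.sw) (#V σ))) (ℕP.≤-trans (s≤s (ℕP.+-monoˡ-≤ (#V R.sw) bal))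
                  (ℕP.≤-reflexive (trans (a₂ (#F σ) (#V τ) (#V R.sw)) (cong (λ f → f + #V τ + #V R.sw) (symm R.gain)))))) R.loss)
        where
        u : Fin #fl
        u = proj₁ (ex-elim {f = again σ st} some)
        both : mixed σ u ≡ true × (lab (Phase.PF.ret σ st u) == lab u) ≡ true
        both = ∧-elim {mixed σ u} (proj₂ (ex-elim {f = again σ st} some))
        module R = Recut σ st u (proj₁ both) (==-sound (proj₂ both))
          using (fewer; gain; loss; next; sw)
        a₁ : ∀ f v w → f + v + suc w ≡ suc (f + w + v)
        a₁ = solve-∀
        a₂ : ∀ f v w → suc (f + v + w) ≡ suc f + v + w
        a₂ = solve-∀

  #X : ℕ
  #X = card X

  -- P marks the corners between different parts before the cut, mate pairs the
  -- marked corners at the two ends of a face segment inside one part, and μ is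
  -- the number of vertices with marked corners.
  record Cutting : Set where
    field
      ρ         : Fin #fl → Fin #fl
      ρ-state   : State ρ
      ρ-part    : ∀ x → part (ρ x) ≡ part x
      P         : Fin #fl → Bool
      P-X       : ∀ {x} → P x ≡ true → Xf x ≡ true
      mate      : Fin #fl → Fin #fl
      mate-P    : ∀ {x} → P x ≡ true → P (mate x) ≡ true
      mate-part : ∀ {x} → P x ≡ true → part (mate x) ≡ part x
      mate-lab  : ∀ {x} → P x ≡ true → lab (mate x) ≢ lab x
      mate-F    : ∀ {x} → P x ≡ true → rF ρ (mate x) ≡ rF ρ x
      μ         : ℕ
      μ-≥2      : ∀ {x} → P x ≡ true → 2 ≤ μ
      V-small   : ∀ Q → (∀ x → Q x ≡ true → P x ≡ true) → card Q ≤ nc Q (rV ρ) * 2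
      balance   : 4 * #V τ + 4 * #F τ + 4 * μ + 8 * nc Xf (rV ρ) + 4 * nc P (rF ρ) ≤
                  8 * #X + 4 * #V ρ + 4 * #F ρ + 3 * card P

  module Cut (ready : Ready) where
    open Ready ready using (σ; st; apart; bal)
    open Phase σ st
      using (P; P-X; P-elim; P-off; P-σ; fixed; fpf; inv; lab-V; lab-σ; ok; retF-part; retV-lab; retV-part; module PF; module PV)

    -- Every maximal segment of a single part in the rotation at a vertex of X
    -- becomes a vertex of its own.
    ρ : Fin #fl → Fin #fl
    ρ x = if P x then PV.ret x else σ x

    ρ-on : ∀ {x} → P x ≡ true → ρ x ≡ PV.ret x
    ρ-on h rewrite h = refl

    ρ-off : ∀ {x} → P x ≡ false → ρ x ≡ σ x
    ρ-off h rewrite h = refl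

    ρ-rot : Rotation ρ
    ρ-rot = rotation ρ-inv ρ-fpf
      where
      ρ-inv : Involutive ρ
      ρ-inv x = [ (λ p → trans (cong ρ (ρ-on {x} p)) (trans (ρ-on {PV.ret x} (PV.ret-P p)) (PV.ret-ret p)))
                , (λ p → trans (cong ρ (ρ-off {x} p)) (trans (ρ-off {σ x} (trans (P-σ x) p)) (inv x))) ]′ (bool-cases (P x))
      ρ-fpf : FixFree ρ
      ρ-fpf x e with bool-cases (P x)
      ... | inj₁ p = PV.ret-≢ p (trans (symm (ρ-on {x} p)) e)
      ... | inj₂ p = fpf x (trans (symm (ρ-off {x} p)) e)

    ρ-part : ∀ x → part (ρ x) ≡ part x
    ρ-part x with bool-cases (P x)
    ... | inj₁ p = trans (cong part (ρ-on {x} p)) (retV-part p)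
    ... | inj₂ p = trans (cong part (ρ-off {x} p)) (P-off {x} p)

    ρ-lab : ∀ x → lab (ρ x) ≡ lab x
    ρ-lab x with bool-cases (P x)
    ... | inj₁ p = trans (cong lab (ρ-on {x} p)) (retV-lab p)
    ... | inj₂ p = trans (cong lab (ρ-off {x} p)) (lab-σ x)

    ρ-state : State ρ
    ρ-state = record { ok = ρ-rot ; lab-σ = ρ-lab
      ; fixed = λ x c → trans (ρ-off {x} (≢true λ p → absurd (P-X {x} p) c)) (fixed x c) }

    module Final = Phase ρ ρ-state
      using (V-C; lab-V; part-connected)

    μ : ℕ
    μ = nc P (rV σ)

    V-pair : ∀ {x y} → P x ≡ true → P y ≡ true → rV ρ x ≡ rV ρ y → y ≡ x ⊎ y ≡ PV.ret x
    V-pair {x} px py h = PV.ret-unique px py (rV-elim ρ-rot (λ z → cl₂ β PV.off x ≡ cl₂ β PV.off z)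
      (λ z e → trans e (symm (cl₂-a β PV.off z))) go h refl)
      where
      go : ∀ z → cl₂ β PV.off x ≡ cl₂ β PV.off z → cl₂ β PV.off x ≡ cl₂ β PV.off (ρ z)
      go z e with bool-cases (P z)
      ... | inj₁ p = trans e (trans (symm (PV.ret-cl p)) (cong (cl₂ β PV.off) (symm (ρ-on {z} p))))
      ... | inj₂ p = trans e (trans (symm (cl₂-b β PV.off z)) (cong (cl₂ β PV.off) (trans (PV.off-off {z} p) (symm (ρ-off {z} p)))))

    ends₂ : Fin #fl → Fin 2 → Fin #fl
    ends₂ x zero       = x
    ends₂ x (suc zero) = PV.ret x

    V-small : ∀ Q → (∀ x → Q x ≡ true → P x ≡ true) → card Q ≤ nc Q (rV ρ) * 2
    V-small Q sub = nc-small 2 Q (rV ρ) ends₂ λ x y qx qy h →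
      [ (λ e → zero , symm e) , (λ e → suc zero , symm e) ]′ (V-pair (sub x qx) (sub y qy) (symm h))

    ρ-V : ∀ {x} → P x ≡ true → rV ρ (PV.ret x) ≡ rV ρ x
    ρ-V {x} p = trans (cong (rV ρ) (symm (ρ-on {x} p))) (cl₂-b β ρ x)

    V-large : nc P (rV ρ) * 2 ≤ card P
    V-large = nc-large′ P (rV ρ) 2 (λ x → x ∷ PV.ret x ∷ []) (λ _ → refl)
      (λ x p → ((PV.ret-≢ p ∘ symm) ∷ []) ∷ [] ∷ []) (λ x p → (p , refl) ∷ (PV.ret-P p , ρ-V p) ∷ [])

    -- A face through a marked corner runs through segments of two different parts there, and each
    -- segment has two marked ends.
    F-large : nc P (rF σ) * 4 ≤ card P
    F-large = nc-large′ P (rF σ) 4 (λ x → x ∷ σ x ∷ PF.ret x ∷ PF.ret (σ x) ∷ []) (λ _ → refl)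
      (λ x p → let p′ = trans (P-σ x) p in
        ((fpf x ∘ symm) ∷ (PF.ret-≢ p ∘ symm) ∷ (λ e → P-elim {x} p (trans (symm (retF-part p′)) (cong part (symm e)))) ∷ []) ∷
        ((λ e → P-elim {x} p (trans (cong part e) (retF-part p))) ∷ (PF.ret-≢ p′ ∘ symm) ∷ []) ∷
        ((λ e → P-elim {x} p (trans (symm (retF-part p′)) (trans (cong part (symm e)) (retF-part p)))) ∷ []) ∷ [] ∷ [])
      (λ x p → let p′ = trans (P-σ x) p in
        (p , refl) ∷ (p′ , cl₂-b α σ x) ∷ (PF.ret-P p , PF.off⊆ σ (λ _ _ → refl) (PF.ret-cl p)) ∷
        (PF.ret-P p′ , trans (PF.off⊆ σ (λ _ _ → refl) (PF.ret-cl p′)) (cl₂-b α σ x)) ∷ [])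

    F-change : #F σ + nc P (rF ρ) ≡ #F ρ + nc P (rF σ)
    F-change = count-change α P α-inv σ ρ inv (Rotation.inv ρ-rot) (λ x h → symm (ρ-off {x} h))

    V-change : #V σ + nc P (rV ρ) ≡ #V ρ + μ
    V-change = count-change β P β-inv σ ρ inv (Rotation.inv ρ-rot) (λ x h → symm (ρ-off {x} h))

    V-old : #V τ ≤ #X + nc (λ x → all x ∧ not (Xf x)) (rV ρ)
    V-old = ℕP.≤-trans (ℕP.≤-reflexive (nc-split all Xf (rV τ) (λ x y h → cong X (Phase.lab-V τ start h))))
      (ℕP.≤-trans (nc-≤ {Q = X} {r′ = id} (λ x _ → lab x) (λ x p → p) (λ x y _ _ → lab-class x y)) (nc≤card X id)
       ⊕ nc-coarser (λ x y _ _ h → lab-class x y (Final.lab-V h)))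

    V-new : #V ρ ≡ nc Xf (rV ρ) + nc (λ x → all x ∧ not (Xf x)) (rV ρ)
    V-new = nc-split all Xf (rV ρ) (λ x y h → cong X (Final.lab-V h))

    -- Cutting changes V and F only at classes with marked flags. An old face holds at least four of
    -- these and a new vertex at least two, which bounds the changes by |P|; outside X the vertices
    -- are the same as before.
    balance : 4 * #V τ + 4 * #F τ + 4 * μ + 8 * nc Xf (rV ρ) + 4 * nc P (rF ρ) ≤
      8 * #X + 4 * #V ρ + 4 * #F ρ + 3 * card P
    balance = lin-≤ _ _ (arith (#V τ) (#F τ) μ (nc Xf (rV ρ)) (nc P (rF ρ)) #X (#V ρ) (#F ρ) (card P) (#F σ) (#V σ)
        (nc P (rF σ)) (nc P (rV ρ)) (nc (λ x → all x ∧ not (Xf x)) (rV ρ)) F-change V-change V-new)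
      (F-large ⊕ scale 2 V-large ⊕ scale 4 bal ⊕ scale 8 V-old)
      where
      arith : ∀ v₀ f₀ μ vx cf k v₂ f₂ p f₁ v₁ cf₁ cv vc → f₁ + cf ≡ f₂ + cf₁ → v₁ + cv ≡ v₂ + μ → v₂ ≡ vx + vc →
        (4 * v₀ + 4 * f₀ + 4 * μ + 8 * vx + 4 * cf) + (p + (2 * p + (4 * (f₁ + v₀) + 8 * (k + vc)))) ≡
        (8 * k + 4 * v₂ + 4 * f₂ + 3 * p) + (cf₁ * 4 + (2 * (cv * 2) + (4 * (f₀ + v₁) + 8 * v₀)))
      arith v₀ f₀ μ vx cf k v₂ f₂ p f₁ v₁ cf₁ cv vc e₁ e₂ e₃ = trans (a₁ v₀ f₀ μ vx cf k p f₁ vc)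
        (trans (cong₂ (λ s t → 8 * v₀ + 4 * f₀ + 4 * μ + 3 * p + 8 * k + 4 * s + 8 * t) e₁ (symm e₃))
          (trans (a₂ v₀ f₀ μ k p f₂ cf₁ v₂) (trans (cong (λ t → 8 * v₀ + 4 * f₀ + 3 * p + 8 * k + 4 * f₂ + 4 * cf₁ + 4 * v₂ + 4 * t) (symm e₂))
            (a₃ v₀ f₀ k p f₂ cf₁ v₂ v₁ cv))))
        where
        a₁ : ∀ v₀ f₀ μ vx cf k p f₁ vc → (4 * v₀ + 4 * f₀ + 4 * μ + 8 * vx + 4 * cf) + (p + (2 * p + (4 * (f₁ + v₀) + 8 * (k + vc)))) ≡
          (8 * v₀ + 4 * f₀ + 4 * μ + 3 * p + 8 * k + 4 * (f₁ + cf) + 8 * (vx + vc))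
        a₁ = solve-∀
        a₂ : ∀ v₀ f₀ μ k p f₂ cf₁ v₂ → 8 * v₀ + 4 * f₀ + 4 * μ + 3 * p + 8 * k + 4 * (f₂ + cf₁) + 8 * v₂ ≡
          8 * v₀ + 4 * f₀ + 3 * p + 8 * k + 4 * f₂ + 4 * cf₁ + 4 * v₂ + 4 * (v₂ + μ)
        a₂ = solve-∀
        a₃ : ∀ v₀ f₀ k p f₂ cf₁ v₂ v₁ cv → 8 * v₀ + 4 * f₀ + 3 * p + 8 * k + 4 * f₂ + 4 * cf₁ + 4 * v₂ + 4 * (v₁ + cv) ≡
          (8 * k + 4 * v₂ + 4 * f₂ + 3 * p) + (cf₁ * 4 + (2 * (cv * 2) + (4 * (f₀ + v₁) + 8 * v₀)))
        a₃ = solve-∀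

    cutting : Cutting
    cutting = record { ρ = ρ ; ρ-state = ρ-state ; ρ-part = ρ-part ; P = P ; P-X = λ {x} → P-X {x}
      ; mate = PF.ret ; mate-P = PF.ret-P ; mate-part = retF-part ; mate-lab = λ {x} → apart x
      ; mate-F = λ p → PF.off⊆ ρ (λ x h → ρ-off {x} h) (PF.ret-cl p)
      ; μ = μ ; μ-≥2 = λ {x} p → nc-≥2 x (PF.ret x) p (PF.ret-P p) (λ e → apart x p (symm (lab-V e)))
      ; V-small = V-small ; balance = balance }

  abstract
    cutting : Cutting
    cutting = Cut.cutting ready

  -- Counting over the parts: which of them are planar

  module Verdict (cut : Cutting) (u₀ : Fin n) (u₀∈X : X u₀ ≡ true) where
    open Cutting cut
    open State ρ-state using () renaming (ok to ρ-rot; lab-σ to ρ-lab)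
    module Final = Phase ρ ρ-state
      using (V-C; lab-V; part-connected)

    Vᵢ Fᵢ VXᵢ fᵢ Pᵢ mᵢ : Fin s → ℕ
    Vᵢ i  = nc (λ x → all x ∧ (part x == i)) (rV ρ)
    Fᵢ i  = nc (λ x → all x ∧ (part x == i)) (rF ρ)
    VXᵢ i = nc (λ x → Xf x ∧ (part x == i)) (rV ρ)
    fᵢ i  = nc (λ x → P x ∧ (part x == i)) (rF ρ)
    Pᵢ i  = card (λ x → P x ∧ (part x == i))
    mᵢ i  = card (λ x → all x ∧ (part x == i))

    part-V : ∀ x y → rV ρ x ≡ rV ρ y → part x ≡ part y
    part-V x y h = rV-elim ρ-rot (λ z → part x ≡ part z) (λ z e → trans e (symm (part-β z))) (λ z e → trans e (symm (ρ-part z))) h refl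

    part-F : ∀ x y → rF ρ x ≡ rF ρ y → part x ≡ part y
    part-F x y h = rF-elim ρ-rot (λ z → part x ≡ part z) (λ z e → trans e (symm (part-α z))) (λ z e → trans e (symm (ρ-part z))) h refl

    In : Fin s → Fin #fl → Bool
    In i x = part x == i

    In-α : ∀ i x → In i (α x) ≡ In i x
    In-α i x = cong (_== i) (part-α x)

    In-β : ∀ i x → In i (β x) ≡ In i x
    In-β i x = cong (_== i) (part-β x)

    In-ρ : ∀ i x → In i (ρ x) ≡ In i x
    In-ρ i x = cong (_== i) (ρ-part x)

    edges-of : ∀ i → ∃[ e ] mᵢ i ≡ e * 4
    edges-of i = Edges.#E piece , symm (Edges.E-count piece)
      where
      piece : Frame (card (In i))
      piece = Sub.sub-frame frame ρ ρ-rot (In i) (In-α i) (In-β i) (In-ρ i)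

    private
      rep₀ : Fin s → Fin #fl
      rep₀ i = proj₁ (cover i u₀ u₀∈X)

      rep₀-part : ∀ i → part (rep₀ i) ≡ i
      rep₀-part i = proj₂ (proj₂ (cover i u₀ u₀∈X))

    planar-≤ : ∀ i → 4 * Vᵢ i + 4 * Fᵢ i ≤ 8 + mᵢ i
    planar-≤ i = ℕP.≤-trans (Sub.euler-on frame ρ ρ-rot (In i) (In-α i) (In-β i) (In-ρ i)) (ℕP.+-monoˡ-≤ (mᵢ i) (ℕP.*-monoʳ-≤ 8
      (nc-one (rK ρ (rep₀ i)) λ x h → Final.part-connected x (rep₀ i) (trans (==-sound h) (symm (rep₀-part i))))))

    X-≤ : ∀ i → #X ≤ VXᵢ i
    X-≤ i = ℕP.≤-trans (card≤nc X id (λ _ _ _ _ e → e)) (nc-≤ (λ u h → proj₁ (cover i u h))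
      (λ u h → ∧-intro (trans (cong X (proj₁ (proj₂ (cover i u h)))) h) (==-complete (proj₂ (proj₂ (cover i u h)))))
      (λ u v h k e → trans (symm (proj₁ (proj₂ (cover i u h)))) (trans (Final.lab-V e) (proj₁ (proj₂ (cover i v k))))))

    private
      X-≥1 : 1 ≤ #X
      X-≥1 = card-≥1 u₀ u₀∈X

    segments-≤ : ∀ i → nc (λ x → P x ∧ In i x) (rV ρ) ≤ VXᵢ i
    segments-≤ i = nc-mono λ x h → let a , b = ∧-elim {P x} h in ∧-intro (P-X {x} a) b

    Pᵢ-≤ : ∀ i → Pᵢ i ≤ nc (λ x → P x ∧ In i x) (rV ρ) * 2
    Pᵢ-≤ i = V-small _ (λ x h → proj₁ (∧-elim {P x} h))

    module Mixed (i : Fin s) (u : Fin #fl) (pu : P u ≡ true) (iu : part u ≡ i) where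
      v : Fin #fl
      v = mate u

      pv : P v ≡ true
      pv = mate-P pu

      iv : part v ≡ i
      iv = trans (mate-part pu) iu

      segments-≥2 : 2 ≤ nc (λ x → P x ∧ In i x) (rV ρ)
      segments-≥2 = nc-≥2 u v (∧-intro pu (==-complete iu)) (∧-intro pv (==-complete iv))
        (λ e → mate-lab pu (symm (Final.lab-V e)))

      faces-≥1 : 1 ≤ fᵢ i
      faces-≥1 = nc-≥1 u (∧-intro pu (==-complete iu))

      X-≥2 : 2 ≤ #X
      X-≥2 = card-≥2 (lab u) (lab v) (mate-lab pu ∘ symm) (P-X {u} pu) (P-X {v} pv)

      same-face : rF ρ u ≡ rF ρ v
      same-face = symm (mate-F pu)

    mixed? : ∀ i → (∃[ u ] (P u ≡ true × part u ≡ i)) ⊎ Pᵢ i ≡ 0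
    mixed? i with bool-cases (ex (λ x → P x ∧ In i x))
    ... | inj₁ h = let u , k = ex-elim h ; a , b = ∧-elim {P u} k in inj₁ (u , a , ==-sound b)
    ... | inj₂ h = inj₂ (card-empty (ex-none h))

    -- Without marked flags VXᵢ ≥ 1 is enough. Otherwise let ν be the number of marked vertices of
    -- the part: Pᵢ ≤ 2ν, 2 ≤ ν ≤ VXᵢ and fᵢ ≥ 1 give 8VXᵢ + 4fᵢ ≥ 6ν + 4 + 4.
    weight : ∀ i → 8 + 3 * Pᵢ i ≤ 8 * VXᵢ i + 4 * fᵢ i
    weight i with mixed? i
    ... | inj₂ z rewrite z = ℕP.≤-trans (scale 8 (ℕP.≤-trans X-≥1 (X-≤ i))) (ℕP.m≤m+n _ _)
    ... | inj₁ (u , pu , iu) = lin-≤ _ _ (arith (Pᵢ i) (VXᵢ i) (fᵢ i) (nc (λ x → P x ∧ In i x) (rV ρ)))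
        (scale 3 (Pᵢ-≤ i) ⊕ scale 8 (segments-≤ i) ⊕ scale 2 segments-≥2 ⊕ scale 4 faces-≥1)
      where
      open Mixed i u pu iu
      arith : ∀ p v f ν → (8 + 3 * p) + (3 * (ν * 2) + (8 * v + (2 * ν + 4 * f))) ≡ (8 * v + 4 * f) + (3 * p + (8 * ν + (2 * 2 + 4 * 1)))
      arith = solve-∀

    record Good (i : Fin s) : Set where
      field
        planar : 8 + mᵢ i ≤ 4 * Vᵢ i + 4 * Fᵢ i
        single : VXᵢ i ≤ #X
        small  : #X ≤ 2
        link   : 2 ≤ #X → ∃[ u ] ∃[ v ] (part u ≡ i × part v ≡ i × Xf u ≡ true × Xf v ≡ true × lab u ≢ lab v × rF ρ u ≡ rF ρ v)

    -- `planar-≤` and `weight` add up to this inequality without the 2. A bad part is one whose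
    -- excess in the sum is at least 2.
    Bad : Fin s → Set
    Bad i = 4 * Vᵢ i + 4 * Fᵢ i + 2 + 3 * Pᵢ i ≤ mᵢ i + 8 * VXᵢ i + 4 * fᵢ i

    Bad? : ∀ i → Dec (Bad i)
    Bad? i = _ ≤? _

    -- Excess at most 1 makes both estimates nearly tight. For `planar-≤` rounding removes the gap
    -- of 1; for `weight` it forces VXᵢ ≤ 1 if no corner is marked, and VXᵢ ≤ 2 otherwise, where a
    -- marked flag and its mate supply `link`.
    good : ∀ i → ¬ Bad i → Good i
    good i nb = go (mixed? i)
      where
      lt : suc (mᵢ i + 8 * VXᵢ i + 4 * fᵢ i) ≤ 4 * Vᵢ i + 4 * Fᵢ i + 2 + 3 * Pᵢ i
      lt = ℕP.≰⇒> nb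
      pl : 8 + mᵢ i ≤ 4 * Vᵢ i + 4 * Fᵢ i
      pl = planar-from (Vᵢ i) (Fᵢ i) (proj₁ (edges-of i)) (proj₂ (edges-of i)) (lin-≤ _ _
        (arith (mᵢ i) (Vᵢ i) (Fᵢ i) (VXᵢ i) (fᵢ i) (Pᵢ i)) (lt ⊕ weight i))
        where
        arith : ∀ m v f x y p → (m + 7) + ((4 * v + 4 * f + 2 + 3 * p) + (8 * x + 4 * y)) ≡
          (4 * v + 4 * f) + (suc (m + 8 * x + 4 * y) + (8 + 3 * p))
        arith = solve-∀
      narrow : 8 * VXᵢ i + 4 * fᵢ i ≤ 9 + 3 * Pᵢ i
      narrow = lin-≤ _ _ (arith (mᵢ i) (Vᵢ i) (Fᵢ i) (VXᵢ i) (fᵢ i) (Pᵢ i)) (lt ⊕ planar-≤ i)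
        where
        arith : ∀ m v f x y p → (8 * x + 4 * y) + ((4 * v + 4 * f + 2 + 3 * p) + (8 + m)) ≡
          (9 + 3 * p) + (suc (m + 8 * x + 4 * y) + (4 * v + 4 * f))
        arith = solve-∀
      go : (∃[ u ] (P u ≡ true × part u ≡ i)) ⊎ Pᵢ i ≡ 0 → Good i
      go (inj₂ z) = record { planar = pl ; single = ℕP.≤-trans one X-≥1
          ; small = ℕP.≤-trans (ℕP.≤-trans (X-≤ i) one) (s≤s z≤n)
          ; link = λ t → ⊥-elim (ℕP.<⇒≱ t (ℕP.≤-trans (X-≤ i) one)) }
        where
        one : VXᵢ i ≤ 1
        one with VXᵢ i ≤? 1
        ... | yes h = h
        ... | no h  = ⊥-elim (ℕP.<⇒≱ (ℕP.≤-trans (s≤s (ℕP.m≤m+n 9 6)) (scale 8 (ℕP.≰⇒> h)))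
                (ℕP.≤-trans (ℕP.m≤m+n (8 * VXᵢ i) (4 * fᵢ i)) (subst (λ p → 8 * VXᵢ i + 4 * fᵢ i ≤ 9 + 3 * p) z narrow)))
      go (inj₁ (u , pu , iu)) = record { planar = pl ; single = ℕP.≤-trans two X-≥2 ; small = ℕP.≤-trans (X-≤ i) two
          ; link = λ _ → u , v , iu , iv , P-X {u} pu , P-X {v} pv , (mate-lab pu ∘ symm) , same-face }
        where
        open Mixed i u pu iu
        ν = nc (λ x → P x ∧ In i x) (rV ρ)
        two : VXᵢ i ≤ 2
        two with VXᵢ i ≤? 2
        ... | yes h = h
        ... | no h  = ⊥-elim (ℕP.1+n≰n (ℕP.≤-trans (ℕP.≤-reflexive (symm (arith (Pᵢ i) (VXᵢ i) (fᵢ i) ν)))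
                (narrow ⊕ scale 3 (Pᵢ-≤ i) ⊕ scale 6 (segments-≤ i) ⊕ scale 4 faces-≥1 ⊕ scale 2 (ℕP.≰⇒> h))))
          where
          arith : ∀ p x y ν → (8 * x + 4 * y) + (3 * p + (6 * ν + (4 * 1 + 2 * 3))) ≡
            suc ((9 + 3 * p) + (3 * (ν * 2) + (6 * x + (4 * y + 2 * x))))
          arith = solve-∀

    private
      idem : ∀ (r : Fin #fl → Fin #fl → Bool) x → rep r (rep r x) ≡ rep r x
      idem r = rep-idem r

      -- Summed over the parts and combined with `balance`, every count of the cut graph cancels.
      -- What is left bounds the sum of the excesses c in terms of the original drawing.
      total : ∀ c → (∀ i → 4 * Vᵢ i + 4 * Fᵢ i + c i + 3 * Pᵢ i ≤ mᵢ i + 8 * VXᵢ i + 4 * fᵢ i) →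
        4 * #V τ + 4 * #F τ + 4 * μ + sumF c ≤ 8 * #X + #fl
      total c h = lin-≤ _ _ (arith (#V τ) (#F τ) μ #X #fl (#V ρ) (#F ρ) (nc Xf (rV ρ)) (nc P (rF ρ)) (card P) (sumF c)) (balance ⊕ sums)
        where
        arith : ∀ v₀ f₀ μ k m v f vx cf p c → (4 * v₀ + 4 * f₀ + 4 * μ + c) +
            ((8 * k + 4 * v + 4 * f + 3 * p) + (m + 8 * vx + 4 * cf)) ≡
          (8 * k + m) + ((4 * v₀ + 4 * f₀ + 4 * μ + 8 * vx + 4 * cf) + (4 * v + 4 * f + c + 3 * p))
        arith = solve-∀
        sum-V : #V ρ ≡ sumF Vᵢ
        sum-V = nc-fibres all (rV ρ) part part-V (idem (link₂ β ρ))
        sum-F : #F ρ ≡ sumF Fᵢ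
        sum-F = nc-fibres all (rF ρ) part part-F (idem (link₂ α ρ))
        sum-VX : nc Xf (rV ρ) ≡ sumF VXᵢ
        sum-VX = nc-fibres Xf (rV ρ) part part-V (idem (link₂ β ρ))
        sum-f : nc P (rF ρ) ≡ sumF fᵢ
        sum-f = nc-fibres P (rF ρ) part part-F (idem (link₂ α ρ))
        sum-P : card P ≡ sumF Pᵢ
        sum-P = card-fibres P part
        sum-m : #fl ≡ sumF mᵢ
        sum-m = trans (symm (card-full #fl)) (card-fibres all part)
        left : sumF (λ i → 4 * Vᵢ i + 4 * Fᵢ i + c i + 3 * Pᵢ i) ≡ 4 * #V ρ + 4 * #F ρ + sumF c + 3 * card P
        left = trans (sumF-+ (λ i → 4 * Vᵢ i + 4 * Fᵢ i + c i) (λ i → 3 * Pᵢ i)) (cong₂ _+_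
          (trans (sumF-+ (λ i → 4 * Vᵢ i + 4 * Fᵢ i) c) (cong (_+ sumF c) (trans (sumF-+ (λ i → 4 * Vᵢ i) (λ i → 4 * Fᵢ i))
            (cong₂ _+_ (trans (sumF-* 4 Vᵢ) (cong (4 *_) (symm sum-V))) (trans (sumF-* 4 Fᵢ) (cong (4 *_) (symm sum-F)))))))
          (trans (sumF-* 3 Pᵢ) (cong (3 *_) (symm sum-P))))
        right : sumF (λ i → mᵢ i + 8 * VXᵢ i + 4 * fᵢ i) ≡ #fl + 8 * nc Xf (rV ρ) + 4 * nc P (rF ρ)
        right = trans (sumF-+ (λ i → mᵢ i + 8 * VXᵢ i) (λ i → 4 * fᵢ i)) (cong₂ _+_
          (trans (sumF-+ mᵢ (λ i → 8 * VXᵢ i)) (cong₂ _+_ (symm sum-m) (trans (sumF-* 8 VXᵢ) (cong (8 *_) (symm sum-VX)))))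
          (trans (sumF-* 4 fᵢ) (cong (4 *_) (symm sum-f))))
        sums : 4 * #V ρ + 4 * #F ρ + sumF c + 3 * card P ≤ #fl + 8 * nc Xf (rV ρ) + 4 * nc P (rF ρ)
        sums = subst₂ _≤_ left right (sumF-mono h)

      K-≥1 : Fin s → 1 ≤ #K τ
      K-≥1 i = nc-≥1 (rep₀ i) refl

    good-exists : 8 * #X + 4 * g < 8 + 2 * s → ∃[ i ] Good i
    good-exists big with FP.all? Bad?
    ... | no nall = let i , nb = FP.¬∀⟶∃¬ s Bad Bad? nall in i , good i nb
    ... | yes bad = ⊥-elim (ℕP.<⇒≱ big (few s (λ { refl → ℕP.<⇒≱ big (ℕP.≤-trans (ℕP.*-monoʳ-≤ 8 X-≥1) (ℕP.m≤m+n _ _)) }) refl))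
      where
      few : ∀ s′ → (s′ ≢ 0) → s′ ≡ s → 8 + 2 * s ≤ 8 * #X + 4 * g
      few zero    nz e = ⊥-elim (nz refl)
      few (suc _) _ refl = lin-≤-slack _ _ (ℕP.≤-trans (ℕP.m≤m+n _ (4 * μ)) (ℕP.≤-reflexive
          (trans (arith (#V τ) (#F τ) μ #X #fl g (#K τ) s) (cong (λ t → (8 * #X + 4 * g) + ((4 * #V τ + 4 * #F τ + 4 * μ + t) + ((8 * #K τ + #fl) + 8 * 1)))
            (symm (sumF-const s 2))))))
        (total (λ _ → 2) bad ⊕ genus ⊕ scale 8 (K-≥1 zero))
        where
        arith : ∀ v f μ k m g K s → (8 + 2 * s) + ((8 * k + m) + ((4 * v + 4 * f + 4 * g) + 8 * K)) + 4 * μ ≡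
          (8 * k + 4 * g) + ((4 * v + 4 * f + 4 * μ + s * 2) + ((8 * K + m) + 8 * 1))
        arith = solve-∀

    -- In the plane two parts already suffice: a mixed corner at each of the two
    -- vertices of X makes up for the slack in the count.
    good-planar : g ≡ 0 → #X ≡ 2 → 2 ≤ s → ∀ i → Good i
    good-planar g≡0 k≡2 s≥2 i = good i λ bad → go bad (bool-cases (ex P))
      where
      genus₀ : 8 * #K τ + #fl ≤ 4 * #V τ + 4 * #F τ
      genus₀ = subst (8 * #K τ + #fl ≤_) (trans (cong (λ t → 4 * #V τ + 4 * #F τ + 4 * t) g≡0) (ℕP.+-identityʳ _)) genus
      close : ∀ c → (∀ i → 4 * Vᵢ i + 4 * Fᵢ i + c i + 3 * Pᵢ i ≤ mᵢ i + 8 * VXᵢ i + 4 * fᵢ i) → 9 ≤ 4 * μ + sumF c → ⊥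
      close c h nine = ℕP.1+n≰n (ℕP.≤-trans (ℕP.≤-reflexive (symm (arith (#V τ) (#F τ) μ #fl (#K τ) (sumF c))))
        (subst (λ k → 4 * #V τ + 4 * #F τ + 4 * μ + sumF c ≤ 8 * k + #fl) k≡2 (total c h) ⊕ genus₀ ⊕ scale 8 (K-≥1 i) ⊕ nine))
        where
        arith : ∀ v f μ m K c → (4 * v + 4 * f + 4 * μ + c) + ((8 * K + m) + (8 * 1 + 9)) ≡
          suc ((8 * 2 + m) + ((4 * v + 4 * f) + (8 * K + (4 * μ + c))))
        arith = solve-∀
      go : Bad i → ex P ≡ true ⊎ ex P ≡ false → ⊥
      go bad (inj₂ none) = close (λ _ → 8) (λ j → lin-≤ _ _ (arith (mᵢ j) (Vᵢ j) (Fᵢ j) (VXᵢ j) (fᵢ j) (Pᵢ j) (P-none j))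
          (planar-≤ j ⊕ scale 8 (subst (_≤ VXᵢ j) k≡2 (X-≤ j)) ⊕ z≤n {4 * fᵢ j}))
          (ℕP.≤-trans (ℕP.≤-trans (ℕP.m≤m+n 9 7) (ℕP.≤-trans (ℕP.*-monoˡ-≤ 8 s≥2) (ℕP.≤-reflexive (symm (sumF-const s 8))))) (ℕP.m≤n+m _ (4 * μ)))
        where
        P-none : ∀ j → Pᵢ j ≡ 0
        P-none j = card-empty λ x → cong (_∧ In j x) (ex-none none x)
        arith : ∀ m v f x y p → p ≡ 0 → (4 * v + 4 * f + 8 + 3 * p) + ((8 + m) + (8 * x + 4 * y)) ≡
          (m + 8 * x + 4 * y) + ((4 * v + 4 * f) + (8 * 2 + 0))
        arith m v f x y _ refl = arith′ m v f x y
          where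
          arith′ : ∀ m v f x y → (4 * v + 4 * f + 8 + 3 * 0) + ((8 + m) + (8 * x + 4 * y)) ≡
            (m + 8 * x + 4 * y) + ((4 * v + 4 * f) + (8 * 2 + 0))
          arith′ = solve-∀
      go bad (inj₁ some) = close c h (ℕP.≤-trans (ℕP.n≤1+n 9) (scale 4 μ≥2 ⊕ c≥2))
        where
        u : Fin #fl
        u = proj₁ (ex-elim some)
        pu : P u ≡ true
        pu = proj₂ (ex-elim some)
        μ≥2 : 2 ≤ μ
        μ≥2 = μ-≥2 pu
        -- Only the part i, assumed bad, contributes its 2. Together with 4μ ≥ 8 this exceeds 8,
        -- which is all that |X| = 2 and genus zero allow.
        c : Fin s → ℕ
        c j = 2 * (if i == j then 1 else 0)
        c≥2 : 2 ≤ sumF c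
        c≥2 = ℕP.≤-reflexive (symm (trans (sumF-* 2 (λ j → if i == j then 1 else 0)) (cong (2 *_) (sumF-indicator i))))
        h : ∀ j → 4 * Vᵢ j + 4 * Fᵢ j + c j + 3 * Pᵢ j ≤ mᵢ j + 8 * VXᵢ j + 4 * fᵢ j
        h j with i ≟ j
        ... | yes refl = bad
        ... | no _ = lin-≤ _ _ (arith (mᵢ j) (Vᵢ j) (Fᵢ j) (VXᵢ j) (fᵢ j) (Pᵢ j)) (planar-≤ j ⊕ weight j)
          where
          arith : ∀ m v f x y p → (4 * v + 4 * f + 2 * 0 + 3 * p) + ((8 + m) + (8 * x + 4 * y)) ≡
            (m + 8 * x + 4 * y) + ((4 * v + 4 * f) + (8 + 3 * p))
          arith = solve-∀

    module Planar (i : Fin s) (gd : Good i) (V⁺ : Fin n → Bool) (E⁺ : Fin n → Fin n → Bool)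
      (vert : ∀ u → V⁺ u ≡ true → ∃[ x ] (part x ≡ i × lab x ≡ u))
      (edge : ∀ u v → V⁺ u ≡ true → V⁺ v ≡ true → E⁺ u v ≡ true →
        (∃[ x ] (part x ≡ i × lab x ≡ u × lab (α x) ≡ v)) ⊎ (X u ≡ true × X v ≡ true × u ≢ v))
      (other : 2 ≤ #X → ∃[ j ] j ≢ i) where
      open Good gd

      -- The part meets every vertex of X and has at most |X| vertices there; two different ones
      -- with the same label would be one too many.
      one-vertex : ∀ x y → part x ≡ i → part y ≡ i → lab x ≡ lab y → rV ρ x ≡ rV ρ y
      one-vertex x y px py e with bool-cases (Xf x)
      ... | inj₂ c = Final.V-C x y c e
      ... | inj₁ c with rV ρ x ≟ rV ρ y
      ...   | yes h = h
      ...   | no ne = ⊥-elim (ℕP.1+n≰n (ℕP.≤-trans many single))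
        where
        S : Fin #fl → Bool
        S z = lab z == lab x
        B : Fin #fl → Bool
        B z = (Xf z ∧ In i z) ∧ not (S z)
        here-2 : 2 ≤ nc (λ z → (Xf z ∧ In i z) ∧ S z) (rV ρ)
        here-2 = nc-≥2 x y (∧-intro (∧-intro c (==-complete px)) (==-refl _))
          (∧-intro (∧-intro (trans (cong X (symm e)) c) (==-complete py)) (==-complete (symm e))) ne
        rest : card (λ u → X u ∧ not (u == lab x)) ≤ nc B (rV ρ)
        rest = ℕP.≤-trans (card≤nc _ id (λ _ _ _ _ e → e)) (nc-≤ (λ u h → proj₁ (at u h)) (λ u h → hits u h)
          (λ u v h k r → trans (symm (proj₁ (proj₂ (at u h)))) (trans (Final.lab-V r) (proj₁ (proj₂ (at v k))))))
          where
          at : ∀ u → X u ∧ not (u == lab x) ≡ true → ∃[ z ] (lab z ≡ u × part z ≡ i)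
          at u h = cover i u (proj₁ (∧-elim {X u} h))
          hits : ∀ u h → B (proj₁ (at u h)) ≡ true
          hits u h with at u h
          ... | z , refl , pz = ∧-intro (∧-intro (proj₁ (∧-elim {X u} h)) (==-complete pz)) (proj₂ (∧-elim {X u} h))
        many : suc #X ≤ VXᵢ i
        many = subst₂ _≤_ (cong suc (symm (card-remove X (lab x) c)))
          (symm (nc-split (λ z → Xf z ∧ In i z) S (rV ρ) (λ a b r → cong (_== lab x) (Final.lab-V r)))) (here-2 ⊕ rest)

      conn : ∀ x y → In i x ≡ true → In i y ≡ true → rK ρ x ≡ rK ρ y
      conn x y px py = Final.part-connected x y (trans (==-sound px) (symm (==-sound py)))

      one-vertex′ : ∀ x y → In i x ≡ true → In i y ≡ true → lab x ≡ lab y → rV ρ x ≡ rV ρ y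
      one-vertex′ x y px py = one-vertex x y (==-sound px) (==-sound py)

      vert′ : ∀ u → V⁺ u ≡ true → ∃[ x ] (In i x ≡ true × lab x ≡ u)
      vert′ u h = let x , px , lx = vert u h in x , ==-complete px , lx

      X-cases : ∀ {u v} → Xf u ≡ true → Xf v ≡ true → lab u ≢ lab v → ∀ w → X w ≡ true → w ≡ lab u ⊎ w ≡ lab v
      X-cases {u} {v} Xu Xv uv w Xw with w ≟ lab u | w ≟ lab v
      ... | yes e | _     = inj₁ e
      ... | no _  | yes e = inj₂ e
      ... | no n₁ | no n₂ = ⊥-elim (ℕP.<⇒≱ three small)
        where
        three : 3 ≤ #X
        three = subst (3 ≤_) (symm (card-remove X w Xw)) (s≤s (card-≥2 (lab u) (lab v) uv
          (∧-intro Xu (not-intro (==-false (n₁ ∘ symm)))) (∧-intro Xv (not-intro (==-false (n₂ ∘ symm))))))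

      ends : ∀ {u v} → Xf u ≡ true → Xf v ≡ true → lab u ≢ lab v → ∀ a b → X a ≡ true → X b ≡ true → a ≢ b →
        (a ≡ lab u × b ≡ lab v) ⊎ (a ≡ lab v × b ≡ lab u)
      ends Xu Xv uv a b Xa Xb ne with X-cases Xu Xv uv a Xa | X-cases Xu Xv uv b Xb
      ... | inj₁ p | inj₁ q = ⊥-elim (ne (trans p (symm q)))
      ... | inj₂ p | inj₂ q = ⊥-elim (ne (trans p (symm q)))
      ... | inj₁ p | inj₂ q = inj₁ (p , q)
      ... | inj₂ p | inj₁ q = inj₂ (p , q)

      alone : ¬ 2 ≤ #X → EmbedsSub n V⁺ E⁺ sphere
      alone X<2 = Join.Alone.result frame ρ ρ-rot lab lab-β ρ-lab (In i) (In-α i) (In-β i) (In-ρ i) conn planar one-vertex′ V⁺ E⁺ vert′ inner (rep₀ i) (==-complete (rep₀-part i))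
        where
        inner : ∀ u v → V⁺ u ≡ true → V⁺ v ≡ true → E⁺ u v ≡ true → ∃[ x ] (In i x ≡ true × lab x ≡ u × lab (α x) ≡ v)
        inner u v h k uv with edge u v h k uv
        ... | inj₁ (x , px , l) = x , ==-complete px , l
        ... | inj₂ (xu , xv , ne) = ⊥-elim (X<2 (card-≥2 u v ne xu xv))

      across : (∃[ u ] ∃[ v ] (part u ≡ i × part v ≡ i × Xf u ≡ true × Xf v ≡ true × lab u ≢ lab v × rF ρ u ≡ rF ρ v)) →
        ∃[ j ] j ≢ i → EmbedsSub n V⁺ E⁺ sphere
      across (u , v , pu , pv , Xu , Xv , uv , fuv) (j , j≢i) =
        Join.Across.result frame ρ ρ-rot lab lab-β ρ-lab (In i) (In-α i) (In-β i) (In-ρ i) conn planar one-vertex′ V⁺ E⁺ vert′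
          u v (rep₀ j) (==-complete pu) (==-complete pv) uv fuv (==-false (λ e → j≢i (trans (symm (rep₀-part j)) e))) inner
        where
        inner : ∀ a b → V⁺ a ≡ true → V⁺ b ≡ true → E⁺ a b ≡ true →
          (∃[ x ] (In i x ≡ true × lab x ≡ a × lab (α x) ≡ b)) ⊎ (a ≡ lab u × b ≡ lab v) ⊎ (a ≡ lab v × b ≡ lab u)
        inner a b ha hb ab with edge a b ha hb ab
        ... | inj₁ (x , px , l) = inj₁ (x , ==-complete px , l)
        ... | inj₂ (Xa , Xb , ne) = inj₂ (ends Xu Xv uv a b Xa Xb ne)

      embedding : EmbedsSub n V⁺ E⁺ sphere
      embedding with 2 ≤? #X
      ... | no X<2 = alone X<2
      ... | yes X≥2 = across (link X≥2) (other X≥2)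

  -- With nothing to glue along no cut is made: the parts are unions of components and K ≥ s. If
  -- every part failed to be planar, the sum of the deficits would give s ≤ 4g.
  module Lonely (noX : ∀ u → X u ≡ false) (occupied : ∀ i → ∃[ x ] part x ≡ i) (large : 4 * g < s) where

    part-τ : ∀ x → part (τ x) ≡ part x
    part-τ x = trans (part-C {τ x} (noX _)) (trans (cong κ (lab-τ x)) (symm (part-C {x} (noX _))))

    In : Fin s → Fin #fl → Bool
    In i x = part x == i

    Vₗ Fₗ Mₗ : Fin s → ℕ
    Vₗ i = nc (λ x → all x ∧ (part x == i)) (rV τ)
    Fₗ i = nc (λ x → all x ∧ (part x == i)) (rF τ)
    Mₗ i = card (λ x → all x ∧ (part x == i))

    Good : Fin s → Set
    Good i = 8 + Mₗ i ≤ 4 * Vₗ i + 4 * Fₗ i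

    private
      τ-part-V : ∀ x y → rV τ x ≡ rV τ y → part x ≡ part y
      τ-part-V x y h = rV-elim rot (λ z → part x ≡ part z) (λ z e → trans e (symm (part-β z))) (λ z e → trans e (symm (part-τ z))) h refl
      τ-part-F : ∀ x y → rF τ x ≡ rF τ y → part x ≡ part y
      τ-part-F x y h = rF-elim rot (λ z → part x ≡ part z) (λ z e → trans e (symm (part-α z))) (λ z e → trans e (symm (part-τ z))) h refl
      τ-part-K : ∀ {x y} → rK τ x ≡ rK τ y → part x ≡ part y
      τ-part-K {x} h = rK-elim rot (λ z → part x ≡ part z) (λ z e → trans e (symm (part-α z))) (λ z e → trans e (symm (part-β z)))
        (λ z e → trans e (symm (part-τ z))) h refl

      K-≥ : s ≤ #K τ
      K-≥ = subst (_≤ #K τ) (nc-id s) (nc-≤ (λ i _ → proj₁ (occupied i)) (λ _ _ → refl)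
        (λ i j _ _ h → trans (symm (proj₂ (occupied i))) (trans (τ-part-K h) (proj₂ (occupied j)))))

    good-exists : ∃[ i ] Good i
    good-exists with FP.all? (λ i → ¬? (8 + Mₗ i ≤? 4 * Vₗ i + 4 * Fₗ i))
    ... | no nall = let i , h = FP.¬∀⟶∃¬ s _ (λ i → ¬? (8 + Mₗ i ≤? 4 * Vₗ i + 4 * Fₗ i)) nall in
        i , decidable-stable (8 + Mₗ i ≤? 4 * Vₗ i + 4 * Fₗ i) h
    ... | yes bad = ⊥-elim (ℕP.<⇒≱ large (lin-≤ _ _ (arith (#V τ) (#F τ) (#K τ) #fl g s)
          (subst₂ _≤_ left right (sumF-mono (λ i → ℕP.≰⇒> (bad i))) ⊕ genus ⊕ scale 8 K-≥)))
      where
      arith : ∀ v f K m g s → s + ((8 * s + m) + ((4 * v + 4 * f + 4 * g) + 8 * K)) ≡ (4 * g) + ((s * 1 + (4 * v + 4 * f)) + ((8 * K + m) + 8 * s))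
      arith = solve-∀
      left : sumF (λ i → 1 + (4 * Vₗ i + 4 * Fₗ i)) ≡ s * 1 + (4 * #V τ + 4 * #F τ)
      left = trans (sumF-+ (λ _ → 1) (λ i → 4 * Vₗ i + 4 * Fₗ i)) (cong₂ _+_ (sumF-const s 1)
        (trans (sumF-+ (λ i → 4 * Vₗ i) (λ i → 4 * Fₗ i)) (cong₂ _+_
          (trans (sumF-* 4 Vₗ) (cong (4 *_) (symm (nc-fibres all (rV τ) part τ-part-V (rep-idem (link₂ β τ))))))
          (trans (sumF-* 4 Fₗ) (cong (4 *_) (symm (nc-fibres all (rF τ) part τ-part-F (rep-idem (link₂ α τ)))))))))
      right : sumF (λ i → 8 + Mₗ i) ≡ 8 * s + #fl
      right = trans (sumF-+ (λ _ → 8) Mₗ) (cong₂ _+_ (trans (sumF-const s 8) (ℕP.*-comm s 8))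
        (trans (symm (card-fibres all part)) (card-full #fl)))

    module Planar (i : Fin s) (gd : Good i) (V⁺ : Fin n → Bool) (E⁺ : Fin n → Fin n → Bool)
      (vert : ∀ u → V⁺ u ≡ true → ∃[ x ] (part x ≡ i × lab x ≡ u))
      (edge : ∀ u v → V⁺ u ≡ true → V⁺ v ≡ true → E⁺ u v ≡ true → ∃[ x ] (part x ≡ i × lab x ≡ u × lab (α x) ≡ v)) where
      embedding : EmbedsSub n V⁺ E⁺ sphere
      embedding = Join.Alone.result frame τ rot lab lab-β lab-τ (In i) (λ x → cong (_== i) (part-α x)) (λ x → cong (_== i) (part-β x))
        (λ x → cong (_== i) (part-τ x)) (λ x y px py → Phase.part-connected τ start x y (trans (==-sound px) (symm (==-sound py))))
        gd (λ x y _ _ → lab-class x y) V⁺ E⁺ (λ u h → let x , px , lx = vert u h in x , ==-complete px , lx)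
        (λ u v h k uv → let x , px , l = edge u v h k uv in x , ==-complete px , l)
        (proj₁ (occupied i)) (==-complete (proj₂ (occupied i)))

another : ∀ {s} → 2 ≤ s → (i : Fin s) → ∃[ j ] j ≢ i
another {suc (suc s)} _ zero    = suc zero , λ ()
another {suc (suc s)} _ (suc i) = zero , λ ()
another {suc zero} (s≤s ())

-- Planar pieces of a graph glued from many parts

module Glue {n s : ℕ} {V : Fin n → Bool} {E : Fin n → Fin n → Bool} {S : Surface} (emb : EmbedsSub n V E S)
  (E-sym : ∀ u v → E u v ≡ true → E v u ≡ true) (E-irr : ∀ u v → E u v ≡ true → u ≢ v)
  (X C : Fin n → Bool) (κ : Fin n → Fin s)
  (X⊆V : ∀ u → X u ≡ true → V u ≡ true) (C⊆V : ∀ u → C u ≡ true → V u ≡ true) (CX : ∀ u → C u ≡ true → X u ≡ false)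
  (conn : ∀ u v → C u ≡ true → C v ≡ true → κ u ≡ κ v → Star (λ a b → E a b ∧ ((C a ∧ C b) ∧ (κ a == κ b))) u v) where

  Cᵢ : Fin s → Fin n → Bool
  Cᵢ i u = C u ∧ (κ u == i)

  V⁺ : Fin s → Fin n → Bool
  V⁺ i u = X u ∨ Cᵢ i u

  E⁺ : Fin s → Fin n → Fin n → Bool
  E⁺ i u v = (E u v ∧ (Cᵢ i u ∨ Cᵢ i v)) ∨ ((X u ∧ X v) ∧ not (u == v))

  private
    -- Edges inside X are left out, as an amalgam forbids them; `E⁺` joins all pairs of X anyway,
    -- and such a pair is supplied by the inserted edge.
    D : Fin n → Fin n → Bool
    D u v = E u v ∧ (((C u ∧ X v) ∨ (X u ∧ C v)) ∨ ((C u ∧ C v) ∧ (κ u == κ v)))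

    data Kind (u v : Fin n) : Set where
      CX-edge : C u ≡ true → X v ≡ true → Kind u v
      XC-edge : X u ≡ true → C v ≡ true → Kind u v
      CC-edge : C u ≡ true → C v ≡ true → κ u ≡ κ v → Kind u v

    D-E : ∀ {u v} → D u v ≡ true → E u v ≡ true
    D-E {u} {v} d = proj₁ (∧-elim {E u v} d)

    D-kind : ∀ {u v} → D u v ≡ true → Kind u v
    D-kind {u} {v} d with ∨-elim {(C u ∧ X v) ∨ (X u ∧ C v)} (proj₂ (∧-elim {E u v} d))
    ... | inj₂ h = let a , b = ∧-elim {C u ∧ C v} h ; c , c′ = ∧-elim {C u} a in CC-edge c c′ (==-sound b)
    ... | inj₁ h with ∨-elim {C u ∧ X v} h
    ...   | inj₁ k = let a , b = ∧-elim {C u} k in CX-edge a b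
    ...   | inj₂ k = let a , b = ∧-elim {X u} k in XC-edge a b

    D-intro : ∀ {u v} → E u v ≡ true → Kind u v → D u v ≡ true
    D-intro e (CX-edge a b)   = ∧-intro e (∨-introˡ (∨-introˡ (∧-intro a b)))
    D-intro {u} {v} e (XC-edge a b) = ∧-intro e (∨-introˡ (∨-introʳ {C u ∧ X v} (∧-intro a b)))
    D-intro {u} {v} e (CC-edge a b k) = ∧-intro e (∨-introʳ {(C u ∧ X v) ∨ (X u ∧ C v)} (∧-intro (∧-intro a b) (==-complete k)))

    flip : ∀ {u v} → Kind u v → Kind v u
    flip (CX-edge a b)   = XC-edge b a
    flip (XC-edge a b)   = CX-edge b a
    flip (CC-edge a b k) = CC-edge b a (symm k)

    D-sym : ∀ u v → D u v ≡ true → D v u ≡ true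
    D-sym u v d = D-intro (E-sym u v (D-E d)) (flip (D-kind d))

    kind-V : ∀ {u v} → Kind u v → V u ≡ true
    kind-V (CX-edge a b)   = C⊆V _ a
    kind-V (XC-edge a b)   = X⊆V _ a
    kind-V (CC-edge a b k) = C⊆V _ a

    abstract
      dr : Drawing n (eulerGenus S) D
      dr = drawing emb D D-sym (λ u v d → E-irr u v (D-E d))
        (λ u v d → kind-V (D-kind d) , kind-V (flip (D-kind d)) , D-E d)

    kind-C : ∀ {u v} → Kind u v → X u ≡ false → C u ≡ true
    kind-C (CX-edge a b) x   = a
    kind-C (XC-edge a b) x   = absurd a x
    kind-C (CC-edge a b k) x = a

    noXX : ∀ {u v} → Kind u v → X u ≡ true → X v ≡ false
    noXX (CX-edge a b) x   = absurd x (CX _ a)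
    noXX (XC-edge a b) x   = CX _ b
    noXX (CC-edge a b k) x = CX _ b

    sameκ : ∀ {u v} → Kind u v → X u ≡ false → X v ≡ false → κ v ≡ κ u
    sameκ (CX-edge a b) x y   = absurd b y
    sameκ (XC-edge a b) x y   = absurd a x
    sameκ (CC-edge a b k) x y = symm k

    open Drawing dr using (lab; α; edge-of; flag-of)

    star : ∀ x y → X (lab x) ≡ false → X (lab y) ≡ false → κ (lab x) ≡ κ (lab y) →
      Star (λ a b → D a b ∧ (not (X a) ∧ not (X b))) (lab x) (lab y)
    star x y p q k = Star-map (λ u → u) inner (conn (lab x) (lab y) (kind-C (D-kind (edge-of x)) p) (kind-C (D-kind (edge-of y)) q) k)
      where
      inner : ∀ a b → E a b ∧ ((C a ∧ C b) ∧ (κ a == κ b)) ≡ true → D a b ∧ (not (X a) ∧ not (X b)) ≡ true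
      inner a b h = let e , h′ = ∧-elim {E a b} h ; c , k = ∧-elim {C a ∧ C b} h′ ; ca , cb = ∧-elim {C a} c in
        ∧-intro (D-intro e (CC-edge ca cb (==-sound k))) (∧-intro (not-intro (CX a ca)) (not-intro (CX b cb)))

    amalgam : (∀ i u (h : X u ≡ true) → ∃[ c ] (C c ≡ true × κ c ≡ i × E u c ≡ true)) → Amalgam {n} {eulerGenus S} {s} dr
    amalgam attach = record { X = X ; κ = κ ; noXX = λ x → noXX (D-kind (edge-of x)) ; sameκ = λ x → sameκ (D-kind (edge-of x))
        ; star = star ; cover = cov }
      where
      part-of : Fin (Drawing.#fl dr) → Fin s
      part-of x = if X (lab x) then κ (lab (α x)) else κ (lab x)
      cov : ∀ i u → X u ≡ true → ∃[ x ] (lab x ≡ u × part-of x ≡ i)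
      cov i u h with attach i u h
      ... | c , cc , kc , e with flag-of u c (D-intro e (XC-edge h cc))
      ...   | x , refl , refl = x , refl , trans (cong (λ b → if b then κ (lab (α x)) else κ (lab x)) h) kc

  module _ (attach : ∀ i u (h : X u ≡ true) → ∃[ c ] (C c ≡ true × κ c ≡ i × E u c ≡ true))
    (start : ∀ i → ∃[ c ] ∃[ y ] (C c ≡ true × κ c ≡ i × E c y ≡ true × (X y ≡ true ⊎ (C y ≡ true × κ c ≡ κ y)))) where
    private
      startD : ∀ i → ∃[ c ] ∃[ y ] (C c ≡ true × κ c ≡ i × D c y ≡ true)
      startD i = let c , y , cc , kc , e , k = start i in c , y , cc , kc , D-intro e ([ CX-edge cc , (λ (cy , q) → CC-edge cc cy q) ]′ k)

      am = amalgam attach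
      part = Amalgam.part am
      cut = Split.cutting dr am

      part-at : ∀ x → X (lab x) ≡ false → part x ≡ κ (lab x)
      part-at x h rewrite h = refl
      part-X : ∀ x → X (lab x) ≡ true → part x ≡ κ (lab (α x))
      part-X x h rewrite h = refl

      flag-C : ∀ i {u v} → C u ≡ true → κ u ≡ i → D u v ≡ true → ∃[ x ] (part x ≡ i × lab x ≡ u × lab (α x) ≡ v)
      flag-C i {u} {v} c k d with flag-of u v d
      ... | x , refl , refl = x , trans (part-at x (CX _ c)) k , refl , refl

      flag-X : ∀ i {u v} → C v ≡ true → κ v ≡ i → D u v ≡ true → ∃[ x ] (part x ≡ i × lab x ≡ u × lab (α x) ≡ v)
      flag-X i {u} {v} c k d with flag-of u v d
      ... | x , refl , refl with bool-cases (X (lab x))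
      ...   | inj₁ h = x , trans (part-X x h) k , refl , refl
      ...   | inj₂ h = x , trans (part-at x h) (trans (symm (sameκ (D-kind d) h (CX _ c))) k) , refl , refl

      -- Vertices are seen through their flags, so each needs an edge. `start` gives the part a
      -- first one, and connectedness provides one at every other vertex.
      inside : ∀ i u → Cᵢ i u ≡ true → ∃[ v ] D u v ≡ true
      inside i u h with ∧-elim {C u} h | startD i
      ... | c , k | w , y , cw , kw , d = go (conn w u cw c (trans kw (symm (==-sound k))))
        where
        go : Star (λ a b → E a b ∧ ((C a ∧ C b) ∧ (κ a == κ b))) w u → ∃[ v ] D u v ≡ true
        go ε = y , d
        go (_▻_ {z} _ r) = let e , h′ = ∧-elim {E z u} r ; c′ , k′ = ∧-elim {C z ∧ C u} h′ ; cz , cu = ∧-elim {C z} c′ in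
          z , D-sym z u (D-intro e (CC-edge cz cu (==-sound k′)))

      vert : ∀ i u → V⁺ i u ≡ true → ∃[ x ] (part x ≡ i × lab x ≡ u)
      vert i u h with ∨-elim {X u} h
      ... | inj₁ x = let z , lz , pz = Amalgam.cover am i u x in z , pz , lz
      ... | inj₂ c = let v , d = inside i u c ; a , b = ∧-elim {C u} c ; z , pz , lz , _ = flag-C i a (==-sound b) d in z , pz , lz

      join : ∀ i {u v} → E u v ≡ true → Cᵢ i u ≡ true → V⁺ i v ≡ true → D u v ≡ true
      join i {u} {v} e cu hv with ∧-elim {C u} cu | ∨-elim {X v} hv
      ... | a , b | inj₁ x = D-intro e (CX-edge a x)
      ... | a , b | inj₂ c = let a′ , b′ = ∧-elim {C v} c in D-intro e (CC-edge a a′ (trans (==-sound b) (symm (==-sound b′))))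

      edge : ∀ i u v → V⁺ i u ≡ true → V⁺ i v ≡ true → E⁺ i u v ≡ true →
        (∃[ x ] (part x ≡ i × lab x ≡ u × lab (α x) ≡ v)) ⊎ (X u ≡ true × X v ≡ true × u ≢ v)
      edge i u v hu hv h with ∨-elim {E u v ∧ (Cᵢ i u ∨ Cᵢ i v)} h
      ... | inj₂ k = let a , b = ∧-elim {X u ∧ X v} k ; xu , xv = ∧-elim {X u} a in inj₂ (xu , xv , ==-refute (not-elim b))
      ... | inj₁ k with ∧-elim {E u v} k
      ...   | e , c with ∨-elim {Cᵢ i u} c
      ...     | inj₁ cu = let a , b = ∧-elim {C u} cu in inj₁ (flag-C i a (==-sound b) (join i e cu hv))
      ...     | inj₂ cv = let a , b = ∧-elim {C v} cv in inj₁ (flag-X i a (==-sound b) (D-sym v u (join i (E-sym u v e) cv hu)))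

    many-copies : ∀ u → X u ≡ true → 2 ≤ s → 8 * card X + 4 * eulerGenus S < 8 + 2 * s →
      card X ≤ 2 × ∃[ i ] EmbedsSub n (V⁺ i) (E⁺ i) sphere
    many-copies u h s≥2 big =
      let i , gd = Split.Verdict.good-exists dr am cut u h big in
      Split.Verdict.Good.small gd , i ,
      Split.Verdict.Planar.embedding dr am cut u h i gd (V⁺ i) (E⁺ i) (vert i) (edge i) (λ _ → another s≥2 i)

    two-parts : S ≡ sphere → card X ≡ 2 → 2 ≤ s → ∀ u → X u ≡ true → ∀ i → EmbedsSub n (V⁺ i) (E⁺ i) sphere
    two-parts refl k s≥2 u h i =
      Split.Verdict.Planar.embedding dr am cut u h i (Split.Verdict.good-planar dr am cut u h refl k s≥2 i)
        (V⁺ i) (E⁺ i) (vert i) (edge i) (λ _ → another s≥2 i)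

    disjoint-copies : (∀ u → X u ≡ false) → 4 * eulerGenus S < s → ∃[ i ] EmbedsSub n (V⁺ i) (E⁺ i) sphere
    disjoint-copies noX big =
      let i , gd = Split.Lonely.good-exists dr am noX occupied big in
      i , Split.Lonely.Planar.embedding dr am noX occupied big i gd (V⁺ i) (E⁺ i) (vert i) (λ u v hu hv h →
        [ id , (λ (xu , _) → absurd xu (noX u)) ]′ (edge i u v hu hv h))
      where
      occupied : ∀ i → ∃[ x ] part x ≡ i
      occupied i = let c , y , cc , kc , d = startD i ; x , px , _ = flag-C i cc kc d in x , px

card-∪ : ∀ {n} {f g k : Fin n → Bool} → (∀ x → f x ≡ true → g x ≡ true ⊎ k x ≡ true) → card f ≤ card g + card k
card-∪ {f = f} {g} {k} h = ℕP.≤-trans (ℕP.≤-reflexive (card-split f g))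
  (card-mono (λ x p → proj₂ (∧-elim {f x} p)) ⊕ card-mono λ x p → let a , b = ∧-elim {f x} p in
    [ (λ q → absurd q (not-elim b)) , id ]′ (h x a))

card-⊇ : ∀ {n} {f g : Fin n → Bool} → (∀ x → f x ≡ true → g x ≡ true) → card g ≤ card f → ∀ x → g x ≡ true → f x ≡ true
card-⊇ {f = f} {g} sub le x gx with bool-cases (f x)
... | inj₁ p = p
... | inj₂ p = ⊥-elim (ℕP.<⇒≱ (ℕP.≤-trans (s≤s (card-mono λ y fy → ∧-intro (sub y fy) (not-intro (==-false λ { refl → absurd fy p }))))
    (ℕP.≤-reflexive (symm (card-remove g x gx)))) le)

card-2 : ∀ {n} {f : Fin n → Bool} → card f ≡ 2 → ∃[ x ] ∃[ y ] (f x ≡ true × f y ≡ true × x ≢ y)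
card-2 {f = f} e with card-positive (ℕP.≤-trans (s≤s z≤n) (ℕP.≤-reflexive (symm e)))
... | x , fx with card-positive (ℕP.≤-reflexive (symm (ℕP.suc-injective (trans (symm (card-remove f x fx)) e))))
...   | y , h = let fy , ne = ∧-elim {f y} h in x , y , fx , fy , ==-refute (not-elim ne) ∘ symm

-- Read the walk from its last visit to x before it reaches y: restart at each return to x and stop
-- at the first y. As x and y are not adjacent, something lies in between.
inner-walk : ∀ {n} (R : Fin n → Fin n → Bool) {x y} → x ≢ y → R x y ≡ false → Star R x y →
  ∃[ w ] ∃[ w′ ] (R x w ≡ true × R w′ y ≡ true × (w ≢ x × w ≢ y) × (w′ ≢ x × w′ ≢ y) ×
    Star (λ a b → R a b ∧ ((not (a == x) ∧ not (a == y)) ∧ (not (b == x) ∧ not (b == y)))) w w′)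
inner-walk {n} R {x} {y} x≢y xy p = finish (go p)
  where
  R′ : Fin n → Fin n → Bool
  R′ a b = R a b ∧ ((not (a == x) ∧ not (a == y)) ∧ (not (b == x) ∧ not (b == y)))
  Inner : Fin n → Set
  Inner z = ∃[ w ] (R x w ≡ true × (w ≢ x × w ≢ y) × (z ≢ x × z ≢ y) × Star R′ w z)
  Done : Set
  Done = ∃[ w ] ∃[ w′ ] (R x w ≡ true × R w′ y ≡ true × (w ≢ x × w ≢ y) × (w′ ≢ x × w′ ≢ y) × Star R′ w w′)
  go : ∀ {z} → Star R x z → (z ≡ x ⊎ Inner z) ⊎ Done
  go ε = inj₁ (inj₁ refl)
  go (_▻_ {z} {z′} q r) with go q
  ... | inj₂ d = inj₂ d
  ... | inj₁ s with z′ ≟ x | z′ ≟ y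
  ...   | yes e | _ = inj₁ (inj₁ e)
  ...   | no n₁ | yes refl with s
  ...     | inj₁ refl = absurd r xy
  ...     | inj₂ (w , xw , a , b , st) = inj₂ (w , z , xw , r , a , b , st)
  go (_▻_ {z} {z′} q r) | inj₁ s | no n₁ | no n₂ with s
  ... | inj₁ refl = inj₁ (inj₂ (z′ , r , (n₁ , n₂) , (n₁ , n₂) , ε))
  ... | inj₂ (w , xw , a , (b , b′) , st) = inj₁ (inj₂ (w , xw , a , (n₁ , n₂) , st ▻
          ∧-intro r (∧-intro (∧-intro (not-intro (==-false b)) (not-intro (==-false b′))) (∧-intro (not-intro (==-false n₁)) (not-intro (==-false n₂))))))
  finish : (y ≡ x ⊎ Inner y) ⊎ Done → Done
  finish (inj₁ (inj₁ e)) = ⊥-elim (x≢y (symm e))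
  finish (inj₁ (inj₂ (_ , _ , _ , (_ , n₂) , _))) = ⊥-elim (n₂ refl)
  finish (inj₂ d) = d

within : ∀ {n} → (Fin n → Fin n → Bool) → (Fin n → Bool) → Fin n → Fin n → Bool
within E U a b = E a b ∧ (U a ∧ U b)

module TwoParts {n : ℕ} {V : Fin n → Bool} {E : Fin n → Fin n → Bool} (emb : EmbedsSub n V E sphere)
  (E-sym : ∀ u v → E u v ≡ true → E v u ≡ true) (E-irr : ∀ u v → E u v ≡ true → u ≢ v)
  (X P Q : Fin n → Bool) (X⊆V : ∀ u → X u ≡ true → V u ≡ true) (P⊆V : ∀ u → P u ≡ true → V u ≡ true)
  (Q⊆V : ∀ u → Q u ≡ true → V u ≡ true) (PX : ∀ u → P u ≡ true → X u ≡ false) (QX : ∀ u → Q u ≡ true → X u ≡ false)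
  (PQ : ∀ u → P u ≡ true → Q u ≡ false)
  (P-conn : ∀ u v → P u ≡ true → P v ≡ true → Star (within E P) u v)
  (Q-conn : ∀ u v → Q u ≡ true → Q v ≡ true → Star (within E Q) u v)
  (X-P : ∀ u → X u ≡ true → ∃[ c ] (P c ≡ true × E u c ≡ true))
  (X-Q : ∀ u → X u ≡ true → ∃[ c ] (Q c ≡ true × E u c ≡ true)) (X-two : card X ≡ 2) where

  private
    C : Fin n → Bool
    C u = P u ∨ Q u

    side : Bool → Fin 2
    side true  = zero
    side false = suc zero

    κ : Fin n → Fin 2
    κ u = side (P u)

    κP : ∀ {u} → P u ≡ true → κ u ≡ zero
    κP h rewrite h = refl
    κQ : ∀ {u} → Q u ≡ true → κ u ≡ suc zero
    κQ {u} h = cong side (≢true λ p → absurd h (PQ u p))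

    conn : ∀ u v → C u ≡ true → C v ≡ true → κ u ≡ κ v → Star (λ a b → E a b ∧ ((C a ∧ C b) ∧ (κ a == κ b))) u v
    conn u v cu cv k with ∨-elim {P u} cu | ∨-elim {P v} cv
    ... | inj₁ p | inj₁ q = Star-map (λ z → z) (λ a b h → let e , h′ = ∧-elim {E a b} h ; pa , pb = ∧-elim {P a} h′ in
            ∧-intro e (∧-intro (∧-intro (∨-introˡ pa) (∨-introˡ pb)) (==-complete (trans (κP {a} pa) (symm (κP {b} pb)))))) (P-conn u v p q)
    ... | inj₂ p | inj₂ q = Star-map (λ z → z) (λ a b h → let e , h′ = ∧-elim {E a b} h ; pa , pb = ∧-elim {Q a} h′ in
            ∧-intro e (∧-intro (∧-intro (∨-introʳ {P a} pa) (∨-introʳ {P b} pb)) (==-complete (trans (κQ {a} pa) (symm (κQ {b} pb)))))) (Q-conn u v p q)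
    ... | inj₁ p | inj₂ q with () ← trans (symm (κP {u} p)) (trans k (κQ {v} q))
    ... | inj₂ p | inj₁ q with () ← trans (symm (κP {v} q)) (trans (symm k) (κQ {u} p))

    x₀ : Fin n
    x₀ = proj₁ (card-2 {f = X} X-two)

    x₀∈ : X x₀ ≡ true
    x₀∈ = proj₁ (proj₂ (proj₂ (card-2 {f = X} X-two)))

    attach : ∀ i u (h : X u ≡ true) → ∃[ c ] (C c ≡ true × κ c ≡ i × E u c ≡ true)
    attach zero u h = let c , p , e = X-P u h in c , ∨-introˡ p , κP {c} p , e
    attach (suc zero) u h = let c , q , e = X-Q u h in c , ∨-introʳ {P c} q , κQ {c} q , e

    module G = Glue {s = 2} {S = sphere} emb E-sym E-irr X C κ X⊆V (λ u h → [ P⊆V u , Q⊆V u ]′ (∨-elim {P u} h))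
      (λ u h → [ PX u , QX u ]′ (∨-elim {P u} h)) conn

  -- Usually Q would be contracted to the edge that joins the two vertices of X. Here Q is the
  -- second part of an amalgam, and two parts in the plane make P planar with both vertices of X on
  -- a common face.
  joined : EmbedsSub n (λ u → X u ∨ P u) (λ u v → (E u v ∧ (P u ∨ P v)) ∨ ((X u ∧ X v) ∧ not (u == v))) sphere
  joined = EmbedsSub-mono {S = sphere}
    (λ u h → [ ∨-introˡ , (λ p → ∨-introʳ {X u} (in₀ u p)) ]′ (∨-elim {X u} h))
    (λ u v _ _ h → [ (λ k → let e , pq = ∧-elim {E u v} k in ∨-introˡ (∧-intro e
        ([ (λ p → ∨-introˡ (in₀ u p)) , (λ p → ∨-introʳ {G.Cᵢ zero u} (in₀ v p)) ]′ (∨-elim {P u} pq)))) ,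
      (λ k → ∨-introʳ {E u v ∧ (G.Cᵢ zero u ∨ G.Cᵢ zero v)} k) ]′ (∨-elim {E u v ∧ (P u ∨ P v)} h))
    (G.two-parts attach (λ i → let c , cc , kc , e = attach i x₀ x₀∈ in c , x₀ , cc , kc , E-sym _ _ e , inj₁ x₀∈)
      refl X-two (s≤s (s≤s z≤n)) x₀ x₀∈ zero)
    where
    in₀ : ∀ u → P u ≡ true → G.Cᵢ zero u ≡ true
    in₀ u p = ∧-intro (∨-introˡ p) (==-complete (κP {u} p))

-- Flaps: trimming, uncrossing and the flap-number

module Component {n : ℕ} (E : Fin n → Fin n → Bool) (E-sym : ∀ u v → E u v ≡ true → E v u ≡ true) (U : Fin n → Bool) (t : Fin n) where

  private
    W-sym : ∀ x y → within E U x y ≡ true → within E U y x ≡ true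
    W-sym x y h = let e , h′ = ∧-elim {E x y} h ; a , b = ∧-elim {U x} h′ in ∧-intro (E-sym x y e) (∧-intro b a)

  comp : Fin n → Bool
  comp x = U x ∧ (rep (within E U) x == rep (within E U) t)

  comp-⊆ : ∀ x → comp x ≡ true → U x ≡ true
  comp-⊆ x h = proj₁ (∧-elim {U x} h)

  comp-self : U t ≡ true → comp t ≡ true
  comp-self h = ∧-intro h (==-refl _)

  comp-closed : ∀ x y → comp x ≡ true → E x y ≡ true → U y ≡ true → comp y ≡ true
  comp-closed x y h e uy = let ux , r = ∧-elim {U x} h in
    ∧-intro uy (==-complete (trans (symm (rep-step (within E U) (∧-intro e (∧-intro ux uy)))) (==-sound r)))

  comp-conn : ∀ x y → comp x ≡ true → comp y ≡ true → Star (within E comp) x y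
  comp-conn x y hx hy = proj₁ (go (rep-sound (within E U) W-sym (trans (==-sound (proj₂ (∧-elim {U x} hx))) (symm (==-sound (proj₂ (∧-elim {U y} hy)))))))
    where
    go : ∀ {z} → Star (within E U) x z → Star (within E comp) x z × comp z ≡ true
    go ε = ε , hx
    go (_▻_ {a} {b} p r) = let st , ha = go p ; e , h′ = ∧-elim {E a b} r ; ua , ub = ∧-elim {U a} h′ ; hb = comp-closed a b ha e ub in
      st ▻ ∧-intro e (∧-intro ha hb) , hb

  comp-reach : ∀ {x} → Star (within E U) t x → U t ≡ true → comp x ≡ true
  comp-reach ε ut = comp-self ut
  comp-reach (_▻_ {a} {b} p r) ut = let e , h′ = ∧-elim {E a b} r ; ua , ub = ∧-elim {U a} h′ in comp-closed a b (comp-reach p ut) e ub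

module Flaps {h : ℕ} (H : Graph h) where
  private
    E : Fin h → Fin h → Bool
    E = adj H

  E-sym : ∀ u v → E u v ≡ true → E v u ≡ true
  E-sym u v e = trans (symm (Graph.sym H u v)) e

  E-irr : ∀ u v → E u v ≡ true → u ≢ v
  E-irr u v e refl = absurd e (irrefl H u)

  nb : (Fin h → Bool) → Fin h → Bool
  nb C x = not (C x) ∧ ex (λ u → C u ∧ E u x)

  VA : (Fin h → Bool) → Fin h → Bool
  VA C x = C x ∨ nb C x

  E⁺ : (Fin h → Bool) → Fin h → Fin h → Bool
  E⁺ C u v = (E u v ∧ (C u ∨ C v)) ∨ ((nb C u ∧ nb C v) ∧ not (u == v))

  nb-out : ∀ C x → nb C x ≡ true → C x ≡ false
  nb-out C x n = not-elim (proj₁ (∧-elim {not (C x)} n))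

  nb-elim : ∀ C x → nb C x ≡ true → ∃[ u ] (C u ≡ true × E u x ≡ true)
  nb-elim C x n = let u , k = ex-elim (proj₂ (∧-elim {not (C x)} n)) ; a , b = ∧-elim {C u} k in u , a , b

  VA-intro : ∀ C {u x} → C u ≡ true → E u x ≡ true → VA C x ≡ true
  VA-intro C {u} {x} c e with bool-cases (C x)
  ... | inj₁ p = ∨-introˡ p
  ... | inj₂ p = ∨-introʳ {C x} (∧-intro (not-intro p) (ex-intro u (∧-intro c e)))

  VA-false : ∀ C {x} → VA C x ≡ false → C x ≡ false × nb C x ≡ false
  VA-false C {x} v = ≢true (λ c → absurd (∨-introˡ c) v) , ≢true (λ c → absurd (∨-introʳ {C x} c) v)

  -- C is the connected interior V(A) minus V(B) of a prospective flap, and `VA C` with `E⁺ C` is A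
  -- with its boundary joined. Whether anything remains on the other side is left to `good-flap`.
  record Good (C : Fin h → Bool) : Set where
    field
      conn   : ∀ u v → C u ≡ true → C v ≡ true → Star (within E C) u v
      small  : card (nb C) ≤ 2
      planar : EmbedsSub h (VA C) (E⁺ C) sphere

  E⁺-sym : ∀ C u v → E⁺ C u v ≡ true → E⁺ C v u ≡ true
  E⁺-sym C u v e with ∨-elim {E u v ∧ (C u ∨ C v)} e
  ... | inj₁ k = let a , b = ∧-elim {E u v} k in ∨-introˡ (∧-intro (E-sym u v a)
                   ([ (λ c → ∨-introʳ {C v} c) , ∨-introˡ ]′ (∨-elim {C u} b)))
  ... | inj₂ k = let a , b = ∧-elim {nb C u ∧ nb C v} k ; c , d = ∧-elim {nb C u} a in
                   ∨-introʳ {E v u ∧ (C v ∨ C u)} (∧-intro (∧-intro d c) (trans (cong not (==-sym v u)) b))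

  E⁺-irr : ∀ C u v → E⁺ C u v ≡ true → u ≢ v
  E⁺-irr C u v e with ∨-elim {E u v ∧ (C u ∨ C v)} e
  ... | inj₁ k = E-irr u v (proj₁ (∧-elim {E u v} k))
  ... | inj₂ k = ==-refute (not-elim (proj₂ (∧-elim {nb C u ∧ nb C v} k)))

  planar-mono : ∀ {V F} C → EmbedsSub h V F sphere → (∀ u → VA C u ≡ true → V u ≡ true) →
    (∀ u v → E u v ≡ true → C u ≡ true ⊎ C v ≡ true → F u v ≡ true) →
    (∀ u v → nb C u ≡ true → nb C v ≡ true → u ≢ v → F u v ≡ true) → EmbedsSub h (VA C) (E⁺ C) sphere
  planar-mono C emb hv he hx = EmbedsSub-mono {S = sphere} hv (λ u v _ _ e → [
      (λ k → let a , b = ∧-elim {E u v} k in he u v a (∨-elim {C u} b)) ,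
      (λ k → let a , b = ∧-elim {nb C u ∧ nb C v} k ; c , d = ∧-elim {nb C u} a in hx u v c d (==-refute (not-elim b))) ]′
        (∨-elim {E u v ∧ (C u ∨ C v)} e)) emb

  planar-joined : ∀ C {F : Fin h → Fin h → Bool} → (∀ u v → E u v ≡ true → C u ≡ true ⊎ C v ≡ true → F u v ≡ true) →
    EmbedsSub h (λ u → nb C u ∨ C u) (λ u v → (F u v ∧ (C u ∨ C v)) ∨ ((nb C u ∧ nb C v) ∧ not (u == v))) sphere →
    EmbedsSub h (VA C) (E⁺ C) sphere
  planar-joined C {F} he emb = planar-mono C emb (λ u v → [ (λ c → ∨-introʳ {nb C u} c) , ∨-introˡ ]′ (∨-elim {C u} v))
    (λ u v e c → ∨-introˡ (∧-intro (he u v e c) ([ ∨-introˡ , (λ k → ∨-introʳ {C u} k) ]′ c)))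
    (λ u v a b ne → ∨-introʳ {F u v ∧ (C u ∨ C v)} (∧-intro (∧-intro a b) (not-intro (==-false ne))))

  comp : (Fin h → Bool) → Fin h → Fin h → Bool
  comp U t = Component.comp E E-sym U t

  nb-comp : ∀ U t z → nb (comp U t) z ≡ true → U z ≡ false
  nb-comp U t z n = let u , c , e = nb-elim (comp U t) z n in
    ≢true λ uz → absurd (Component.comp-closed E E-sym U t u z c e uz) (nb-out (comp U t) z n)

  -- A loses B and the neighbours of B, and the component of the rest that holds tA is kept; tA
  -- survives because it lies outside `VA B`.
  module Trim (A B : Fin h → Bool) (tA tB : Fin h) (B-conn : ∀ u v → B u ≡ true → B v ≡ true → Star (within E B) u v)
    (B∋ : B tB ≡ true) (tB∉ : VA A tB ≡ false) (A∋ : A tA ≡ true) (tA∉ : VA B tA ≡ false) where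

    U A* : Fin h → Bool
    U x = A x ∧ not (VA B x)
    A* = comp U tA

    A*-U : ∀ x → A* x ≡ true → A x ≡ true × VA B x ≡ false
    A*-U x a = let p , q = ∧-elim {A x} (Component.comp-⊆ E E-sym U tA x a) in p , not-elim q

    A*∋ : A* tA ≡ true
    A*∋ = Component.comp-self E E-sym U tA (∧-intro A∋ (not-intro tA∉))

    A*-conn : ∀ u v → A* u ≡ true → A* v ≡ true → Star (within E A*) u v
    A*-conn = Component.comp-conn E E-sym U tA

    A*-B : ∀ x → B x ≡ true → A* x ≡ false
    A*-B x b = ≢true λ a → absurd b (proj₁ (VA-false B (proj₂ (A*-U x a))))

    -- The neighbours of the trimmed set come from N(A) outside B or from N(B) inside A. Exchanging
    -- A and B gives the other two quarters of N(A) and N(B), whence posimodularity.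
    nb-cases : ∀ z → nb A* z ≡ true → (nb A z ≡ true × B z ≡ false) ⊎ (nb B z ≡ true × A z ≡ true)
    nb-cases z n with nb-elim A* z n
    ... | u , a , e with A*-U u a | ∨-elim {A z} (VA-intro A (proj₁ (A*-U u a)) e)
    ...   | au , bu | inj₂ m = inj₁ (m , ≢true λ bz → absurd (VA-intro B bz (E-sym u z e)) bu)
    ...   | au , bu | inj₁ az with bool-cases (VA B z)
    ...     | inj₂ no′ = absurd (∧-intro az (not-intro no′)) (nb-comp U tA z n)
    ...     | inj₁ v with ∨-elim {B z} v
    ...       | inj₂ m = inj₂ (m , az)
    ...       | inj₁ bz = absurd (VA-intro B bz (E-sym u z e)) bu

    VA* : ∀ z → VA A* z ≡ true → VA A z ≡ true
    VA* z v with ∨-elim {A* z} v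
    ... | inj₁ a = ∨-introˡ (proj₁ (A*-U z a))
    ... | inj₂ n = [ (λ (m , _) → ∨-introʳ {A z} m) , (λ (_ , a) → ∨-introˡ a) ]′ (nb-cases z n)

    nb-count : card (nb A*) ≤ card (λ x → nb A x ∧ not (B x)) + card (λ x → nb B x ∧ A x)
    nb-count = card-∪ λ z n → [ (λ (m , b) → inj₁ (∧-intro m (not-intro b))) , (λ (m , a) → inj₂ (∧-intro m a)) ]′ (nb-cases z n)

    module _ (gA : Good A) where
      open Good gA using (small; planar)

      private
        F : Fin h → Fin h → Bool
        F = E⁺ A

        R : Fin h → Fin h → Bool
        R a b = F a b ∧ (not (A* a) ∧ not (A* b))

        F-A : ∀ {u v} → E u v ≡ true → A u ≡ true ⊎ A v ≡ true → F u v ≡ true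
        F-A {u} {v} e c = ∨-introˡ (∧-intro e ([ ∨-introˡ , (λ k → ∨-introʳ {A u} k) ]′ c))

        F-A* : ∀ u v → E u v ≡ true → A* u ≡ true ⊎ A* v ≡ true → F u v ≡ true
        F-A* u v e c = F-A e ([ (λ a → inj₁ (proj₁ (A*-U u a))) , (λ a → inj₂ (proj₁ (A*-U v a))) ]′ c)

        nbA-A* : ∀ z → nb A z ≡ true → A* z ≡ false
        nbA-A* z n = ≢true λ a → absurd (proj₁ (A*-U z a)) (nb-out A z n)

        -- From a neighbour of A* one gets to a neighbour of A outside A*,
        -- through B if necessary.
        escape : ∀ z → nb A* z ≡ true → ∃[ ν ] (nb A ν ≡ true × Star R z ν)
        escape z n with nb-cases z n
        ... | inj₁ (m , _) = z , m , ε
        ... | inj₂ (m , az) with nb-elim B z m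
        ...   | b , bb , e = finish (through (B-conn b tB bb B∋))
          where
          first : (A b ≡ true × Star R z b) ⊎ (∃[ ν ] (nb A ν ≡ true × Star R z ν))
          first with ∨-elim {A b} (VA-intro A az (E-sym b z e))
          ... | inj₁ ab = inj₁ (ab , ε ▻ ∧-intro (F-A (E-sym b z e) (inj₁ az)) (∧-intro (not-intro (nb-out A* z n)) (not-intro (A*-B b bb))))
          ... | inj₂ nb′ = inj₂ (b , nb′ , ε ▻ ∧-intro (F-A (E-sym b z e) (inj₁ az)) (∧-intro (not-intro (nb-out A* z n)) (not-intro (A*-B b bb))))
          -- tB lies outside `VA A`, so the walk inside B has to leave A, and the first vertex it
          -- meets outside A belongs to N(A).
          through : ∀ {y} → Star (within E B) b y → (A y ≡ true × Star R z y) ⊎ (∃[ ν ] (nb A ν ≡ true × Star R z ν))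
          through ε = first
          through (_▻_ {c} {d} p r) with through p
          ... | inj₂ done = inj₂ done
          ... | inj₁ (ac , st) with ∧-elim {E c d} r
          ...   | ecd , bcd with ∧-elim {B c} bcd | ∨-elim {A d} (VA-intro A ac ecd)
          ...     | bc , bd | inj₁ ad = inj₁ (ad , st ▻ ∧-intro (F-A ecd (inj₁ ac)) (∧-intro (not-intro (A*-B c bc)) (not-intro (A*-B d bd))))
          ...     | bc , bd | inj₂ nd = inj₂ (d , nd , st ▻ ∧-intro (F-A ecd (inj₁ ac)) (∧-intro (not-intro (A*-B c bc)) (not-intro (A*-B d bd))))
          finish : (A tB ≡ true × Star R z tB) ⊎ (∃[ ν ] (nb A ν ≡ true × Star R z ν)) → ∃[ ν ] (nb A ν ≡ true × Star R z ν)
          finish (inj₁ (a , _)) = absurd a (proj₁ (VA-false A tB∉))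
          finish (inj₂ d) = d

        R-sym : ∀ x y → R x y ≡ true → R y x ≡ true
        R-sym x y r = let e , k = ∧-elim {F x y} r ; a , b = ∧-elim {not (A* x)} k in ∧-intro (E⁺-sym A x y e) (∧-intro b a)

        -- Both escapes end in N(A), whose vertices are pairwise joined in `E⁺ A`. The resulting
        -- walk avoids A* and stands in for the missing edge between x and y.
        link : ∀ x y → nb A* x ≡ true → nb A* y ≡ true → Star R x y
        link x y nx ny with escape x nx | escape y ny
        ... | ν , mν , p | ν′ , mν′ , p′ = Star-trans R p (Star-trans R (mid (ν ≟ ν′)) (Star-sym R R-sym p′))
          where
          mid : Dec (ν ≡ ν′) → Star R ν ν′
          mid (yes refl) = ε
          mid (no ne) = ε ▻ ∧-intro (∨-introʳ {E ν ν′ ∧ (A ν ∨ A ν′)} (∧-intro (∧-intro mν mν′) (not-intro (==-false ne))))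
            (∧-intro (not-intro (nbA-A* ν mν)) (not-intro (nbA-A* ν′ mν′)))

        F-VA : ∀ u v → F u v ≡ true → VA A u ≡ true
        F-VA u v e with ∨-elim {E u v ∧ (A u ∨ A v)} e
        ... | inj₂ k = ∨-introʳ {A u} (proj₁ (∧-elim {nb A u} (proj₁ (∧-elim {nb A u ∧ nb A v} k))))
        ... | inj₁ k with ∧-elim {E u v} k
        ...   | a , b with ∨-elim {A u} b
        ...     | inj₁ au = ∨-introˡ au
        ...     | inj₂ av = VA-intro A av (E-sym u v a)

        only : ∀ {x y} → card (nb A*) ≡ 2 → nb A* x ≡ true → nb A* y ≡ true → x ≢ y → ∀ z → nb A* z ≡ true → z ≡ x ⊎ z ≡ y
        only {x} {y} two nx ny ne z nz with z ≟ x | z ≟ y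
        ... | yes e | _ = inj₁ e
        ... | no _ | yes e = inj₂ e
        ... | no n₁ | no n₂ = ⊥-elim (ℕP.<⇒≱ {2} (ℕP.≤-trans (s≤s (card-≥2 x y ne (∧-intro nx (not-intro (==-false (n₁ ∘ symm))))
            (∧-intro ny (not-intro (==-false (n₂ ∘ symm)))))) (ℕP.≤-reflexive (symm (card-remove (nb A*) z nz)))) (ℕP.≤-reflexive two))

        module Pair {x y : Fin h} (two : card (nb A*) ≡ 2) (nx : nb A* x ≡ true) (ny : nb A* y ≡ true) (ne : x ≢ y) where
          adjacent : F x y ≡ true → EmbedsSub h (VA A*) (E⁺ A*) sphere
          adjacent fxy = planar-mono A* planar VA* F-A* edge
            where
            edge : ∀ u v → nb A* u ≡ true → nb A* v ≡ true → u ≢ v → F u v ≡ true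
            edge u v nu nv uv with only two nx ny ne u nu | only two nx ny ne v nv
            ... | inj₁ refl | inj₁ refl = ⊥-elim (uv refl)
            ... | inj₂ refl | inj₂ refl = ⊥-elim (uv refl)
            ... | inj₁ refl | inj₂ refl = fxy
            ... | inj₂ refl | inj₁ refl = E⁺-sym A x y fxy

          module Detour {w w′ : Fin h} (xw : R x w ≡ true) (w′y : R w′ y ≡ true) (wxy : w ≢ x × w ≢ y) (w′xy : w′ ≢ x × w′ ≢ y)
            (st : Star (λ a b → R a b ∧ ((not (a == x) ∧ not (a == y)) ∧ (not (b == x) ∧ not (b == y)))) w w′) where
            N : Fin h → Bool
            N z = not (A* z) ∧ (not (z == x) ∧ not (z == y))
            Wt : Fin h → Bool
            Wt z = VA A z ∧ N z
            -- The inner part of the detour, enlarged to a component, is the second connected part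
            -- that `TwoParts` asks for.
            Q : Fin h → Bool
            Q = Component.comp F (E⁺-sym A) Wt w
            ends : ∀ {a b} → R a b ≡ true → F a b ≡ true × A* a ≡ false × A* b ≡ false
            ends {a} {b} r = let e , k = ∧-elim {F a b} r ; p , q = ∧-elim {not (A* a)} k in e , not-elim p , not-elim q
            Wt-w : Wt w ≡ true
            Wt-w = let e , p , q = ends xw in ∧-intro (F-VA w x (E⁺-sym A x w e))
              (∧-intro (not-intro q) (∧-intro (not-intro (==-false (proj₁ wxy))) (not-intro (==-false (proj₂ wxy)))))
            st′ : Star (within F Wt) w w′
            st′ = Star-map (λ z → z) (λ a b r → let r′ , k = ∧-elim {R a b} r ; ka , kb = ∧-elim {not (a == x) ∧ not (a == y)} k ; e , p , q = ends r′ in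
              ∧-intro e (∧-intro (∧-intro (F-VA a b e) (∧-intro (not-intro p) ka))
                                 (∧-intro (F-VA b a (E⁺-sym A a b e)) (∧-intro (not-intro q) kb)))) st
            Qw : Q w ≡ true
            Qw = Component.comp-self F (E⁺-sym A) Wt w Wt-w
            Qw′ : Q w′ ≡ true
            Qw′ = Component.comp-reach F (E⁺-sym A) Wt w st′ Wt-w
            Q-Wt : ∀ u → Q u ≡ true → VA A u ≡ true × A* u ≡ false × u ≢ x × u ≢ y
            Q-Wt u q = let a , b = ∧-elim {VA A u} (Component.comp-⊆ F (E⁺-sym A) Wt w u q) ; c , d = ∧-elim {not (A* u)} b ; e , f = ∧-elim {not (u == x)} d in
              a , not-elim c , ==-refute (not-elim e) , ==-refute (not-elim f)
            joined = TwoParts.joined planar (E⁺-sym A) (E⁺-irr A) (nb A*) A* Q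
              (λ u n → VA* u (∨-introʳ {A* u} n)) (λ u a → ∨-introˡ (proj₁ (A*-U u a))) (λ u q → proj₁ (Q-Wt u q))
              (λ u a → ≢true λ n → absurd a (nb-out A* u n))
              (λ u q → let _ , _ , ux , uy = Q-Wt u q in ≢true λ n → [ ux , uy ]′ (only two nx ny ne u n))
              (λ u a → ≢true λ q → absurd a (proj₁ (proj₂ (Q-Wt u q))))
              (λ u v a b → Star-map (λ z → z) (λ c d r → let e , k = ∧-elim {E c d} r in
                 ∧-intro (F-A* c d e (inj₁ (proj₁ (∧-elim {A* c} k)))) k) (A*-conn u v a b))
              (Component.comp-conn F (E⁺-sym A) Wt w)
              (λ u n → let c , a , e = nb-elim A* u n in c , a , F-A* u c (E-sym c u e) (inj₂ a))
              (λ u n → [ (λ { refl → w , Qw , proj₁ (ends xw) }) , (λ { refl → w′ , Qw′ , E⁺-sym A w′ y (proj₁ (ends w′y)) }) ]′ (only two nx ny ne u n))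
              two

          detour : F x y ≡ false → EmbedsSub h (VA A*) (E⁺ A*) sphere
          detour fxy = let w , w′ , xw , w′y , wxy , w′xy , st =
                             inner-walk R ne (≢true λ r → absurd (proj₁ (∧-elim {F x y} r)) fxy) (link x y nx ny)
                       in planar-joined A* F-A* (Detour.joined xw w′y wxy w′xy st)

        two-case : card (nb A*) ≡ 2 → EmbedsSub h (VA A*) (E⁺ A*) sphere
        two-case two = let x , y , nx , ny , ne = card-2 two in
          [ Pair.adjacent two nx ny ne , Pair.detour two nx ny ne ]′ (bool-cases (F x y))

      trim-good : card (nb A*) ≤ 2 → Good A*
      trim-good le = record { conn = A*-conn ; small = le ; planar = pl }
        where
        pl : EmbedsSub h (VA A*) (E⁺ A*) sphere
        pl with ℕP.m≤n⇒m<n∨m≡n le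
        ... | inj₂ two = two-case two
        ... | inj₁ lt  = planar-mono A* planar VA* F-A*
              (λ u v nu nv ne → ⊥-elim (ℕP.<⇒≱ lt (card-≥2 u v ne nu nv)))

sumF-strict : ∀ {n} {a b : Fin n → ℕ} → (∀ i → a i ≤ b i) → ∀ j → a j < b j → sumF a < sumF b
sumF-strict h zero    lt = ℕP.+-mono-≤ lt (sumF-mono (h ∘ suc))
sumF-strict {a = a} {b} h (suc j) lt = ℕP.≤-trans (ℕP.≤-reflexive (symm (ℕP.+-suc (a zero) _)))
  (ℕP.+-mono-≤ (h zero) (sumF-strict (h ∘ suc) j lt))

module FlapFamilies {h : ℕ} (H : Graph h) where
  open Flaps H
    using (E-irr; E-sym; E⁺; Good; VA; VA-false; VA-intro; comp; nb; nb-comp; nb-elim; nb-out; planar-joined; planar-mono; module Trim)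

  private
    E : Fin h → Fin h → Bool
    E = adj H

  EA EB : (Fin h → Bool) → Fin h → Fin h → Bool
  EA C u v = E u v ∧ (C u ∨ C v)
  EB C u v = E u v ∧ (not (C u) ∧ not (C v))

  -- The second side is all of H - C, so V(A) minus V(B) is C itself, and every edge within N(C)
  -- goes to B.
  sep : (Fin h → Bool) → Sep h
  sep C = (VA C , EA C) , ((λ x → not (C x)) , EB C)

  sepX-nb : ∀ C x → VA C x ∧ not (C x) ≡ nb C x
  sepX-nb C x with bool-cases (C x)
  ... | inj₁ p rewrite p = refl
  ... | inj₂ p rewrite p = BP.∧-identityʳ _

  good-flap : ∀ C → Good C → ∃[ v ] C v ≡ true → ∃[ w ] VA C w ≡ false → IsFlap H (sep C)
  good-flap C g (v , cv) (w , cw) = (_ , small′ , (EA-sym , EA-sub) , (EB-sym , EB-sub) , disj , cover , edges ,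
      (v , ∨-introˡ cv , cong not cv) , (w , not-intro (proj₁ (VA-false C cw)) , cw) , refl) ,
      EmbedsSub-mono {S = sphere} (λ _ p → p) plus planar
    where
    open Good g
    small′ : card (λ x → VA C x ∧ not (C x)) ≤ 2
    small′ = subst (_≤ 2) (card-cong (λ x → symm (sepX-nb C x))) small
    E-≡ : ∀ u v → E u v ≡ E v u
    E-≡ = Graph.sym H
    EA-sym : ∀ u v → EA C u v ≡ EA C v u
    EA-sym u v = cong₂ _∧_ (E-≡ u v) (BP.∨-comm (C u) (C v))
    EB-sym : ∀ u v → EB C u v ≡ EB C v u
    EB-sym u v = cong₂ _∧_ (E-≡ u v) (BP.∧-comm (not (C u)) (not (C v)))
    EA-sub : ∀ u v → EA C u v ≡ true → E u v ≡ true × VA C u ≡ true × VA C v ≡ true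
    EA-sub u v e with ∧-elim {E u v} e
    ... | a , b with ∨-elim {C u} b
    ...   | inj₁ c = a , ∨-introˡ c , VA-intro C c a
    ...   | inj₂ c = a , VA-intro C c (E-sym u v a) , ∨-introˡ c
    EB-sub : ∀ u v → EB C u v ≡ true → E u v ≡ true × not (C u) ≡ true × not (C v) ≡ true
    EB-sub u v e = let a , b = ∧-elim {E u v} e ; c , d = ∧-elim {not (C u)} b in a , c , d
    disj : ∀ u v → EA C u v ≡ true → EB C u v ≡ false
    disj u v e = ≢true λ k → let _ , c , d = EB-sub u v k in
      [ (λ p → absurd p (not-elim c)) , (λ p → absurd p (not-elim d)) ]′ (∨-elim {C u} (proj₂ (∧-elim {E u v} e)))
    cover : ∀ x → VA C x ∨ not (C x) ≡ true
    cover x with bool-cases (C x)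
    ... | inj₁ p = ∨-introˡ (∨-introˡ p)
    ... | inj₂ p = ∨-introʳ {VA C x} (not-intro p)
    edges : ∀ u v → E u v ≡ true → EA C u v ∨ EB C u v ≡ true
    edges u v e with bool-cases (C u ∨ C v)
    ... | inj₁ p = ∨-introˡ (∧-intro e p)
    ... | inj₂ p = ∨-introʳ {EA C u v} (∧-intro e (∧-intro (not-intro (≢true λ c → absurd (∨-introˡ c) p))
                     (not-intro (≢true λ c → absurd (∨-introʳ {C u} c) p))))
    plus : ∀ u v → VA C u ≡ true → VA C v ≡ true → plusE (sep C) u v ≡ true → E⁺ C u v ≡ true
    plus u v _ _ e with ∨-elim {EA C u v} e
    ... | inj₁ a = ∨-introˡ a
    ... | inj₂ k = let a , b = ∧-elim {VA C u ∧ not (C u)} k ; c , d = ∧-elim {VA C v ∧ not (C v)} b in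
      ∨-introʳ {EA C u v} (∧-intro (∧-intro (trans (symm (sepX-nb C u)) a) (trans (symm (sepX-nb C v)) c)) d)

  apart-independent : ∀ C C′ → (∀ x → C x ≡ true → VA C′ x ≡ false) → Independent (sep C) (sep C′)
  apart-independent C C′ ap = (λ u v e → ≢true λ e′ → clash u v (proj₁ (∧-elim {EA C u v} e)) (proj₁ (∧-elim {EA C′ u v} e′))) ,
      λ x _ b _ d → absurd (not-neg d) (proj₁ (VA-false C′ (ap x (not-neg b))))
    where
    not-neg : ∀ {b} → not b ≡ false → b ≡ true
    not-neg {true} _ = refl
    clash : ∀ u v → EA C u v ≡ true → EA C′ u v ≡ true → ⊥
    clash u v e e′ with ∧-elim {E u v} e | ∧-elim {E u v} e′
    ... | a , b | _ , b′ with ∨-elim {C u} b | ∨-elim {C′ u} b′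
    ...   | inj₁ c | inj₁ c′ = absurd (∨-introˡ c′) (ap u c)
    ...   | inj₁ c | inj₂ c′ = absurd (VA-intro C′ c′ (E-sym u v a)) (ap u c)
    ...   | inj₂ c | inj₁ c′ = absurd (VA-intro C′ c′ a) (ap v c)
    ...   | inj₂ c | inj₂ c′ = absurd (∨-introˡ c′) (ap v c)

  -- The representative t i avoids not only the other sets but also their neighbourhoods. It thus
  -- survives trimming, and it later witnesses that the other sides are not empty.
  record Family (k : ℕ) (t : Fin k → Fin h) (C : Fin k → Fin h → Bool) : Set where
    field
      good  : ∀ i → Good (C i)
      has   : ∀ i → C i (t i) ≡ true
      apart : ∀ i j → i ≢ j → VA (C j) (t i) ≡ false

  private
    upd : ∀ {k} → (Fin k → Fin h → Bool) → Fin k → (Fin h → Bool) → Fin k → Fin h → Bool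
    upd C i A l = if l == i then A else C l

    upd-at : ∀ {k} (C : Fin k → Fin h → Bool) i A → upd C i A i ≡ A
    upd-at C i A rewrite ==-refl i = refl

    upd-off : ∀ {k} (C : Fin k → Fin h → Bool) i A {l} → l ≢ i → upd C i A l ≡ C l
    upd-off C i A ne rewrite ==-false ne = refl

    replace : ∀ {k t C} → Family k t C → ∀ i A → Good A → A (t i) ≡ true → (∀ x → VA A x ≡ true → VA (C i) x ≡ true) → Family k t (upd C i A)
    replace {k} {t} {C} fam i A gA hA sub = record { good = λ l → go l (l ≟ i) ; has = λ l → hs l (l ≟ i) ; apart = λ l j ne → ap l j ne (j ≟ i) }
      where
      open Family fam
      go : ∀ l → Dec (l ≡ i) → Good (upd C i A l)
      go l (yes refl) = subst Good (symm (upd-at C i A)) gA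
      go l (no ne)    = subst Good (symm (upd-off C i A ne)) (good l)
      hs : ∀ l → Dec (l ≡ i) → upd C i A l (t l) ≡ true
      hs l (yes refl) = trans (cong (λ f → f (t i)) (upd-at C i A)) hA
      hs l (no ne)    = trans (cong (λ f → f (t l)) (upd-off C i A ne)) (has l)
      ap : ∀ l j → l ≢ j → Dec (j ≡ i) → VA (upd C i A j) (t l) ≡ false
      ap l j ne (yes refl) = trans (cong (λ f → VA f (t l)) (upd-at C i A)) (≢true λ v → absurd (sub (t l) v) (apart l i ne))
      ap l j ne (no n)     = trans (cong (λ f → VA f (t l)) (upd-off C i A n)) (apart l j ne)

    smaller : ∀ {k} (C : Fin k → Fin h → Bool) i A x → (∀ y → A y ≡ true → C i y ≡ true) → C i x ≡ true → A x ≡ false →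
      sumF (λ l → card (upd C i A l)) < sumF (λ l → card (C l))
    smaller C i A x sub cx ax = sumF-strict (λ l → le l (l ≟ i)) i
        (ℕP.≤-trans (s≤s (ℕP.≤-reflexive (cong card (upd-at C i A)))) less)
      where
      le : ∀ l → Dec (l ≡ i) → card (upd C i A l) ≤ card (C l)
      le l (yes refl) = ℕP.≤-trans (ℕP.≤-reflexive (cong card (upd-at C i A))) (card-mono sub)
      le l (no ne)    = ℕP.≤-reflexive (cong card (upd-off C i A ne))
      less : card A < card (C i)
      less = ℕP.≤-trans (s≤s (card-mono λ y ay → ∧-intro (sub y ay) (not-intro (==-false λ { refl → absurd ay ax }))))
        (ℕP.≤-reflexive (symm (card-remove (C i) x cx)))

    touch-sym : ∀ A B x → A x ≡ true → VA B x ≡ true → ∃[ y ] (B y ≡ true × VA A y ≡ true)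
    touch-sym A B x a v with ∨-elim {B x} v
    ... | inj₁ b = x , b , ∨-introˡ a
    ... | inj₂ n = let u , b , e = nb-elim B x n in u , b , VA-intro A a (E-sym u x e)

  -- Crossing members are separated by trimming one of them: by posimodularity
  -- of the neighbourhood size, one of the two trimmed sets has at most two
  -- neighbours.
  uncross : ∀ fuel {k t} C → sumF (λ l → card (C l)) < fuel → Family k t C →
    ∃[ C′ ] (Family k t C′ × (∀ i j → i ≢ j → ∀ x → C′ i x ≡ true → VA (C′ j) x ≡ false))
  uncross (suc fuel) {k} {t} C (s≤s b) fam
    with bool-cases (ex (λ i → ex (λ j → not (i == j) ∧ ex (λ x → C i x ∧ VA (C j) x))))
  ... | inj₂ none = C , fam , λ i j ne x c → ≢true λ v →
          absurd (∧-intro (not-intro (==-false ne)) (ex-intro x (∧-intro c v))) (ex-none (ex-none none i) j)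
  ... | inj₁ some = step (proj₁ (ex-elim some)) (proj₁ (ex-elim (proj₂ (ex-elim some))))
          (∧-elim {not (proj₁ (ex-elim some) == proj₁ (ex-elim (proj₂ (ex-elim some))))} (proj₂ (ex-elim (proj₂ (ex-elim some)))))
    where
    open Family fam
    Result : Set
    Result = ∃[ C′ ] (Family k t C′ × (∀ i j → i ≢ j → ∀ x → C′ i x ≡ true → VA (C′ j) x ≡ false))
    step : ∀ i j → not (i == j) ≡ true × ex (λ x → C i x ∧ VA (C j) x) ≡ true → Result
    step i j (ne′ , cross) = go (card (nb TA.A*) ≤? 2)
      where
      ne : i ≢ j
      ne = ==-refute (not-elim ne′)
      x : Fin h
      x = proj₁ (ex-elim cross)
      cx : C i x ≡ true × VA (C j) x ≡ true
      cx = ∧-elim {C i x} (proj₂ (ex-elim cross))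
      module TA = Trim (C i) (C j) (t i) (t j) (Good.conn (good j)) (has j) (apart j i (ne ∘ symm)) (has i) (apart i j ne)
        using (A*; A*-U; A*∋; VA*; nb-count; trim-good)
      module TB = Trim (C j) (C i) (t j) (t i) (Good.conn (good i)) (has i) (apart i j ne) (has j) (apart j i (ne ∘ symm))
        using (A*; A*-U; A*∋; VA*; nb-count; trim-good)
      go : Dec (card (nb TA.A*) ≤ 2) → Result
      go (yes le) = uncross fuel (upd C i TA.A*)
        (ℕP.<-≤-trans (smaller C i TA.A* x (λ y a → proj₁ (TA.A*-U y a)) (proj₁ cx)
          (≢true λ a → absurd (proj₂ cx) (proj₂ (TA.A*-U x a)))) b)
        (replace fam i TA.A* (TA.trim-good (good i) le) TA.A*∋ TA.VA*)
      go (no gt) = uncross fuel (upd C j TB.A*)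
        (ℕP.<-≤-trans (smaller C j TB.A* (proj₁ y) (λ z a → proj₁ (TB.A*-U z a)) (proj₁ (proj₂ y))
          (≢true λ a → absurd (proj₂ (proj₂ y)) (proj₂ (TB.A*-U (proj₁ y) a)))) b)
        (replace fam j TB.A* (TB.trim-good (good j) le′) TB.A*∋ TB.VA*)
        where
        y : ∃[ y ] (C j y ≡ true × VA (C i) y ≡ true)
        y = touch-sym (C i) (C j) x (proj₁ cx) (proj₂ cx)
        le′ : card (nb TB.A*) ≤ 2
        -- The two trimmed sets have at most |N(A)| + |N(B)| ≤ 4 neighbours together; if one has at
        -- least 3, the other has at most 1.
        le′ = ℕP.≤-trans (posimodular (card (λ z → nb (C i) z ∧ not (C j z))) (card (λ z → nb (C j) z ∧ C i z))
          (card (λ z → nb (C j) z ∧ not (C i z))) (card (λ z → nb (C i) z ∧ C j z)) (ℕP.≰⇒> gt) TA.nb-count TB.nb-count (card-split (nb (C i)) (C j)) (card-split (nb (C j)) (C i))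
          (Good.small (good i)) (Good.small (good j))) (s≤s z≤n)
          where
          posimodular : ∀ p q r s {a b m n} → 3 ≤ a → a ≤ p + q → b ≤ r + s → m ≡ s + p → n ≡ q + r → m ≤ 2 → n ≤ 2 → b ≤ 1
          posimodular p q r s {a} {b} a≥ ap br refl refl m≤ n≤ = lin-≤ _ _ (arith a b p q r s) (a≥ ⊕ ap ⊕ br ⊕ m≤ ⊕ n≤)
            where
            arith : ∀ a b p q r s → b + (a + ((p + q) + ((r + s) + (2 + 2)))) ≡ 1 + (3 + (a + (b + ((s + p) + (q + r)))))
            arith = solve-∀

  -- A flap needs a vertex beyond its boundary. For k ≥ 2 any other representative is one.
  independent-flaps : ∀ {k t C} → Family k t C → 2 ≤ k → ∃[ fs ] IndepFlapFamily H k fs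
  independent-flaps {k} {t} {C} fam k≥2 = (λ i → sep (C′ i)) ,
      (λ i → good-flap (C′ i) (good i) (t i , has i) (let j , ne = another k≥2 i in t j , apart j i ne)) ,
      λ i j ne → apart-independent (C′ i) (C′ j) (ap i j ne)
    where
    un = uncross _ C ℕP.≤-refl fam
    C′ = proj₁ un
    open Family (proj₁ (proj₂ un))
    ap = proj₂ (proj₂ un)

  -- Let C₁ and C₂ be components of H - X on the two sides. One with at most one neighbour is a flap
  -- as it stands. Otherwise both are attached to two common vertices, and C₂ replaces the edge
  -- needed to close C₁.
  planar-flap : Planar H → ∀ A B → IsSmallSeparation H A B → ∃[ s ] IsFlap H s
  planar-flap pl (VA₁ , EA₁) (VB₁ , EB₁) (k , k≤2 , subA , subB , _ , cover , edges , (a , aA , aB) , (b , bB , bA) , size)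
    = go (card (nb C₁) ≤? 1) (card (nb C₂) ≤? 1)
    where
    X U : Fin h → Bool
    X v = VA₁ v ∧ VB₁ v
    U v = not (X v)
    C₁ C₂ : Fin h → Bool
    C₁ = comp U a
    C₂ = comp U b
    Ua : U a ≡ true
    Ua = not-intro (≢true λ x → absurd (proj₂ (∧-elim {VA₁ a} x)) aB)
    Ub : U b ≡ true
    Ub = not-intro (≢true λ x → absurd (proj₁ (∧-elim {VA₁ b} x)) bA)
    side : ∀ u v → VB₁ u ≡ false → E u v ≡ true → VA₁ v ≡ true
    side u v ub e with ∨-elim {EA₁ u v} (edges u v e)
    ... | inj₁ p = proj₂ (proj₂ (proj₂ subA u v p))
    ... | inj₂ p = absurd (proj₁ (proj₂ (proj₂ subB u v p))) ub
    inA : ∀ {z} → Star (within E C₁) a z → VB₁ z ≡ false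
    inA ε = aB
    inA (_▻_ {c} {d} p r) = let e , k = ∧-elim {E c d} r ; _ , cd = ∧-elim {C₁ c} k in
      ≢true λ db → absurd (∧-intro (side c d (inA p) e) db) (not-elim (Component.comp-⊆ E E-sym U a d cd))
    C₁-B : ∀ z → C₁ z ≡ true → VB₁ z ≡ false
    C₁-B z c = inA (Component.comp-conn E E-sym U a a z (Component.comp-self E E-sym U a Ua) c)
    nb₁-X : ∀ t z → nb (comp U t) z ≡ true → X z ≡ true
    nb₁-X t z n with bool-cases (X z)
    ... | inj₁ p = p
    ... | inj₂ p = absurd (not-intro p) (nb-comp U t z n)
    outside₁ : VA C₁ b ≡ false
    outside₁ = ≢true λ v → [ (λ c → absurd bB (C₁-B b c)) , (λ n → absurd (nb₁-X a b n) (not-elim Ub)) ]′ (∨-elim {C₁ b} v)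
    disj : ∀ z → C₁ z ≡ true → C₂ z ≡ false
    disj z c = ≢true λ d → absurd bB (inA (Component.comp-conn E E-sym U a a b (Component.comp-self E E-sym U a Ua) (join z c d)))
      where
      join : ∀ z → C₁ z ≡ true → C₂ z ≡ true → C₁ b ≡ true
      join z c d = ∧-intro Ub (==-complete (trans (symm (==-sound (proj₂ (∧-elim {U z} d)))) (==-sound (proj₂ (∧-elim {U z} c)))))
    outside₂ : VA C₂ a ≡ false
    outside₂ = ≢true λ v → [ (λ c → absurd c (disj a (Component.comp-self E E-sym U a Ua))) ,
      (λ n → absurd (nb₁-X b a n) (not-elim Ua)) ]′ (∨-elim {C₂ a} v)
    lone : ∀ t → card (nb (comp U t)) ≤ 1 → Good (comp U t)
    lone t le = record { conn = Component.comp-conn E E-sym U t ; small = ℕP.≤-trans le (s≤s z≤n)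
      ; planar = planar-mono (comp U t) pl (λ _ _ → refl) (λ u v e _ → e) (λ u v p q ne → ⊥-elim (ℕP.<⇒≱ (card-≥2 u v ne p q) le)) }
    X≤2 : card X ≤ 2
    X≤2 = ℕP.≤-trans (ℕP.≤-reflexive size) k≤2
    full : ∀ t → ¬ card (nb (comp U t)) ≤ 1 → ∀ x → X x ≡ true → nb (comp U t) x ≡ true
    full t gt = card-⊇ (nb₁-X t) (ℕP.≤-trans X≤2 (ℕP.≰⇒> gt))
    go : Dec (card (nb C₁) ≤ 1) → Dec (card (nb C₂) ≤ 1) → ∃[ s ] IsFlap H s
    go (yes p) _ = sep C₁ , good-flap C₁ (lone a p) (a , Component.comp-self E E-sym U a Ua) (b , outside₁)
    go (no _) (yes p) = sep C₂ , good-flap C₂ (lone b p) (b , Component.comp-self E E-sym U b Ub) (a , outside₂)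
    go (no p) (no q) = sep C₁ , good-flap C₁ (record { conn = Component.comp-conn E E-sym U a ; small = ℕP.≤-reflexive two ; planar = pl₁ })
        (a , Component.comp-self E E-sym U a Ua) (b , outside₁)
      where
      two : card (nb C₁) ≡ 2
      two = ℕP.≤-antisym (ℕP.≤-trans (card-mono (nb₁-X a)) X≤2) (ℕP.≰⇒> p)
      pl₁ : EmbedsSub h (VA C₁) (E⁺ C₁) sphere
      pl₁ = planar-joined C₁ {E} (λ u v e _ → e) (TwoParts.joined pl E-sym E-irr (nb C₁) C₁ C₂
        (λ _ _ → refl) (λ _ _ → refl) (λ _ _ → refl)
        (λ u c → ≢true λ n → absurd c (nb-out C₁ u n))
        (λ u c → ≢true λ n → absurd (nb₁-X a u n) (not-elim (Component.comp-⊆ E E-sym U b u c)))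
        disj (Component.comp-conn E E-sym U a) (Component.comp-conn E E-sym U b)
        (λ u n → let c , cc , e = nb-elim C₁ u n in c , cc , E-sym c u e)
        (λ u n → let c , cc , e = nb-elim C₂ u (full b q u (nb₁-X a u n)) in c , cc , E-sym c u e) two)

  -- For k ≥ 2 the uncrossed family is one of independent flaps. The case k = 1, f = 0 is delicate:
  -- there are no flaps, so the single good set leaves nothing outside and H is planar; by
  -- `planar-flap` it has no small separation, and f would have been set to 1.
  family-bound : ∀ {f} → FlapNumber H f → ∀ {k t C} → Family k t C → ¬ f < k
  family-bound (inj₁ (_ , no-sep , refl)) fam lt with independent-flaps fam lt
  ... | fs , flap , _ = no-sep _ _ (proj₁ (flap (fromℕ< lt)))
  family-bound {f} (inj₂ (not-3c , _ , maximal)) {k} {t} {C} fam lt with 2 ≤? k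
  ... | yes k≥2 = let fs , ind = independent-flaps fam k≥2 in ℕP.<⇒≱ lt (maximal k fs ind)
  ... | no k<2 = not-3c (planar , λ A B s → no-flap (proj₁ (planar-flap planar A B s)) (proj₂ (planar-flap planar A B s)))
    where
    f≡0 : f ≡ 0
    f≡0 = ℕP.n≤0⇒n≡0 (ℕP.≤-pred (ℕP.≤-trans lt (ℕP.≤-pred (ℕP.≰⇒> k<2))))
    no-flap : ∀ s → IsFlap H s → ⊥
    no-flap s fl = ℕP.1+n≰n {0} (subst (1 ≤_) f≡0 (maximal 1 (λ _ → s) ((λ _ → fl) , λ { zero zero ne → ⊥-elim (ne refl) })))
    i₀ : Fin k
    i₀ = fromℕ< lt
    open Family fam
    open Good (good i₀) using () renaming (planar to pl)
    total : ∀ w → VA (C i₀) w ≡ true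
    total w with bool-cases (VA (C i₀) w)
    ... | inj₁ p = p
    ... | inj₂ p = ⊥-elim (no-flap _ (good-flap (C i₀) (good i₀) (t i₀ , has i₀) (w , p)))
    edge : ∀ u v → E u v ≡ true → E⁺ (C i₀) u v ≡ true
    edge u v e with ∨-elim {C i₀ u} (total u) | ∨-elim {C i₀ v} (total v)
    ... | inj₁ c | _ = ∨-introˡ (∧-intro e (∨-introˡ c))
    ... | inj₂ _ | inj₁ c = ∨-introˡ (∧-intro e (∨-introʳ {C i₀ u} c))
    ... | inj₂ m | inj₂ n = ∨-introʳ {E u v ∧ (C i₀ u ∨ C i₀ v)} (∧-intro (∧-intro m n) (not-intro (==-false (E-irr u v e))))
    planar : Planar H
    planar = EmbedsSub-mono {S = sphere} (λ u _ → total u) (λ u v _ _ e → edge u v e) pl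

card-≤ : ∀ {n} (f : Fin n → Bool) → card f ≤ n
card-≤ {n} f = ℕP.≤-trans (card-mono {f = f} {g = λ _ → true} (λ _ _ → refl)) (ℕP.≤-reflexive (card-full n))

-- Degeneracy orders, pigeonholes and sunflowers

module Degenerate {n : ℕ} (G : Graph n) {S : Surface} (emb : EmbedsIn G S) where
  private
    g = eulerGenus S

  low-degree : ∀ (R : Fin n → Bool) u → R u ≡ true → ∃[ v ] (R v ≡ true × card (λ w → adj G v w ∧ R w) ≤ 6 + 6 * g)
  low-degree R u ru with bool-cases (ex (λ v → R v ∧ ⌊ card (λ w → adj G v w ∧ R w) ≤? 6 + 6 * g ⌋))
  ... | inj₁ p = let v , q = ex-elim p ; a , b = ∧-elim {R v} q in v , a , ⌊⌋-sound (card (λ w → adj G v w ∧ R w) ≤? 6 + 6 * g) b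
  ... | inj₂ none = ⊥-elim (Sparse.too-dense dr (λ a b d → irr a b (proj₁ (∧-elim {adj G a b} d))) R
          (λ a b d → proj₁ (∧-elim {R a} (proj₂ (∧-elim {adj G a b} d)))) u ru deg)
    where
    irr : ∀ a b → adj G a b ≡ true → a ≢ b
    irr a b e refl = absurd e (irrefl G a)
    D : Fin n → Fin n → Bool
    D = within (adj G) R
    dr : Drawing n g D
    dr = drawing {S = S} emb D
      (λ a b d → let e , k = ∧-elim {adj G a b} d ; x , y = ∧-elim {R a} k in ∧-intro (trans (symm (Graph.sym G a b)) e) (∧-intro y x))
      (λ a b d → irr a b (proj₁ (∧-elim {adj G a b} d))) (λ a b d → refl , refl , proj₁ (∧-elim {adj G a b} d))
    deg : ∀ a → R a ≡ true → 7 + 6 * g ≤ card (D a)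
    deg a ra = ℕP.≤-trans (ℕP.≰⇒> λ le → absurd (∧-intro ra (⌊⌋-complete (card (λ w → adj G a w ∧ R w) ≤? 6 + 6 * g) le)) (ex-none none a))
      (card-mono λ w h → let e , r = ∧-elim {adj G a w} h in ∧-intro e (∧-intro ra r))

  record Ranking (R : Fin n → Bool) : Set where
    field
      rk    : Fin n → ℕ
      inj   : ∀ u v → R u ≡ true → R v ≡ true → rk u ≡ rk v → u ≡ v
      later : ∀ u → R u ≡ true → card (λ w → (adj G u w ∧ R w) ∧ ⌊ rk u <? rk w ⌋) ≤ 6 + 6 * g

  -- A vertex of low degree in R gets rank 0, before all the others, so its later neighbours are
  -- among its few neighbours in R.
  ranking : ∀ j R → card R ≡ j → Ranking R
  ranking zero R e = record { rk = λ _ → 0 ; inj = λ u v ru → ⊥-elim (none u ru) ; later = λ u ru → ⊥-elim (none u ru) }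
    where
    none : ∀ u → R u ≡ true → ⊥
    none u ru = ℕP.<⇒≱ (card-≥1 u ru) (ℕP.≤-reflexive e)
  ranking (suc j) R e = record { rk = rk ; inj = inj ; later = later }
    where
    u₀ = card-positive {f = R} (ℕP.≤-trans (s≤s z≤n) (ℕP.≤-reflexive (symm e)))
    low = low-degree R (proj₁ u₀) (proj₂ u₀)
    v = proj₁ low
    rv : R v ≡ true
    rv = proj₁ (proj₂ low)
    R′ : Fin n → Bool
    R′ w = R w ∧ not (w == v)
    module I = Ranking (ranking j R′ (ℕP.suc-injective (trans (symm (card-remove R v rv)) e)))
    rk : Fin n → ℕ
    rk w = if w == v then 0 else suc (I.rk w)
    rk-v : rk v ≡ 0
    rk-v rewrite ==-refl v = refl
    rk-off : ∀ {w} → w ≢ v → rk w ≡ suc (I.rk w)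
    rk-off ne rewrite ==-false ne = refl
    in′ : ∀ {w} → R w ≡ true → w ≢ v → R′ w ≡ true
    in′ r ne = ∧-intro r (not-intro (==-false ne))
    inj : ∀ a b → R a ≡ true → R b ≡ true → rk a ≡ rk b → a ≡ b
    inj a b ra rb q = go (a ≟ v) (b ≟ v)
      where
      go : Dec (a ≡ v) → Dec (b ≡ v) → a ≡ b
      go (yes p) (yes p′) = trans p (symm p′)
      go (yes p) (no n₂) with () ← trans (symm rk-v) (trans (cong rk (symm p)) (trans q (rk-off n₂)))
      go (no n₁) (yes p) with () ← trans (symm rk-v) (trans (cong rk (symm p)) (trans (symm q) (rk-off n₁)))
      go (no n₁) (no n₂) = I.inj a b (in′ ra n₁) (in′ rb n₂) (ℕP.suc-injective (trans (symm (rk-off n₁)) (trans q (rk-off n₂))))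
    later : ∀ a → R a ≡ true → card (λ w → (adj G a w ∧ R w) ∧ ⌊ rk a <? rk w ⌋) ≤ 6 + 6 * g
    later a ra = go (a ≟ v)
      where
      sub : a ≢ v → ∀ w → (adj G a w ∧ R w) ∧ ⌊ rk a <? rk w ⌋ ≡ true → (adj G a w ∧ R′ w) ∧ ⌊ I.rk a <? I.rk w ⌋ ≡ true
      sub ne w h = let x , y = ∧-elim {adj G a w ∧ R w} h ; e , r = ∧-elim {adj G a w} x in rest e r (⌊⌋-sound (rk a <? rk w) y) (w ≟ v)
        where
        rest : adj G a w ≡ true → R w ≡ true → rk a < rk w → Dec (w ≡ v) → (adj G a w ∧ R′ w) ∧ ⌊ I.rk a <? I.rk w ⌋ ≡ true
        rest e r lt (yes p) with () ← subst (rk a <_) (trans (cong rk p) rk-v) lt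
        rest e r lt (no nw) = ∧-intro (∧-intro e (in′ r nw)) (⌊⌋-complete (I.rk a <? I.rk w)
          (ℕP.≤-pred (subst₂ _<_ (rk-off ne) (rk-off nw) lt)))
      go : Dec (a ≡ v) → card (λ w → (adj G a w ∧ R w) ∧ ⌊ rk a <? rk w ⌋) ≤ 6 + 6 * g
      go (yes p) = ℕP.≤-trans (card-mono λ w h → proj₁ (∧-elim {adj G a w ∧ R w} h))
        (subst (λ u → card (λ w → adj G u w ∧ R w) ≤ 6 + 6 * g) (symm p) (proj₂ (proj₂ low)))
      go (no ne) = ℕP.≤-trans (card-mono (sub ne)) (I.later a (in′ ra ne))

card-cover : ∀ {N p} (L : Fin N → Bool) (T : Fin p → Fin N → Bool) → (∀ i → L i ≡ true → ∃[ j ] T j i ≡ true) →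
  card L ≤ sumF (λ j → card (λ i → L i ∧ T j i))
card-cover {zero}  L T h = z≤n
card-cover {suc N} {p} L T h = ℕP.≤-trans (ℕP.+-mono-≤ (head (L zero) refl) (card-cover (L ∘ suc) (λ j → T j ∘ suc) (h ∘ suc)))
  (ℕP.≤-reflexive (symm (sumF-+ (λ j → if L zero ∧ T j zero then 1 else 0) _)))
  where
  head : ∀ b → L zero ≡ b → (if b then 1 else 0) ≤ sumF (λ j → if b ∧ T j zero then 1 else 0)
  head false e = z≤n
  head true  e = let j , t = h zero e in ℕP.≤-trans (ℕP.≤-reflexive (symm (sumF-indicator j))) (sumF-mono λ i → le j i t (j ≟ i))
    where
    le : ∀ j i → T j zero ≡ true → Dec (j ≡ i) → (if j == i then 1 else 0) ≤ (if T i zero then 1 else 0)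
    le j i t (yes refl) rewrite t | ==-refl j = ℕP.≤-refl
    le j i t (no ne) rewrite ==-false ne = z≤n

pigeon : ∀ {N p} (L : Fin N → Bool) (T : Fin p → Fin N → Bool) q → (∀ i → L i ≡ true → ∃[ j ] T j i ≡ true) →
  p * q < card L → ∃[ j ] q < card (λ i → L i ∧ T j i)
pigeon {p = p} L T q h big with FP.all? (λ j → card (λ i → L i ∧ T j i) ≤? q)
... | yes small = ⊥-elim (ℕP.<⇒≱ big (ℕP.≤-trans (card-cover L T h) (ℕP.≤-trans (sumF-mono small) (ℕP.≤-reflexive (sumF-const p q)))))
... | no ns = let j , b = FP.¬∀⟶∃¬ p _ (λ j → card (λ i → L i ∧ T j i) ≤? q) ns in j , ℕP.≰⇒> b

pin : ∀ {N p} (keys : List (Fin N → Fin p)) (L : Fin N → Bool) q → p ^ length keys * q < card L →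
  ∃[ L′ ] ((∀ i → L′ i ≡ true → L i ≡ true) × q < card L′ ×
    (∀ key → key ∈ keys → ∀ i j → L′ i ≡ true → L′ j ≡ true → key i ≡ key j))
pin [] L q big = L , (λ _ p → p) , subst (_< card L) (ℕP.*-identityˡ q) big , λ key ()
pin {p = p} (key ∷ keys) L q big
  with pigeon L (λ j i → key i == j) (p ^ length keys * q) (λ i _ → key i , ==-refl (key i)) (subst (_< card L) (ℕP.*-assoc p _ q) big)
... | j , big′ with pin keys _ q big′
...   | L′ , sub , big″ , const = L′ , (λ i h → proj₁ (∧-elim {L i} (sub i h))) , big″ ,
        λ { k (here refl) a b la lb → trans (at a la) (symm (at b lb)) ; k (there m) → const k m }
  where
  at : ∀ i → L′ i ≡ true → key i ≡ j
  at i h = ==-sound (proj₂ (∧-elim {L i} (sub i h)))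

not-∨ : ∀ a b → not (a ∨ b) ≡ not a ∧ not b
not-∨ true  b = refl
not-∨ false b = refl

-- The three factors count what one round fixes: the vertex at which a copy collides, the petal that
-- it hits, and the vertex of that petal.
sun : ℕ → ℕ → ℕ → ℕ
sun h s zero    = 1
sun h s (suc j) = h * (s * (h * sun h s j))

sun-mono : ∀ {h s} → 1 ≤ h → 1 ≤ s → ∀ {i j} → i ≤ j → sun h s i ≤ sun h s j
sun-mono {h} {s} h≥ s≥ {zero} {zero} z≤n = ℕP.≤-refl
sun-mono {h} {s} h≥ s≥ {zero} {suc j} z≤n = ℕP.*-mono-≤ h≥ (ℕP.*-mono-≤ s≥ (ℕP.*-mono-≤ h≥ (sun-mono h≥ s≥ {zero} {j} z≤n)))
sun-mono {h} {s} h≥ s≥ {suc i} {suc j} (s≤s le) = scale h (scale s (scale h (sun-mono h≥ s≥ le)))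

module Sunflower {N h n : ℕ} (φ : Fin N → Fin h → Fin n) (s : ℕ)
  (distinct : ∀ i j → i ≢ j → ∃[ v ] φ i v ≢ φ j v) (s≥2 : 2 ≤ s) where

  record Flower (L : Fin N → Bool) (K₀ : Fin h → Bool) : Set where
    field
      K      : Fin h → Bool
      K₀⊆K   : ∀ v → K₀ v ≡ true → K v ≡ true
      petal  : Fin s → Fin N
      in-L   : ∀ l → L (petal l) ≡ true
      agree  : ∀ l l′ v → K v ≡ true → φ (petal l) v ≡ φ (petal l′) v
      disj   : ∀ l l′ u u′ → l ≢ l′ → K u ≡ false → K u′ ≡ false → φ (petal l) u ≢ φ (petal l′) u′
      free   : ∃[ v ] K v ≡ false

  -- Petals are chosen greedily. When this gets stuck, every copy meets a chosen petal off the
  -- kernel; fixing how, many copies agree at a further vertex u of H, which joins the kernel. The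
  -- base 1 is enough, as two copies that agree everywhere would coincide.
  flower : ∀ j (L : Fin N → Bool) (K : Fin h → Bool) → card (λ v → not (K v)) ≡ j →
    (∀ i i′ v → L i ≡ true → L i′ ≡ true → K v ≡ true → φ i v ≡ φ i′ v) → sun h s j < card L → Flower L K
  flower zero L K e agree big with card-positive {f = L} (ℕP.≤-trans (s≤s z≤n) big)
  ... | i , li with card-positive {f = λ z → L z ∧ not (z == i)} (ℕP.≤-pred (subst (2 ≤_) (card-remove L i li) big))
  ...   | i′ , h with ∧-elim {L i′} h
  ...     | li′ , ne with distinct i i′ (==-refute (not-elim ne) ∘ symm)
  ...       | v , d = ⊥-elim (d (agree i i′ v li li′ (all-K v)))
    where
    all-K : ∀ v → K v ≡ true
    all-K v with bool-cases (K v)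
    ... | inj₁ p = p
    ... | inj₂ p = ⊥-elim (ℕP.<⇒≱ (card-≥1 {f = λ v → not (K v)} v (not-intro p)) (ℕP.≤-reflexive e))
  flower (suc j) L K e agree big = [ id , done ]′ (greedy s ℕP.≤-refl)
    where
    Chosen : ℕ → Set
    Chosen r = Σ[ c ∈ (Fin r → Fin N) ] ((∀ l → L (c l) ≡ true) ×
      (∀ l l′ u u′ → l ≢ l′ → K u ≡ false → K u′ ≡ false → φ (c l) u ≢ φ (c l′) u′))
    done : Chosen s → Flower L K
    done (c , inL , dis) = record { K = K ; K₀⊆K = λ _ p → p ; petal = c ; in-L = inL
      ; agree = λ l l′ v → agree (c l) (c l′) v (inL l) (inL l′) ; disj = dis
      ; free = let v , p = card-positive {f = λ v → not (K v)} (ℕP.≤-trans (s≤s z≤n) (ℕP.≤-reflexive (symm e))) in v , not-elim p }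
    module _ {r : ℕ} (c : Fin r → Fin N) where
      hit₃ : Fin h → Fin r → Fin h → Fin N → Bool
      hit₃ u l u′ i = not (K u′) ∧ (φ i u == φ (c l) u′)
      hit₂ : Fin h → Fin r → Fin N → Bool
      hit₂ u l i = ex (λ u′ → hit₃ u l u′ i)
      hit₁ : Fin h → Fin N → Bool
      hit₁ u i = not (K u) ∧ ex (λ l → hit₂ u l i)
      hit : Fin N → Bool
      hit i = ex (λ u → hit₁ u i)
    greedy : ∀ r → r ≤ s → Flower L K ⊎ Chosen r
    greedy zero _ = inj₂ ((λ ()) , (λ ()) , λ ())
    greedy (suc r) r< with greedy r (ℕP.<⇒≤ r<)
    ... | inj₁ f = inj₁ f
    ... | inj₂ (c , inL , dis) with bool-cases (ex (λ i → L i ∧ not (hit c i)))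
    ...   | inj₁ some = inj₂ (c′ , inL′ , dis′)
      where
      i₀ : Fin N
      i₀ = proj₁ (ex-elim some)
      li : L i₀ ≡ true × not (hit c i₀) ≡ true
      li = ∧-elim {L i₀} (proj₂ (ex-elim some))
      miss : ∀ l u u′ → K u ≡ false → K u′ ≡ false → φ i₀ u ≢ φ (c l) u′
      miss l u u′ a b q = absurd (ex-intro u (∧-intro (not-intro a) (ex-intro l (ex-intro u′ (∧-intro (not-intro b) (==-complete q)))))) (not-elim (proj₂ li))
      c′ : Fin (suc r) → Fin N
      c′ zero    = i₀
      c′ (suc l) = c l
      inL′ : ∀ l → L (c′ l) ≡ true
      inL′ zero    = proj₁ li
      inL′ (suc l) = inL l
      dis′ : ∀ l l′ u u′ → l ≢ l′ → K u ≡ false → K u′ ≡ false → φ (c′ l) u ≢ φ (c′ l′) u′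
      dis′ zero    zero     u u′ ne a b q = ne refl
      dis′ zero    (suc l′) u u′ ne a b q = miss l′ u u′ a b q
      dis′ (suc l) zero     u u′ ne a b q = miss l u′ u b a (symm q)
      dis′ (suc l) (suc l′) u u′ ne a b q = dis l l′ u u′ (ne ∘ cong suc) a b q
    ...   | inj₂ none = inj₁ (shrink (pigeon L (hit₁ c) (s * (h * sun h s j)) (λ i li → ex-elim (hits i li)) big))
      where
      hits : ∀ i → L i ≡ true → hit c i ≡ true
      hits i li with bool-cases (hit c i)
      ... | inj₁ p = p
      ... | inj₂ p = absurd (∧-intro li (not-intro p)) (ex-none none i)
      Target : Set
      Target = Flower L K
      shrink : ∃[ u ] (s * (h * sun h s j) < card (λ i → L i ∧ hit₁ c u i)) → Target
      shrink (u , big₁) with pigeon (λ i → L i ∧ hit₁ c u i) (hit₂ c u) (h * sun h s j)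
          (λ i p → ex-elim (proj₂ (∧-elim {not (K u)} (proj₂ (∧-elim {L i} p))))) (ℕP.≤-<-trans (ℕP.*-monoˡ-≤ (h * sun h s j) (ℕP.<⇒≤ r<)) big₁)
      ... | l , big₂ with pigeon (λ i → (L i ∧ hit₁ c u i) ∧ hit₂ c u l i) (hit₃ c u l) (sun h s j)
          (λ i p → ex-elim (proj₂ (∧-elim {L i ∧ hit₁ c u i} p))) big₂
      ...   | u′ , big₃ = lift (flower j L₃ K′ e′ agree′ big₃)
        where
        L₃ : Fin N → Bool
        L₃ i = ((L i ∧ hit₁ c u i) ∧ hit₂ c u l i) ∧ hit₃ c u l u′ i
        K′ : Fin h → Bool
        K′ x = K x ∨ (x == u)
        L₃-L : ∀ i → L₃ i ≡ true → L i ≡ true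
        L₃-L i p = proj₁ (∧-elim {L i} (proj₁ (∧-elim {L i ∧ hit₁ c u i} (proj₁ (∧-elim {(L i ∧ hit₁ c u i) ∧ hit₂ c u l i} p)))))
        value : ∀ i → L₃ i ≡ true → φ i u ≡ φ (c l) u′
        value i p = ==-sound (proj₂ (∧-elim {not (K u′)} (proj₂ (∧-elim {(L i ∧ hit₁ c u i) ∧ hit₂ c u l i} p))))
        Ku : not (K u) ≡ true
        Ku = let i , p = card-positive {f = L₃} (ℕP.≤-trans (s≤s z≤n) big₃) in
          proj₁ (∧-elim {not (K u)} (proj₂ (∧-elim {L i} (proj₁ (∧-elim {L i ∧ hit₁ c u i} (proj₁ (∧-elim {(L i ∧ hit₁ c u i) ∧ hit₂ c u l i} p)))))))
        e′ : card (λ v → not (K′ v)) ≡ j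
        e′ = ℕP.suc-injective (trans (cong suc (card-cong λ v → not-∨ (K v) (v == u))) (trans (symm (card-remove (λ v → not (K v)) u Ku)) e))
        agree′ : ∀ i i′ v → L₃ i ≡ true → L₃ i′ ≡ true → K′ v ≡ true → φ i v ≡ φ i′ v
        agree′ i i′ v p p′ k with ∨-elim {K v} k
        ... | inj₁ kv = agree i i′ v (L₃-L i p) (L₃-L i′ p′) kv
        ... | inj₂ vu rewrite ==-sound {u = v} {u} vu = trans (value i p) (symm (value i′ p′))
        lift : Flower L₃ K′ → Target
        lift f = record { K = F′.K ; K₀⊆K = λ v p → F′.K₀⊆K v (∨-introˡ p) ; petal = F′.petal ; in-L = λ l → L₃-L _ (F′.in-L l)
                        ; agree = F′.agree ; disj = F′.disj ; free = F′.free }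
          where module F′ = Flower f

module Dipole where
  private
    α β : Fin 4 → Fin 4
    α zero                   = suc (suc zero)
    α (suc zero)             = suc (suc (suc zero))
    α (suc (suc zero))       = zero
    α (suc (suc (suc zero))) = suc zero
    β zero                   = suc zero
    β (suc zero)             = zero
    β (suc (suc zero))       = suc (suc (suc zero))
    β (suc (suc (suc zero))) = suc (suc zero)

    every : ∀ {P : Fin 4 → Set} → P zero → P (suc zero) → P (suc (suc zero)) → P (suc (suc (suc zero))) → ∀ x → P x
    every a b c d zero                   = a
    every a b c d (suc zero)             = b
    every a b c d (suc (suc zero))       = c
    every a b c d (suc (suc (suc zero))) = d

    fr : Frame 4
    fr = record { α = α ; β = β ; α-inv = every refl refl refl refl ; β-inv = every refl refl refl refl
      ; α-fpf = every (λ ()) (λ ()) (λ ()) (λ ()) ; β-fpf = every (λ ()) (λ ()) (λ ()) (λ ())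
      ; αβ-comm = every refl refl refl refl ; αβ-fpf = every (λ ()) (λ ()) (λ ()) (λ ()) }

    open Ribbon fr
      using (#V; rF; rK; rV-elim)
    ro : Rotation β
    ro = rotation (Frame.β-inv fr) (Frame.β-fpf fr)

    to-0 : ∀ x → rK β x ≡ rK β zero
    to-0 = every refl (cl₃-b α β β zero) (cl₃-a α β β zero) (trans (cl₃-b α β β (suc (suc zero))) (cl₃-a α β β zero))

    two-V : 2 ≤ #V β
    two-V = nc-≥2 zero (suc (suc zero)) refl refl λ e →
      [ (λ ()) , (λ ()) ]′ (rV-elim ro (λ z → z ≡ zero ⊎ z ≡ suc zero)
        (λ { z (inj₁ refl) → inj₂ refl ; z (inj₂ refl) → inj₁ refl })
        (λ { z (inj₁ refl) → inj₂ refl ; z (inj₂ refl) → inj₁ refl }) e (inj₁ refl))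

    module TM = ToMap fr β ro zero (λ x y → trans (to-0 x) (symm (to-0 y))) (scale 4 two-V ⊕ scale 4 (nc-≥1 {P = all} {r = rF β} zero refl))

  -- For a single vertex without edges, which no drawing can show; it is placed at an end of an edge
  -- drawn on the sphere.
  trivial-embedding : ∀ {n} (V : Fin n → Bool) (E : Fin n → Fin n → Bool) → (∀ u v → V u ≡ true → V v ≡ true → u ≡ v) →
    (∀ u v → V u ≡ true → V v ≡ true → E u v ≡ false) → EmbedsSub n V E sphere
  trivial-embedding V E one none = TM.map , TM.map-sphere , (λ _ → vtx TM.map zero) , (λ u v p q _ → one u v p q) ,
    λ u v p q e → absurd e (none u v p q)

-- From many copies to many independent flaps

argmin : ∀ {n} (f : Fin n → ℕ) (C : Fin n → Bool) v → C v ≡ true → ∃[ a ] (C a ≡ true × (∀ b → C b ≡ true → f a ≤ f b))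
argmin f C v cv = go (suc (f v)) v cv ℕP.≤-refl
  where
  go : ∀ fuel v → C v ≡ true → f v < fuel → ∃[ a ] (C a ≡ true × (∀ b → C b ≡ true → f a ≤ f b))
  go (suc fuel) v cv (s≤s le) with bool-cases (ex (λ b → C b ∧ ⌊ f b <? f v ⌋))
  ... | inj₂ none = v , cv , λ b cb → ℕP.≮⇒≥ λ lt → absurd (∧-intro cb (⌊⌋-complete (f b <? f v) lt)) (ex-none none b)
  ... | inj₁ some = let b , p = ex-elim some ; cb , lt = ∧-elim {C b} p in go fuel b cb (ℕP.<-≤-trans (⌊⌋-sound (f b <? f v) lt) le)

¬¬-em : {P : Set} → (Dec P → ⊥) → ⊥
¬¬-em k = k (no λ p → k (yes p))

-- Double negation commutes with finite conjunctions; this collects the private sets of all members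
-- of a hitting set.
¬¬-choice : ∀ {m} {P : Fin m → Set} → (∀ i → (P i → ⊥) → ⊥) → ((∀ i → P i) → ⊥) → ⊥
¬¬-choice {zero}  h k = k λ ()
¬¬-choice {suc m} h k = h zero λ p → ¬¬-choice (h ∘ suc) λ ps → k λ { zero → p ; (suc i) → ps i }

-- Large enough for three purposes: more petals than later neighbours of a vertex, more than 4g, and
-- enough parts for up to h attachment vertices.
petals : ℕ → ℕ → ℕ
petals h g = 4 * h + 6 * g + 7

vertex-pairs : ∀ h → List (Fin h × Fin h)
vertex-pairs h = cartesianProduct (allFin h) (allFin h)

-- The order that a copy induces on V(H) is recorded by one Boolean for each pair of vertices, hence
-- the power of two.
flap-constant : ℕ → ℕ → ℕ
flap-constant h g = 2 ^ length (vertex-pairs h) * sun h (petals h g) h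

petals>degree : ∀ h g → 6 + 6 * g < petals h g
petals>degree h g = ℕP.≤-trans (ℕP.m≤m+n (suc (6 + 6 * g)) (4 * h)) (ℕP.≤-reflexive (arith h g))
  where
  arith : ∀ h g → suc (6 + 6 * g) + 4 * h ≡ 4 * h + 6 * g + 7
  arith = solve-∀

petals>genus : ∀ h g → 4 * g < petals h g
petals>genus h g = ℕP.≤-trans (ℕP.m≤m+n (suc (4 * g)) (4 * h + 2 * g + 6)) (ℕP.≤-reflexive (arith h g))
  where
  arith : ∀ h g → suc (4 * g) + (4 * h + 2 * g + 6) ≡ 4 * h + 6 * g + 7
  arith = solve-∀

petals-large : ∀ h g → 8 * h + 4 * g < 8 + 2 * petals h g
petals-large h g = ℕP.≤-trans (ℕP.m≤m+n _ (8 * g + 21)) (ℕP.≤-reflexive (arith h g))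
  where
  arith : ∀ h g → suc (8 * h + 4 * g) + (8 * g + 21) ≡ 8 + 2 * (4 * h + 6 * g + 7)
  arith = solve-∀

module Copies {h n N : ℕ} (H : Graph h) (G : Graph n) {S : Surface} (emb : EmbedsIn G S) (h≥1 : 1 ≤ h)
  (φ : Fin N → Fin h → Fin n) (φ-inj : ∀ i u v → φ i u ≡ φ i v → u ≡ v)
  (φ-hom : ∀ i u v → adj H u v ≡ true → adj G (φ i u) (φ i v) ≡ true)
  (distinct : ∀ i j → i ≢ j → ∃[ v ] φ i v ≢ φ j v) where
  open Flaps H
    using (E-irr; E-sym; E⁺; E⁺-irr; Good; VA; comp; nb; nb-comp; nb-elim; nb-out; planar-mono)

  private
    g s : ℕ
    g = eulerGenus S
    s = petals h g

    s≥7 : 7 ≤ s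
    s≥7 = ℕP.m≤n+m 7 _

    s≥2 : 2 ≤ s
    s≥2 = ℕP.≤-trans (s≤s (s≤s z≤n)) s≥7

    l₀ : Fin s
    l₀ = fromℕ< (ℕP.≤-trans (s≤s z≤n) s≥2)

    adjG-sym : ∀ u v → adj G u v ≡ true → adj G v u ≡ true
    adjG-sym u v e = trans (symm (Graph.sym G u v)) e

    adjG-irr : ∀ u v → adj G u v ≡ true → u ≢ v
    adjG-irr u v e refl = absurd e (irrefl G u)

  open Sunflower φ s distinct s≥2
    using (Flower; flower)

  -- The petals of a sunflower are copies of a component C of H - K attached
  -- to the common image of the neighbours of C.
  module Petals {L : Fin N → Bool} {K₀ : Fin h → Bool} (fl : Flower L K₀) where
    open Flower fl

    ψ : Fin s → Fin h → Fin n
    ψ l = φ (petal l)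

    v₀ : Fin h
    v₀ = proj₁ free

    U C : Fin h → Bool
    U x = not (K x)
    C = comp U v₀

    C-self : C v₀ ≡ true
    C-self = Component.comp-self (adj H) E-sym U v₀ (not-intro (proj₂ free))

    C-K : ∀ u → C u ≡ true → K u ≡ false
    C-K u c = not-elim (Component.comp-⊆ (adj H) E-sym U v₀ u c)

    nb-K : ∀ u → nb C u ≡ true → K u ≡ true
    nb-K u m with bool-cases (K u)
    ... | inj₁ p = p
    ... | inj₂ p = absurd (not-intro p) (nb-comp U v₀ u m)

    private
      X C⁺ : Fin n → Bool
      X x = ex (λ w → nb C w ∧ (ψ l₀ w == x))
      C⁺ x = ex (λ l → ex (λ a → C a ∧ (ψ l a == x)))

      X-elim : ∀ {x} → X x ≡ true → ∃[ w ] (nb C w ≡ true × ψ l₀ w ≡ x)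
      X-elim p = let w , q = ex-elim p ; a , b = ∧-elim {nb C w} q in w , a , ==-sound b
      X-intro : ∀ l w → nb C w ≡ true → X (ψ l w) ≡ true
      X-intro l w m = ex-intro w (∧-intro m (==-complete (agree l₀ l w (nb-K w m))))
      C-elim : ∀ {x} → C⁺ x ≡ true → ∃[ l ] ∃[ a ] (C a ≡ true × ψ l a ≡ x)
      C-elim p = let l , q = ex-elim p ; a , r = ex-elim q ; c , e = ∧-elim {C a} r in l , a , c , ==-sound e
      C-intro : ∀ l a → C a ≡ true → C⁺ (ψ l a) ≡ true
      C-intro l a c = ex-intro l (ex-intro a (∧-intro c (==-refl (ψ l a))))

      κ′ : ∀ x b → C⁺ x ≡ b → Fin s
      κ′ x true  p = proj₁ (C-elim p)
      κ′ x false p = l₀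

      -- The petal on which a point lies, unambiguous because petals are disjoint off the kernel.
      -- Elsewhere `l₀` is a dummy.
      κ : Fin n → Fin s
      κ x = κ′ x (C⁺ x) refl

      same-petal : ∀ {l l′ a a′} → C a ≡ true → C a′ ≡ true → ψ l a ≡ ψ l′ a′ → l ≡ l′
      same-petal {l} {l′} {a} {a′} c c′ e = decidable-stable (l ≟ l′) λ ne → disj l l′ a a′ ne (C-K a c) (C-K a′ c′) e

      κ-at : ∀ l a → C a ≡ true → κ (ψ l a) ≡ l
      κ-at l a c = go (C⁺ (ψ l a)) refl (C-intro l a c)
        where
        go : ∀ b (e : C⁺ (ψ l a) ≡ b) → b ≡ true → κ′ (ψ l a) b e ≡ l
        go true e _ = let l′ , a′ , c′ , q = C-elim e in same-petal c′ c q

      CX : ∀ x → C⁺ x ≡ true → X x ≡ false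
      CX x c = ≢true λ p → go (C-elim c) (X-elim p)
        where
        go : ∃[ l ] ∃[ a ] (C a ≡ true × ψ l a ≡ x) → ∃[ w ] (nb C w ≡ true × ψ l₀ w ≡ x) → ⊥
        go (l , a , ca , p) (w , m , q) = absurd (subst (λ z → C z ≡ true)
          (φ-inj (petal l) a w (trans p (trans (symm q) (agree l₀ l w (nb-K w m))))) ca) (nb-out C w m)

      conn : ∀ u v → C⁺ u ≡ true → C⁺ v ≡ true → κ u ≡ κ v → Star (λ a b → adj G a b ∧ ((C⁺ a ∧ C⁺ b) ∧ (κ a == κ b))) u v
      conn u v p q k with C-elim p | C-elim q
      ... | l , a , ca , refl | l′ , b , cb , refl with trans (symm (κ-at l a ca)) (trans k (κ-at l′ b cb))
      ...   | refl = Star-map (ψ l) (λ c d r → let e , k′ = ∧-elim {adj H c d} r ; cc , cd = ∧-elim {C c} k′ in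
              ∧-intro (φ-hom (petal l) c d e) (∧-intro (∧-intro (C-intro l c cc) (C-intro l d cd))
                (==-complete (trans (κ-at l c cc) (symm (κ-at l d cd)))))) (Component.comp-conn (adj H) E-sym U v₀ a b ca cb)

      attach : ∀ i u (p : X u ≡ true) → ∃[ c ] (C⁺ c ≡ true × κ c ≡ i × adj G u c ≡ true)
      attach i u p = let w , m , q = X-elim p ; a , ca , e = nb-elim C w m in ψ i a , C-intro i a ca , κ-at i a ca ,
        subst (λ z → adj G z (ψ i a) ≡ true) (trans (agree i l₀ w (nb-K w m)) q) (φ-hom (petal i) w a (E-sym a w e))

      Start : Set
      Start = ∀ i → ∃[ c ] ∃[ y ] (C⁺ c ≡ true × κ c ≡ i × adj G c y ≡ true × (X y ≡ true ⊎ (C⁺ y ≡ true × κ c ≡ κ y)))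

      nb≤X : card (nb C) ≤ card X
      nb≤X = card-inj (nb C) X (λ w _ → ψ l₀ w) (λ w m → X-intro l₀ w m) (λ w w′ _ _ e → φ-inj _ w w′ e)

      X≤nb : card X ≤ card (nb C)
      X≤nb = card-inj X (nb C) (λ x p → proj₁ (X-elim p)) (λ x p → proj₁ (proj₂ (X-elim p)))
        (λ x y p q e → trans (symm (proj₂ (proj₂ (X-elim p)))) (trans (cong (ψ l₀) e) (proj₂ (proj₂ (X-elim q)))))

      module Gl = Glue {n} {s} {S = S} emb adjG-sym adjG-irr X C⁺ κ (λ _ _ → refl) (λ _ _ → refl) CX conn

      pull : ∀ i → EmbedsSub n (Gl.V⁺ i) (Gl.E⁺ i) sphere → EmbedsSub h (VA C) (E⁺ C) sphere
      pull i em = planar-mono C (EmbedsSub-pull {S = sphere} (ψ i) (φ-inj (petal i)) em)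
          (λ u v → [ (λ c → ∨-introʳ {X (ψ i u)} (inᵢ u c)) , (λ m → ∨-introˡ (X-intro i u m)) ]′ (∨-elim {C u} v))
          (λ u v e c → ∨-introˡ (∧-intro (φ-hom (petal i) u v e) ([ (λ k → ∨-introˡ (inᵢ u k)) , (λ k → ∨-introʳ {Gl.Cᵢ i (ψ i u)} (inᵢ v k)) ]′ c)))
          (λ u v p q ne → ∨-introʳ {adj G (ψ i u) (ψ i v) ∧ (Gl.Cᵢ i (ψ i u) ∨ Gl.Cᵢ i (ψ i v))}
            (∧-intro (∧-intro (X-intro i u p) (X-intro i v q)) (not-intro (==-false λ k → ne (φ-inj (petal i) u v k)))))
        where
        inᵢ : ∀ u → C u ≡ true → Gl.Cᵢ i (ψ i u) ≡ true
        inᵢ u c = ∧-intro (C-intro i u c) (==-complete (κ-at i u c))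

      C-conn : ∀ u v → C u ≡ true → C v ≡ true → Star (within (adj H) C) u v
      C-conn = Component.comp-conn (adj H) E-sym U v₀

      make : card (nb C) ≤ 2 → EmbedsSub h (VA C) (E⁺ C) sphere → Good C
      make a b = record { conn = C-conn ; small = a ; planar = b }

      attached : ∀ w → nb C w ≡ true → Good C
      attached w m = make (ℕP.≤-trans nb≤X (proj₁ r)) (pull (proj₁ (proj₂ r)) (proj₂ (proj₂ r)))
        where
        x : Fin n
        x = ψ l₀ w
        x∈ : X x ≡ true
        x∈ = X-intro l₀ w m
        start : Start
        start i = let c , cc , kc , e = attach i x x∈ in c , x , cc , kc , adjG-sym x c e , inj₁ x∈
        bound : 8 * card X + 4 * g < 8 + 2 * s
        bound = ℕP.≤-trans (s≤s (ℕP.+-monoˡ-≤ (4 * g) (scale 8 (ℕP.≤-trans X≤nb (card-≤ (nb C)))))) (petals-large h g)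
        r : card X ≤ 2 × ∃[ i ] EmbedsSub n (Gl.V⁺ i) (Gl.E⁺ i) sphere
        r = Gl.many-copies attach start x x∈ s≥2 bound

      -- The disjoint petals form the parts if C has an edge. Otherwise connectedness makes C a
      -- single vertex.
      lonely : (∀ w → nb C w ≡ false) → Good C
      lonely none with bool-cases (ex (λ a → ex (λ b → within (adj H) C a b)))
      ... | inj₁ some = make nb≤2 (pull (proj₁ r) (proj₂ r))
        where
        nb≤2 : card (nb C) ≤ 2
        nb≤2 = ℕP.≤-trans (ℕP.≤-reflexive (card-empty none)) z≤n
        a b : Fin h
        a = proj₁ (ex-elim some)
        b = proj₁ (ex-elim (proj₂ (ex-elim some)))
        w : within (adj H) C a b ≡ true
        w = proj₂ (ex-elim (proj₂ (ex-elim some)))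
        ca : C a ≡ true
        ca = proj₁ (∧-elim {C a} (proj₂ (∧-elim {adj H a b} w)))
        cb : C b ≡ true
        cb = proj₂ (∧-elim {C a} (proj₂ (∧-elim {adj H a b} w)))
        start : Start
        start i = ψ i a , ψ i b , C-intro i a ca , κ-at i a ca , φ-hom (petal i) a b (proj₁ (∧-elim {adj H a b} w)) ,
          inj₂ (C-intro i b cb , trans (κ-at i a ca) (symm (κ-at i b cb)))
        noX : ∀ x → X x ≡ false
        noX x = ≢true λ p → let w′ , m , _ = X-elim p in absurd m (none w′)
        r : ∃[ i ] EmbedsSub n (Gl.V⁺ i) (Gl.E⁺ i) sphere
        r = Gl.disjoint-copies attach start noX (petals>genus h g)
      ... | inj₂ no-edge = make (ℕP.≤-trans (ℕP.≤-reflexive (card-empty none)) z≤n)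
            (Dipole.trivial-embedding (VA C) (E⁺ C) single (λ u v p q → ≢true λ e → E⁺-irr C u v e (single u v p q)))
        where
        step : ∀ {u v} → Star (within (adj H) C) u v → u ≡ v
        step ε = refl
        step (_▻_ {a} {b} p r) = absurd r (ex-none (ex-none no-edge a) b)
        single : ∀ u v → VA C u ≡ true → VA C v ≡ true → u ≡ v
        single u v p q = step (C-conn u v (c u p) (c v q))
          where
          c : ∀ u → VA C u ≡ true → C u ≡ true
          c u p = [ id , (λ m → absurd m (none u)) ]′ (∨-elim {C u} p)

    good : Good C
    good with bool-cases (ex (nb C))
    ... | inj₁ p = let w , m = ex-elim p in attached w m
    ... | inj₂ p = lonely (ex-none p)

  private
    module Rk = Degenerate.Ranking (Degenerate.ranking G {S = S} emb n (λ _ → true) (card-full n))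

    lt : Fin N → Fin h → Fin h → Bool
    lt i a b = ⌊ Rk.rk (φ i a) <? Rk.rk (φ i b) ⌋

  module Ordered (L : Fin N → Bool) (i₀ : Fin N) (i₀∈ : L i₀ ≡ true)
    (same : ∀ i j a b → L i ≡ true → L j ≡ true → lt i a b ≡ lt j a b) where

    -- Read off from the one copy i₀, as all copies in L induce the same order.
    source : Fin h → Bool
    source a = not (ex (λ b → adj H a b ∧ not (lt i₀ a b)))

    source-elim : ∀ {a b} → source a ≡ true → adj H a b ≡ true → lt i₀ a b ≡ true
    source-elim {a} {b} sa e with bool-cases (lt i₀ a b)
    ... | inj₁ p = p
    ... | inj₂ p = absurd (ex-intro b (∧-intro e (not-intro p))) (not-elim sa)

    -- Sets of this kind are to be hit by sources. Thanks to `no-spill`, a source outside such a set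
    -- is outside its neighbourhood as well.
    record Free (C : Fin h → Bool) : Set where
      field
        good     : Good C
        spring   : ∃[ t ] (source t ≡ true × C t ≡ true)
        no-spill : ∀ t → source t ≡ true → nb C t ≡ false

    -- A vertex has few later neighbours, so a petal is never later than the
    -- kernel vertices that it is attached to.
    module Petal {K₀ : Fin h → Bool} {L′ : Fin N → Bool} (sub : ∀ i → L′ i ≡ true → L i ≡ true) (fl : Flower L′ K₀) where
      open Flower fl
      open Petals fl
        using (C; C-K; C-self; good; nb-K; v₀; ψ)

      petal∈ : ∀ l → L (petal l) ≡ true
      petal∈ l = sub _ (in-L l)

      module Late (a b : Fin h) (ca : C a ≡ true) (mb : nb C b ≡ true) (e : adj H a b ≡ true) (p : lt i₀ a b ≡ false) where
        w : Fin n
        w = ψ l₀ b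
        late : Fin n → Bool
        late x = (adj G w x ∧ true) ∧ ⌊ Rk.rk w <? Rk.rk x ⌋
        edge : ∀ l → adj G w (ψ l a) ≡ true
        edge l = subst (λ z → adj G z (ψ l a) ≡ true) (agree l l₀ b (nb-K b mb)) (φ-hom (petal l) b a (E-sym a b e))
        not< : ∀ l → ¬ Rk.rk (ψ l a) < Rk.rk w
        not< l q = absurd (⌊⌋-complete (Rk.rk (ψ l a) <? Rk.rk (ψ l b)) (subst (λ z → Rk.rk (ψ l a) < Rk.rk z) (agree l₀ l b (nb-K b mb)) q))
          (trans (same (petal l) i₀ a b (petal∈ l) i₀∈) p)
        late-petal : ∀ l → late (ψ l a) ≡ true
        late-petal l = ∧-intro (∧-intro (edge l) refl) (⌊⌋-complete (Rk.rk w <? Rk.rk (ψ l a))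
          (ℕP.≤∧≢⇒< (ℕP.≮⇒≥ (not< l)) (λ q → adjG-irr w (ψ l a) (edge l) (Rk.inj w (ψ l a) refl refl q))))
        inj : ∀ l l′ → ψ l a ≡ ψ l′ a → l ≡ l′
        inj l l′ q = decidable-stable (l ≟ l′) λ ne → disj l l′ a a ne (C-K a ca) (C-K a ca) q
        impossible : ⊥
        impossible = ℕP.<⇒≱ (petals>degree h g) (ℕP.≤-trans (subst (_≤ card late) (card-full s) (card-inj (λ _ → true) late
          (λ l _ → ψ l a) (λ l _ → late-petal l) (λ l l′ _ _ q → inj l l′ q))) (Rk.later w refl))

      inward : ∀ a b → C a ≡ true → nb C b ≡ true → adj H a b ≡ true → lt i₀ a b ≡ true
      inward a b ca mb e = [ id , (λ p → ⊥-elim (Late.impossible a b ca mb e p)) ]′ (bool-cases (lt i₀ a b))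

      free-C : Free C
      free-C = record { good = Petals.good fl ; spring = spring ; no-spill = no-spill }
        where
        low = argmin (λ a → Rk.rk (φ i₀ a)) C v₀ C-self
        a = proj₁ low
        ca = proj₁ (proj₂ low)
        least = proj₂ (proj₂ low)
        -- The earliest vertex of C precedes its neighbours inside C by choice and those in the
        -- kernel by `inward`.
        spring : ∃[ t ] (source t ≡ true × C t ≡ true)
        spring = a , not-intro (≢true λ p → let b , q = ex-elim p ; e , r = ∧-elim {adj H a b} q in absurd (below b e) (not-elim r)) , ca
          where
          below : ∀ b → adj H a b ≡ true → lt i₀ a b ≡ true
          below b e with bool-cases (C b)
          ... | inj₁ cb = ⌊⌋-complete (Rk.rk (φ i₀ a) <? Rk.rk (φ i₀ b)) (ℕP.≤∧≢⇒< (least b cb)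
                (λ q → E-irr a b e (φ-inj i₀ a b (Rk.inj _ _ refl refl q))))
          ... | inj₂ cb = inward a b ca (∧-intro (not-intro cb) (ex-intro a (∧-intro ca e))) e
        no-spill : ∀ t → source t ≡ true → nb C t ≡ false
        no-spill t st = ≢true λ m → let c , cc , e = nb-elim C t m in
          ℕP.<-asym (⌊⌋-sound (Rk.rk (φ i₀ c) <? Rk.rk (φ i₀ t)) (inward c t cc m e))
            (⌊⌋-sound (Rk.rk (φ i₀ t) <? Rk.rk (φ i₀ c)) (source-elim st (E-sym c t e)))

    module _ {f : ℕ} (n≥1 : 1 ≤ n) (big : n ^ f * sun h s h < card L) (fn : FlapNumber H f) where

      -- Fixing the images of T costs a factor of at most n ^ f. The remaining copies agree on T, so
      -- T lies in the kernel of their sunflower and is avoided by C.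
      unhit : ∀ T → card T ≤ f → ∃[ C ] (Free C × (∀ t → T t ≡ true → C t ≡ false))
      unhit T T≤f with pin keys L (sun h s h) (ℕP.≤-<-trans (ℕP.*-monoˡ-≤ (sun h s h) power) big)
        where
        keys : List (Fin N → Fin n)
        keys = Data.List.map (λ a i → φ i (enum T a)) (allFin (card T))
        power : n ^ length keys ≤ n ^ f
        power = ℕP.^-monoʳ-≤ n {{ℕ.>-nonZero n≥1}} (ℕP.≤-trans (ℕP.≤-reflexive (trans (LP.length-map _ (allFin (card T))) (LP.length-tabulate id))) T≤f)
      ... | L′ , sub , big′ , const = C , Petal.free-C sub fl , λ t tt → ≢true λ c → absurd (Flower.K₀⊆K fl t tt) (C-K t c)
        where
        agree : ∀ i j v → L′ i ≡ true → L′ j ≡ true → T v ≡ true → φ i v ≡ φ j v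
        agree i j v p q tv = let a , e = enum-onto T v tv in
          subst (λ z → φ i z ≡ φ j z) e (const (λ i → φ i (enum T a)) (LM.∈-map⁺ (λ a i → φ i (enum T a)) (LM.∈-allFin a)) i j p q)
        fl : Flower L′ T
        fl = flower (card (λ v → not (T v))) L′ T refl agree
          (ℕP.≤-<-trans (sun-mono h≥1 (ℕP.≤-trans (s≤s z≤n) s≥2) (card-≤ (λ v → not (T v)))) big′)
        open Petals fl
          using (C; C-K)

      Hits : (Fin h → Bool) → Set
      Hits T = ∀ C → Free C → ∃[ t ] (T t ≡ true × C t ≡ true)

      _∖_ : (Fin h → Bool) → Fin h → Fin h → Bool
      (T ∖ v) x = T x ∧ not (x == v)

      -- `Hits` ranges over undecided sets, so dropping v is decided under double negation only.
      -- Keeping v stays justified when T shrinks further, since a smaller set hits no more.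
      minimize : ∀ (l : List (Fin h)) T → Hits T → (∀ v → T v ≡ true → source v ≡ true) →
        ((T′ : Fin h → Bool) → Hits T′ → (∀ v → T′ v ≡ true → T v ≡ true) →
          (∀ v → v ∈ l → T′ v ≡ true → ¬ Hits (T′ ∖ v)) → ⊥) → ⊥
      minimize [] T hits src k = k T hits (λ _ p → p) λ v ()
      minimize (v ∷ l) T hits src k = ¬¬-em {Hits (T ∖ v)} λ
        { (yes hits′) → minimize l (T ∖ v) hits′ (λ u p → src u (proj₁ (∧-elim {T u} p))) λ T′ ht sub min →
            k T′ ht (λ u p → proj₁ (∧-elim {T u} (sub u p)))
              λ { u (here refl) p → ⊥-elim (==-refute (not-elim (proj₂ (∧-elim {T u} (sub u p)))) refl) ; u (there m) p → min u m p }
        ; (no nh) → minimize l T hits src λ T′ ht sub min → k T′ ht sub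
            λ { u (here refl) p hv → nh (λ C fr → let t , q , c = hv C fr ; a , b = ∧-elim {T′ t} q in t , ∧-intro (sub t a) b , c)
              ; u (there m) p → min u m p } }

      -- Applied to a minimal hitting set of sources: `unhit` shows that it has more than f members,
      -- and `no-spill` strengthens privacy to the `apart` of a `Family`.
      contradiction : ⊥
      contradiction = minimize (allFin h) source (λ C fr → Free.spring fr) (λ _ p → p) λ T hits src min →
        let t = enum T
            Private : Fin (card T) → Set
            Private i = Σ[ C ∈ (Fin h → Bool) ] (Free C × C (t i) ≡ true × (∀ x → T x ≡ true → x ≢ t i → C x ≡ false))
            private-set : ∀ i → (Private i → ⊥) → ⊥
            private-set i k = min (t i) (LM.∈-allFin (t i)) (enum-true T i) λ C fr →
              let x , Tx , Cx = hits C fr in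
              decide T (t i) C (λ none → k (C , fr , subst (λ z → C z ≡ true) (only T (t i) C none x Tx Cx) Cx , λ y Ty ne → ≢true λ Cy → ne (only T (t i) C none y Ty Cy)))
        in ¬¬-choice private-set λ P →
          family-bound fn {card T} {t} {λ i → proj₁ (P i)} (record
            { good = λ i → Free.good (proj₁ (proj₂ (P i)))
            ; has = λ i → proj₁ (proj₂ (proj₂ (P i)))
            ; apart = λ i j ne → ≢true λ v → [
                (λ c → absurd c (proj₂ (proj₂ (proj₂ (P j))) (t i) (enum-true T i) (λ e → ne (enum-injective T i j e)))) ,
                (λ m → absurd m (Free.no-spill (proj₁ (proj₂ (P j))) (t i) (src (t i) (enum-true T i)))) ]′ (∨-elim {proj₁ (P j) (t i)} v) })
            (ℕP.≰⇒> λ le → let C , fr , miss = unhit T le ; x , Tx , Cx = hits C fr in absurd Cx (miss x Tx))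
        where
        open FlapFamilies H using (family-bound)
        only : ∀ T v C → (∀ x → (T ∖ v) x ∧ C x ≡ false) → ∀ x → T x ≡ true → C x ≡ true → x ≡ v
        only T v C none x Tx Cx = decidable-stable (x ≟ v) λ ne → absurd (∧-intro (∧-intro Tx (not-intro (==-false ne))) Cx) (none x)
        decide : ∀ T v C → ((∀ x → (T ∖ v) x ∧ C x ≡ false) → ⊥) → ∃[ x ] ((T ∖ v) x ≡ true × C x ≡ true)
        decide T v C k with bool-cases (ex (λ x → (T ∖ v) x ∧ C x))
        ... | inj₁ p = let x , q = ex-elim p ; a , b = ∧-elim {(T ∖ v) x} q in x , a , b
        ... | inj₂ p = ⊥-elim (k (ex-none p))

  -- The power of two is spent on passing to copies that all induce the same order on V(H).
  few : ∀ {f} → 1 ≤ n → FlapNumber H f → N ≤ flap-constant h g * n ^ f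
  few {f} n≥1 fn with N ≤? flap-constant h g * n ^ f
  ... | yes le = le
  ... | no gt = ⊥-elim (go (pin keys (λ _ → true) (n ^ f * sun h s h) (subst₂ _<_ arith (symm (card-full N)) (ℕP.≰⇒> gt))))
    where
    side : Bool → Fin 2
    side true  = zero
    side false = suc zero
    side-inj : ∀ {a b} → side a ≡ side b → a ≡ b
    side-inj {true}  {true}  e = refl
    side-inj {false} {false} e = refl
    key : Fin h × Fin h → Fin N → Fin 2
    key (a , b) i = side (lt i a b)
    keys : List (Fin N → Fin 2)
    keys = Data.List.map key (vertex-pairs h)
    arith : flap-constant h g * n ^ f ≡ 2 ^ length keys * (n ^ f * sun h s h)
    arith = trans (ℕP.*-assoc (2 ^ length (vertex-pairs h)) (sun h s h) (n ^ f))
      (cong₂ _*_ (cong (2 ^_) (symm (LP.length-map key (vertex-pairs h)))) (ℕP.*-comm (sun h s h) (n ^ f)))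
    go : ∃[ L ] ((∀ i → L i ≡ true → true ≡ true) × n ^ f * sun h s h < card L ×
      (∀ k → k ∈ keys → ∀ i j → L i ≡ true → L j ≡ true → k i ≡ k j)) → ⊥
    go (L , _ , big , const) = Ordered.contradiction L (proj₁ i₀) (proj₂ i₀)
        (λ i j a b p q → side-inj (const (key (a , b)) (LM.∈-map⁺ key (LM.∈-cartesianProduct⁺ (LM.∈-allFin a) (LM.∈-allFin b))) i j p q)) n≥1 big fn
      where
      i₀ : ∃[ i ] L i ≡ true
      i₀ = card-positive (ℕP.≤-trans (s≤s z≤n) big)

module _ {h n : ℕ} (H : Graph h) (G : Graph n) where
  -- A copy is determined by its map: its vertices are the image, and its edges run between image
  -- points exactly as in H.
  same-image : ∀ {A B : Sub n} (a : IsCopy H G A) (b : IsCopy H G B) →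
    (∀ v → proj₁ (proj₂ a) v ≡ proj₁ (proj₂ b) v) → ¬ SubDiffer A B
  same-image {V₁ , E₁} {V₂ , E₂} ((_ , sub₁) , φ , _ , on₁ , in₁ , ad₁) ((_ , sub₂) , ψ , _ , on₂ , in₂ , ad₂) e =
      [ (λ (v , ne) → ne (bool-iff (V→ v) (V← v))) , (λ (u , v , ne) → ne (bool-iff (E→ u v) (E← u v))) ]′
    where
    V→ : ∀ v → V₁ v ≡ true → V₂ v ≡ true
    V→ v p = let i , q = on₁ v p in subst (λ z → V₂ z ≡ true) (trans (symm (e i)) q) (in₂ i)
    V← : ∀ v → V₂ v ≡ true → V₁ v ≡ true
    V← v p = let i , q = on₂ v p in subst (λ z → V₁ z ≡ true) (trans (e i) q) (in₁ i)
    E→ : ∀ u v → E₁ u v ≡ true → E₂ u v ≡ true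
    E→ u v p = let _ , vu , vv = sub₁ u v p ; i , q = on₁ u vu ; j , r = on₁ v vv in
      subst₂ (λ a b → E₂ a b ≡ true) (trans (symm (e i)) q) (trans (symm (e j)) r)
        (trans (symm (ad₂ i j)) (trans (ad₁ i j) (subst₂ (λ a b → E₁ a b ≡ true) (symm q) (symm r) p)))
    E← : ∀ u v → E₂ u v ≡ true → E₁ u v ≡ true
    E← u v p = let _ , vu , vv = sub₂ u v p ; i , q = on₂ u vu ; j , r = on₂ v vv in
      subst₂ (λ a b → E₁ a b ≡ true) (trans (e i) q) (trans (e j) r)
        (trans (symm (ad₁ i j)) (trans (ad₂ i j) (subst₂ (λ a b → E₂ a b ≡ true) (symm q) (symm r) p)))

  copies-differ : ∀ {A B : Sub n} (a : IsCopy H G A) (b : IsCopy H G B) → SubDiffer A B →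
    ∃[ v ] proj₁ (proj₂ a) v ≢ proj₁ (proj₂ b) v
  copies-differ a b d with FP.all? (λ v → proj₁ (proj₂ a) v ≟ proj₁ (proj₂ b) v)
  ... | yes e = ⊥-elim (same-image a b e d)
  ... | no ne = FP.¬∀⟶∃¬ h _ (λ v → proj₁ (proj₂ a) v ≟ proj₁ (proj₂ b) v) ne

theorem10 : Σ[ c ∈ (ℕ → ℕ → ℕ) ]
    (∀ (h g : ℕ) (H : Graph h) → 1 ≤ h →
    (S : Surface) → eulerGenus S ≡ g → EmbedsIn H S →
    ∀ (f : ℕ) → FlapNumber H f →
    ∀ (n : ℕ) → 1 ≤ n → (G : Graph n) → EmbedsIn G S →
    CopiesAtMost H G (c h g * n ^ f))
theorem10 = flap-constant , λ { h .(eulerGenus S) H h≥1 S refl _ f fn n n≥1 G emb k cs copy differ →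
  Copies.few H G {S = S} emb h≥1 (λ i → proj₁ (proj₂ (copy i))) (λ i → proj₁ (proj₂ (proj₂ (copy i))))
    (λ i u v e → proj₁ (proj₂ (proj₁ (copy i)) _ _ (trans (symm (proj₂ (proj₂ (proj₂ (proj₂ (proj₂ (copy i))))) u v)) e)))
    (λ i j ne → copies-differ H G (copy i) (copy j) (differ i j ne)) n≥1 fn }
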